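{- Let $(W,S)$ be an arbitrary Coxeter system, $H\subseteq S$, $w\in W^H$, $x\in\{ -1,q\}$, and let $M$ be an $H$-special matching of $w$. Then for every $u\in W^H$ with $u\le w$, $$R^{H,x}_{u,w}(q)=\begin{cases}R^{H,x}_{M(u),M(w)}(q), & \text{if } M(u)\lhd u,\\ (q-1)R^{H,x}_{u,M(w)}(q)+qR^{H,x}_{M(u),M(w)}(q), & \text{if } M(u)\rhd u \text{ and } M(u)\in W^H,\\ (q-1-x)R^{H,x}_{u,M(w)}(q), & \text{if } M(u)\rhd u \text{ and } M(u)\notin W^H.\end{cases}$$
   Context: For a Coxeter system $(W,S)$ with identity $e$ and length function $\ell$, $\le$ denotes Bruhat order, $u\lhd v$ (equivalently $v\rhd u$) means $v$ covers $u$ in Bruhat order, $[u,v]=\{z: u\le z\le v\}$, $D_L(w)=\{s\in S:\ell(sw)<\ell(w)\}$, $D_R(w)=\{s\in S:\ell(ws)<\ell(w)\}$, and for $H\subseteq S$, $W^H=\{w\in W: D_R(w)\subseteq S\setminus H\}$. An $H$-special matching of $w$ is an involution $M:[e,w]\to[e,w]$ such that (1) for all $u\in[e,w]$, either $u\lhd M(u)$ or $M(u)\lhd u$; (2) for all $u_1,u_2\in[e,w]$ with $u_1\lhd u_2$ and $M(u_1)\ne u_2$, we have $M(u_1)\le M(u_2)$; (3) if $u\le w$, $u\in W^H$ and $M(u)\lhd u$, then $M(u)\in W^H$. For $x\in\{ -1,q\}$, the parabolic Kazhdan–Lusztig $R$-polynomials $\{R^{H,x}_{u,v}(q)\}_{u,v\in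 W^H}\subseteq\mathbb Z[q]$ are the unique family such that: $R^{H,x}_{u,v}=0$ if $u\not\le v$; $R^{H,x}_{u,u}=1$; and if $u<v$ and $s\in D_L(v)$, then $R^{H,x}_{u,v}=R^{H,x}_{su,sv}$ if $s\in D_L(u)$; $R^{H,x}_{u,v}=(q-1)R^{H,x}_{u,sv}+qR^{H,x}_{su,sv}$ if $s\notin D_L(u)$ and $su\in W^H$; $R^{H,x}_{u,v}=(q-1-x)R^{H,x}_{u,sv}$ if $s\notin D_L(u)$ and $su\notin W^H$. -}

module Defs where

open import Level using (0ℓ)
open import Data.Nat using (ℕ; zero; suc; _<_; _≤_)
open import Data.Integer using (ℤ; +_; -_) renaming (_+_ to _+ℤ_; _*_ to _*ℤ_)
open import Data.List using (List; []; _∷_; foldr; length)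
open import Data.List.Relation.Unary.All using (All)
open import Data.Product using (Σ; _×_; _,_)
open import Data.Sum using (_⊎_)
open import Relation.Nullary using (¬_)
open import Relation.Binary.PropositionalEquality using (_≡_)
open import Algebra.Bundles using (Group)
open import Algebra.Structures using (IsGroup)

-- Polynomials in ℤ[q] as coefficient lists (constant term first),
-- compared up to trailing zeros.

Poly : Set
Poly = List ℤ

coeff : Poly → ℕ → ℤ
coeff []       _       = + 0
coeff (a ∷ p)  zero    = a
coeff (a ∷ p)  (suc n) = coeff p n

infix 4 _≈P_
_≈P_ : Poly → Poly → Set
p ≈P r = ∀ n → coeff p n ≡ coeff r n

addP : Poly → Poly → Poly
addP []       r        = r
addP (a ∷ p)  []       = a ∷ p
addP (a ∷ p)  (b ∷ r)  = (a +ℤ b) ∷ addP p r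

scaleP : ℤ → Poly → Poly
scaleP c []      = []
scaleP c (a ∷ p) = (c *ℤ a) ∷ scaleP c p

mulP : Poly → Poly → Poly
mulP []      r = []
mulP (a ∷ p) r = addP (scaleP a r) (+ 0 ∷ mulP p r)

zeroP oneP qP : Poly
zeroP = []
oneP  = + 1 ∷ []
qP    = + 0 ∷ + 1 ∷ []

qm1P : Poly
qm1P = - (+ 1) ∷ + 1 ∷ []

data XParam : Set where
  x=-1 : XParam
  x=q  : XParam

xPoly : XParam → Poly
xPoly x=-1 = - (+ 1) ∷ []
xPoly x=q  = qP

qm1mxP : XParam → Poly
qm1mxP x = addP qm1P (scaleP (- (+ 1)) (xPoly x))

powW : {A : Set} → (A → A → A) → A → A → ℕ → A
powW _∙_ ε a zero    = ε
powW _∙_ ε a (suc n) = a ∙ powW _∙_ ε a n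

record CoxeterSystem : Set₁ where
  infixl 7 _·_
  field
    W       : Set
    _·_     : W → W → W
    e       : W
    _⁻¹     : W → W
    isGroup : IsGroup _≡_ _·_ e _⁻¹
    S       : W → Set
    S-invol : ∀ s → S s → s · s ≡ e
    ℓ       : W → ℕ
    ℓ-word  : ∀ w → Σ (List W) λ ws →
                All S ws × foldr _·_ e ws ≡ w × length ws ≡ ℓ w
    ℓ-min   : ∀ w (ws : List W) → All S ws → foldr _·_ e ws ≡ w → ℓ w ≤ length ws
    -- Coxeter presentation: W = ⟨ S | (s s')^{m(s,s')} = e ⟩, expressed by
    -- the universal property of the presentation (extension of maps S → G
    -- satisfying the relations to group homomorphisms W → G).
    universal : (G : Group 0ℓ 0ℓ) (f : W → Group.Carrier G) →
      (∀ s s' m → S s → S s' → powW _·_ e (s · s') (suc m) ≡ e →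
         Group._≈_ G (powW (Group._∙_ G) (Group.ε G) (Group._∙_ G (f s) (f s')) (suc m))
                     (Group.ε G)) →
      Σ (W → Group.Carrier G) λ φ →
        (∀ a b → Group._≈_ G (φ (a · b)) (Group._∙_ G (φ a) (φ b))) ×
        (∀ s → S s → Group._≈_ G (φ s) (f s))

module _ (C : CoxeterSystem) where
  open CoxeterSystem C

  Reflection : W → Set
  Reflection t = Σ W λ w → Σ W λ s → S s × t ≡ w · s · (w ⁻¹)

  infix 4 _≤B_
  data _≤B_ (u : W) : W → Set where
    ≤B-refl : u ≤B u
    ≤B-step : ∀ {v t} → u ≤B v → Reflection t → ℓ v < ℓ (v · t) → u ≤B v · t

  _<B_ : W → W → Set
  u <B v = u ≤B v × ¬ (u ≡ v)

  _⊲_ : W → W → Set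
  u ⊲ v = u <B v × (∀ z → u ≤B z → z ≤B v → z ≡ u ⊎ z ≡ v)

  InDL : W → W → Set
  InDL s w = S s × ℓ (s · w) < ℓ w

  InDR : W → W → Set
  InDR s w = S s × ℓ (w · s) < ℓ w

  InWH : (W → Set) → W → Set
  InWH H w = ∀ s → InDR s w → ¬ H s

  -- H-special matching of w, given as a map W → W whose behaviour
  -- outside [e,w] is irrelevant (note e ≤ u for every u).
  record IsSpecialMatching (H : W → Set) (w : W) (M : W → W) : Set where
    field
      closed  : ∀ u → u ≤B w → M u ≤B w
      invol   : ∀ u → u ≤B w → M (M u) ≡ u
      cover   : ∀ u → u ≤B w → u ⊲ M u ⊎ M u ⊲ u
      compat  : ∀ u₁ u₂ → u₁ ≤B w → u₂ ≤B w → u₁ ⊲ u₂ → ¬ (M u₁ ≡ u₂) → M u₁ ≤B M u₂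
      par     : ∀ u → u ≤B w → InWH H u → M u ⊲ u → InWH H (M u)

  -- The defining properties of the parabolic KL R-polynomials R^{H,x}
  -- (entries outside W^H × W^H are irrelevant).
  record IsParabolicR (H : W → Set) (x : XParam) (R : W → W → Poly) : Set where
    field
      R-zero : ∀ u v → InWH H u → InWH H v → ¬ (u ≤B v) → R u v ≈P zeroP
      R-diag : ∀ u → InWH H u → R u u ≈P oneP
      R-desc : ∀ u v s → InWH H u → InWH H v → u <B v → InDL s v →
                 InDL s u → R u v ≈P R (s · u) (s · v)
      R-asc-in : ∀ u v s → InWH H u → InWH H v → u <B v → InDL s v →
                 ¬ InDL s u → InWH H (s · u) →
                 R u v ≈P addP (mulP qm1P (R u (s · v))) (mulP qP (R (s · u) (s · v)))
      R-asc-out : ∀ u v s → InWH H u → InWH H v → u <B v → InDL s v →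
                 ¬ InDL s u → ¬ InWH H (s · u) →
                 R u v ≈P mulP (qm1mxP x) (R u (s · v))

module Submission where

-- Evaluating at integers q ≥ 1 turns the claim into identities in ℤ. By Deodhar's formula
-- R^{H,x}_{u,w} is the sum of (-x)^{ℓ(y)-ℓ(u)} R_{y,w} over y ∈ uW_H. The matching M permutes
-- the parts of the cosets of W_H below w, so reindexing this sum along M reduces the claim to
-- the ordinary polynomials R_{y,w}; in the third case of the recursion the terms at y and M(y)
-- combine through (x + 1)(x - q) = 0.
-- For ordinary polynomials put v = M(w). If a left descent p of v satisfies M(pu) = pM(u) for
-- all u, then p is a left descent of w, and the claim for w follows from the claim for the
-- restriction of M to [e, pw] because the recursion operators of p and M commute; the same
-- holds on the right. If no descent of v is of this kind, then v, and hence w, lies in a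
-- dihedral subgroup ⟨a,t⟩ with a = M(e), where R depends on lengths only.
-- The dihedral case is forced by the following conflict: if M destroys all left descents of z,
-- then M(z) = kz for a letter k, so M keeps all right descents of z. An element on which M is
-- not given by multiplication by a has a destroyed descent, and following destroyed left and
-- right descents upwards leads to a conflict unless v is dihedral.

open import Algebra.Bundles using (Group)
open import Algebra.Structures using (IsGroup)
open import Data.Bool using (Bool; true; false; _xor_)
open import Data.Bool.Properties using (xor-assoc; xor-identityʳ; xor-same)
open import Data.Empty using (⊥; ⊥-elim)
open import Data.Fin using (toℕ)
open import Data.Fin.Properties using (pigeonhole)
open import Data.Integer using (ℤ; +_; -[1+_]; -_; _+_; _*_; _-_; _^_; ∣_∣)
import Data.Integer.Properties as ℤₚ
open import Data.Integer.Tactic.RingSolver using (solve-∀)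
open import Data.List using (List; []; _∷_; _++_; map; foldr; length; lookup; deduplicate)
open import Data.List.Membership.Propositional using (_∈_; find; lose)
open import Data.List.Membership.Propositional.Properties using (∈-++⁺ʳ; ∈-++⁺ˡ; ∈-++⁻; ∈-deduplicate⁺; ∈-deduplicate⁻; ∈-map⁺; ∈-map⁻)
open import Data.List.Properties using (length-++)
import Data.List.Relation.Unary.All as All
open import Data.List.Relation.Unary.All using (All; []; _∷_)
import Data.List.Relation.Unary.All.Properties as Allₚ
open import Data.List.Relation.Unary.AllPairs using ([]; _∷_)
open import Data.List.Relation.Unary.Any using (any?; here; index; satisfied; there)
open import Data.List.Relation.Unary.Any.Properties using (lookup-index)
open import Data.List.Relation.Unary.Unique.DecPropositional.Properties using (deduplicate-!)
open import Data.List.Relation.Unary.Unique.Propositional using (Unique)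
open import Data.Nat using (ℕ; zero; suc; _∸_; _<_; z≤n; s≤s; _<ᵇ_) renaming (_≤_ to _≤ℕ_; _+_ to _+ℕ_; _*_ to _*ℕ_)
open import Data.Nat.Induction using (<-rec)
import Data.Nat.Properties as ℕₚ
open import Data.Product using (∃; _×_; _,_; proj₁; proj₂)
open import Data.Sum using (_⊎_; inj₁; inj₂; [_,_]′; swap)
open import Defs
open import Level using (0ℓ)
open import Relation.Binary.PropositionalEquality using (_≡_; refl; sym; trans; cong; cong₂; subst; subst₂; module ≡-Reasoning)
open import Relation.Nullary using (¬_; Dec; yes; no; does)
open import Relation.Nullary.Decidable using (_×-dec_; _⊎-dec_; dec-false; dec-true; decidable-stable; ¬?)

-- The difficulty is that M need not be multiplication by a letter, and that the recursion operators
-- of M and of a descent p of v commute only if p and M commute on the whole interval. No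
-- classification of special matchings is assumed: a failure to commute is traced to an element of a
-- dihedral subgroup containing a at which M destroys a descent, and `propagate` carries this
-- failure to larger elements until it becomes contradictory. A letter t that does not commute with
-- a is of left type, M(t) = a·t, or of right type, M(t) = t·a. One expects M to be multiplication
-- by a on that side throughout ⟨a,t⟩; a letter for which this fails is called bad, and most of the
-- proof shows that a bad letter t forces v into ⟨a,t⟩. Left and right play mirrored roles at every
-- stage, hence the reversible structure below. Membership in H and equality of values have to be
-- decided along the way; this is possible because only the finitely many letters below w matter and
-- the conclusion, evaluated at an integer, is an equation in ℤ.

-- Coxeter theory in a form invariant under reversing the multiplication: every statement
-- about left descents applies to right descents through `op`.
record Sys : Set₁ where
  infixr 7 _·_
  infix 4 _≤_
  field
    W     : Set
    _·_   : W → W → W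
    e     : W
    inv   : W → W
    assoc : ∀ x y z → (x · y) · z ≡ x · (y · z)
    -- With both directions as fields, `op` merely permutes fields and `op (op Y)` is `Y` by
    -- definition, so mirrored statements can be mirrored back without transport.
    assoc' : ∀ x y z → x · (y · z) ≡ (x · y) · z
    idˡ   : ∀ x → e · x ≡ x
    idʳ   : ∀ x → x · e ≡ x
    invˡ  : ∀ x → inv x · x ≡ e
    invʳ  : ∀ x → x · inv x ≡ e
    S     : W → Set
    SS    : ∀ {s} → S s → s · s ≡ e
    ℓ     : W → ℕ
    ℓ0    : ∀ {w} → ℓ w ≡ 0 → w ≡ e
    ℓe    : ℓ e ≡ 0
    ℓ1    : ∀ {w} → ℓ w ≡ 1 → S w
    ℓS    : ∀ {s} → S s → ℓ s ≡ 1
    descL : ∀ w → ¬ w ≡ e → ∃ λ s → S s × ℓ w ≡ suc (ℓ (s · w))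
    descR : ∀ w → ¬ w ≡ e → ∃ λ s → S s × ℓ w ≡ suc (ℓ (w · s))
    stepL : ∀ {s} w → S s → ℓ (s · w) ≡ suc (ℓ w) ⊎ ℓ w ≡ suc (ℓ (s · w))
    stepR : ∀ {s} w → S s → ℓ (w · s) ≡ suc (ℓ w) ⊎ ℓ w ≡ suc (ℓ (w · s))
    _≤_   : W → W → Set
    ≤r    : ∀ {u} → u ≤ u
    ≤t    : ∀ {u v w} → u ≤ v → v ≤ w → u ≤ w
    ≤ℓ    : ∀ {u w} → u ≤ w → ℓ u ≤ℕ ℓ w
    ≤≡    : ∀ {u w} → u ≤ w → ℓ w ≤ℕ ℓ u → u ≡ w
    upL   : ∀ {s w} → S s → ℓ (s · w) ≡ suc (ℓ w) → w ≤ s · w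
    upR   : ∀ {s w} → S s → ℓ (w · s) ≡ suc (ℓ w) → w ≤ w · s
    monoL : ∀ {s u w} → S s → u ≤ w → ℓ (s · w) ≡ suc (ℓ w) → s · u ≤ s · w
    monoR : ∀ {s u w} → S s → u ≤ w → ℓ (w · s) ≡ suc (ℓ w) → u · s ≤ w · s
    liftL : ∀ {s u w} → S s → u ≤ w → ℓ w ≡ suc (ℓ (s · w)) → ℓ (s · u) ≡ suc (ℓ u) → u ≤ s · w
    liftR : ∀ {s u w} → S s → u ≤ w → ℓ w ≡ suc (ℓ (w · s)) → ℓ (u · s) ≡ suc (ℓ u) → u ≤ w · s
    -- Strong exchange in the form used for additivity of lengths over parabolic cosets: since s
    -- turns from an ascent of u into a descent of u·v, the conjugate of s by u must be an inversion
    -- of v.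
    crossL : ∀ {s} u v → S s → ℓ (s · u) ≡ suc (ℓ u) → ℓ (u · v) ≡ suc (ℓ (s · (u · v))) →
             ℓ ((inv u · (s · u)) · v) < ℓ v
    crossR : ∀ {s} u v → S s → ℓ (u · s) ≡ suc (ℓ u) → ℓ (v · u) ≡ suc (ℓ ((v · u) · s)) →
             ℓ (v · ((u · s) · inv u)) < ℓ v

op : Sys → Sys
op Y = record
  { W = W ; _·_ = λ x y → y · x ; e = e ; inv = inv
  ; assoc = λ x y z → assoc' z y x ; assoc' = λ x y z → assoc z y x ; idˡ = idʳ ; idʳ = idˡ ; invˡ = invʳ ; invʳ = invˡ
  ; S = S ; SS = SS ; ℓ = ℓ ; ℓ0 = ℓ0 ; ℓe = ℓe ; ℓ1 = ℓ1 ; ℓS = ℓS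
  ; descL = descR ; descR = descL ; stepL = stepR ; stepR = stepL
  ; _≤_ = _≤_ ; ≤r = ≤r ; ≤t = ≤t ; ≤ℓ = ≤ℓ ; ≤≡ = ≤≡
  ; upL = upR ; upR = upL ; monoL = monoR ; monoR = monoL ; liftL = liftR ; liftR = liftL
  ; crossL = crossR ; crossR = crossL }
  where open Sys Y

-- Descents, exchange and lifting in Bruhat order

module Basics (Y : Sys) where
  open Sys Y

  UpL DnL UpR DnR : W → W → Set
  UpL s w = ℓ (s · w) ≡ suc (ℓ w)
  DnL s w = ℓ w ≡ suc (ℓ (s · w))
  UpR w s = ℓ (w · s) ≡ suc (ℓ w)
  DnR w s = ℓ w ≡ suc (ℓ (w · s))

  infix 4 _⋖_
  _⋖_ : W → W → Set
  u ⋖ v = u ≤ v × ℓ v ≡ suc (ℓ u)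

  sc : ∀ {s} x → S s → s · (s · x) ≡ x
  sc {s} x σ = trans (sym (assoc s s x)) (trans (cong (_· x) (SS σ)) (idˡ x))

  scR : ∀ {s} x → S s → (x · s) · s ≡ x
  scR {s} x σ = trans (assoc x s s) (trans (cong (x ·_) (SS σ)) (idʳ x))

  canL : ∀ {x y} z → z · x ≡ z · y → x ≡ y
  canL {x} {y} z q = trans (sym (h x)) (trans (cong (inv z ·_) q) (h y))
    where h : ∀ x → inv z · (z · x) ≡ x
          h x = trans (sym (assoc _ _ _)) (trans (cong (_· x) (invˡ z)) (idˡ x))

  canR : ∀ {x y} z → x · z ≡ y · z → x ≡ y
  canR {x} {y} z q = trans (sym (h x)) (trans (cong (_· inv z) q) (h y))
    where h : ∀ x → (x · z) · inv z ≡ x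
          h x = trans (assoc _ _ _) (trans (cong (x ·_) (invʳ z)) (idʳ x))

  mvL : ∀ {s x y} → S s → s · x ≡ y → x ≡ s · y
  mvL σ q = trans (sym (sc _ σ)) (cong (_ ·_) q)

  infix 4 _≟_
  _≟_ : (u v : W) → Dec (u ≡ v)
  u ≟ v with ℓ (inv u · v) ℕₚ.≟ 0
  ... | yes p = yes (canL (inv u) (trans (invˡ u) (sym (ℓ0 p))))
  ... | no ¬p = no λ { refl → ¬p (trans (cong ℓ (invˡ u)) ℓe) }

  dnup : ∀ {s w} → DnL s w → UpL s w → ⊥
  dnup {s} {w} d u = ℕₚ.<-irrefl refl (ℕₚ.<-trans (ℕₚ.≤-reflexive (sym u)) (ℕₚ.≤-reflexive (sym d)))

  dn⇒up : ∀ {s w} → S s → DnL s w → UpL s (s · w)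
  dn⇒up {s} {w} σ d = trans (cong ℓ (sc w σ)) d

  up⇒dn : ∀ {s w} → S s → UpL s w → DnL s (s · w)
  up⇒dn {s} {w} σ u = trans u (cong suc (cong ℓ (sym (sc w σ))))

  ¬up⇒dn : ∀ {s w} → S s → ¬ UpL s w → DnL s w
  ¬up⇒dn {s} {w} σ n with stepL w σ
  ... | inj₁ u = ⊥-elim (n u)
  ... | inj₂ d = d

  ¬dn⇒up : ∀ {s w} → S s → ¬ DnL s w → UpL s w
  ¬dn⇒up {s} {w} σ n with stepL w σ
  ... | inj₁ u = u
  ... | inj₂ d = ⊥-elim (n d)

  upe : ∀ {s} → S s → UpL s e
  upe σ = trans (cong ℓ (idʳ _)) (trans (ℓS σ) (cong suc (sym ℓe)))

  dn≤ : ∀ {s w} → S s → DnL s w → s · w ≤ w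
  dn≤ {s} {w} σ d = subst (s · w ≤_) (sc w σ) (upL σ (dn⇒up σ d))

  ℓ≤suc : ∀ {s} w → S s → ℓ (s · w) ≤ℕ suc (ℓ w)
  ℓ≤suc w σ with stepL w σ
  ... | inj₁ u = ℕₚ.≤-reflexive u
  ... | inj₂ d = ℕₚ.≤-trans (ℕₚ.n≤1+n _) (ℕₚ.≤-trans (ℕₚ.≤-reflexive (sym d)) (ℕₚ.n≤1+n _))

  lt⇒dn : ∀ {s} w → S s → ℓ (s · w) < ℓ w → DnL s w
  lt⇒dn w σ l with stepL w σ
  ... | inj₂ d = d
  ... | inj₁ u = ⊥-elim (ℕₚ.<-asym l (ℕₚ.≤-reflexive (sym u)))

  e≤ : ∀ w → e ≤ w
  e≤ w = go (ℓ w) w refl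
    where
    go : ∀ n w → ℓ w ≡ n → e ≤ w
    go zero w q = subst (e ≤_) (sym (ℓ0 q)) ≤r
    go (suc n) w q with w ≟ e
    ... | yes p = subst (e ≤_) (sym p) ≤r
    ... | no p with descL w p
    ... | s , σ , d = ≤t (go n (s · w) (ℕₚ.suc-injective (trans (sym d) q))) (dn≤ σ d)

  ≤-anti : ∀ {u w} → u ≤ w → w ≤ u → u ≡ w
  ≤-anti p q = ≤≡ p (≤ℓ q)

  ≤ℓ≡ : ∀ {u w} → u ≤ w → ℓ u ≡ ℓ w → u ≡ w
  ≤ℓ≡ p q = ≤≡ p (ℕₚ.≤-reflexive (sym q))

  ≤e : ∀ {u} → u ≤ e → u ≡ e
  ≤e p = ≤-anti p (e≤ _)

  star : ∀ {s u w} → S s → u ≤ w → DnL s w → s · u ≤ w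
  star {s} {u} {w} σ p d with stepL u σ
  ... | inj₁ up = subst (s · u ≤_) (sc w σ) (monoL σ (liftL σ p d up) (dn⇒up σ d))
  ... | inj₂ dn = ≤t (dn≤ σ dn) p

  liftdd : ∀ {s u w} → S s → u ≤ w → DnL s w → DnL s u → s · u ≤ s · w
  liftdd σ p d du = liftL σ (≤t (dn≤ σ du) p) d (dn⇒up σ du)

  up-mono : ∀ {s u w} → S s → u ≤ s · w → UpL s w → UpL s u → u ≤ w
  up-mono {s} {u} {w} σ p uw uu = subst (u ≤_) (sc w σ) (liftL σ p (up⇒dn σ uw) uu)

  peel : ∀ {s u w} → S s → u ≤ s · w → UpL s u → u ≤ w
  peel {s} {u} {w} σ p uu with stepL w σ
  ... | inj₁ uw = up-mono σ p uw uu
  ... | inj₂ dw = ≤t p (dn≤ σ dw)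

  -- `star` puts s·u below z, and both have the same length. A cover that turns the ascent s into a
  -- descent is therefore multiplication by s.
  exch : ∀ {s u z} → S s → u ⋖ z → UpL s u → DnL s z → z ≡ s · u
  exch {s} {u} {z} σ (p , q) uu dz = sym (≤ℓ≡ (star σ p dz) (trans uu (sym q)))

  ⋖up : ∀ {s u} → S s → UpL s u → u ⋖ s · u
  ⋖up σ p = upL σ p , p

  ⋖mono : ∀ {s u v} → S s → u ⋖ v → UpL s u → UpL s v → s · u ⋖ s · v
  ⋖mono σ (p , q) a b = monoL σ p b , trans b (cong suc (trans q (sym a)))

  up-below : ∀ {s u v} → S s → u ⋖ v → UpL s u → ¬ v ≡ s · u → UpL s v
  up-below σ c a n = ¬dn⇒up σ λ d → n (exch σ c a d)

  <ℓ : ∀ {u w} → u ≤ w → ¬ u ≡ w → ℓ u < ℓ w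
  <ℓ p n = ℕₚ.≤∧≢⇒< (≤ℓ p) λ q → n (≤ℓ≡ p q)

  S≢e : ∀ {s} → S s → ¬ s ≡ e
  S≢e σ refl with trans (sym ℓe) (ℓS σ)
  ... | ()

  ≤s : ∀ {u s} → S s → u ≤ s → u ≡ e ⊎ u ≡ s
  ≤s {u} {s} σ p with u ≟ s
  ... | yes q = inj₂ q
  ... | no q = inj₁ (ℓ0 (ℕₚ.n<1⇒n≡0 (subst (ℓ u <_) (ℓS σ) (<ℓ p q))))

  dnS : ∀ {s b} → S s → S b → DnL s b → s ≡ b
  dnS {s} {b} σ β d = sym (trans (mvL σ (ℓ0 (ℕₚ.suc-injective (trans (sym d) (ℓS β))))) (idʳ s))

  upS : ∀ {s b} → S s → S b → ¬ s ≡ b → UpL s b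
  upS σ β n = ¬dn⇒up σ λ d → n (dnS σ β d)

  dn⇒≤ : ∀ {s w} → S s → DnL s w → s ≤ w
  dn⇒≤ {s} {w} σ d = subst (_≤ w) (idʳ s) (star σ (e≤ w) d)

  supp-s : ∀ {s b u} → S s → S b → b ≤ s · u → b ≡ s ⊎ b ≤ u
  supp-s {s} {b} {u} σ β p with s ≟ b
  ... | yes q = inj₁ (sym q)
  ... | no q = inj₂ (peel σ p (upS σ β q))

  -- Gradedness from lifting alone, by induction along a left descent s of w. If s also descends on
  -- u, a coatom found below s·w is either multiplied back by s or shows that s·w itself serves.
  chain-dn : ∀ {u w} → u ≤ w → ¬ u ≡ w → ∃ λ z → u ≤ z × z ⋖ w
  chain-dn {u} {w} = go (ℓ w) u w refl
    where
    go : ∀ n u w → ℓ w ≡ n → u ≤ w → ¬ u ≡ w → ∃ λ z → u ≤ z × z ⋖ w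
    go zero u w q p ne = ⊥-elim (ne (trans (≤e (subst (u ≤_) (ℓ0 q) p)) (sym (ℓ0 q))))
    go (suc n) u w q p ne with w ≟ e
    ... | yes r = ⊥-elim (ne (trans (≤e (subst (u ≤_) r p)) (sym r)))
    ... | no r with descL w r
    ... | s , σ , d with stepL u σ
    ... | inj₁ up = s · w , liftL σ p d up , dn≤ σ d , d
    ... | inj₂ dn with go n (s · u) (s · w) (ℕₚ.suc-injective (trans (sym d) q)) (liftdd σ p d dn)
                          (λ r → ne (trans (sym (sc u σ)) (trans (cong (s ·_) r) (sc w σ))))
    ... | z , a , (b , c) with stepL z σ
    ... | inj₁ up = s · z , subst (_≤ s · z) (sc u σ) (monoL σ a up)
                  , star σ (≤t b (dn≤ σ d)) d , trans d (cong suc (trans c (sym up)))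
    ... | inj₂ dz = s · w , ≤t (subst (_≤ z) (sc u σ) (star σ a dz)) b , dn≤ σ d , d

  chain-up : ∀ {u w} → u ≤ w → ¬ u ≡ w → ∃ λ z → u ⋖ z × z ≤ w
  chain-up {u} {w} = go (ℓ w) u w refl
    where
    go : ∀ n u w → ℓ w ≡ n → u ≤ w → ¬ u ≡ w → ∃ λ z → u ⋖ z × z ≤ w
    go zero u w q p ne = ⊥-elim (ne (trans (≤e (subst (u ≤_) (ℓ0 q) p)) (sym (ℓ0 q))))
    go (suc n) u w q p ne with w ≟ e
    ... | yes r = ⊥-elim (ne (trans (≤e (subst (u ≤_) r p)) (sym r)))
    ... | no r with descL w r
    ... | s , σ , d with stepL u σ
    ... | inj₁ up = s · u , ⋖up σ up , star σ p d
    ... | inj₂ dn with go n (s · u) (s · w) (ℕₚ.suc-injective (trans (sym d) q)) (liftdd σ p d dn)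
                          (λ r → ne (trans (sym (sc u σ)) (trans (cong (s ·_) r) (sc w σ))))
    ... | z , a , b with z ≟ u
    ... | no zu = s · z , subst (_⋖ s · z) (sc u σ) (⋖mono σ a (dn⇒up σ dn) upz) , star σ (≤t b (dn≤ σ d)) d
      where upz : UpL s z
            upz = up-below σ a (dn⇒up σ dn) λ q → zu (trans q (sc u σ))
    ... | yes zu with u ≟ s · w
    ... | yes r' = w , (p , trans d (cong suc (cong ℓ (sym r')))) , ≤r
    ... | no r' with go n u (s · w) (ℕₚ.suc-injective (trans (sym d) q)) (subst (_≤ s · w) zu b) r'
    ... | z' , a' , b' = z' , a' , ≤t b' (dn≤ σ d)

  infix 4 _≤?_
  _≤?_ : ∀ u w → Dec (u ≤ w)
  u ≤? w = go (ℓ w) u w refl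
    where
    go : ∀ n u w → ℓ w ≡ n → Dec (u ≤ w)
    go n u w q with w ≟ e
    go n u w q | yes r with u ≟ e
    ... | yes r' = yes (subst (_≤ w) (sym r') (e≤ w))
    ... | no r' = no λ p → r' (≤e (subst (u ≤_) r p))
    go zero u w q | no r = ⊥-elim (r (ℓ0 q))
    go (suc n) u w q | no r with descL w r
    ... | s , σ , d with stepL u σ
    go (suc n) u w q | no r | s , σ , d | inj₁ up with go n u (s · w) (ℕₚ.suc-injective (trans (sym d) q))
    ... | yes p = yes (≤t p (dn≤ σ d))
    ... | no p = no λ p' → p (liftL σ p' d up)
    go (suc n) u w q | no r | s , σ , d | inj₂ dn with go n (s · u) (s · w) (ℕₚ.suc-injective (trans (sym d) q))
    ... | yes p = yes (subst₂ _≤_ (sc u σ) (sc w σ) (monoL σ p (dn⇒up σ d)))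
    ... | no p = no λ p' → p (liftdd σ p' d dn)

  private
    -- By lifting, everything below w is below s·w or is s times such an element, where s is a left
    -- descent of w. The list has repetitions, which are removed where sums are taken.
    lows : ℕ → W → List W
    lows zero w = e ∷ []
    lows (suc n) w with w ≟ e
    ... | yes r = e ∷ []
    ... | no r with descL w r
    ... | s , _ = lows n (s · w) ++ map (s ·_) (lows n (s · w))

    lows-sound : ∀ n w → ℓ w ≡ n → ∀ {u} → u ∈ lows n w → u ≤ w
    lows-sound zero w q (here refl) = e≤ w
    lows-sound (suc n) w q m with w ≟ e
    lows-sound (suc n) w q (here refl) | yes r = e≤ w
    ... | no r with descL w r
    ... | s , σ , d with ∈-++⁻ (lows n (s · w)) m
    ... | inj₁ m' = ≤t (lows-sound n (s · w) (ℕₚ.suc-injective (trans (sym d) q)) m') (dn≤ σ d)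
    ... | inj₂ m' with ∈-map⁻ (s ·_) m'
    ... | u' , m'' , refl = star σ (≤t (lows-sound n (s · w) (ℕₚ.suc-injective (trans (sym d) q)) m'') (dn≤ σ d)) d

    lows-complete : ∀ n w → ℓ w ≡ n → ∀ {u} → u ≤ w → u ∈ lows n w
    lows-complete zero w q p = here (≤e (subst (_ ≤_) (ℓ0 q) p))
    lows-complete (suc n) w q p with w ≟ e
    ... | yes r = here (≤e (subst (_ ≤_) r p))
    ... | no r with descL w r
    ... | s , σ , d with stepL _ σ
    ... | inj₁ up = ∈-++⁺ˡ (lows-complete n (s · w) (ℕₚ.suc-injective (trans (sym d) q)) (liftL σ p d up))
    ... | inj₂ dn = ∈-++⁺ʳ (lows n (s · w)) (subst (_∈ map (s ·_) (lows n (s · w))) (sc _ σ)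
                      (∈-map⁺ (s ·_) (lows-complete n (s · w) (ℕₚ.suc-injective (trans (sym d) q)) (liftdd σ p d dn))))

  low : W → List W
  low w = lows (ℓ w) w

  ∈low⇒≤ : ∀ {u w} → u ∈ low w → u ≤ w
  ∈low⇒≤ = lows-sound _ _ refl

  ≤⇒∈low : ∀ {u w} → u ≤ w → u ∈ low w
  ≤⇒∈low = lows-complete _ _ refl

-- Strong exchange and Bruhat order from the Coxeter presentation

module FromCoxeter (C : CoxeterSystem) where
  open CoxeterSystem C
  open IsGroup isGroup using (assoc; identityˡ; identityʳ; inverseˡ; inverseʳ)
  open ≡-Reasoning

  prod : List W → W
  prod = foldr _·_ e

  private
    cancˡ : ∀ z x → z ⁻¹ · (z · x) ≡ x
    cancˡ z x = trans (sym (assoc _ _ _)) (trans (cong (_· x) (inverseˡ z)) (identityˡ x))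

    cancˡ' : ∀ z x → z · (z ⁻¹ · x) ≡ x
    cancˡ' z x = trans (sym (assoc _ _ _)) (trans (cong (_· x) (inverseʳ z)) (identityˡ x))

    cancʳ : ∀ z x → x · z · z ⁻¹ ≡ x
    cancʳ z x = trans (assoc _ _ _) (trans (cong (x ·_) (inverseʳ z)) (identityʳ x))

    cancʳ' : ∀ z x → x · z ⁻¹ · z ≡ x
    cancʳ' z x = trans (assoc _ _ _) (trans (cong (x ·_) (inverseˡ z)) (identityʳ x))

    injˡ : ∀ z {x y} → z · x ≡ z · y → x ≡ y
    injˡ z {x} {y} q = trans (sym (cancˡ z x)) (trans (cong (z ⁻¹ ·_) q) (cancˡ z y))

    inv-uniq : ∀ x y → x · y ≡ e → y ≡ x ⁻¹
    inv-uniq x y q = injˡ x (trans q (sym (inverseʳ x)))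

    inv-inv : ∀ x → (x ⁻¹) ⁻¹ ≡ x
    inv-inv x = sym (inv-uniq (x ⁻¹) x (inverseˡ x))

    inv-· : ∀ x y → (x · y) ⁻¹ ≡ y ⁻¹ · x ⁻¹
    inv-· x y = sym (inv-uniq (x · y) (y ⁻¹ · x ⁻¹)
      (trans (assoc _ _ _) (trans (cong (x ·_) (cancˡ' y (x ⁻¹))) (inverseʳ x))))

    inv-e : e ⁻¹ ≡ e
    inv-e = sym (inv-uniq e e (identityˡ e))

    inv-S : ∀ {s} → S s → s ⁻¹ ≡ s
    inv-S {s} σ = sym (inv-uniq s s (S-invol s σ))

    ss : ∀ {s} x → S s → s · (s · x) ≡ x
    ss {s} x σ = trans (cong (_· (s · x)) (sym (inv-S σ))) (cancˡ s x)

    ssʳ : ∀ {s} x → S s → x · s · s ≡ x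
    ssʳ {s} x σ = trans (cong (x · s ·_) (sym (inv-S σ))) (cancʳ s x)

    ℓ-0 : ∀ {w} → ℓ w ≡ 0 → w ≡ e
    ℓ-0 {w} q with ℓ-word w
    ... | [] , _ , p , _ = sym p
    ... | x ∷ ws , _ , _ , l with trans l q
    ... | ()

    ℓ-e : ℓ e ≡ 0
    ℓ-e = ℕₚ.n≤0⇒n≡0 (ℓ-min e [] [] refl)

    infix 4 _≟_
    _≟_ : (u v : W) → Dec (u ≡ v)
    u ≟ v with ℓ (u ⁻¹ · v) ℕₚ.≟ 0
    ... | yes p = yes (injˡ (u ⁻¹) (trans (inverseˡ u) (sym (ℓ-0 p))))
    ... | no ¬p = no λ { refl → ¬p (trans (cong ℓ (inverseˡ u)) ℓ-e) }

    ℓ-·≤ : ∀ {s} w → S s → ℓ (s · w) ≤ℕ suc (ℓ w)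
    ℓ-·≤ {s} w σ with ℓ-word w
    ... | ws , a , p , l = subst (λ n → ℓ (s · w) ≤ℕ suc n) l
                             (ℓ-min (s · w) (s ∷ ws) (σ ∷ a) (cong (s ·_) p))

    invw : List W → List W
    invw [] = []
    invw (s ∷ ws) = invw ws ++ (s ∷ [])

    prod-++ : ∀ us vs → prod (us ++ vs) ≡ prod us · prod vs
    prod-++ [] vs = sym (identityˡ _)
    prod-++ (u ∷ us) vs = trans (cong (u ·_) (prod-++ us vs)) (sym (assoc _ _ _))

    invw-All : ∀ {ws} → All S ws → All S (invw ws)
    invw-All [] = []
    invw-All (σ ∷ a) = Allₚ.++⁺ (invw-All a) (σ ∷ [])

    invw-prod : ∀ {ws} → All S ws → prod (invw ws) ≡ prod ws ⁻¹
    invw-prod [] = sym inv-e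
    invw-prod {s ∷ ws} (σ ∷ a) = trans (prod-++ (invw ws) (s ∷ []))
      (trans (cong₂ _·_ (invw-prod a) (trans (identityʳ s) (sym (inv-S σ)))) (sym (inv-· s (prod ws))))

    invw-len : ∀ ws → length (invw ws) ≡ length ws
    invw-len [] = refl
    invw-len (s ∷ ws) = trans (length-++ (invw ws)) (trans (cong (_+ℕ 1) (invw-len ws)) (ℕₚ.+-comm _ 1))

    ℓ-inv≤ : ∀ w → ℓ (w ⁻¹) ≤ℕ ℓ w
    ℓ-inv≤ w with ℓ-word w
    ... | ws , a , p , l = subst (ℓ (w ⁻¹) ≤ℕ_) (trans (invw-len ws) l)
            (ℓ-min (w ⁻¹) (invw ws) (invw-All a) (trans (invw-prod a) (cong _⁻¹ p)))

    ℓ-inv : ∀ w → ℓ (w ⁻¹) ≡ ℓ w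
    ℓ-inv w = ℕₚ.≤-antisym (ℓ-inv≤ w) (subst (λ z → ℓ z ≤ℕ ℓ (w ⁻¹)) (inv-inv w) (ℓ-inv≤ (w ⁻¹)))

    conj : W → W → W
    conj b t = b · t · b ⁻¹

    conj-e : ∀ t → conj e t ≡ t
    conj-e t = trans (cong₂ _·_ (identityˡ t) inv-e) (identityʳ t)

    conj-· : ∀ a b t → conj (a · b) t ≡ conj a (conj b t)
    conj-· a b t = begin
      a · b · t · (a · b) ⁻¹         ≡⟨ cong (a · b · t ·_) (inv-· a b) ⟩
      a · b · t · (b ⁻¹ · a ⁻¹)      ≡⟨ sym (assoc _ _ _) ⟩
      a · b · t · b ⁻¹ · a ⁻¹        ≡⟨ cong (λ z → z · b ⁻¹ · a ⁻¹) (assoc a b t) ⟩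
      a · (b · t) · b ⁻¹ · a ⁻¹      ≡⟨ cong (_· a ⁻¹) (assoc a (b · t) (b ⁻¹)) ⟩
      a · (b · t · b ⁻¹) · a ⁻¹      ∎

    conj-inv : ∀ b t → conj (b ⁻¹) (conj b t) ≡ t
    conj-inv b t = trans (sym (conj-· (b ⁻¹) b t)) (trans (cong (λ z → conj z t) (inverseˡ b)) (conj-e t))

    conj-mul : ∀ b t u → conj b (t · u) ≡ conj b t · conj b u
    conj-mul b t u = sym (begin
      b · t · b ⁻¹ · (b · u · b ⁻¹)    ≡⟨ cong (b · t · b ⁻¹ ·_) (assoc b u (b ⁻¹)) ⟩
      b · t · b ⁻¹ · (b · (u · b ⁻¹))  ≡⟨ assoc _ _ _ ⟩
      b · t · (b ⁻¹ · (b · (u · b ⁻¹))) ≡⟨ cong (b · t ·_) (cancˡ b _) ⟩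
      b · t · (u · b ⁻¹)               ≡⟨ sym (assoc _ _ _) ⟩
      b · t · u · b ⁻¹                 ≡⟨ cong (_· b ⁻¹) (assoc b t u) ⟩
      b · (t · u) · b ⁻¹               ∎)

    conj-1 : ∀ b → conj b e ≡ e
    conj-1 b = trans (cong (_· b ⁻¹) (identityʳ b)) (inverseʳ b)

    -- W acting on reflections with signs: the semidirect product of the functions
    -- W → Bool with W.
    G : Group 0ℓ 0ℓ
    G = record
      { Carrier = (W → Bool) × W
      ; _≈_ = λ x y → (∀ t → proj₁ x t ≡ proj₁ y t) × proj₂ x ≡ proj₂ y
      ; _∙_ = λ x y → (λ t → proj₁ y t xor proj₁ x (conj (proj₂ y) t)) , proj₂ x · proj₂ y
      ; ε = (λ _ → false) , e
      ; _⁻¹ = λ x → (λ t → proj₁ x (conj (proj₂ x ⁻¹) t)) , proj₂ x ⁻¹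
      ; isGroup = record
        { isMonoid = record
          { isSemigroup = record
            { isMagma = record
              { isEquivalence = record
                { refl = (λ _ → refl) , refl
                ; sym = λ p → (λ t → sym (proj₁ p t)) , sym (proj₂ p)
                ; trans = λ p q → (λ t → trans (proj₁ p t) (proj₁ q t)) , trans (proj₂ p) (proj₂ q) }
              ; ∙-cong = λ {x} {y} {u} {v} p q →
                  (λ t → cong₂ _xor_ (proj₁ q t)
                    (trans (proj₁ p (conj (proj₂ u) t)) (cong (λ z → proj₁ y (conj z t)) (proj₂ q))))
                  , cong₂ _·_ (proj₂ p) (proj₂ q) }
            ; assoc = λ x y z →
                (λ t → trans (sym (xor-assoc (proj₁ z t) _ _))
                         (cong (λ k → (proj₁ z t xor proj₁ y (conj (proj₂ z) t)) xor proj₁ x k)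
                           (sym (conj-· (proj₂ y) (proj₂ z) t))))
                , assoc _ _ _ }
          ; identity = (λ x → (λ t → xor-identityʳ (proj₁ x t)) , identityˡ _)
                     , (λ x → (λ t → cong (proj₁ x) (conj-e t)) , identityʳ _) }
        ; inverse = (λ x → (λ t → trans (cong (λ k → proj₁ x t xor proj₁ x k) (conj-inv (proj₂ x) t))
            (xor-same (proj₁ x t))) , inverseˡ _)
                  , (λ x → (λ t → xor-same (proj₁ x (conj (proj₂ x ⁻¹) t))) , inverseʳ _)
        ; ⁻¹-cong = λ {x} {y} p → (λ t → trans (proj₁ p _) (cong (λ z → proj₁ y (conj (z ⁻¹) t)) (proj₂ p)))
                                  , cong _⁻¹ (proj₂ p) } }

    [_≈?_] : W → W → Bool
    [ s ≈? t ] = does (s ≟ t)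

    ≈?-true : ∀ {s t} → s ≡ t → [ s ≈? t ] ≡ true
    ≈?-true p = dec-true (_ ≟ _) p

    ≈?-sound : ∀ {s t} → [ s ≈? t ] ≡ true → s ≡ t
    ≈?-sound {s} {t} q with s ≟ t
    ... | yes p = p

    ≈?-iff : ∀ {s t s' t'} → (s ≡ t → s' ≡ t') → (s' ≡ t' → s ≡ t) → [ s ≈? t ] ≡ [ s' ≈? t' ]
    ≈?-iff {s} {t} {s'} {t'} f g with s ≟ t
    ... | yes p = sym (dec-true (s' ≟ t') (f p))
    ... | no ¬p = sym (dec-false (s' ≟ t') (λ q → ¬p (g q)))

    gen : W → Group.Carrier G
    gen s = (λ t → [ s ≈? t ]) , s

    pw : W → ℕ → W
    pw = powW _·_ e

    module Relation (s s' : W) (σ : S s) (σ' : S s') where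
      ρ = s · s'

      pw-comm : ∀ n → ρ · pw ρ n ≡ pw ρ n · ρ
      pw-comm zero = trans (identityʳ ρ) (sym (identityˡ ρ))
      pw-comm (suc n) = trans (cong (ρ ·_) (pw-comm n)) (sym (assoc _ _ _))

      pw-+ : ∀ m n → pw ρ (m +ℕ n) ≡ pw ρ m · pw ρ n
      pw-+ zero n = sym (identityˡ _)
      pw-+ (suc m) n = trans (cong (ρ ·_) (pw-+ m n)) (sym (assoc _ _ _))

      -- Conjugation by the involution s' inverts the rotation ρ = s·s'.
      flip : ∀ n → pw ρ n · s' · pw ρ n ≡ s'
      flip zero = trans (identityʳ _) (identityˡ s')
      flip (suc n) = begin
        ρ · pw ρ n · s' · (ρ · pw ρ n)   ≡⟨ cong (ρ · pw ρ n · s' ·_) (pw-comm n) ⟩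
        ρ · pw ρ n · s' · (pw ρ n · ρ)   ≡⟨ sym (assoc _ _ _) ⟩
        ρ · pw ρ n · s' · pw ρ n · ρ     ≡⟨ cong (λ z → z · pw ρ n · ρ) (assoc ρ (pw ρ n) s') ⟩
        ρ · (pw ρ n · s') · pw ρ n · ρ   ≡⟨ cong (_· ρ) (assoc ρ (pw ρ n · s') (pw ρ n)) ⟩
        ρ · (pw ρ n · s' · pw ρ n) · ρ   ≡⟨ cong (λ z → ρ · z · ρ) (flip n) ⟩
        s · s' · s' · (s · s')           ≡⟨ cong (_· (s · s')) (ssʳ s σ') ⟩
        s · (s · s')                     ≡⟨ ss s' σ ⟩
        s'                               ∎

      -- Parity of the number of k < n with t = s'·ρᵏ. These are the reflections met when an
      -- alternating word in s and s' is read from the right.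
      Q : ℕ → W → Bool
      Q zero t = false
      Q (suc n) t = Q n t xor [ t ≈? s' · pw ρ n ]

      -- p = ρⁿ satisfies p s' p = s', hence p (s' r) p⁻¹ = s' p⁻¹ r p⁻¹; below r = p·p or ρ·p·p.
      conj-pow : ∀ n r → pw ρ n · ρ ≡ ρ · pw ρ n → conj (pw ρ n) (s' · (pw ρ r · (pw ρ n · pw ρ n))) ≡ s' · pw ρ r
      conj-pow n r g = begin
        p · (s' · (pw ρ r · (p · p))) · p ⁻¹   ≡⟨ cong (λ z → p · (s' · z) · p ⁻¹) comm ⟩
        p · (s' · (p · pw ρ r · p)) · p ⁻¹     ≡⟨ cong (λ z → p · z · p ⁻¹) (sym (assoc _ _ _)) ⟩
        p · (s' · (p · pw ρ r) · p) · p ⁻¹     ≡⟨ cong (_· p ⁻¹) (sym (assoc _ _ _)) ⟩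
        p · (s' · (p · pw ρ r)) · p · p ⁻¹     ≡⟨ cancʳ p _ ⟩
        p · (s' · (p · pw ρ r))                ≡⟨ sym (assoc _ _ _) ⟩
        p · s' · (p · pw ρ r)                  ≡⟨ sym (assoc _ _ _) ⟩
        p · s' · p · pw ρ r                    ≡⟨ cong (_· pw ρ r) (flip n) ⟩
        s' · pw ρ r                            ∎
        where
        p = pw ρ n
        comm : pw ρ r · (p · p) ≡ p · pw ρ r · p
        comm = trans (sym (assoc _ _ _)) (cong (_· p)
          (trans (sym (pw-+ r n)) (trans (cong (pw ρ) (ℕₚ.+-comm r n)) (pw-+ n r))))

      conj⇔ : ∀ n r t → (conj (pw ρ n) t ≡ s' · pw ρ r → t ≡ s' · pw ρ (r +ℕ (n +ℕ n)))
                      × (t ≡ s' · pw ρ (r +ℕ (n +ℕ n)) → conj (pw ρ n) t ≡ s' · pw ρ r)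
      conj⇔ n r t = (λ q → trans (inj-conj (trans q (sym (conj-pow n r (sym (pw-comm n)))))) (sym expand))
                  , λ q → trans (cong (conj (pw ρ n)) (trans q expand)) (conj-pow n r (sym (pw-comm n)))
        where
        inj-conj : ∀ {b x y} → conj b x ≡ conj b y → x ≡ y
        inj-conj {b} {x} {y} q = trans (sym (conj-inv b x)) (trans (cong (conj (b ⁻¹)) q) (conj-inv b y))
        expand : s' · pw ρ (r +ℕ (n +ℕ n)) ≡ s' · (pw ρ r · (pw ρ n · pw ρ n))
        expand = cong (s' ·_) (trans (pw-+ r (n +ℕ n)) (cong (pw ρ r ·_) (pw-+ n n)))

      step2 : ∀ t' → (s ≡ conj s' t' → t' ≡ s' · pw ρ 1) × (t' ≡ s' · pw ρ 1 → s ≡ conj s' t')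
      step2 t' = (λ q → begin
            t'                        ≡⟨ sym (conj-inv s' t') ⟩
            conj (s' ⁻¹) (conj s' t') ≡⟨ cong₂ conj (inv-S σ') (sym q) ⟩
            s' · s · s' ⁻¹            ≡⟨ cong (s' · s ·_) (inv-S σ') ⟩
            s' · s · s'               ≡⟨ assoc s' s s' ⟩
            s' · ρ                    ≡⟨ cong (s' ·_) (sym (identityʳ ρ)) ⟩
            s' · (ρ · e)              ∎)
        , λ { refl → sym (begin
            s' · (s' · (ρ · e)) · s' ⁻¹  ≡⟨ cong (_· s' ⁻¹) (ss (ρ · e) σ') ⟩
            s · s' · e · s' ⁻¹           ≡⟨ cong (_· s' ⁻¹) (identityʳ ρ) ⟩
            s · s' · s' ⁻¹               ≡⟨ cancʳ s' s ⟩
            s                            ∎) }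

      PX : ℕ → Group.Carrier G
      PX = powW (Group._∙_ G) (Group.ε G) (Group._∙_ G (gen s) (gen s'))

      PX₂ : ∀ n → proj₂ (PX n) ≡ pw ρ n
      PX₂ zero = refl
      PX₂ (suc n) = cong (ρ ·_) (PX₂ n)

      PX₁ : ∀ n t → proj₁ (PX n) t ≡ Q (n +ℕ n) t
      PX₁ zero t = refl
      PX₁ (suc n) t = begin
        proj₁ (PX n) t xor ([ s' ≈? conj (proj₂ (PX n)) t ] xor [ s ≈? conj s' (conj (proj₂ (PX n)) t) ])
          ≡⟨ cong₂ (λ u p → u xor ([ s' ≈? conj p t ] xor [ s ≈? conj s' (conj p t) ])) (PX₁ n t) (PX₂ n) ⟩
        Q (n +ℕ n) t xor ([ s' ≈? conj p t ] xor [ s ≈? conj s' (conj p t) ])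
          ≡⟨ sym (xor-assoc (Q (n +ℕ n) t) _ _) ⟩
        (Q (n +ℕ n) t xor [ s' ≈? conj p t ]) xor [ s ≈? conj s' (conj p t) ]
          ≡⟨ cong₂ (λ a b → (Q (n +ℕ n) t xor a) xor b)
               (≈?-iff (λ q → proj₁ (conj⇔ n 0 t) (trans (sym q) (sym (identityʳ s'))))
                       (λ q → sym (trans (proj₂ (conj⇔ n 0 t) q) (identityʳ s'))))
               (≈?-iff (λ q → proj₁ (conj⇔ n 1 t) (proj₁ (step2 _) q))
                       (λ q → proj₂ (step2 _) (proj₂ (conj⇔ n 1 t) q))) ⟩
        Q (suc (suc (n +ℕ n))) t
          ≡⟨ cong (λ k → Q (suc k) t) (sym (ℕₚ.+-suc n n)) ⟩
        Q (suc n +ℕ suc n) t ∎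
        where p = pw ρ n

      Q-+ : ∀ m → pw ρ m ≡ e → ∀ j t → Q (j +ℕ m) t ≡ Q m t xor Q j t
      Q-+ m q zero t = sym (xor-identityʳ _)
      Q-+ m q (suc j) t = trans
        (cong₂ (λ a b → a xor [ t ≈? s' · b ]) (Q-+ m q j t)
           (trans (pw-+ j m) (trans (cong (pw ρ j ·_) q) (identityʳ _))))
        (xor-assoc (Q m t) _ _)

      -- The reflections s'·ρᵏ have period m + 1, so the 2(m + 1) of them met by this power occur in
      -- equal pairs and every parity is even.
      relation : ∀ m → pw ρ (suc m) ≡ e → Group._≈_ G (PX (suc m)) (Group.ε G)
      relation m q = (λ t → trans (PX₁ (suc m) t) (trans (Q-+ (suc m) q (suc m) t) (xor-same (Q (suc m) t))))
                   , trans (PX₂ (suc m)) q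

    hom = universal G gen (λ s s' m σ σ' q → Relation.relation s s' σ σ' m q)

    abstract
      φ : W → Group.Carrier G
      φ = proj₁ hom

      φ-· : ∀ a b → Group._≈_ G (φ (a · b)) (Group._∙_ G (φ a) (φ b))
      φ-· = proj₁ (proj₂ hom)

      φ-S : ∀ s → S s → Group._≈_ G (φ s) (gen s)
      φ-S = proj₂ (proj₂ hom)

    φ₂-e : proj₂ (φ e) ≡ e
    φ₂-e = injˡ (proj₂ (φ e)) (trans (sym (proj₂ (φ-· e e)))
             (trans (cong (λ z → proj₂ (φ z)) (identityˡ e)) (sym (identityʳ _))))

    φ₂-prod : ∀ {ws} → All S ws → proj₂ (φ (prod ws)) ≡ prod ws
    φ₂-prod [] = φ₂-e
    φ₂-prod {s ∷ ws} (σ ∷ a) = trans (proj₂ (φ-· s (prod ws))) (cong₂ _·_ (proj₂ (φ-S s σ)) (φ₂-prod a))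

    φ₂ : ∀ w → proj₂ (φ w) ≡ w
    φ₂ w with ℓ-word w
    ... | ws , a , refl , _ = φ₂-prod a

    -- η w t is true iff the reflection t is a right inversion of w
    η : W → W → Bool
    η w t = proj₁ (φ w) t

    η-· : ∀ a b t → η (a · b) t ≡ η b t xor η a (conj b t)
    η-· a b t = trans (proj₁ (φ-· a b) t) (cong (λ z → η b t xor η a (conj z t)) (φ₂ b))

    η-e : ∀ t → η e t ≡ false
    η-e t = begin
      η e t                               ≡⟨ sym (xor-identityʳ _) ⟩
      η e t xor false                     ≡⟨ cong (η e t xor_) (sym (xor-same (η e t))) ⟩
      η e t xor (η e t xor η e t)         ≡⟨ sym (xor-assoc (η e t) _ _) ⟩
      (η e t xor η e t) xor η e t         ≡⟨ cong (λ k → (η e t xor η e k) xor η e t) (sym (conj-e t)) ⟩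
      (η e t xor η e (conj e t)) xor η e t ≡⟨ cong (_xor η e t) (sym (η-· e e t)) ⟩
      η (e · e) t xor η e t               ≡⟨ cong (λ z → η z t xor η e t) (identityˡ e) ⟩
      η e t xor η e t                     ≡⟨ xor-same (η e t) ⟩
      false                               ∎

    η-S : ∀ {s} t → S s → η s t ≡ [ s ≈? t ]
    η-S {s} t σ = proj₁ (φ-S s σ) t

    conj-S : ∀ {s} → S s → conj s s ≡ s
    conj-S {s} σ = cancʳ s s

    -- Strong exchange. By the cocycle rule `η-·`, an odd parity means that some suffix of the word
    -- conjugates t to the letter in front of it; deleting that letter multiplies the product by t.
    η-del : ∀ {ws} t → All S ws → η (prod ws) t ≡ true →
            ∃ λ ws' → All S ws' × length ws ≡ suc (length ws') × prod ws' ≡ prod ws · t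
    η-del t [] q with trans (sym (η-e t)) q
    ... | ()
    η-del {s ∷ ws} t (σ ∷ a) q with η (prod ws) t in r
    ... | true with η-del t a r
    ... | ws' , a' , l , p = s ∷ ws' , σ ∷ a' , cong suc l , trans (cong (s ·_) p) (sym (assoc _ _ _))
    η-del {s ∷ ws} t (σ ∷ a) q | false = ws , a , refl , sym (begin
        s · prod ws · t          ≡⟨ assoc _ _ _ ⟩
        s · (prod ws · t)        ≡⟨ cong (s ·_) (sym (cancʳ' (prod ws) _)) ⟩
        s · (conj (prod ws) t · prod ws) ≡⟨ cong (λ z → s · (z · prod ws)) (sym eq) ⟩
        s · (s · prod ws)        ≡⟨ ss _ σ ⟩
        prod ws                  ∎)
      where
      eq : s ≡ conj (prod ws) t
      eq = ≈?-sound (trans (sym (η-S _ σ)) (trans (cong (_xor η s (conj (prod ws) t)) (sym r))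
          (trans (sym (η-· s (prod ws) t)) q)))

    η-true : ∀ w t → η w t ≡ true → ℓ (w · t) < ℓ w
    η-true w t q with ℓ-word w
    ... | ws , a , refl , l with η-del t a q
    ... | ws' , a' , l' , p = ℕₚ.≤-trans (s≤s (ℓ-min (prod ws · t) ws' a' p))
                                (ℕₚ.≤-reflexive (trans (sym l') l))

    refl-invol : ∀ {t} → Reflection C t → t · t ≡ e
    refl-invol (u , s , σ , refl) = trans (sym (conj-mul u s s)) (trans (cong (conj u) (S-invol s σ)) (conj-1 u))

    -- Write t as a conjugate of s by u: the contributions of u and of its inverse are equal and
    -- cancel, and the middle letter s contributes one.
    η-refl : ∀ {t} → Reflection C t → η t t ≡ true
    η-refl {t} (u , s , σ , refl) = begin
      η (u · s · u ⁻¹) t                            ≡⟨ η-· (u · s) (u ⁻¹) t ⟩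
      η (u ⁻¹) t xor η (u · s) (conj (u ⁻¹) t)      ≡⟨ cong (λ z → η (u ⁻¹) t xor η (u · s) z) (conj-inv u s) ⟩
      η (u ⁻¹) t xor η (u · s) s                    ≡⟨ cong (η (u ⁻¹) t xor_) (η-· u s s) ⟩
      η (u ⁻¹) t xor (η s s xor η u (conj s s))     ≡⟨ cong₂ (λ a b → η (u ⁻¹) t xor (a xor η u b))
                                                         (trans (η-S s σ) (≈?-true refl)) (conj-S σ) ⟩
      η (u ⁻¹) t xor (true xor η u s)               ≡⟨ cong (_xor (true xor η u s)) (ab (η (u ⁻¹) t) (η u s) same) ⟩
      η u s xor (true xor η u s)                    ≡⟨ xt (η u s) ⟩
      true                                          ∎
      where
      same : η (u ⁻¹) t xor η u s ≡ false
      same = begin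
        η (u ⁻¹) t xor η u s                     ≡⟨ cong (λ z → η (u ⁻¹) t xor η u z) (sym (conj-inv u s)) ⟩
        η (u ⁻¹) t xor η u (conj (u ⁻¹) t)       ≡⟨ sym (η-· u (u ⁻¹) t) ⟩
        η (u · u ⁻¹) t                           ≡⟨ cong (λ z → η z t) (inverseʳ u) ⟩
        η e t                                    ≡⟨ η-e t ⟩
        false                                    ∎
      ab : ∀ a b → a xor b ≡ false → a ≡ b
      ab false false _ = refl
      ab true true _ = refl
      xt : ∀ b → b xor (true xor b) ≡ true
      xt false = refl
      xt true = refl

    tt : ∀ {t} w → Reflection C t → w · t · t ≡ w
    tt w r = trans (assoc _ _ _) (trans (cong (w ·_) (refl-invol r)) (identityʳ w))

    η-false : ∀ w t → Reflection C t → η w t ≡ false → ℓ w < ℓ (w · t)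
    η-false w t r q = subst (λ z → ℓ z < ℓ (w · t)) (tt w r) (η-true (w · t) t (begin
      η (w · t) t                  ≡⟨ η-· w t t ⟩
      η t t xor η w (conj t t)     ≡⟨ cong₂ (λ a b → a xor η w b) (η-refl r) (cancʳ t t) ⟩
      true xor η w t               ≡⟨ cong (true xor_) q ⟩
      true                         ∎))

    η⇐< : ∀ w t → Reflection C t → ℓ (w · t) < ℓ w → η w t ≡ true
    η⇐< w t r l with η w t in q
    ... | true = refl
    ... | false = ⊥-elim (ℕₚ.<-asym l (η-false w t r q))

    η⇐> : ∀ w t → ℓ w < ℓ (w · t) → η w t ≡ false
    η⇐> w t l with η w t in q
    ... | false = refl
    ... | true = ⊥-elim (ℕₚ.<-asym l (η-true w t q))

    S-refl : ∀ {s} → S s → Reflection C s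
    S-refl {s} σ = e , s , σ , sym (conj-e s)

    conj-refl : ∀ {t} b → Reflection C t → Reflection C (conj b t)
    conj-refl b (u , s , σ , refl) = b · u , s , σ , sym (conj-· b u s)

    ℓ-s· : ∀ {s} w → S s → ℓ (s · w) ≡ ℓ (w ⁻¹ · s)
    ℓ-s· {s} w σ = trans (sym (ℓ-inv (s · w))) (cong ℓ (trans (inv-· s w) (cong (w ⁻¹ ·_) (inv-S σ))))

    ℓ-·s≤ : ∀ {s} w → S s → ℓ (w · s) ≤ℕ suc (ℓ w)
    ℓ-·s≤ {s} w σ = subst₂ (λ a b → a ≤ℕ suc b)
      (trans (ℓ-s· (w ⁻¹) σ) (cong (λ z → ℓ (z · s)) (inv-inv w))) (ℓ-inv w) (ℓ-·≤ (w ⁻¹) σ)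

    stepʳ : ∀ {s} w → S s → ℓ (w · s) ≡ suc (ℓ w) ⊎ ℓ w ≡ suc (ℓ (w · s))
    stepʳ {s} w σ with η w s in q
    ... | true = inj₂ (ℕₚ.≤-antisym (subst (λ z → ℓ z ≤ℕ suc (ℓ (w · s))) (ssʳ w σ) (ℓ-·s≤ (w · s) σ)) (η-true w s q))
    ... | false = inj₁ (ℕₚ.≤-antisym (ℓ-·s≤ w σ) (η-false w s (S-refl σ) q))

    stepˡ : ∀ {s} w → S s → ℓ (s · w) ≡ suc (ℓ w) ⊎ ℓ w ≡ suc (ℓ (s · w))
    stepˡ {s} w σ with stepʳ (w ⁻¹) σ
    ... | inj₁ p = inj₁ (trans (ℓ-s· w σ) (trans p (cong suc (ℓ-inv w))))
    ... | inj₂ p = inj₂ (trans (sym (ℓ-inv w)) (trans p (cong suc (sym (ℓ-s· w σ)))))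

    infix 4 _≤_
    _≤_ : W → W → Set
    _≤_ = _≤B_ C

    ≤-trans : ∀ {u v w} → u ≤ v → v ≤ w → u ≤ w
    ≤-trans p ≤B-refl = p
    ≤-trans p (≤B-step q r l) = ≤B-step (≤-trans p q) r l

    ≤⇒ℓ : ∀ {u w} → u ≤ w → ℓ u ≤ℕ ℓ w
    ≤⇒ℓ ≤B-refl = ℕₚ.≤-refl
    ≤⇒ℓ (≤B-step p r l) = ℕₚ.≤-trans (≤⇒ℓ p) (ℕₚ.<⇒≤ l)

    ≤∧ℓ⇒≡ : ∀ {u w} → u ≤ w → ℓ w ≤ℕ ℓ u → u ≡ w
    ≤∧ℓ⇒≡ ≤B-refl _ = refl
    ≤∧ℓ⇒≡ (≤B-step p r l) q = ⊥-elim (ℕₚ.<-irrefl refl (ℕₚ.≤-trans l (ℕₚ.≤-trans q (≤⇒ℓ p))))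

    edge : ∀ {v t} → Reflection C t → ℓ v < ℓ (v · t) → v ≤ v · t
    edge r l = ≤B-step ≤B-refl r l

    edge' : ∀ {v t z} → Reflection C t → ℓ v < ℓ z → z ≡ v · t → v ≤ z
    edge' r l refl = edge r l

    inv-mono : ∀ {u w} → u ≤ w → u ⁻¹ ≤ w ⁻¹
    inv-mono ≤B-refl = ≤B-refl
    inv-mono (≤B-step {v} {t} p r l) = ≤-trans (inv-mono p) (edge' (conj-refl v r)
      (subst₂ _<_ (sym (ℓ-inv v)) (sym (ℓ-inv (v · t))) l)
      (begin
        (v · t) ⁻¹               ≡⟨ inv-· v t ⟩
        t ⁻¹ · v ⁻¹              ≡⟨ cong (_· v ⁻¹) (sym (inv-uniq t t (refl-invol r))) ⟩
        t · v ⁻¹                 ≡⟨ sym (cancˡ v _) ⟩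
        v ⁻¹ · (v · (t · v ⁻¹))  ≡⟨ cong (v ⁻¹ ·_) (sym (assoc v t _)) ⟩
        v ⁻¹ · conj v t          ∎))

    inv-mono' : ∀ {u w} → u ⁻¹ ≤ w ⁻¹ → u ≤ w
    inv-mono' p = subst₂ _≤_ (inv-inv _) (inv-inv _) (inv-mono p)

    -- The cocycles of s·v and v differ at one reflection only, the one that carries v to s·v. Hence
    -- left multiplication by s preserves every other edge.
    left-edge : ∀ {s v t} → S s → Reflection C t → ℓ v < ℓ (v · t) → v · t ≡ s · v ⊎ s · v ≤ s · (v · t)
    left-edge {s} {v} {t} σ r l with s ≟ conj v t
    ... | yes p = inj₁ (sym (trans (cong (_· v) p) (cancʳ' v (v · t))))
    ... | no ¬p = inj₂ (subst (s · v ≤_) (assoc s v t) (edge r (η-false (s · v) t r (begin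
          η (s · v) t                 ≡⟨ η-· s v t ⟩
          η v t xor η s (conj v t)    ≡⟨ cong₂ _xor_ (η⇐> v t l) (trans (η-S _ σ) (dec-false (s ≟ conj v t) ¬p)) ⟩
          false                       ∎))))

    mult-up : ∀ {s w} → S s → ℓ (s · w) ≡ suc (ℓ w) → w ≤ s · w
    mult-up {s} {w} σ q = edge' (conj-refl (w ⁻¹) (S-refl σ)) (ℕₚ.≤-reflexive (sym q)) (sym (begin
      w · (w ⁻¹ · s · (w ⁻¹) ⁻¹)  ≡⟨ cong (λ z → w · (w ⁻¹ · s · z)) (inv-inv w) ⟩
      w · (w ⁻¹ · s · w)          ≡⟨ cong (w ·_) (assoc _ _ _) ⟩
      w · (w ⁻¹ · (s · w))        ≡⟨ cancˡ' w (s · w) ⟩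
      s · w                       ∎))

    -- The longer and the shorter of w and s·w. Both maps are monotone in Bruhat order, which
    -- contains the multiplication and the lifting property in one symmetric form.
    mx mn : ∀ {s} → S s → W → W
    mx {s} σ w with stepˡ w σ
    ... | inj₁ _ = s · w
    ... | inj₂ _ = w
    mn {s} σ w with stepˡ w σ
    ... | inj₁ _ = w
    ... | inj₂ _ = s · w

    ≤mx : ∀ {s} (σ : S s) w → w ≤ mx σ w
    ≤mx σ w with stepˡ w σ
    ... | inj₁ u = mult-up σ u
    ... | inj₂ _ = ≤B-refl

    s≤mx : ∀ {s} (σ : S s) w → s · w ≤ mx σ w
    s≤mx {s} σ w with stepˡ w σ
    ... | inj₁ u = ≤B-refl
    ... | inj₂ d = subst (s · w ≤_) (ss w σ) (mult-up σ (trans (cong ℓ (ss w σ)) d))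

    mn≤ : ∀ {s} (σ : S s) w → mn σ w ≤ w
    mn≤ {s} σ w with stepˡ w σ
    ... | inj₁ u = ≤B-refl
    ... | inj₂ d = subst (s · w ≤_) (ss w σ) (mult-up σ (trans (cong ℓ (ss w σ)) d))

    mx-edge : ∀ {s v t} (σ : S s) → Reflection C t → ℓ v < ℓ (v · t) → mx σ v ≤ mx σ (v · t)
    mx-edge {s} {v} {t} σ r l with stepˡ v σ
    ... | inj₂ d = ≤-trans (edge r l) (≤mx σ (v · t))
    ... | inj₁ u with left-edge σ r l
    ... | inj₁ p = subst (_≤ mx σ (v · t)) p (≤mx σ (v · t))
    ... | inj₂ p = ≤-trans p (s≤mx σ (v · t))

    mn-edge : ∀ {s v t} (σ : S s) → Reflection C t → ℓ v < ℓ (v · t) → mn σ v ≤ mn σ (v · t)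
    mn-edge {s} {v} {t} σ r l with stepˡ (v · t) σ
    ... | inj₁ u = ≤-trans (mn≤ σ v) (edge r l)
    ... | inj₂ d with stepˡ v σ
    ... | inj₁ u with left-edge σ r l
    ...   | inj₁ p = subst (v ≤_) (trans (sym (ss v σ)) (cong (s ·_) (sym p))) ≤B-refl
    ...   | inj₂ p = ≤-trans (mult-up σ u) p
    mn-edge {s} {v} {t} σ r l | inj₂ d | inj₂ d' with left-edge σ r l
    ... | inj₂ p = p
    ... | inj₁ p = ⊥-elim (ℕₚ.<-asym l (subst (λ z → ℓ z < ℓ v) (sym p) (ℕₚ.≤-reflexive (sym d'))))

    mx-mono : ∀ {s u w} (σ : S s) → u ≤ w → mx σ u ≤ mx σ w
    mx-mono σ ≤B-refl = ≤B-refl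
    mx-mono σ (≤B-step p r l) = ≤-trans (mx-mono σ p) (mx-edge σ r l)

    mn-mono : ∀ {s u w} (σ : S s) → u ≤ w → mn σ u ≤ mn σ w
    mn-mono σ ≤B-refl = ≤B-refl
    mn-mono σ (≤B-step p r l) = ≤-trans (mn-mono σ p) (mn-edge σ r l)

    abs : ∀ {a b} {X : Set} → a ≡ suc b → b ≡ suc a → X
    abs p q = ⊥-elim (ℕₚ.<-asym (ℕₚ.≤-reflexive (sym p)) (ℕₚ.≤-reflexive (sym q)))

    mult-mono : ∀ {s u w} → S s → u ≤ w → ℓ (s · w) ≡ suc (ℓ w) → s · u ≤ s · w
    mult-mono {s} {u} {w} σ p q = ≤-trans (s≤mx σ u) (subst (mx σ u ≤_) eq (mx-mono σ p))
      where
      eq : mx σ w ≡ s · w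
      eq with stepˡ w σ
      ... | inj₁ _ = refl
      ... | inj₂ d = abs d q

    lift : ∀ {s u w} → S s → u ≤ w → ℓ w ≡ suc (ℓ (s · w)) → ℓ (s · u) ≡ suc (ℓ u) → u ≤ s · w
    lift {s} {u} {w} σ p q q' = subst₂ _≤_ eq₁ eq₂ (mn-mono σ p)
      where
      eq₁ : mn σ u ≡ u
      eq₁ with stepˡ u σ
      ... | inj₁ _ = refl
      ... | inj₂ d = abs d q'
      eq₂ : mn σ w ≡ s · w
      eq₂ with stepˡ w σ
      ... | inj₂ _ = refl
      ... | inj₁ d = abs d q

    ·inv : ∀ {s} w → S s → (w · s) ⁻¹ ≡ s · w ⁻¹
    ·inv {s} w σ = trans (inv-· w s) (cong (_· w ⁻¹) (inv-S σ))

    ℓ-·s : ∀ {s} w → S s → ℓ (w · s) ≡ ℓ (s · w ⁻¹)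
    ℓ-·s w σ = trans (sym (ℓ-inv _)) (cong ℓ (·inv w σ))

    up-inv : ∀ {s w} → S s → ℓ (w · s) ≡ suc (ℓ w) → ℓ (s · w ⁻¹) ≡ suc (ℓ (w ⁻¹))
    up-inv {s} {w} σ q = trans (sym (ℓ-·s w σ)) (trans q (cong suc (sym (ℓ-inv w))))

    dn-inv : ∀ {s w} → S s → ℓ w ≡ suc (ℓ (w · s)) → ℓ (w ⁻¹) ≡ suc (ℓ (s · w ⁻¹))
    dn-inv {s} {w} σ q = trans (ℓ-inv w) (trans q (cong suc (ℓ-·s w σ)))

    crossʳ : ∀ {s} u v → S s → ℓ (u · s) ≡ suc (ℓ u) → ℓ (v · u) ≡ suc (ℓ (v · u · s)) →
             ℓ (v · (u · s · u ⁻¹)) < ℓ v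
    crossʳ {s} u v σ p q = η-true v (conj u s) (begin
      η v (conj u s)               ≡⟨ cong (_xor η v (conj u s)) (sym (η⇐> u s (ℕₚ.≤-reflexive (sym p)))) ⟩
      η u s xor η v (conj u s)     ≡⟨ sym (η-· v u s) ⟩
      η (v · u) s                  ≡⟨ η⇐< (v · u) s (S-refl σ) (ℕₚ.≤-reflexive (sym q)) ⟩
      true                         ∎)

    crossˡ : ∀ {s} u v → S s → ℓ (s · u) ≡ suc (ℓ u) → ℓ (u · v) ≡ suc (ℓ (s · (u · v))) →
             ℓ (u ⁻¹ · (s · u) · v) < ℓ v
    crossˡ {s} u v σ p q = subst₂ _<_
      (trans (sym (ℓ-inv _)) (cong ℓ (begin
        (v ⁻¹ · (u ⁻¹ · s · (u ⁻¹) ⁻¹)) ⁻¹        ≡⟨ inv-· _ _ ⟩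
        (u ⁻¹ · s · (u ⁻¹) ⁻¹) ⁻¹ · (v ⁻¹) ⁻¹     ≡⟨ cong₂ _·_ eq (inv-inv v) ⟩
        u ⁻¹ · (s · u) · v                        ∎)))
      (ℓ-inv v)
      (crossʳ (u ⁻¹) (v ⁻¹) σ (trans (sym (ℓ-s· u σ)) (trans p (cong suc (sym (ℓ-inv u)))))
        (begin
          ℓ (v ⁻¹ · u ⁻¹)              ≡⟨ cong ℓ (sym (inv-· u v)) ⟩
          ℓ ((u · v) ⁻¹)               ≡⟨ ℓ-inv _ ⟩
          ℓ (u · v)                    ≡⟨ q ⟩
          suc (ℓ (s · (u · v)))        ≡⟨ cong suc (ℓ-s· (u · v) σ) ⟩
          suc (ℓ ((u · v) ⁻¹ · s))     ≡⟨ cong (λ z → suc (ℓ (z · s))) (inv-· u v) ⟩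
          suc (ℓ (v ⁻¹ · u ⁻¹ · s))    ∎))
      where
      eq : (u ⁻¹ · s · (u ⁻¹) ⁻¹) ⁻¹ ≡ u ⁻¹ · (s · u)
      eq = begin
        (u ⁻¹ · s · (u ⁻¹) ⁻¹) ⁻¹   ≡⟨ sym (inv-uniq _ _ (refl-invol (conj-refl (u ⁻¹) (S-refl σ)))) ⟩
        u ⁻¹ · s · (u ⁻¹) ⁻¹        ≡⟨ cong (u ⁻¹ · s ·_) (inv-inv u) ⟩
        u ⁻¹ · s · u                ≡⟨ assoc _ _ _ ⟩
        u ⁻¹ · (s · u)              ∎

    ℓ-S≤1 : ∀ {s} → S s → ℓ s ≤ℕ 1
    ℓ-S≤1 {s} σ = ℓ-min s (s ∷ []) (σ ∷ []) (identityʳ s)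

    -- A generator is different from e because its cocycle is true at the generator itself, whereas
    -- the cocycle of e vanishes.
    ℓ-S : ∀ {s} → S s → ℓ s ≡ 1
    ℓ-S {s} σ with ℓ s in q | ℓ-S≤1 σ
    ... | 1 | _ = refl
    ... | suc (suc _) | s≤s ()
    ... | 0 | _ with trans (sym (η-e s)) (trans (cong (λ z → η z s) (sym (ℓ-0 q))) (trans (η-S s σ) (≈?-true refl)))
    ... | ()

    desc : ∀ w → ¬ w ≡ e → ∃ λ s → S s × ℓ w ≡ suc (ℓ (s · w))
    desc w n with ℓ-word w
    ... | [] , _ , p , _ = ⊥-elim (n (sym p))
    ... | s ∷ ws , σ ∷ a , refl , l with stepˡ (s · prod ws) σ
    ... | inj₂ d = s , σ , d
    ... | inj₁ u = ⊥-elim (ℕₚ.<-irrefl refl (ℕₚ.≤-trans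
            (s≤s (ℕₚ.n≤1+n (length ws)))
            (ℕₚ.≤-trans (ℕₚ.≤-reflexive (trans (cong suc l) (trans (sym u) (cong ℓ (ss (prod ws) σ)))))
               (ℓ-min (prod ws) ws a refl))))

    descʳ : ∀ w → ¬ w ≡ e → ∃ λ s → S s × ℓ w ≡ suc (ℓ (w · s))
    descʳ w n with desc (w ⁻¹) (λ q → n (trans (sym (inv-inv w)) (trans (cong _⁻¹ q) inv-e)))
    ... | s , σ , d = s , σ , trans (sym (ℓ-inv w)) (trans d (cong suc (sym (ℓ-·s w σ))))

    ℓ-1 : ∀ {w} → ℓ w ≡ 1 → S w
    ℓ-1 {w} q with ℓ-word w
    ... | s ∷ [] , σ ∷ [] , p , _ = subst S (trans (sym (identityʳ s)) p) σ
    ... | [] , _ , _ , l with trans l q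
    ... | ()
    ℓ-1 {w} q | _ ∷ _ ∷ _ , _ , _ , l with trans l q
    ... | ()

  sys : Sys
  sys = record
    { W = W ; _·_ = _·_ ; e = e ; inv = _⁻¹
    ; assoc = assoc ; assoc' = λ x y z → sym (assoc x y z) ; idˡ = identityˡ ; idʳ = identityʳ ; invˡ = inverseˡ ; invʳ = inverseʳ
    ; S = S ; SS = λ σ → S-invol _ σ ; ℓ = ℓ ; ℓ0 = ℓ-0 ; ℓe = ℓ-e ; ℓ1 = ℓ-1 ; ℓS = ℓ-S
    ; descL = desc ; descR = descʳ ; stepL = stepˡ ; stepR = stepʳ
    ; _≤_ = _≤B_ C ; ≤r = ≤B-refl ; ≤t = ≤-trans ; ≤ℓ = ≤⇒ℓ ; ≤≡ = ≤∧ℓ⇒≡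
    ; upL = mult-up ; upR = λ σ q → edge (S-refl σ) (ℕₚ.≤-reflexive (sym q))
    ; monoL = mult-mono
    ; monoR = λ {s} {u} {w} σ p q → inv-mono' (subst₂ _≤_ (sym (·inv u σ)) (sym (·inv w σ))
                (mult-mono σ (inv-mono p) (up-inv σ q)))
    ; liftL = lift
    ; liftR = λ {s} {u} {w} σ p q q' → inv-mono' (subst (u ⁻¹ ≤_) (sym (·inv w σ))
                (lift σ (inv-mono p) (dn-inv σ q) (up-inv σ q')))
    ; crossL = crossˡ ; crossR = crossʳ }

-- Reduced products, parabolic and dihedral subgroups

module Products (Y : Sys) where
  open Sys Y
  open Basics Y public

  ℓ-sub : ∀ x y → ℓ (x · y) ≤ℕ ℓ x +ℕ ℓ y
  ℓ-sub x y = go (ℓ x) x refl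
    where
    go : ∀ n x → ℓ x ≡ n → ℓ (x · y) ≤ℕ n +ℕ ℓ y
    go n x q with x ≟ e
    go n x q | yes refl = ℕₚ.≤-trans (ℕₚ.≤-reflexive (cong ℓ (idˡ y))) (ℕₚ.m≤n+m _ n)
    go zero x q | no r = ⊥-elim (r (ℓ0 q))
    go (suc n) x q | no r with descL x r
    ... | s , σ , d = subst (λ z → ℓ z ≤ℕ suc n +ℕ ℓ y) (trans (cong (s ·_) (assoc s x y)) (sc (x · y) σ))
      (ℕₚ.≤-trans (ℓ≤suc ((s · x) · y) σ) (s≤s (go n (s · x) (ℕₚ.suc-injective (trans (sym d) q)))))

  inv-· : ∀ x y → inv (x · y) ≡ inv y · inv x
  inv-· x y = canL (x · y) (trans (invʳ (x · y)) (sym (trans (assoc x y _)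
    (trans (cong (x ·_) (trans (sym (assoc y (inv y) (inv x))) (trans (cong (_· inv x) (invʳ y)) (idˡ _)))) (invʳ x)))))

  inv-S : ∀ {s} → S s → inv s ≡ s
  inv-S {s} σ = canL s (trans (invʳ s) (sym (SS σ)))

  additive-mid : ∀ {s} m n → S s → ℓ (m · n) ≡ ℓ m +ℕ ℓ n → DnR n s →
                 ℓ (m · (n · s)) ≡ ℓ m +ℕ ℓ (n · s) × UpR (m · (n · s)) s
  additive-mid {s} m n σ q d with stepR (m · (n · s)) σ
  ... | inj₁ up = ℕₚ.suc-injective (trans (sym up) (trans (cong ℓ (trans (assoc m (n · s) s) (cong (m ·_) (scR n σ))))
                     (trans q (trans (cong (ℓ m +ℕ_) d) (ℕₚ.+-suc _ _))))) , up
  ... | inj₂ dn = ⊥-elim (ℕₚ.<-irrefl refl (ℕₚ.≤-trans (s≤s (ℕₚ.≤-reflexive refl)) (ℕₚ.≤-trans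
        (ℕₚ.≤-trans (s≤s (ℕₚ.≤-reflexive (sym (trans q (trans (cong (ℓ m +ℕ_) d) (ℕₚ.+-suc _ _))))))
            (ℕₚ.≤-trans (s≤s (ℕₚ.≤-reflexive (cong ℓ (sym (trans (assoc m (n · s) s) (cong (m ·_) (scR n σ)))))))
                (ℕₚ.≤-trans (ℕₚ.≤-reflexive (sym dn)) (ℓ-sub m (n · s)))))
        (ℕₚ.n≤1+n _))))

  mul≤ : ∀ {u v m n} → u ≤ m → v ≤ n → ℓ (m · n) ≡ ℓ m +ℕ ℓ n → u · v ≤ m · n
  mul≤ {u} {v} {m} {n} p = go (ℓ n) v n refl
    where
    go : ∀ k v n → ℓ n ≡ k → v ≤ n → ℓ (m · n) ≡ ℓ m +ℕ ℓ n → u · v ≤ m · n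
    go k v n q r a with n ≟ e
    go k v n q r a | yes refl = subst₂ _≤_ (trans (sym (idʳ u)) (cong (u ·_) (sym (≤e r)))) (sym (idʳ m)) p
    go zero v n q r a | no n≢ = ⊥-elim (n≢ (ℓ0 q))
    go (suc k) v n q r a | no n≢ with descR n n≢
    ... | g , γ , d with additive-mid m n γ a d | stepR v γ
    ... | a' , up | inj₂ dn = subst₂ _≤_ (trans (assoc u (v · g) g) (cong (u ·_) (scR v γ)))
                                         (trans (assoc m (n · g) g) (cong (m ·_) (scR n γ)))
          (monoR γ (go k (v · g) (n · g) (ℕₚ.suc-injective (trans (sym d) q)) v≤ a') up)
      where v≤ : v · g ≤ n · g
            v≤ = Basics.liftdd (op Y) γ r d dn
    ... | a' , up | inj₁ upv = ≤t (go k v (n · g) (ℕₚ.suc-injective (trans (sym d) q)) (liftR γ r d upv) a')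
          (subst (m · (n · g) ≤_) (trans (assoc m (n · g) g) (cong (m ·_) (scR n γ))) (upR γ up))

  prefix-dn : ∀ {k} m n → S k → ℓ (m · n) ≡ ℓ m +ℕ ℓ n → DnL k m → DnL k (m · n)
  prefix-dn {k} m n κ q d = lt⇒dn (m · n) κ (subst (λ z → ℓ z < ℓ (m · n)) (assoc k m n)
    (ℕₚ.≤-trans (s≤s (ℓ-sub (k · m) n)) (ℕₚ.≤-reflexive (sym (trans q (cong (_+ℕ ℓ n) d))))))

  cancel≤ : ∀ m {u v} → ℓ (m · u) ≡ ℓ m +ℕ ℓ u → ℓ (m · v) ≡ ℓ m +ℕ ℓ v → m · u ≤ m · v → u ≤ v
  cancel≤ m {u} {v} = go (ℓ m) m refl
    where
    go : ∀ n m → ℓ m ≡ n → ℓ (m · u) ≡ ℓ m +ℕ ℓ u → ℓ (m · v) ≡ ℓ m +ℕ ℓ v → m · u ≤ m · v → u ≤ v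
    go n m q au av p with m ≟ e
    go n m q au av p | yes refl = subst₂ _≤_ (idˡ u) (idˡ v) p
    go zero m q au av p | no r = ⊥-elim (r (ℓ0 q))
    go (suc n) m q au av p | no r with descL m r
    ... | k , κ , d = go n (k · m) (ℕₚ.suc-injective (trans (sym d) q)) (tail u au) (tail v av)
          (subst₂ _≤_ (sym (assoc k m u)) (sym (assoc k m v)) (liftdd κ p (prefix-dn m v κ av d) (prefix-dn m u κ au d)))
      where
      tail : ∀ u → ℓ (m · u) ≡ ℓ m +ℕ ℓ u → ℓ ((k · m) · u) ≡ ℓ (k · m) +ℕ ℓ u
      tail u q = ℕₚ.suc-injective (trans (trans (cong suc (cong ℓ (assoc k m u))) (sym (prefix-dn m u κ q d)))
                   (trans q (cong (_+ℕ ℓ u) d)))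

module Para (Y : Sys) (K : Sys.W Y → Set) (K? : ∀ s → Dec (K s)) where
  open Sys Y
  open Products Y

  -- The parabolic subgroup of K is described by support: all letters below u in Bruhat order lie in
  -- K. In this form it is visibly closed downwards. `MinL` singles out the minimal representatives
  -- of its left-multiplication cosets.
  In MinL : W → Set
  In u = ∀ {s} → S s → s ≤ u → K s
  MinL h = ∀ {k} → S k → K k → UpL k h

  In-e : In e
  In-e σ p = ⊥-elim (S≢e σ (≤e p))

  In-S : ∀ {k} → S k → K k → In k
  In-S κ Kk σ p with ≤s κ p
  ... | inj₁ q = ⊥-elim (S≢e σ q)
  ... | inj₂ refl = Kk

  In-≤ : ∀ {u v} → u ≤ v → In v → In u
  In-≤ p i σ q = i σ (≤t q p)

  In-cons : ∀ {k u} → S k → K k → In u → In (k · u)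
  In-cons κ Kk i σ p with supp-s κ σ p
  ... | inj₁ refl = Kk
  ... | inj₂ q = i σ q

  In-dn : ∀ {k u} → S k → In u → DnL k u → K k
  In-dn κ i d = i κ (dn⇒≤ κ d)

  In-ind : (P : W → Set) → P e → (∀ {k u} → S k → K k → In u → UpL k u → P u → P (k · u)) → ∀ u → In u → P u
  In-ind P pe ps u = go (ℓ u) u refl
    where
    go : ∀ n u → ℓ u ≡ n → In u → P u
    go n u q i with u ≟ e
    go n u q i | yes refl = pe
    go zero u q i | no r = ⊥-elim (r (ℓ0 q))
    go (suc n) u q i | no r with descL u r
    ... | k , κ , d = subst P (sc u κ) (ps κ (In-dn κ i d) i' (dn⇒up κ d)
                        (go n (k · u) (ℕₚ.suc-injective (trans (sym d) q)) i'))
      where i' : In (k · u)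
            i' = In-≤ (dn≤ κ d) i

  In-· : ∀ {v} → In v → ∀ u → In u → In (u · v)
  In-· {v} j = In-ind (λ u → In (u · v)) (λ {s} → subst In (sym (idˡ v)) j {s})
    (λ {k} {u} κ Kk _ _ h {s} → subst In (sym (assoc k u v)) (In-cons κ Kk h) {s})

  In-inv : ∀ u → In u → In (inv u)
  In-inv = In-ind (λ u → In (inv u))
    (λ {s} → subst In (trans (sym (invˡ e)) (idʳ _)) In-e {s})
    (λ {k} {u} κ Kk _ _ h {s} → subst In (sym (trans (inv-· k u) (cong (inv u ·_) (inv-S κ))))
                                  (In-· (In-S κ Kk) (inv u) h) {s})

  -- S need not be listable, but every left descent of w lies below w, so searching `low w`
  -- suffices.
  findK : ∀ w → (∃ λ k → S k × K k × DnL k w) ⊎ MinL w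
  findK w with any? (λ s → (ℓ s ℕₚ.≟ 1) ×-dec K? s ×-dec (ℓ w ℕₚ.≟ suc (ℓ (s · w)))) (low w)
  ... | yes a with satisfied a
  ... | k , l , Kk , d = inj₁ (k , ℓ1 l , Kk , d)
  findK w | no n = inj₂ λ κ Kk → ¬dn⇒up κ λ d → n (lose (≤⇒∈low (dn⇒≤ κ d)) (ℓS κ , Kk , d))

  record Split (w : W) : Set where
    constructor split
    field
      d h : W
      inD : In d
      minH : MinL h
      eq : w ≡ d · h
      len : ℓ w ≡ ℓ d +ℕ ℓ h

  abstract
    decomp : ∀ w → Split w
    decomp w = go (ℓ w) w refl
      where
      go : ∀ n w → ℓ w ≡ n → Split w
      go n w q with findK w
      go n w q | inj₂ m = split e w In-e m (sym (idˡ w)) (cong (_+ℕ ℓ w) (sym ℓe))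
      go zero w q | inj₁ (k , κ , Kk , d) with trans (sym q) d
      ... | ()
      go (suc n) w q | inj₁ (k , κ , Kk , dn) with go n (k · w) (ℕₚ.suc-injective (trans (sym dn) q))
      ... | split d h i m eq len = split (k · d) h (In-cons κ Kk i) m
            (trans (mvL κ eq) (sym (assoc k d h)))
            (ℕₚ.≤-antisym
              (ℕₚ.≤-trans (ℕₚ.≤-reflexive (cong ℓ (trans (mvL κ eq) (sym (assoc k d h))))) (ℓ-sub (k · d) h))
              (ℕₚ.≤-trans (ℕₚ.+-monoˡ-≤ (ℓ h) (ℓ≤suc d κ)) (ℕₚ.≤-reflexive (sym (trans dn (cong suc len))))))

  private
    -- the Demazure product z of g and y dominates g·y but has no new minimal elements below it
    demazure : ∀ y g → In g → ∃ λ z → g · y ≤ z × (∀ {h} → MinL h → h ≤ z → h ≤ y)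
    demazure y = In-ind (λ g → ∃ λ z → g · y ≤ z × (∀ {h} → MinL h → h ≤ z → h ≤ y))
      (y , subst (_≤ y) (sym (idˡ y)) ≤r , λ _ p → p)
      step
      where
      step : ∀ {k g} → S k → K k → In g → UpL k g → ∃ (λ z → g · y ≤ z × (∀ {h} → MinL h → h ≤ z → h ≤ y)) →
             ∃ (λ z → (k · g) · y ≤ z × (∀ {h} → MinL h → h ≤ z → h ≤ y))
      step {k} {g} κ Kk _ _ (z , p , f) with stepL z κ
      ... | inj₁ up = k · z , subst (_≤ k · z) (sym (assoc k g y)) (monoL κ p up)
                    , λ m q → f m (up-mono κ q up (m κ Kk))
      ... | inj₂ dn = z , subst (_≤ z) (sym (assoc k g y)) (star κ p dn) , f

    min≤ : ∀ {g y h} → In g → MinL h → h ≡ g · y → h ≤ y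
    min≤ {g} {y} {h} i m refl with demazure y g i
    ... | z , p , f = f m p

  uniq : ∀ {g y h} → In g → MinL y → MinL h → h ≡ g · y → h ≡ y
  uniq {g} {y} {h} i my mh q = ≤-anti (min≤ i mh q)
    (min≤ (In-inv g i) my (sym (trans (cong (inv g ·_) q)
      (trans (sym (assoc _ _ _)) (trans (cong (_· y) (invˡ g)) (idˡ y))))))

  minlen : ∀ {g h} → In g → MinL h → ℓ h ≤ℕ ℓ (g · h)
  minlen {g} {h} i m with decomp (g · h)
  ... | split d y j my eq len = subst (λ z → ℓ z ≤ℕ ℓ (g · h))
        (sym (uniq (In-· j (inv g) (In-inv g i)) my m
          (trans (trans (sym (idˡ h)) (trans (cong (_· h) (sym (invˡ g))) (assoc _ _ _)))
                 (trans (cong (inv g ·_) eq) (sym (assoc _ _ _))))))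
        (ℕₚ.≤-trans (ℕₚ.m≤n+m (ℓ y) (ℓ d)) (ℕₚ.≤-reflexive (sym len)))

  -- The first letter at which additivity fails would, by `crossL`, produce an element of the coset
  -- of h shorter than h, against `minlen`.
  add : ∀ {h} → MinL h → ∀ d → In d → ℓ (d · h) ≡ ℓ d +ℕ ℓ h
  add {h} m = In-ind (λ d → ℓ (d · h) ≡ ℓ d +ℕ ℓ h) (trans (cong ℓ (idˡ h)) (cong (_+ℕ ℓ h) (sym ℓe))) step
    where
    step : ∀ {k u} → S k → K k → In u → UpL k u → ℓ (u · h) ≡ ℓ u +ℕ ℓ h → ℓ ((k · u) · h) ≡ ℓ (k · u) +ℕ ℓ h
    step {k} {u} κ Kk i up ih with stepL (u · h) κ
    ... | inj₁ u' = trans (cong ℓ (assoc k u h)) (trans u' (trans (cong suc ih) (cong (_+ℕ ℓ h) (sym up))))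
    ... | inj₂ d' = ⊥-elim (ℕₚ.<-irrefl refl (ℕₚ.≤-trans (crossL u h κ up d')
                      (minlen (In-· (In-cons κ Kk i) (inv u) (In-inv u i)) m)))

  up-h : ∀ {k d h} → S k → K k → In d → MinL h → UpL k d → UpL k (d · h)
  up-h {k} {d} {h} κ Kk i m u = trans (cong ℓ (sym (assoc k d h)))
    (trans (add m (k · d) (In-cons κ Kk i)) (trans (cong (_+ℕ ℓ h) u) (cong suc (sym (add m d i)))))

  dn-h : ∀ {k d h} → S k → In d → MinL h → DnL k d → DnL k (d · h)
  dn-h {k} {d} {h} κ i m = prefix-dn d h κ (add m d i)

  dn-d : ∀ {k d h} → S k → K k → In d → MinL h → DnL k (d · h) → DnL k d
  dn-d κ Kk i m d = ¬up⇒dn κ λ u → dnup d (up-h κ Kk i m u)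

  peelAll : ∀ {u y} → MinL u → ∀ d → In d → u ≤ d · y → u ≤ y
  peelAll {u} {y} m = In-ind (λ d → u ≤ d · y → u ≤ y) (subst (u ≤_) (idˡ y))
    λ {k} {d} κ Kk _ _ h p → h (peel κ (subst (u ≤_) (assoc k d y) p) (m κ Kk))

  proj≤ : ∀ {d h d' h'} → In d → MinL h → In d' → d · h ≤ d' · h' → h ≤ h'
  proj≤ {d} {h} {d'} i m j p = peelAll m d' j (≤t (subst (_≤ d · h) (idˡ h) (mul≤ (e≤ d) ≤r (add m d i))) p)

  In? : ∀ u → Dec (In u)
  In? u with decomp u
  ... | split d h i m eq len with h ≟ e
  ...   | yes refl = yes λ {s} → subst In (sym (trans eq (idʳ d))) i {s}
  ...   | no n = no λ j → n (uniq (In-· j (inv d) (In-inv d i)) (λ κ _ → upe κ) m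
            (trans (trans (sym (idˡ h)) (trans (cong (_· h) (sym (invˡ d))) (assoc _ _ _)))
              (trans (cong (inv d ·_) (sym eq)) (sym (idʳ _)))))

  min-right : ∀ {h g} → S g → MinL h → DnR h g → MinL (h · g)
  min-right {h} {g} γ m d {k} κ Kk = ¬dn⇒up κ λ dk → ℕₚ.<-irrefl refl (ℕₚ.≤-trans
    (ℕₚ.≤-reflexive (sym (m κ Kk)))
    (subst (λ z → ℓ z ≤ℕ ℓ h) (trans (cong (_· g) (sym (assoc k h g))) (scR (k · h) γ))
      (ℕₚ.≤-trans (Basics.ℓ≤suc (op Y) (k · (h · g)) γ) (ℕₚ.≤-trans (ℕₚ.≤-reflexive (sym dk))
          (ℕₚ.≤-trans (ℕₚ.n≤1+n _) (ℕₚ.≤-reflexive (sym d)))))))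

module Dih (Y : Sys) (a t : Sys.W Y) (α : Sys.S Y a) (τ : Sys.S Y t) (a≢t : ¬ a ≡ t) where
  open Sys Y
  open Products Y
  K : W → Set
  K s = s ≡ a ⊎ s ≡ t

  K? : ∀ s → Dec (K s)
  K? s = (s ≟ a) ⊎-dec (s ≟ t)
  open Para Y K K? public

  Sof : ∀ {k} → K k → S k
  Sof (inj₁ refl) = α
  Sof (inj₂ refl) = τ

  Ka : K a
  Ka = inj₁ refl

  Kt : K t
  Kt = inj₂ refl

  other : ∀ {k} → K k → ∃ λ l → K l × ¬ k ≡ l × (∀ {s} → K s → ¬ s ≡ k → s ≡ l)
  other (inj₁ refl) = t , Kt , a≢t , λ { (inj₁ q) n → ⊥-elim (n q) ; (inj₂ q) _ → q }
  other (inj₂ refl) = a , Ka , (λ q → a≢t (sym q)) , λ { (inj₁ q) _ → q ; (inj₂ q) n → ⊥-elim (n q) }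

  third : ∀ {k l s} → K k → K l → K s → ¬ k ≡ l → ¬ s ≡ k → s ≡ l
  third Kk Kl Ks n n' with other Kk
  ... | o , Ko , _ , f = trans (f Ks n') (sym (f Kl λ q → n (sym q)))

  abstract
    first : ∀ {u} → In u → ¬ u ≡ e → ∃ λ k → K k × DnL k u
    first {u} i n with descL u n
    ... | k , κ , d = k , In-dn κ i d , d

  firstOther : ∀ {u k l} → In u → ¬ u ≡ e → K k → K l → ¬ k ≡ l → UpL k u → DnL l u
  firstOther i n Kk Kl kl up with first i n
  ... | s , Ks , d with third Kk Kl Ks kl (λ { refl → dnup d up })
  ... | refl = d

  -- Elements of a dihedral subgroup are alternating words, so a length and a first letter leave one
  -- possibility.
  dih1 : ∀ {u v k} → K k → In u → In v → ℓ u ≡ ℓ v → DnL k u → DnL k v → u ≡ v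
  dih1 {u} {v} {k} Kk i j q = go (ℓ u) u v k Kk i j refl (sym q)
    where
    go : ∀ n u v k → K k → In u → In v → ℓ u ≡ n → ℓ v ≡ n → DnL k u → DnL k v → u ≡ v
    go zero u v k Kk i j q r d d' with trans (sym q) d
    ... | ()
    go (suc n) u v k Kk i j q r d d' with (k · u) ≟ e
    ... | yes p = trans (mvL κ p) (sym (mvL κ (ℓ0 (trans (ℕₚ.suc-injective (trans (sym d') r))
                    (trans (sym (ℕₚ.suc-injective (trans (sym d) q))) (trans (cong ℓ p) ℓe))))))
      where κ = Sof Kk
    ... | no p with other Kk
    ... | l , Kl , kl , _ = canL k (go n (k · u) (k · v) l Kl (In-≤ (dn≤ κ d) i) (In-≤ (dn≤ κ d') j)
            (ℕₚ.suc-injective (trans (sym d) q)) (ℕₚ.suc-injective (trans (sym d') r))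
            (firstOther (In-≤ (dn≤ κ d) i) p Kk Kl kl (dn⇒up κ d))
            (firstOther (In-≤ (dn≤ κ d') j) p' Kk Kl kl (dn⇒up κ d')))
      where
      κ = Sof Kk
      p' : ¬ k · v ≡ e
      p' p' = p (ℓ0 (trans (ℕₚ.suc-injective (trans (sym d) q))
                 (trans (sym (ℕₚ.suc-injective (trans (sym d') r))) (trans (cong ℓ p') ℓe))))

  dih2 : ∀ {u v} → In u → In v → ℓ u < ℓ v → u ≤ v
  dih2 {u} {v} i j l = go (ℓ v) u v i j l refl
    where
    go : ∀ n u v → In u → In v → ℓ u < ℓ v → ℓ v ≡ n → u ≤ v
    go zero u v i j l q = ⊥-elim (ℕₚ.n≮0 (subst (ℓ u <_) q l))
    go (suc n) u v i j l q with v ≟ e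
    ... | yes refl = ⊥-elim (ℕₚ.n≮0 (subst (ℓ u <_) ℓe l))
    ... | no r with first j r
    ... | k , Kk , d with stepL u (Sof Kk)
    ... | inj₂ du = subst₂ _≤_ (sc u κ) (sc v κ) (monoL κ
            (go n (k · u) (k · v) (In-≤ (dn≤ κ du) i) (In-≤ (dn≤ κ d) j)
              (ℕₚ.≤-pred (subst₂ (λ x y → suc x ≤ℕ y) du d l)) (ℕₚ.suc-injective (trans (sym d) q))) (dn⇒up κ d))
      where κ = Sof Kk
    ... | inj₁ up with ℓ u ℕₚ.≟ ℓ (k · v)
    ... | no ne = ≤t (go n u (k · v) i (In-≤ (dn≤ κ d) j)
            (ℕₚ.≤∧≢⇒< (ℕₚ.≤-pred (subst (ℓ u <_) d l)) ne) (ℕₚ.suc-injective (trans (sym d) q))) (dn≤ κ d)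
      where κ = Sof Kk
    ... | yes eq with u ≟ e
    ... | yes refl = e≤ v
    ... | no u≢e with other Kk
    ... | o , Ko , ko , _ = subst (_≤ v) (sym (dih1 Ko i (In-≤ (dn≤ κ d) j) eq (firstOther i u≢e Kk Ko ko up)
            (firstOther (In-≤ (dn≤ κ d) j) (λ p → u≢e (ℓ0 (trans eq (trans (cong ℓ p) ℓe)))) Kk Ko ko (dn⇒up κ d)))) (dn≤ κ d)
      where κ = Sof Kk

  -- Only the longest element of a dihedral subgroup has both letters as left descents, and v is
  -- longer than u.
  one-desc : ∀ {u v k l} → In u → In v → ℓ u < ℓ v → K k → K l → DnL k u → DnL l u → k ≡ l
  one-desc {u} {v} {k} {l} i j lt Kk Kl dk dl = go (ℓ v) v j lt refl
    where
    go : ∀ n v → In v → ℓ u < ℓ v → ℓ v ≡ n → k ≡ l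
    go zero v j lt q = ⊥-elim (ℕₚ.n≮0 (subst (ℓ u <_) q lt))
    go (suc n) v j lt q with v ≟ e
    ... | yes refl = ⊥-elim (ℕₚ.n≮0 (subst (ℓ u <_) ℓe lt))
    ... | no r with first j r
    ... | s , Ks , d with ℓ u ℕₚ.≟ ℓ (s · v)
    ... | no ne = go n (s · v) (In-≤ (dn≤ (Sof Ks) d) j)
                    (ℕₚ.≤∧≢⇒< (ℕₚ.≤-pred (subst (ℓ u <_) d lt)) ne) (ℕₚ.suc-injective (trans (sym d) q))
    ... | yes eq with k ≟ l
    ... | yes p = p
    ... | no p = ⊥-elim (dnup (subst (DnL s) uv ds) (dn⇒up (Sof Ks) d))
      where
      ds : DnL s u
      ds with s ≟ k
      ... | yes refl = dk
      ... | no n = subst (λ z → DnL z u) (sym (third Kk Kl Ks p n)) dl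
      u≢e : ¬ u ≡ e
      u≢e refl with trans (sym ℓe) dk
      ... | ()
      uv : u ≡ s · v
      uv with other Ks
      ... | o , Ko , so , f = dih1 Ko i (In-≤ (dn≤ (Sof Ks) d) j) eq dno
              (firstOther (In-≤ (dn≤ (Sof Ks) d) j) (λ p → u≢e (ℓ0 (trans eq (trans (cong ℓ p) ℓe)))) Ks Ko so (dn⇒up (Sof Ks) d))
        where
        dno : DnL o u
        dno with o ≟ k
        ... | yes refl = dk
        ... | no n = subst (λ z → DnL z u) (sym (third Kk Kl Ko p n)) dl

-- Pairs of descents and commuting letters

module Descents (Y : Sys) where
  open Sys Y
  open Products Y

  suffix-dn : ∀ {k} m n → S k → ℓ (m · n) ≡ ℓ m +ℕ ℓ n → DnR n k → DnR (m · n) k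
  suffix-dn m n κ q = Products.prefix-dn (op Y) n m κ (trans q (ℕₚ.+-comm (ℓ m) (ℓ n)))

  -- With both k and l as descents, l·u starts with the longest element of their dihedral subgroup.
  -- After l is removed the word starts with k, and the next letter is l unless nothing of the
  -- dihedral part is left, in which case k and l commute.
  DD : ∀ {k l u} → S k → S l → ¬ k ≡ l → UpL l u → DnL k (l · u) →
       DnL k u × (k · l ≡ l · k ⊎ DnL l (k · u))
  DD {k} {l} {u} κ λ' k≢l up dk = dku , last
    where
    open Dih Y k l κ λ' k≢l
    sp = decomp (l · u)
    d = Split.d sp
    h = Split.h sp
    i : In d
    i = Split.inD sp
    m = Split.minH sp
    q : l · u ≡ d · h
    q = Split.eq sp
    dl : DnL l d
    dl = dn-d λ' Kt i m (subst (DnL l) q (up⇒dn λ' up))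
    dk' : DnL k d
    dk' = dn-d κ Ka i m (subst (DnL k) q dk)
    ul : u ≡ (l · d) · h
    ul = trans (mvL λ' q) (sym (assoc l d h))
    i₁ : In (l · d)
    i₁ = In-≤ (dn≤ λ' dl) i
    ne₁ : ¬ l · d ≡ e
    ne₁ p = k≢l (dnS κ λ' (subst (DnL k) (trans (mvL λ' p) (idʳ l)) dk'))
    dk₁ : DnL k (l · d)
    dk₁ = firstOther i₁ ne₁ Kt Ka (λ p → k≢l (sym p)) (dn⇒up λ' dl)
    dku : DnL k u
    dku = subst (DnL k) (sym ul) (dn-h κ i₁ m dk₁)
    i₂ : In (k · (l · d))
    i₂ = In-≤ (dn≤ κ dk₁) i₁
    last : k · l ≡ l · k ⊎ DnL l (k · u)
    last with (k · (l · d)) ≟ e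
    ... | no n = inj₂ (subst (DnL l) (trans (assoc k (l · d) h) (cong (k ·_) (sym ul)))
                   (dn-h λ' i₂ m (firstOther i₂ n Ka Kt k≢l (dn⇒up κ dk₁))))
    ... | yes p = inj₁ (sym (trans (sym dlk) (trans (exch' ) refl)))
      where
      ld : l · d ≡ k
      ld = trans (mvL κ p) (idʳ k)
      dlk : d ≡ l · k
      dlk = mvL λ' ld
      -- d = l·k has k as a left descent, hence k·d is the remaining letter l
      exch' : d ≡ k · l
      exch' = exch κ (subst (l ≤_) (sym dlk) (upR κ upr) , trans (cong ℓ dlk) upr) (upS κ λ' k≢l) dk'
        where
        upr : UpR l k
        upr = trans (trans (cong ℓ (sym dlk)) dl) (cong suc (trans (cong ℓ ld) (trans (ℓS κ) (sym (ℓS λ')))))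

  -- Strip the first letter g of m. By `DD` either b and g commute, or g is a descent of b·X with X
  -- = m₁·b·d. In the second case b commutes with the rest m₁ by induction, so b·X = m₁·d, of which
  -- g is an ascent.
  insert-desc : ∀ {b} m d → S b → ℓ (m · d) ≡ ℓ m +ℕ ℓ d → ℓ (m · (b · d)) ≡ ℓ m +ℕ ℓ (b · d) →
                ¬ b ≤ m · d → DnL b (m · (b · d)) →
                ∀ {s} → S s → s ≤ m → b · s ≡ s · b
  insert-desc {b} m d β = go (ℓ m) m refl
    where
    b∉m : ∀ m → ℓ (m · d) ≡ ℓ m +ℕ ℓ d → ¬ b ≤ m · d → ¬ b ≤ m
    b∉m m q n p = n (≤t p (subst (_≤ m · d) (idʳ m) (mul≤ ≤r (e≤ d) q)))
    go : ∀ n m → ℓ m ≡ n → ℓ (m · d) ≡ ℓ m +ℕ ℓ d → ℓ (m · (b · d)) ≡ ℓ m +ℕ ℓ (b · d) →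
                ¬ b ≤ m · d → DnL b (m · (b · d)) →
         ∀ {s} → S s → s ≤ m → b · s ≡ s · b
    go n m q a ab n∉ dn σ p with m ≟ e
    go n m q a ab n∉ dn σ p | yes refl = ⊥-elim (S≢e σ (≤e p))
    go zero m q a ab n∉ dn σ p | no r = ⊥-elim (r (ℓ0 q))
    go (suc n) m q a ab n∉ dn {s} σ p | no r with descL m r
    ... | g , γ , dg = res
      where
      m₁ = g · m
      m≡ : m ≡ g · m₁
      m≡ = sym (sc m γ)
      b≢g : ¬ b ≡ g
      b≢g refl = b∉m m a n∉ (dn⇒≤ γ dg)
      split-len : ℓ (m · d) ≡ suc (ℓ m₁ +ℕ ℓ d)
      split-len = trans a (cong (_+ℕ ℓ d) dg)
      gm₁d : m · d ≡ g · (m₁ · d)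
      gm₁d = trans (cong (_· d) m≡) (assoc g m₁ d)
      a₁ : ℓ (m₁ · d) ≡ ℓ m₁ +ℕ ℓ d
      a₁ = ℕₚ.≤-antisym (ℓ-sub m₁ d) (ℕₚ.≤-pred (ℕₚ.≤-trans (ℕₚ.≤-reflexive (trans (sym split-len) (cong ℓ gm₁d)))
          (ℓ≤suc (m₁ · d) γ)))
      upg : UpL g (m₁ · d)
      upg = trans (cong ℓ (sym gm₁d)) (trans split-len (cong suc (sym a₁)))
      n₁ : ¬ b ≤ m₁ · d
      n₁ p = n∉ (≤t p (subst (m₁ · d ≤_) (sym gm₁d) (upL γ upg)))
      X = m₁ · (b · d)
      gX : m · (b · d) ≡ g · X
      gX = trans (cong (_· (b · d)) m≡) (assoc g m₁ (b · d))
      dnX : DnL b (g · X)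
      dnX = subst (DnL b) gX dn
      split-lenb : ℓ (m · (b · d)) ≡ suc (ℓ m₁ +ℕ ℓ (b · d))
      split-lenb = trans ab (cong (_+ℕ ℓ (b · d)) dg)
      ab₁ : ℓ X ≡ ℓ m₁ +ℕ ℓ (b · d)
      ab₁ = ℕₚ.≤-antisym (ℓ-sub m₁ (b · d)) (ℕₚ.≤-pred (ℕₚ.≤-trans
          (ℕₚ.≤-reflexive (trans (sym split-lenb) (cong ℓ gX))) (ℓ≤suc X γ)))
      upgX : UpL g X
      upgX = trans (cong ℓ (sym gX)) (trans split-lenb (cong suc (sym ab₁)))
      comm₁ : DnL b X → ∀ {s} → S s → s ≤ m₁ → b · s ≡ s · b
      comm₁ = go n m₁ (ℕₚ.suc-injective (trans (sym dg) q)) a₁ ab₁ n₁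
      bm₁ : (∀ {s} → S s → s ≤ m₁ → b · s ≡ s · b) → b · m₁ ≡ m₁ · b
      bm₁ f = comm-all m₁ (λ σ p → f σ p)
        where
        comm-all : ∀ m → (∀ {s} → S s → s ≤ m → b · s ≡ s · b) → b · m ≡ m · b
        comm-all m f = Para.In-ind Y (λ s → s ≡ s) (λ _ → yes refl) (λ m → (∀ {s} → S s → s ≤ m → b · s ≡ s · b) → b · m ≡ m · b)
          (λ _ → trans (idʳ b) (sym (idˡ b)))
          (λ {k} {u} κ _ _ up ih f → trans (sym (assoc b k u)) (trans (cong (_· u) (f κ (dn⇒≤ κ (up⇒dn κ up))))
             (trans (assoc k b u) (trans (cong (k ·_) (ih (λ σ p → f σ (≤t p (upL κ up))))) (sym (assoc k u b))))))
          m (λ _ _ → refl) f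
      dd = DD β γ b≢g upgX dnX
      bg : b · g ≡ g · b
      bg with proj₂ dd
      ... | inj₁ q = q
      ... | inj₂ dgb = ⊥-elim (dnup (subst (DnL g) eqX dgb) upg)
        where
        eqX : b · X ≡ m₁ · d
        eqX = trans (sym (assoc b m₁ (b · d))) (trans (cong (_· (b · d)) (bm₁ (comm₁ (proj₁ dd))))
                (trans (assoc m₁ b (b · d)) (cong (m₁ ·_) (sc d β))))
      res : b · s ≡ s · b
      res with supp-s γ σ (subst (s ≤_) m≡ p)
      ... | inj₁ refl = bg
      ... | inj₂ p' = comm₁ (proj₁ dd) σ p'

module Factor (Y : Sys) where
  open Sys Y
  open Products Y

  peelR : ∀ {x} d h → (∀ {g} → S g → g ≤ h → UpR x g) → x ≤ d · h → x ≤ d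
  peelR {x} d h f p = go (ℓ h) h refl (h ≟ e) f p
    where
    go : ∀ n h → ℓ h ≡ n → Dec (h ≡ e) → (∀ {g} → S g → g ≤ h → UpR x g) → x ≤ d · h → x ≤ d
    go n h q (yes r) f p = subst (x ≤_) (trans (cong (d ·_) r) (idʳ d)) p
    go zero h q (no r) f p = ⊥-elim (r (ℓ0 q))
    go (suc n) h q (no r) f p = step (descR h r)
      where
      step : (∃ λ g → S g × DnR h g) → x ≤ d
      step (g , γ , dg) = go n (h · g) (ℕₚ.suc-injective (trans (sym dg) q)) ((h · g) ≟ e)
        (λ σ z → f σ (≤t z (Basics.dn≤ (op Y) γ dg)))
        (Basics.peel (op Y) γ (subst (x ≤_) (trans (cong (d ·_) (sym (scR h γ))) (sym (assoc d (h · g) g))) p)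
          (f γ (Basics.dn⇒≤ (op Y) γ dg)))

  -- A shortest left factor y of h in which s occurs: s is the last letter of every reduced word of
  -- y and occurs nowhere before.
  record Prefix (s h : W) : Set where
    field
      y z : W
      eq : h ≡ y · z
      len : ℓ h ≡ ℓ y +ℕ ℓ z
      dn : DnR y s
      new : ¬ s ≤ y · s
      only : ∀ {g} → S g → DnR y g → g ≡ s

  prefix : ∀ {s} → S s → ∀ h → s ≤ h → Prefix s h
  prefix {s} σ h p = go (ℓ h) h refl p
    where
    go : ∀ n h → ℓ h ≡ n → s ≤ h → Prefix s h
    go n h q p with any? (λ g → (ℓ g ℕₚ.≟ 1) ×-dec (ℓ h ℕₚ.≟ suc (ℓ (h · g))) ×-dec (s ≤? (h · g))) (low h)
    go n h q p | no none = record
      { y = h ; z = e ; eq = sym (idʳ h) ; len = trans (sym (ℕₚ.+-identityʳ _)) (cong (ℓ h +ℕ_) (sym ℓe))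
      ; dn = dns ; new = shorter σ dns ; only = isS }
      where
      shorter : ∀ {g} → S g → DnR h g → ¬ s ≤ h · g
      shorter {g} γ d z = none (lose (≤⇒∈low (Basics.dn⇒≤ (op Y) γ d)) (ℓS γ , d , z))
      isS : ∀ {g} → S g → DnR h g → g ≡ s
      isS {g} γ d with Basics.supp-s (op Y) γ σ (subst (s ≤_) (sym (scR h γ)) p)
      ... | inj₁ r = sym r
      ... | inj₂ r = ⊥-elim (shorter γ d r)
      dns : DnR h s
      dns with descR h (λ r → S≢e σ (≤e (subst (s ≤_) r p)))
      ... | g , γ , d = subst (DnR h) (isS γ d) d
    go zero h q p | yes a = ⊥-elim (S≢e σ (≤e (subst (s ≤_) (ℓ0 q) p)))
    go (suc n) h q p | yes a with satisfied a
    ... | g , l1 , d , sg with go n (h · g) (ℕₚ.suc-injective (trans (sym d) q)) sg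
    ...   | r = record { y = y ; z = z · g ; eq = eq' ; len = len' ; dn = dn ; new = new ; only = only }
      where
      open Prefix r
      eq' : h ≡ y · (z · g)
      eq' = trans (sym (scR h (ℓ1 l1))) (trans (cong (_· g) eq) (assoc y z g))
      len' : ℓ h ≡ ℓ y +ℕ ℓ (z · g)
      len' = ℕₚ.≤-antisym (ℕₚ.≤-trans (ℕₚ.≤-reflexive (cong ℓ eq')) (ℓ-sub y (z · g)))
        (ℕₚ.≤-trans (ℕₚ.+-monoʳ-≤ (ℓ y) (Basics.ℓ≤suc (op Y) z (ℓ1 l1)))
          (ℕₚ.≤-reflexive (trans (ℕₚ.+-suc _ _) (trans (cong suc (sym len)) (sym d)))))

  -- Read c from the right and drop letters other than b and t, which lifting permits for both x and
  -- y. The first of b, t to be met can be appended to the element that does not end in it.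
  ord : ∀ {x y b t} c → x ≤ c → y ≤ c → ¬ x ≡ e →
        (∀ {k} → S k → DnR x k → k ≡ b) → (∀ {k} → S k → DnR y k → k ≡ t) → x · t ≤ c ⊎ y · b ≤ c
  ord {x} {y} {b} {t} c px py ne fx fy = go (ℓ c) c refl (c ≟ e) px py
    where
    go : ∀ n c → ℓ c ≡ n → Dec (c ≡ e) → x ≤ c → y ≤ c → x · t ≤ c ⊎ y · b ≤ c
    go n c q (yes r) px py = ⊥-elim (ne (≤e (subst (x ≤_) r px)))
    go zero c q (no r) px py = ⊥-elim (r (ℓ0 q))
    go (suc n) c q (no r) px py = step (descR c r)
      where
      step : (∃ λ g → S g × DnR c g) → x · t ≤ c ⊎ y · b ≤ c
      step (g , γ , d) = cases (g ≟ b) (g ≟ t)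
        where
        cg≤ : c · g ≤ c
        cg≤ = Basics.dn≤ (op Y) γ d
        cases : Dec (g ≡ b) → Dec (g ≡ t) → x · t ≤ c ⊎ y · b ≤ c
        cases (yes refl) _ = inj₂ (Basics.star (op Y) γ py d)
        cases (no _) (yes refl) = inj₁ (Basics.star (op Y) γ px d)
        cases (no n₁) (no n₂) = [ (λ z → inj₁ (≤t z cg≤)) , (λ z → inj₂ (≤t z cg≤)) ]′
          (go n (c · g) (ℕₚ.suc-injective (trans (sym d) q)) ((c · g) ≟ e)
            (liftR γ px d (Basics.¬dn⇒up (op Y) γ λ z → n₁ (fx γ z)))
            (liftR γ py d (Basics.¬dn⇒up (op Y) γ λ z → n₂ (fy γ z))))

  comm-all : ∀ {s} m → (∀ {g} → S g → g ≤ m → s · g ≡ g · s) → s · m ≡ m · s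
  comm-all {s} m f = Para.In-ind Y (λ g → g ≡ g) (λ _ → yes refl) (λ m → (∀ {g} → S g → g ≤ m → s · g ≡ g · s) → s · m ≡ m · s)
    (λ _ → trans (idʳ s) (sym (idˡ s)))
    (λ {k} {u} κ _ _ up ih f → trans (sym (assoc s k u)) (trans (cong (_· u) (f κ (dn⇒≤ κ (up⇒dn κ up))))
       (trans (assoc k s u) (trans (cong (k ·_) (ih (λ σ p → f σ (≤t p (upL κ up))))) (sym (assoc k u s))))))
    m (λ _ _ → refl) f

  -- `DD` moves the descent b past the letters of m one at a time.
  strip-dn : ∀ {b} m z → S b → ℓ (m · z) ≡ ℓ m +ℕ ℓ z → ¬ b ≤ m → DnL b (m · z) → DnL b z
  strip-dn {b} m z β = λ q n dn → go (ℓ m) m refl (m ≟ e) q n dn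
    where
    go : ∀ k m → ℓ m ≡ k → Dec (m ≡ e) → ℓ (m · z) ≡ ℓ m +ℕ ℓ z → ¬ b ≤ m → DnL b (m · z) → DnL b z
    go k m q (yes r) a n dn = subst (DnL b) (trans (cong (_· z) r) (idˡ z)) dn
    go zero m q (no r) a n dn = ⊥-elim (r (ℓ0 q))
    go (suc k) m q (no r) a n dn = step (descL m r)
      where
      step : (∃ λ g → S g × DnL g m) → DnL b z
      step (g , γ , dg) = go k (g · m) (ℕₚ.suc-injective (trans (sym dg) q)) ((g · m) ≟ e) a' (λ p → n (≤t p (dn≤ γ dg)))
          (proj₁ (Descents.DD Y β γ (λ { refl → n (dn⇒≤ γ dg) }) ug (subst (DnL b) gz dn)))
        where
        gz : m · z ≡ g · ((g · m) · z)
        gz = trans (cong (_· z) (sym (sc m γ))) (assoc g (g · m) z)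
        a' : ℓ ((g · m) · z) ≡ ℓ (g · m) +ℕ ℓ z
        a' = ℕₚ.≤-antisym (ℓ-sub (g · m) z) (ℕₚ.≤-pred (ℕₚ.≤-trans
            (ℕₚ.≤-reflexive (trans (cong (_+ℕ ℓ z) (sym dg)) (trans (sym a) (cong ℓ gz)))) (ℓ≤suc ((g · m) · z) γ)))
        ug : UpL g ((g · m) · z)
        ug = trans (cong ℓ (sym gz)) (trans a (trans (cong (_+ℕ ℓ z) dg) (cong suc (sym a'))))

  -- The last letter s of the shortest left factor containing s commutes with everything before it,
  -- so it can be moved to the front.
  commute-desc : ∀ {s} y → S s → (∀ {g} → S g → g ≤ y → s · g ≡ g · s) → s ≤ y → DnL s y
  commute-desc {s} y σ f p = subst (DnL s) (sym (Prefix.eq r))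
      (prefix-dn P Z σ (trans (cong ℓ (sym (Prefix.eq r))) (Prefix.len r))
      (trans (Prefix.dn r) (cong suc (cong ℓ (sym (comm-all P λ γ q → f γ (≤t q P≤)))))))
    where
    r = prefix σ y p
    P = Prefix.y r
    Z = Prefix.z r
    P≤ : P ≤ y
    P≤ = subst₂ _≤_ (idʳ P) (sym (Prefix.eq r)) (mul≤ ≤r (e≤ Z) (trans (cong ℓ (sym (Prefix.eq r))) (Prefix.len r)))

-- Special matchings

record Special (Y : Sys) (w : Sys.W Y) (M : Sys.W Y → Sys.W Y) : Set where
  open Sys Y
  open Basics Y using (_⋖_)
  field
    closed : ∀ {u} → u ≤ w → M u ≤ w
    invol  : ∀ {u} → u ≤ w → M (M u) ≡ u
    cov    : ∀ {u} → u ≤ w → u ⋖ M u ⊎ M u ⋖ u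
    compat : ∀ {u v} → u ⋖ v → v ≤ w → ¬ M u ≡ v → M u ≤ M v

opS : ∀ {Y w M} → Special Y w M → Special (op Y) w M
opS sp = record { closed = closed ; invol = invol ; cov = cov ; compat = compat }
  where open Special sp

module Coatoms (Y : Sys) where
  open Sys Y
  open Products Y

  up-right : ∀ {s d g} → S s → S g → UpL s d → DnR d g → UpL s (d · g)
  up-right {s} {d} {g} σ γ u dn = ¬dn⇒up σ λ dk → ℕₚ.<-irrefl refl (ℕₚ.≤-trans
    (ℕₚ.≤-reflexive (sym u))
    (subst (λ z → ℓ z ≤ℕ ℓ d) (trans (cong (_· g) (sym (assoc s d g))) (scR (s · d) γ))
      (ℕₚ.≤-trans (Basics.ℓ≤suc (op Y) (s · (d · g)) γ) (ℕₚ.≤-trans (ℕₚ.≤-reflexive (sym dk))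
          (ℕₚ.≤-trans (ℕₚ.n≤1+n _) (ℕₚ.≤-reflexive (sym dn)))))))

  dn≤R : ∀ {s w} → S s → DnR w s → w · s ≤ w
  dn≤R = Basics.dn≤ (op Y)

  -- Outside dihedral subgroups, an element of the quotient by {s} has two coatoms in the quotient.
  two-coatoms : ∀ {s} z → S s → UpL s z → ¬ z ≡ e →
    (∃ λ r → S r × ¬ s ≡ r × (∀ {b} → S b → b ≤ z → b ≡ s ⊎ b ≡ r)) ⊎
    (∃ λ c → ∃ λ c' → c ⋖ z × c' ⋖ z × ¬ c ≡ c' × UpL s c × UpL s c')
  two-coatoms {s} z σ up ne with descL z ne
  ... | r , ρ , dr = res
    where
    s≢r : ¬ s ≡ r
    s≢r refl = dnup dr up
    open Dih Y s r σ ρ s≢r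
    open Split (decomp z)
    usd : UpL s d
    usd = ¬dn⇒up σ λ ds → dnup (subst (DnL s) (sym eq) (dn-h σ inD minH ds)) up
    d≢e : ¬ d ≡ e
    d≢e q = dnup dr (subst (UpL r) (trans (sym (idˡ h)) (trans (cong (_· h) (sym q)) (sym eq))) (minH ρ Kt))
    res : _
    res with h ≟ e
    ... | yes q = inj₁ (r , ρ , s≢r , λ {b} β p → inD β (subst (b ≤_) (trans eq (trans (cong (d ·_) q) (idʳ d))) p))
    ... | no h≢e with descR h h≢e | descR d d≢e
    ... | g , γ , dg | g' , γ' , dg' = inj₂ (d · (h · g) , (d · g') · h , cz , c'z , dist
            , up-h σ Ka inD minhg usd , up-h σ Ka i' minH (up-right σ γ' usd dg'))
      where
      minhg : MinL (h · g)
      minhg = min-right γ minH dg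
      i' : In (d · g')
      i' = In-≤ (dn≤R γ' dg') inD
      addz : ℓ (d · h) ≡ ℓ d +ℕ ℓ h
      addz = add minH d inD
      cz : d · (h · g) ⋖ z
      cz = subst (d · (h · g) ≤_) (sym eq) (mul≤ ≤r (dn≤R γ dg) addz)
         , trans len (trans (cong (ℓ d +ℕ_) dg) (trans (ℕₚ.+-suc _ _) (cong suc (sym (add minhg d inD)))))
      c'z : (d · g') · h ⋖ z
      c'z = subst ((d · g') · h ≤_) (sym eq) (mul≤ (dn≤R γ' dg') ≤r addz)
          , trans len (trans (cong (_+ℕ ℓ h) dg') (cong suc (sym (add minH _ i'))))
      dist : ¬ d · (h · g) ≡ (d · g') · h
      dist q = ℕₚ.<-irrefl refl (ℕₚ.≤-trans (ℕₚ.≤-reflexive (sym dg)) (ℕₚ.≤-reflexive (cong ℓ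
        (sym (uniq (In-· i' (inv d) (In-inv d inD)) minH minhg
          (trans (trans (sym (idˡ _)) (trans (cong (_· (h · g)) (sym (invˡ d))) (assoc _ _ _)))
            (trans (cong (inv d ·_) q) (sym (assoc _ _ _)))))))))

module Match (Y : Sys) (w : Sys.W Y) (M : Sys.W Y → Sys.W Y) (sp : Special Y w M) where
  open Sys Y
  open Products Y
  open Special sp public

  Up Down : W → Set
  Up u = u ≤ w × u ⋖ M u
  Down u = u ≤ w × M u ⋖ u

  up-down : ∀ {u} → Up u → Down u → ⊥
  up-down (_ , _ , p) (_ , _ , q) = ℕₚ.<-asym (ℕₚ.≤-reflexive (sym p)) (ℕₚ.≤-reflexive (sym q))

  dir : ∀ {u} → u ≤ w → Up u ⊎ Down u
  dir p with cov p
  ... | inj₁ c = inj₁ (p , c)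
  ... | inj₂ c = inj₂ (p , c)

  ¬down⇒up : ∀ {u} → u ≤ w → ¬ Down u → Up u
  ¬down⇒up p n with dir p
  ... | inj₁ x = x
  ... | inj₂ x = ⊥-elim (n x)

  M-up : ∀ {u} → Up u → Down (M u)
  M-up {u} (p , c) = closed p , subst (_⋖ M u) (sym (invol p)) c

  M-down : ∀ {u} → Down u → Up (M u)
  M-down {u} (p , c) = closed p , subst (M u ⋖_) (sym (invol p)) c

  a : W
  a = M e

  e-up : Up e
  e-up with dir (e≤ w)
  ... | inj₁ x = x
  ... | inj₂ (_ , _ , q) with trans (sym q) ℓe
  ... | ()

  a-S : S a
  a-S = ℓ1 (trans (proj₂ (proj₂ e-up)) (cong suc ℓe))

  a≤w : a ≤ w
  a≤w = closed (e≤ w)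

  ℓM≤ : ∀ {u} → u ≤ w → ℓ (M u) ≤ℕ suc (ℓ u)
  ℓM≤ {u} p with cov p
  ... | inj₁ (_ , q) = ℕₚ.≤-reflexive q
  ... | inj₂ (_ , q) = ℕₚ.≤-trans (ℕₚ.n≤1+n _) (ℕₚ.≤-trans (ℕₚ.≤-reflexive (sym q)) (ℕₚ.n≤1+n _))

  -- `compat` gives M u ≤ M v, and if v were matched downwards M v would be shorter than M u.
  up-next : ∀ {u v} → Up u → u ⋖ v → v ≤ w → ¬ M u ≡ v → Up v × M u ⋖ M v
  up-next {u} {v} U c p n with dir p | compat c p n
  ... | inj₁ V | q = V , q , trans (proj₂ (proj₂ V)) (cong suc (trans (proj₂ c) (sym (proj₂ (proj₂ U)))))
  ... | inj₂ V | q = ⊥-elim (ℕₚ.<-irrefl refl (ℕₚ.≤-trans (ℕₚ.≤-reflexive (sym (proj₂ (proj₂ V))))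
          (ℕₚ.≤-trans (ℕₚ.≤-reflexive (trans (proj₂ c) (sym (proj₂ (proj₂ U))))) (≤ℓ q))))

  up-step : ∀ {u v} → Up u → u ⋖ v → Up v → M u ⋖ M v
  up-step {u} {v} U c V = proj₂ (up-next U c (proj₁ V) λ q → up-down V (subst Down q (M-up U)))

  down-next : ∀ {z c} → Down z → c ⋖ z → ¬ c ≡ M z → Down c × M c ⋖ M z
  down-next {z} {c} Z cz n with dir (≤t (proj₁ cz) (proj₁ Z))
                              | compat cz (proj₁ Z) (λ q → n (trans (sym (invol (≤t (proj₁ cz) (proj₁ Z)))) (cong M q)))
  ... | inj₂ D | q = D , q , ℕₚ.suc-injective (trans (sym (proj₂ (proj₂ Z)))
          (trans (proj₂ cz) (cong suc (proj₂ (proj₂ D)))))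
  ... | inj₁ U | q = ⊥-elim (ℕₚ.<-irrefl refl (ℕₚ.≤-trans (ℕₚ.≤-reflexive (sym (proj₂ (proj₂ U))))
          (ℕₚ.≤-trans (≤ℓ q) (ℕₚ.≤-reflexive (ℕₚ.suc-injective (trans (sym (proj₂ (proj₂ Z))) (proj₂ cz)))))))

  -- The lifting property with M in place of multiplication by a letter: go down a chain from z to u
  -- with `down-next` until the chain meets M z.
  M-lift : ∀ {u z} → u ≤ z → Up u → Down z → u ≤ M z
  M-lift {u} {z} p U Z = go (ℓ z) z refl p Z
    where
    go : ∀ n z → ℓ z ≡ n → u ≤ z → Down z → u ≤ M z
    go n z q p Z with chain-dn p (λ { refl → up-down U Z })
    ... | c , uc , cz with c ≟ M z
    ... | yes refl = uc
    go zero z q p Z | c , uc , cz | no ne with trans (sym q) (proj₂ cz)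
    ... | ()
    go (suc n) z q p Z | c , uc , cz | no ne with down-next Z cz ne
    ... | D , m = ≤t (go n c (ℕₚ.suc-injective (trans (sym (proj₂ cz)) q)) uc D) (proj₁ m)

  M-lift' : ∀ {u z} → u ≤ z → Up u → Down z → M u ≤ z
  M-lift' {u} {z} p U Z = go (ℓ z) u U p (ℕₚ.m≤n+m (ℓ z) (ℓ u))
    where
    go : ∀ n u → Up u → u ≤ z → ℓ z ≤ℕ ℓ u +ℕ n → M u ≤ z
    go n u U p b with chain-up p (λ { refl → up-down U Z })
    ... | v , uv , vz with M u ≟ v
    ... | yes refl = vz
    go zero u U p b | v , uv , vz | no ne = ⊥-elim (ℕₚ.<-irrefl refl (ℕₚ.≤-trans
        (ℕₚ.≤-reflexive (sym (proj₂ uv))) (ℕₚ.≤-trans (≤ℓ vz) (subst (ℓ z ≤ℕ_) (ℕₚ.+-identityʳ _) b))))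
    go (suc n) u U p b | v , uv , vz | no ne with up-next U uv (≤t vz (proj₁ Z)) ne
    ... | V , m = ≤t (proj₁ m) (go n v V vz (subst (ℓ z ≤ℕ_) (trans (ℕₚ.+-suc (ℓ u) n) (cong (_+ℕ n) (sym (proj₂ uv)))) b))

  restrict : ∀ {z} → Down z → Special Y z M
  restrict {z} Z = record
    { closed = cl ; invol = λ p → invol (≤t p (proj₁ Z)) ; cov = λ p → cov (≤t p (proj₁ Z))
    ; compat = λ c p n → compat c (≤t p (proj₁ Z)) n }
    where
    cl : ∀ {u} → u ≤ z → M u ≤ z
    cl p with dir (≤t p (proj₁ Z))
    ... | inj₁ U = M-lift' p U Z
    ... | inj₂ D = ≤t (proj₁ (proj₂ D)) p

  a≤down : ∀ {z} → Down z → a ≤ z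
  a≤down Z = M-lift' (e≤ _) e-up Z

  S-up : ∀ {s} → S s → s ≤ w → ¬ s ≡ a → Up s
  S-up {s} σ p n = proj₁ (up-next e-up (e≤ s , trans (ℓS σ) (cong suc (sym ℓe))) p (λ q → n (sym q)))

  -- The matching introduces no letter except a: any other letter s below w is matched upwards, so
  -- lifting along M moves it from M u down to u.
  M-supp : ∀ {s u} → S s → u ≤ w → s ≤ M u → s ≡ a ⊎ s ≤ u
  M-supp {s} {u} σ p q with s ≟ a | dir p
  ... | yes r | _ = inj₁ r
  ... | no r | inj₂ D = inj₂ (≤t q (proj₁ (proj₂ D)))
  ... | no r | inj₁ U = inj₂ (subst (s ≤_) (invol p) (M-lift q (S-up σ (≤t q (closed p)) r) (M-up U)))

  noa⇒up : ∀ {u} → u ≤ w → ¬ a ≤ u → Up u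
  noa⇒up p n = ¬down⇒up p λ D → n (a≤down D)

  -- s is a left descent of q which M destroys: the orbit of s·q under M and left
  -- multiplication by s has more than four elements
  record Lost (s q : W) : Set where
    constructor lost
    field
      σ    : S s
      up   : Up q
      dn   : DnL s q
      upb  : Up (s · q)
      gone : UpL s (M q)
  open Lost public

  M-upL : ∀ {s u} → S s → Up u → UpL s u → ¬ M u ≡ s · u → UpL s (M u)
  M-upL σ U us n = up-below σ (proj₂ U) us n

  -- If s were a descent of M(s·v), then by `exch` both M v and M(s·u), which M(s·v) covers, would
  -- equal s·M(s·v). Then v = s·u, although s is an ascent of v.
  propagate : ∀ {s u v} → Lost s (s · u) → UpL s u → u ⋖ v → Up v → UpL s v → s · v ≤ w → Lost s (s · v)
  propagate {s} {u} {v} L us uv V vs p = lost σ₀ SV (up⇒dn σ₀ vs) (subst Up (sym (sc v σ₀)) V) gone'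
    where
    σ₀ = σ L
    U : Up u
    U = subst Up (sc u σ₀) (upb L)
    SU = up L
    suv : s · u ⋖ s · v
    suv = ⋖mono σ₀ uv us vs
    Msu≢ : ¬ M (s · u) ≡ s · v
    Msu≢ q = dnup (up⇒dn σ₀ vs) (subst (UpL s) q (gone L))
    SV : Up (s · v)
    SV = proj₁ (up-next SU suv p Msu≢)
    gone' : UpL s (M (s · v))
    gone' = ¬dn⇒up σ₀ λ d → dnup (up⇒dn σ₀ us) (subst (UpL s) (contra d) vs)
      where
      Mv≢ : ¬ M v ≡ s · v
      Mv≢ q = up-down SV (subst Down q (M-up V))
      contra : DnL s (M (s · v)) → v ≡ s · u
      contra d = trans (sym (invol (proj₁ V))) (trans (cong M (canL s
          (trans (sym (exch σ₀ (up-step V (⋖up σ₀ vs) SV) (M-upL σ₀ V vs Mv≢) d))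
                 (exch σ₀ (up-step SU suv SV) (gone L) d)))) (invol (proj₁ SU)))

  not-below : ∀ {s u} → Lost s (s · u) → UpL s u → ¬ M u ≡ s · u
  not-below {s} {u} L us q = up-down (up L) (subst Down q (M-up (subst Up (sc u (σ L)) (upb L))))

  -- If M destroys all left descents of q, then M q = k·q for some k, so M keeps all right descents.
  all-lost : ∀ {q} → Up q → (∀ {k} → S k → DnL k q → UpL k (M q)) → ∃ λ k → S k × UpL k q × M q ≡ k · q
  all-lost {q} Q f with descL (M q) (λ p → ne p)
    where
    ne : ¬ M q ≡ e
    ne p with trans (sym (proj₂ (proj₂ Q))) (trans (cong ℓ p) ℓe)
    ... | ()
  ... | k , κ , d = k , κ , uk , exch κ (proj₂ Q) uk d
    where
    uk : UpL k q
    uk = ¬dn⇒up κ λ d' → dnup d (f κ d')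

  conflict : ∀ {q r} → Up q → (∀ {k} → S k → DnL k q → UpL k (M q)) → S r → DnR q r → UpR (M q) r → ⊥
  conflict {q} {r} Q f ρ d u with all-lost Q f
  ... | k , κ , uk , p = ℕₚ.<-irrefl refl (ℕₚ.≤-trans (ℕₚ.≤-reflexive (sym (subst (λ z → UpR z r) p u)))
      (ℕₚ.≤-trans (ℕₚ.≤-trans (ℕₚ.≤-reflexive (cong ℓ (assoc k q r))) (ℓ≤suc (q · r) κ))
      (ℕₚ.≤-trans (ℕₚ.≤-reflexive (sym d)) (ℕₚ.≤-trans (ℕₚ.n≤1+n _) (ℕₚ.≤-reflexive (sym uk))))))

  Comm : W → Set
  Comm s = ∀ {u} → UpL s u → s · u ≤ w → M (s · u) ≡ s · M u

  -- The obstruction found when s fails to commute with M: s is destroyed at an element q of a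
  -- dihedral subgroup ⟨s,r⟩ one of whose letters is a.
  Witness : W → Set
  Witness s = ∃ λ r → ∃ λ q → S r × ¬ s ≡ r × (a ≡ s ⊎ a ≡ r) × (∀ {b} → S b → b ≤ q → b ≡ s ⊎ b ≡ r) × Lost s q

  -- The essential case has u matched upwards and s an ascent of z = M(s·u). If z is not dihedral,
  -- it has a coatom c other than M u with s as an ascent; then s is a descent of M c, and the
  -- induction hypothesis would make M lengthen s·M c by three.
  comm-or-witness : ∀ {s} → S s → ∀ u → UpL s u → s · u ≤ w → M (s · u) ≡ s · M u ⊎ Witness s
  comm-or-witness {s} σ u us p = <-rec P step (ℓ u) u refl us p
    where
    P : ℕ → Set
    P n = ∀ u → ℓ u ≡ n → UpL s u → s · u ≤ w → M (s · u) ≡ s · M u ⊎ Witness s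
    step : ∀ n → (∀ {m} → m < n → P m) → P n
    step n ih u q us p with M u ≟ s · u
    ... | yes r = inj₁ (trans (cong M (sym r)) (trans (invol u≤w) (trans (sym (sc u σ)) (cong (s ·_) (sym r)))))
      where u≤w = ≤t (upL σ us) p
    ... | no r with dir (≤t (upL σ us) p)
    step n ih u q us p | no r | inj₂ D = down (stepL u0 σ)
      where
      u0 = M u
      MM : M u0 ≡ u
      MM = invol (proj₁ D)
      l0 : ℓ u ≡ suc (ℓ u0)
      l0 = proj₂ (proj₂ D)
      su0≤ : s · u0 ≤ w
      su0≤ = ≤t (monoL σ (proj₁ (proj₂ D)) us) p
      down : UpL s u0 ⊎ DnL s u0 → M (s · u) ≡ s · M u ⊎ Witness s
      down (inj₁ us0) with ih (subst (ℓ u0 <_) q (ℕₚ.≤-reflexive (sym l0))) u0 refl us0 su0≤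
      ... | inj₂ W = inj₂ W
      ... | inj₁ c = inj₁ (trans (cong M (trans (cong (s ·_) (sym MM)) (sym c))) (invol su0≤))
      down (inj₂ ds0) with ih (subst (ℓ (s · u0) <_) q (ℕₚ.≤-trans (ℕₚ.≤-reflexive (sym ds0))
          (ℕₚ.≤-trans (ℕₚ.n≤1+n _) (ℕₚ.≤-reflexive (sym l0)))))
                             (s · u0) refl (dn⇒up σ ds0) (subst (_≤ w) (sym (sc u0 σ)) (≤t (proj₁ (proj₂ D)) (proj₁ D)))
      ... | inj₂ W = inj₂ W
      ... | inj₁ c = ⊥-elim (ℕₚ.<-irrefl refl (ℕₚ.≤-trans (ℕₚ.n≤1+n _) (ℕₚ.≤-trans (ℕₚ.≤-reflexive l3)
                       (ℓM≤ (≤t (dn≤ σ ds0) (closed (proj₁ D)))))))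
        where
        -- M u0 = u = s·M(s u0) forces M (s u0) = s u, which is too long
        l3 : suc (suc (suc (ℓ (s · u0)))) ≡ ℓ (M (s · u0))
        l3 = trans (cong (λ k → suc (suc k)) (sym ds0)) (trans (cong suc (sym l0)) (trans (sym us)
               (cong ℓ (sym (mvL σ (trans (sym c) (trans (cong M (sc u0 σ)) MM)))))))
    step n ih u q us p | no r | inj₁ U = up' (stepL z σ)
      where
      SU : Up (s · u) × M u ⋖ M (s · u)
      SU = up-next U (⋖up σ us) p r
      z = M (s · u)
      Z : Down z
      Z = M-up (proj₁ SU)
      Mz : M z ≡ s · u
      Mz = invol p
      coatom : ∀ c → c ⋖ z → UpL s c → ¬ c ≡ M u → M (s · u) ≡ s · M u ⊎ Witness s
      coatom c cz uc n = res
        where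
        C = down-next Z cz (λ q → dnup (up⇒dn σ us) (subst (UpL s) (trans q Mz) uc))
        d = M c
        dsu : d ⋖ s · u
        dsu = subst (d ⋖_) Mz (proj₂ C)
        ds : DnL s d
        ds = ¬up⇒dn σ λ ud → n (trans (sym (invol (proj₁ (proj₁ C)))) (cong M (canL s (sym (exch σ dsu ud (up⇒dn σ us))))))
        lc : ℓ c ≡ suc (suc (ℓ (s · d)))
        lc = trans (proj₂ (proj₂ (proj₁ C))) (cong suc ds)
        res : M (s · u) ≡ s · M u ⊎ Witness s
        res with ih (subst (ℓ (s · d) <_) q (ℕₚ.≤-reflexive (trans (sym ds)
            (ℕₚ.suc-injective (trans (sym (proj₂ dsu)) us))))) (s · d) refl (dn⇒up σ ds)
                    (subst (_≤ w) (sym (sc d σ)) (≤t (proj₁ dsu) p))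
        ... | inj₂ W = inj₂ W
        ... | inj₁ k = ⊥-elim (ℕₚ.<-irrefl refl (ℕₚ.≤-trans (ℕₚ.n≤1+n _) (ℕₚ.≤-trans (ℕₚ.≤-reflexive l3)
                         (ℓM≤ (≤t (dn≤ σ ds) (≤t (proj₁ dsu) p))))))
          where
          l3 : suc (suc (suc (ℓ (s · d)))) ≡ ℓ (M (s · d))
          l3 = trans (cong suc (sym lc)) (trans (sym uc) (cong ℓ (sym (mvL σ (trans (sym k)
                 (trans (cong M (sc d σ)) (invol (proj₁ (proj₁ C)))))))))
      up' : UpL s z ⊎ DnL s z → M (s · u) ≡ s · M u ⊎ Witness s
      up' (inj₂ dz) = inj₁ (exch σ (proj₂ SU) (M-upL σ U us r) dz)
      up' (inj₁ uz) with two-coatoms z σ uz (λ z≡e → S≢e a-S (≤e (subst (a ≤_) z≡e (a≤down Z))))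
        where open Coatoms Y
      ... | inj₁ (g , γ , s≢g , f) = inj₂ (g , s · u , γ , s≢g , f a-S (a≤down Z)
            , (λ {_} β b → f β (≤t b (proj₁ (proj₂ (proj₁ SU)))))
            , lost σ (proj₁ SU) (up⇒dn σ us) (subst Up (sym (sc u σ)) U) uz)
      ... | inj₂ (c₁ , c₂ , cz₁ , cz₂ , ne , uc₁ , uc₂) with c₁ ≟ M u
      ...   | no n₁ = coatom c₁ cz₁ uc₁ n₁
      ...   | yes r₁ = coatom c₂ cz₂ uc₂ (λ r₂ → ne (trans r₁ (sym r₂)))

  comm? : ∀ s → S s → Comm s ⊎ Witness s
  comm? s σ with any? (λ v → (ℓ v ℕₚ.≟ suc (ℓ (s · v))) ×-dec ¬? (M v ≟ s · M (s · v))) (low w)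
  ... | no n = inj₁ λ {u} us p → ok u us p
    where
    ok : ∀ u → UpL s u → s · u ≤ w → M (s · u) ≡ s · M u
    ok u us p with M (s · u) ≟ s · M u
    ... | yes q = q
    ... | no q = ⊥-elim (n (lose (≤⇒∈low p) (up⇒dn σ us , λ q' → q (trans q' (cong (λ z → s · M z) (sc u σ))))))
  ... | yes x with find x
  ...   | v , m , d , q with comm-or-witness σ (s · v) (dn⇒up σ d) (subst (_≤ w) (sym (sc v σ)) (∈low⇒≤ m))
  ...     | inj₂ W = inj₂ W
  ...     | inj₁ c = ⊥-elim (q (trans (cong M (sym (sc v σ))) c))

-- Destroyed descents and the types of letters

module Half (Y : Sys) (w : Sys.W Y) (M : Sys.W Y → Sys.W Y) (sp : Special Y w M) where
  open Sys Y
  open Products Y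
  open Descents Y
  open Coatoms Y
  open Match Y w M sp public

  Supp2 : W → W → W → Set
  Supp2 x y u = ∀ {b} → S b → b ≤ u → b ≡ x ⊎ b ≡ y

  new-up : ∀ {b u} → S b → ¬ b ≤ u → UpL b u
  new-up β n = ¬dn⇒up β λ d → n (dn⇒≤ β d)

  supp-· : ∀ {s} u v → S s → s ≤ u · v → s ≤ u ⊎ s ≤ v
  supp-· {s} u v σ = Para.In-ind Y (λ s → s ≡ s) (λ _ → yes refl) (λ u → s ≤ u · v → s ≤ u ⊎ s ≤ v)
    (λ p → inj₂ (subst (s ≤_) (idˡ v) p))
    (λ {k} {u} κ _ _ up ih p → step κ up ih (supp-s κ σ (subst (s ≤_) (assoc k u v) p)))
    u (λ _ _ → refl)
    where
    step : ∀ {k u} → S k → UpL k u → (s ≤ u · v → s ≤ u ⊎ s ≤ v) → s ≡ k ⊎ s ≤ u · v → s ≤ k · u ⊎ s ≤ v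
    step κ up ih (inj₁ refl) = inj₁ (dn⇒≤ κ (up⇒dn κ up))
    step κ up ih (inj₂ p) with ih p
    ... | inj₁ q = inj₁ (≤t q (upL κ up))
    ... | inj₂ q = inj₂ q

  ℓ2 : ∀ {s r} → S s → S r → ¬ s ≡ r → ℓ (s · r) ≡ 2
  ℓ2 σ ρ n = trans (upS σ ρ n) (cong suc (ℓS ρ))

  dn-self : ∀ {s} → S s → DnL s s
  dn-self {s} σ = trans (ℓS σ) (cong suc (sym (trans (cong ℓ (SS σ)) ℓe)))

  NC : W → Set
  NC t = ¬ a · t ≡ t · a

  -- Letters of left type. The mirrored predicate `TR` reads M t = t·a, and by `letter` every letter
  -- other than a that does not commute with a is of one of the two types.
  TL : W → Set
  TL t = S t × t ≤ w × ¬ t ≡ a × M t ≡ a · t × NC t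

  letter : ∀ {t} → S t → t ≤ w → ¬ t ≡ a → M t ≡ t · a ⊎ M t ≡ a · t
  letter {t} τ p n with descL (M t) ne
    where
    ne : ¬ M t ≡ e
    ne q with trans (sym (proj₂ (proj₂ (S-up τ p n)))) (trans (cong ℓ q) ℓe)
    ... | ()
  ... | k , κ , d with k ≟ t
  ... | no k≢t = inj₂ (trans q (cong (_· t) (sym k≡a)))
    where
    q : M t ≡ k · t
    q = exch κ (proj₂ (S-up τ p n)) (upS κ τ k≢t) d
    k≡a : a ≡ k
    k≡a with supp-s κ a-S (subst (a ≤_) q (a≤down (M-up (S-up τ p n))))
    ... | inj₁ r = r
    ... | inj₂ r with ≤s τ r
    ...   | inj₁ r' = ⊥-elim (S≢e a-S r')
    ...   | inj₂ r' = ⊥-elim (n (sym r'))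
  ... | yes refl = inj₁ (trans q (cong (t ·_) g≡a))
    where
    g = t · M t
    q : M t ≡ t · g
    q = sym (sc (M t) τ)
    γ : S g
    γ = ℓ1 (trans (ℕₚ.suc-injective (trans (sym d) (proj₂ (proj₂ (S-up τ p n))))) (ℓS τ))
    g≡a : g ≡ a
    g≡a with supp-s τ a-S (subst (a ≤_) q (a≤down (M-up (S-up τ p n))))
    ... | inj₁ r = ⊥-elim (n (sym r))
    ... | inj₂ r with ≤s γ r
    ...   | inj₁ r' = ⊥-elim (S≢e a-S r')
    ...   | inj₂ r' = sym r'

  lostTL : ∀ {t} → TL t → Lost t t
  lostTL {t} (τ , p , n , q , nc) = lost τ (S-up τ p n) (dn-self τ) (subst Up (sym (SS τ)) e-up)
    (subst (UpL t) (sym q) (¬dn⇒up τ λ d → bad (DD τ a-S n (upS a-S τ (λ r → n (sym r))) d)))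
    where
    bad : DnL t t × (t · a ≡ a · t ⊎ DnL a (t · t)) → ⊥
    bad (_ , inj₁ c) = nc (sym c)
    bad (_ , inj₂ d) with trans (sym (trans (cong ℓ (SS τ)) ℓe)) d
    ... | ()

  -- M destroys k at k itself, and every element without the letter a is matched upwards, so
  -- `propagate` applies while u is built up letter by letter on the right.
  chain-TL : ∀ {k} → TL k → ∀ u → ¬ a ≤ u → UpL k u → k · u ≤ w → Lost k (k · u)
  chain-TL {k} T u = go (ℓ u) u refl
    where
    κ = proj₁ T
    go : ∀ n u → ℓ u ≡ n → ¬ a ≤ u → UpL k u → k · u ≤ w → Lost k (k · u)
    go n u q na up p with u ≟ e
    go n u q na up p | yes refl = subst (Lost k) (sym (idʳ k)) (lostTL T)
    go zero u q na up p | no r = ⊥-elim (r (ℓ0 q))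
    go (suc n) u q na up p | no r with descR u r
    ... | g , γ , d = propagate
            (go n (u · g) (ℕₚ.suc-injective (trans (sym d) q)) (λ x → na (≤t x ug≤)) up' (≤t (monoL κ ug≤ up) p))
            up' (ug≤ , d) (noa⇒up (≤t (upL κ up) p) na) up p
      where
      ug≤ : u · g ≤ u
      ug≤ = dn≤R γ d
      up' = up-right κ γ up d

  -- Right multiplication cannot destroy a left descent, so a good letter excludes lost left
  -- descents throughout ⟨a,t⟩; see `good-kept`.
  Good : W → Set
  Good t = ∀ {u} → Up u → Supp2 a t u → M u ≡ u · a

  up-R : ∀ {u} → Up u → M u ≡ u · a → UpR u a
  up-R U q = trans (cong ℓ (sym q)) (proj₂ (proj₂ U))

  good-kept : ∀ {t s q} → Good t → Supp2 a t q → Lost s q → ⊥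
  good-kept {t} {s} {q} G i L = dnup (prefix-dn q a (σ L) (trans (up-R (up L) (G (up L) i))
      (trans (ℕₚ.+-comm 1 _) (cong (ℓ q +ℕ_) (sym (ℓS a-S))))) (dn L))
                                     (subst (UpL s) (G (up L) i) (gone L))

  -- A witness against t involves a and t, hence lies in ⟨a,t⟩, where no left descent is lost.
  Good⇒Comm : ∀ {t} → S t → ¬ t ≡ a → Good t → Comm t
  Good⇒Comm {t} τ n G with comm? t τ
  ... | inj₁ c = c
  ... | inj₂ (r , q , ρ , t≢r , inj₁ x , i , L) = ⊥-elim (n (sym x))
  ... | inj₂ (r , q , ρ , t≢r , inj₂ refl , i , L) = ⊥-elim (good-kept G (λ β p → swap (i β p)) L)

  -- The subgroup ⟨a,c⟩ has only four elements, of which e and c alone are matched upwards.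
  C-good : ∀ {c} → S c → c ≤ w → ¬ c ≡ a → a · c ≡ c · a → Good c
  C-good {c} γ c≤ c≢a ac {u} U i = bound (ℓ u) refl
    where
    a≢c : ¬ a ≡ c
    a≢c p = c≢a (sym p)
    open Dih Y a c a-S γ a≢c using (one-desc; dih1; first; K; In-cons; In-S)
    ℓac : ℓ (a · c) ≡ 2
    ℓac = ℓ2 a-S γ a≢c
    dna : DnL a (a · c)
    dna = up⇒dn a-S (upS a-S γ a≢c)
    dnc : DnL c (a · c)
    dnc = subst (DnL c) (sym ac) (up⇒dn γ (upS γ a-S c≢a))
    iac : Supp2 a c (a · c)
    iac = In-cons a-S (inj₁ refl) (In-S γ (inj₂ refl))
    dnk : ∀ {k} → K k → DnL k (a · c)
    dnk (inj₁ refl) = dna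
    dnk (inj₂ refl) = dnc
    Mc : M c ≡ c · a
    Mc = [ (λ q → q) , (λ q → trans q ac) ]′ (letter γ c≤ c≢a)
    bound : ∀ n → ℓ u ≡ n → M u ≡ u · a
    bound 0 q = trans (cong M (ℓ0 q)) (trans (sym (idˡ a)) (cong (_· a) (sym (ℓ0 q))))
    bound 1 q = [ (λ r → ⊥-elim (up-down U (subst Down (sym r) (M-up e-up)))) ,
        (λ r → trans (cong M r) (trans Mc (cong (_· a) (sym r)))) ]′
                  (i (ℓ1 q) ≤r)
    bound 2 q = ⊥-elim (top (first i λ r → ℕₚ.1+n≢0 (trans (sym q) (trans (cong ℓ r) ℓe))))
      where
      top : (∃ λ k → K k × DnL k u) → ⊥
      top (k , Kk , d) = up-down U (subst Down (trans Mc (trans (sym ac)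
          (sym (dih1 Kk i iac (trans q (sym ℓac)) d (dnk Kk))))) (M-up (S-up γ c≤ c≢a)))
    bound (suc (suc (suc n))) q = ⊥-elim (a≢c (one-desc iac i (subst₂ _<_ (sym ℓac) (sym q) (s≤s (s≤s (s≤s z≤n))))
        (inj₁ refl) (inj₂ refl) dna dnc))

  -- A letter c commuting with M cannot stand between a destroyed descent l and the rest of the word.
  star-lemma : ∀ {l r x c} → S r → ¬ l ≡ r → ¬ l · r ≡ r · l → a ≡ l ⊎ a ≡ r →
    Lost l (l · x) → UpL l x → Supp2 l r (l · x) → ¬ x ≡ e →
    S c → ¬ c ≡ l → ¬ c ≡ r → Comm c → ¬ l · c ≡ c · l → l · (c · x) ≤ w → ⊥
  star-lemma {l} {r} {x} {c} ρ l≢r nlr ain L ux i x≢e χ c≢l c≢r com nlc q≤ = fin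
    where
    λ' = σ L
    X : Up x
    X = subst Up (sc x λ') (upb L)
    ix : Supp2 l r x
    ix β p = i β (≤t p (upL λ' ux))
    c∉ : ¬ c ≤ l · x
    c∉ p with i χ p
    ... | inj₁ q = c≢l q
    ... | inj₂ q = c≢r q
    c∉x : ¬ c ≤ x
    c∉x p = c∉ (≤t p (upL λ' ux))
    c∉s : ∀ {k y} → S k → ¬ c ≡ k → ¬ c ≤ y → ¬ c ≤ k · y
    c∉s κ n m p with supp-s κ χ p
    ... | inj₁ q = n q
    ... | inj₂ q = m q
    c≢a : ¬ c ≡ a
    c≢a q = [ (λ p → c≢l (trans q p)) , (λ p → c≢r (trans q p)) ]′ ain
    c∉M : ∀ {y} → y ≤ w → ¬ c ≤ y → ¬ c ≤ M y
    c∉M p n m with M-supp χ p m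
    ... | inj₁ q = c≢a q
    ... | inj₂ q = n q
    ucx : UpL c x
    ucx = new-up χ c∉x
    ulcx : UpL l (c · x)
    ulcx = ¬dn⇒up λ' λ d → dnup (proj₁ (DD λ' χ (λ p → c≢l (sym p)) ucx d)) ux
    q = l · (c · x)
    cx≤ : c · x ≤ w
    cx≤ = ≤t (upL λ' ulcx) q≤
    CX : Up (c · x)
    CX = proj₁ (up-next X (⋖up χ ucx) cx≤ λ p → c∉M (proj₁ X) c∉x (subst (c ≤_) (sym p) (dn⇒≤ χ (up⇒dn χ ucx))))
    Lq : Lost l q
    Lq = propagate L ux (⋖up χ ucx) CX ulcx q≤
    dr≢c : ∀ {k} → S k → ¬ k ≡ l → ¬ k ≡ c → DnL k x → k · c ≡ c · k → k · l ≡ l · k ⊎ DnL l (k · (c · x)) → ⊥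
    dr≢c {k} κ k≢l k≢c dk kc alt = [ k≢l , at-r ]′ (ix κ (dn⇒≤ κ dk))
      where
      at-r : k ≡ r → ⊥
      at-r refl = [ (λ p → nlr (sym p)) , (λ p → [ nlc , (λ z → c∉s λ' c≢l c∉kx (dn⇒≤ χ z)) ]′
          (proj₂ (DD λ' χ (λ z → c≢l (sym z)) (new-up χ c∉kx)
            (subst (DnL l) (trans (sym (assoc k c x)) (trans (cong (_· x) kc) (assoc c k x))) p)))) ]′ alt
        where
        c∉kx : ¬ c ≤ k · x
        c∉kx = c∉s κ (λ z → k≢c (sym z)) c∉x
    dc : ∀ {k} → S k → ¬ k ≡ l → Dec (k ≡ c) → DnL k (c · x) × (k · l ≡ l · k ⊎ DnL l (k · (c · x))) → ⊥
    dc κ k≢l (yes refl) (_ , alt) = [ (λ p → nlc (sym p)) , (λ p → dnup (subst (DnL l) (sc x χ) p) ux) ]′ alt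
    dc {k} κ k≢l (no k≢c) (d , alt) = next (DD κ χ k≢c ucx d)
      where
      next : DnL k x × (k · c ≡ c · k ⊎ DnL c (k · x)) → ⊥
      next (dk , inj₁ kc) = dr≢c κ k≢l k≢c dk kc alt
      next (dk , inj₂ p) = c∉s κ (λ z → k≢c (sym z)) c∉x (dn⇒≤ χ p)
    dl : ∀ {k} → S k → DnL k q → k ≡ l
    dl {k} κ d = go (k ≟ l)
      where
      go : Dec (k ≡ l) → k ≡ l
      go (yes p) = p
      go (no n) = ⊥-elim (dc κ n (k ≟ c) (DD κ λ' n ulcx d))
    mid : M (l · x) ⋖ M q
    mid = up-step (up L) (⋖mono λ' (⋖up χ ucx) ux ulcx) (up Lq)
    supq : ∀ {b} → S b → b ≡ a ⊎ b ≤ q → b ≡ l ⊎ b ≡ r ⊎ b ≡ c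
    supq β (inj₁ p) = [ (λ z → inj₁ (trans p z)) , (λ z → inj₂ (inj₁ (trans p z))) ]′ ain
    supq β (inj₂ p) = [ inj₁ , (λ p' → [ (λ z → inj₂ (inj₂ z)) , (λ p'' → [ inj₁ , (λ z → inj₂ (inj₁ z)) ]′ (ix β p'')) ]′
                          (supp-s χ β p')) ]′ (supp-s λ' β p)
    vM : M (c · x) ⋖ M q
    vM = up-step CX (⋖up λ' ulcx) (up Lq)
    cMx : M (c · x) ≡ c · M x
    cMx = com ucx cx≤
    ulM : UpL l (M (c · x))
    ulM = M-upL λ' CX ulcx (not-below Lq ulcx)
    c∉Mx : ¬ c ≤ M x
    c∉Mx = c∉M (proj₁ X) c∉x
    k≢c : ¬ M q ≡ c · q
    k≢c Mq = c∉M (proj₁ (up L)) c∉ (subst (c ≤_) (sym same) (≤t (dn⇒≤ χ (up⇒dn χ ucx)) (upL λ' ulcx)))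
      where
      same : M (l · x) ≡ q
      same = ≤ℓ≡ (peel χ (subst (M (l · x) ≤_) Mq (proj₁ mid)) (new-up χ (c∉M (proj₁ (up L)) c∉)))
               (trans (proj₂ (proj₂ (up L))) (trans (cong suc ux) (trans (cong suc (sym ucx)) (sym ulcx))))
    k≢r : UpL r q → ¬ M q ≡ r · q
    k≢r uk Mq = [ upM , dnM ]′ (stepL (M (c · x)) ρ)
      where
      upM : UpL r (M (c · x)) → ⊥
      upM u = ℕₚ.<-irrefl refl (ℕₚ.≤-trans (ℕₚ.≤-reflexive (sym (proj₂ (proj₂ CX))))
                (≤ℓ (peel λ' (peel ρ (subst (M (c · x) ≤_) Mq (proj₁ vM)) u) ulM)))
      y = r · M x
      c∉y : ¬ c ≤ y
      c∉y = c∉s ρ c≢r c∉Mx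
      comm-case : DnL r (M (c · x)) → DnL r (M x) → r · c ≡ c · r → ⊥
      comm-case dr dM rc = dnup dx ux'
        where
        cy : r · M (c · x) ≡ c · y
        cy = trans (cong (r ·_) cMx) (trans (sym (assoc r c (M x))) (trans (cong (_· M x) rc) (assoc c r (M x))))
        cy≤q : c · y ≤ q
        cy≤q = subst₂ _≤_ cy (trans (cong (r ·_) Mq) (sc q ρ)) (liftdd ρ (proj₁ vM) (subst (DnL r) (sym Mq) (up⇒dn ρ uk)) dr)
        ucy : UpL l (c · y)
        ucy = ¬dn⇒up λ' λ d → [ nlc , (λ z → c∉s λ' c≢l c∉y (dn⇒≤ χ z)) ]′
                (proj₂ (DD λ' χ (λ z → c≢l (sym z)) (new-up χ c∉y) d))
        y≡x : y ≡ x
        y≡x = canL c (≤ℓ≡ (peel λ' cy≤q ucy) (trans (new-up χ c∉y) (trans (cong suc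
                (ℕₚ.suc-injective (trans (sym dM) (proj₂ (proj₂ X))))) (sym ucx))))
        ux' : UpL r x
        ux' = subst (UpL r) y≡x (dn⇒up ρ dM)
        dx : DnL r x
        dx = Dih.firstOther Y l r λ' ρ l≢r ix x≢e (inj₁ refl) (inj₂ refl) l≢r ux
      dnM : DnL r (M (c · x)) → ⊥
      dnM dr = split' (DD ρ χ (λ z → c≢r (sym z)) (new-up χ c∉Mx) (subst (DnL r) cMx dr))
        where
        split' : DnL r (M x) × (r · c ≡ c · r ⊎ DnL c (r · M x)) → ⊥
        split' (dM , alt) = [ comm-case dr dM , (λ z → c∉s ρ c≢r c∉Mx (dn⇒≤ χ z)) ]′ alt
    -- The only left descent l of q is destroyed, so M q = k·q for a letter k. The choice k = l is
    -- excluded since l is a descent; k = c and k = r are excluded by comparison with M(l·x) and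
    -- M(c·x), both covered by M q.
    fin : ⊥
    fin = go (all-lost (up Lq) (λ {k} κ d → subst (λ z → UpL z (M q)) (sym (dl κ d)) (gone Lq)))
      where
      cases : ∀ {k} → UpL k q → M q ≡ k · q → k ≡ l ⊎ k ≡ r ⊎ k ≡ c → ⊥
      cases uk Mq (inj₁ refl) = dnup (up⇒dn λ' ulcx) uk
      cases uk Mq (inj₂ (inj₁ refl)) = k≢r uk Mq
      cases uk Mq (inj₂ (inj₂ refl)) = k≢c Mq
      go : (∃ λ k → S k × UpL k q × M q ≡ k · q) → ⊥
      go (k , κ , uk , Mq) = cases uk Mq (supq κ (M-supp κ q≤ (subst (k ≤_) (sym Mq) (dn⇒≤ κ (up⇒dn κ uk)))))

module Two (Y : Sys) (w : Sys.W Y) (M : Sys.W Y → Sys.W Y) (sp : Special Y w M) where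
  open Sys Y
  open Products Y
  open Descents Y
  open Coatoms Y
  open Half Y w M sp public
  module R = Half (op Y) w M (opS sp)

  TR : W → Set
  TR = R.TL

  clash : ∀ {q l r} → Lost l q → (∀ {k} → S k → DnL k q → k ≡ l) → R.Lost r q → ⊥
  clash {q} L f L' = conflict (up L) (λ {k} κ d → subst (λ z → UpL z (M q)) (sym (f κ d)) (gone L))
                       (R.σ L') (R.dn L') (R.gone L')

  TL≢TR : ∀ {l r} → TL l → TR r → ¬ l ≡ r
  TL≢TR (_ , _ , _ , q , nc) (_ , _ , _ , q' , _) refl = nc (trans (sym q) q')

  -- Without a, `chain-TL` applies from both sides: all left descents of y and its right descent t
  -- are destroyed, which is the conflict.
  beta* : ∀ {y t} → y ≤ w → ¬ a ≤ y → (∀ {k} → S k → DnL k y → TL k) → DnR y t → TR t → ⊥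
  beta* {y} {t} p na f d T = conflict (noa⇒up p na) g (proj₁ T) d (subst (λ z → UpR (M z) t) (scR y τ)
      (R.gone (R.chain-TL T (y · t) (λ z → na (≤t z (Basics.dn≤ (op Y) τ d))) (Basics.dn⇒up (op Y) τ d)
        (subst (_≤ w) (sym (scR y τ)) p))))
    where
    τ = proj₁ T
    g : ∀ {k} → S k → DnL k y → UpL k (M y)
    g {k} κ dk = subst (λ z → UpL k (M z)) (sc y κ)
      (gone (chain-TL (f κ dk) (k · y) (λ z → na (≤t z (dn≤ κ dk))) (dn⇒up κ dk) (subst (_≤ w) (sym (sc y κ)) p)))

  private
    ≢sym : ∀ {A : Set} {x y : A} → ¬ x ≡ y → ¬ y ≡ x
    ≢sym n p = n (sym p)

  -- At l·a·r the left descent l and the right descent r are both destroyed, and l is the only left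
  -- descent because neither l nor r commutes with a.
  lar : ∀ {l r} → TL l → TR r → l · (a · r) ≤ w → ⊥
  lar {l} {r} A@(λ' , _ , l≢a , Ml , ncl) B@(ρ , r≤w , r≢a , Mr , ncr) p =
    clash Ll dl (subst (R.Lost r) (assoc l a r) Rr)
    where
    l≢r = TL≢TR A B
    l∉ar : ¬ l ≤ a · r
    l∉ar z = [ l≢a , (λ z' → [ S≢e λ' , l≢r ]′ (≤s ρ z')) ]′ (supp-s a-S λ' z)
    r∉la : ¬ r ≤ l · a
    r∉la z = [ (λ z' → l≢r (sym z')) , (λ z' → [ S≢e ρ , r≢a ]′ (≤s a-S z')) ]′ (supp-s λ' ρ z)
    uar : UpL a r
    uar = upS a-S ρ (≢sym r≢a)
    ular : UpL l (a · r)
    ular = new-up λ' l∉ar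
    ulr : UpL l r
    ulr = upS λ' ρ l≢r
    a∉ : ∀ {s} → S s → ¬ s ≡ a → ¬ a ≤ s
    a∉ σ n z = [ S≢e a-S , ≢sym n ]′ (≤s σ z)
    ar≤ : a · r ≤ w
    ar≤ = ≤t (upL λ' ular) p
    Ll : Lost l (l · (a · r))
    Ll = propagate (chain-TL A r (a∉ ρ r≢a) ulr (≤t (monoL λ' (upL a-S uar) ular) p)) ulr (⋖up a-S uar)
           (proj₁ (up-next (S-up ρ r≤w r≢a) (⋖up a-S uar) ar≤ (λ q → ncr (trans (sym Mr) q)))) ular p
    ula : UpR l a
    ula = Basics.upS (op Y) a-S λ' (≢sym l≢a)
    p' : (l · a) · r ≤ w
    p' = subst (_≤ w) (sym (assoc l a r)) p
    ular' : UpR (l · a) r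
    ular' = R.new-up ρ r∉la
    la≤ : l · a ≤ w
    la≤ = ≤t (upR ρ ular') p'
    Rr : R.Lost r ((l · a) · r)
    Rr = R.propagate (R.chain-TL B l (a∉ λ' l≢a) (Basics.upS (op Y) ρ λ' (≢sym l≢r))
             (≤t (monoR ρ (upR a-S ula) ular') p')) (Basics.upS (op Y) ρ λ' (≢sym l≢r)) (upR a-S ula , ula)
           (proj₁ (up-next (S-up λ' (proj₁ (proj₂ A)) l≢a) (upR a-S ula , ula) la≤ (λ q → ncl (trans (sym Ml) q)))) ular' p'
    dl : ∀ {k} → S k → DnL k (l · (a · r)) → k ≡ l
    dl {k} κ d = go (k ≟ l)
      where
      not-e : ∀ {s} → ¬ DnL s e
      not-e z with trans (sym ℓe) z
      ... | ()
      ka : Dec (k ≡ a) → DnL k (a · r) → k ≡ a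
      ka (yes q) _ = q
      ka (no n) z = ⊥-elim (bad (DD κ a-S n uar z) )
        where
        bad : DnL k r × (k · a ≡ a · k ⊎ DnL a (k · r)) → ⊥
        bad (z' , alt) = kr (dnS κ ρ z') alt
          where
          kr : k ≡ r → k · a ≡ a · k ⊎ DnL a (k · r) → ⊥
          kr refl = [ ncr , (λ y → not-e (subst (DnL a) (SS ρ) y)) ]′
      at-a : ∀ {k} → k ≡ a → k · l ≡ l · k ⊎ DnL l (k · (a · r)) → ⊥
      at-a refl (inj₁ q) = ncl q
      at-a refl (inj₂ q) = l≢r (dnS λ' ρ (subst (DnL l) (sc r a-S) q))
      go : Dec (k ≡ l) → k ≡ l
      go (yes q) = q
      go (no n) = ⊥-elim (at-a (ka (k ≟ a) (proj₁ dd)) (proj₂ dd))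
        where dd = DD κ λ' n ular d

  -- Shorten y on the right as long as t still occurs; left descents stay of left type. In the end y
  -- is a word ending in t: if a occurs, y lies above some l·a·t, against `lar`, and otherwise
  -- `beta*` applies.
  no-TR-above : ∀ {t} → TR t → ∀ y → y ≤ w → (∀ {k} → S k → DnL k y → TL k) → t ≤ y → ⊥
  no-TR-above {t} T y p f ty = go (ℓ y) y refl p f ty
    where
    τ = proj₁ T
    go : ∀ n y → ℓ y ≡ n → y ≤ w → (∀ {k} → S k → DnL k y → TL k) → t ≤ y → ⊥
    go n y q p f ty with y ≟ e
    go n y q p f ty | yes refl = S≢e τ (≤e ty)
    go zero y q p f ty | no ne = ne (ℓ0 q)
    go (suc n) y q p f ty | no ne = step (descR y ne) (descL y ne)
      where
      step : (∃ λ r → S r × DnR y r) → (∃ λ l → S l × DnL l y) → ⊥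
      step (r , ρ , d) (l , λ' , dl) with t ≤? (y · r)
      ... | yes ty' = go n (y · r) (ℕₚ.suc-injective (trans (sym d) q)) (≤t (dn≤R ρ d) p)
                        (λ {k} κ dk → f κ (¬up⇒dn κ λ u → dnup dk (up-right κ ρ u d))) ty'
      ... | no nt = last (a ≤? y)
        where
        r≡t : t ≡ r
        r≡t = [ (λ z → z) , (λ z → ⊥-elim (nt z)) ]′ (Basics.supp-s (op Y) ρ τ (subst (t ≤_) (sym (scR y ρ)) ty))
        dt : DnR y t
        dt = subst (DnR y) (sym r≡t) d
        last : Dec (a ≤ y) → ⊥
        last (no na) = beta* p na f dt T
        last (yes ay) = lar (f λ' dl) T (≤t (star λ' (Basics.star (op Y) τ ay dt) dl) p)

  record BadR (t : W) : Set where
    field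
      x    : W
      Ux   : Up x
      ix   : Supp2 a t x
      Mx≢  : ¬ M x ≡ x · a
      min  : ∀ {u} → Up u → Supp2 a t u → ℓ u < ℓ x → M u ≡ u · a

  good-or-bad : ∀ {t} → S t → ¬ t ≡ a → Good t ⊎ BadR t
  good-or-bad {t} τ n = finish (search (suc (ℓ w)))
    where
    open Dih Y a t a-S τ (λ p → n (sym p)) using (In?)
    Below : ℕ → Set
    Below k = ∀ {u} → Up u → Supp2 a t u → ℓ u < k → M u ≡ u · a
    search : ∀ k → Below k ⊎ BadR t
    search zero = inj₁ λ _ _ ()
    search (suc k) with search k
    ... | inj₂ b = inj₂ b
    ... | inj₁ f with any? (λ u → (ℓ u ℕₚ.≟ k) ×-dec (ℓ (M u) ℕₚ.≟ suc (ℓ u)) ×-dec In? u ×-dec ¬? (M u ≟ u · a)) (low w)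
    ...   | yes z = inj₂ (found (find z))
      where
      found : (∃ λ u → _ × (ℓ u ≡ k × ℓ (M u) ≡ suc (ℓ u) × Supp2 a t u × ¬ M u ≡ u · a)) → BadR t
      found (u , m , q , l , i , ne) = record { x = u ; Ux = U ; ix = i ; Mx≢ = ne ; min = λ V j lt → f V j (subst (_ <_) q lt) }
        where
        U : Up u
        U = ¬down⇒up (∈low⇒≤ m) λ D → ℕₚ.<-asym (ℕₚ.≤-reflexive (sym l)) (ℕₚ.≤-reflexive (sym (proj₂ (proj₂ D))))
    ...   | no z = inj₁ g
      where
      g : Below (suc k)
      g {u} U i (s≤s lt) with ℓ u ℕₚ.≟ k | M u ≟ u · a
      ... | _ | yes q = q
      ... | no r | no _ = f U i (ℕₚ.≤∧≢⇒< lt r)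
      ... | yes r | no q = ⊥-elim (z (lose (≤⇒∈low (proj₁ U)) (r , proj₂ (proj₂ U) , i , q)))
    finish : Below (suc (ℓ w)) ⊎ BadR t → Good t ⊎ BadR t
    finish (inj₂ b) = inj₂ b
    finish (inj₁ f) = inj₁ λ U i → f U i (s≤s (≤ℓ (proj₁ U)))

-- Bad letters

-- x is the first element of the dihedral subgroup ⟨a,t⟩ at which M is not right multiplication by a.
module Bad (Y : Sys) (w : Sys.W Y) (M : Sys.W Y → Sys.W Y) (sp : Special Y w M)
           (t : Sys.W Y) (T : Two.TR Y w M sp t) (B : Two.BadR Y w M sp t) where
  open Sys Y
  open Products Y
  open Descents Y
  open Coatoms Y
  open Two Y w M sp
  open BadR B public

  τ : S t
  τ = proj₁ T

  t≢a : ¬ t ≡ a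
  t≢a = proj₁ (proj₂ (proj₂ T))

  a≢t : ¬ a ≡ t
  a≢t p = t≢a (sym p)

  nc : ¬ a · t ≡ t · a
  nc p = proj₂ (proj₂ (proj₂ (proj₂ T))) (sym p)

  open Dih Y a t a-S τ a≢t public
  module DR = Dih (op Y) a t a-S τ a≢t

  Third : W → Set
  Third b = S b × ¬ b ≡ a × ¬ b ≡ t

  third∉ : ∀ {b u} → Third b → In u → ¬ b ≤ u
  third∉ (β , n , m) i p = [ n , m ]′ (i β p)

  down-form : ∀ {u} → Down u → In u → ℓ u ≤ℕ ℓ x → DnR u a
  down-form {u} D i l = trans (proj₂ (proj₂ D)) (cong suc (cong ℓ (sym (trans (cong (_· a) q) (scR (M u) a-S)))))
    where
    q : u ≡ M u · a
    q = trans (sym (invol (proj₁ D))) (min (M-down D) (In-≤ (proj₁ (proj₂ D)) i)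
          (ℕₚ.≤-trans (ℕₚ.≤-reflexive (sym (proj₂ (proj₂ D)))) l))

  ¬Rdnup : ∀ {u s} → DnR u s → UpR u s → ⊥
  ¬Rdnup d u = Basics.dnup (op Y) d u

  -- If x·a were shorter than x, minimality would either match it with x, so that x is matched
  -- downwards, or make it end in a itself.
  xa : UpR x a
  xa = Basics.¬dn⇒up (op Y) a-S bad
    where
    bad : DnR x a → ⊥
    bad d with dir (≤t (dn≤R a-S d) (proj₁ Ux))
    ... | inj₁ U = up-down Ux (subst Down (trans (min U (In-≤ (dn≤R a-S d) ix) (ℕₚ.≤-reflexive (sym d))) (scR x a-S)) (M-up U))
    ... | inj₂ D = ¬Rdnup (down-form D (In-≤ (dn≤R a-S d) ix) (≤ℓ (dn≤R a-S d))) (Basics.dn⇒up (op Y) a-S d)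

  x≢e : ¬ x ≡ e
  x≢e p = Mx≢ (trans (cong M p) (trans (sym (idˡ a)) (cong (_· a) (sym p))))

  ixa : In (x · a)
  ixa = In-· (In-S a-S Ka) x ix

  lt-xa : ∀ {u} → ℓ u ≤ℕ ℓ x → ℓ u < ℓ (x · a)
  lt-xa p = ℕₚ.≤-trans (s≤s p) (ℕₚ.≤-reflexive (sym xa))

  private
    fst = first ix x≢e

  l : W
  l = proj₁ fst

  Kl : K l
  Kl = proj₁ (proj₂ fst)

  λ' : S l
  λ' = Sof Kl

  dlx : DnL l x
  dlx = proj₂ (proj₂ fst)

  x₀ : W
  x₀ = l · x

  x₀≤ : x₀ ≤ x
  x₀≤ = dn≤ λ' dlx

  ix₀ : In x₀
  ix₀ = In-≤ x₀≤ ix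

  ulx₀ : UpL l x₀
  ulx₀ = dn⇒up λ' dlx

  lx₀ : l · x₀ ≡ x
  lx₀ = sc x λ'

  strip-up : ∀ {u k} → In u → ℓ u ≤ℕ ℓ x → u ≤ w → UpR u a → S k → DnL k u → Up (k · u) × UpR (k · u) a
  strip-up {u} {k} i lu p ua κ d = ¬down⇒up (≤t ku≤ p) (λ D → ¬Rdnup
      (down-form D (In-≤ ku≤ i) (ℕₚ.≤-trans (≤ℓ ku≤) lu)) ua') , ua'
    where
    ku≤ = dn≤ κ d
    ua' : UpR (k · u) a
    ua' = Coatoms.up-right (op Y) a-S κ ua d

  Ux₀ : Up x₀
  Ux₀ = proj₁ (strip-up ix ℕₚ.≤-refl (proj₁ Ux) xa λ' dlx)

  Mx₀ : M x₀ ≡ x₀ · a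
  Mx₀ = min Ux₀ ix₀ (ℕₚ.≤-reflexive (sym dlx))

  iMx : In (M x)
  iMx σ p = [ inj₁ , ix σ ]′ (M-supp σ (proj₁ Ux) p)

  -- If l survived, M x and x·a would have the same length and the same first letter in ⟨a,t⟩ and so
  -- be equal, against the choice of x.
  lostx : Lost l x
  lostx = lost λ' Ux dlx Ux₀ (¬dn⇒up λ' λ d → Mx≢ (dih1 Kl iMx ixa (trans (proj₂ (proj₂ Ux)) (sym xa)) d
            (prefix-dn x a λ' (trans xa (trans (ℕₚ.+-comm 1 _) (cong (ℓ x +ℕ_) (sym (ℓS a-S))))) dlx)))

  -- As x·a is longer, x is not the longest element of ⟨a,t⟩.
  only-l : ∀ {k} → S k → DnL k x → k ≡ l
  only-l κ d = one-desc ix ixa (lt-xa ℕₚ.≤-refl) (In-dn κ ix d) Kl d dlx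

  dxt : DnR x t
  dxt = DR.firstOther ix x≢e Ka Kt a≢t xa

  only-t : ∀ {k} → S k → DnR x k → k ≡ t
  only-t {k} κ d = [ (λ q → ⊥-elim (¬Rdnup (subst (DnR x) q d) xa)) , (λ q → q) ]′ (ix κ (Basics.dn⇒≤ (op Y) κ d))

  x≢t : ¬ x ≡ t
  x≢t p = Mx≢ (trans (cong M p) (trans (proj₁ (proj₂ (proj₂ (proj₂ T)))) (cong (_· a) (sym p))))

  2≤x : 2 ≤ℕ ℓ x
  2≤x = bound (ℓ x) refl
    where
    bound : ∀ n → ℓ x ≡ n → 2 ≤ℕ n
    bound zero q = ⊥-elim (x≢e (ℓ0 q))
    bound 1 q = ⊥-elim ([ (λ p → up-down Ux (subst Down (sym p) (M-up e-up))) , x≢t ]′ (ix (ℓ1 q) ≤r))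
    bound (suc (suc n)) q = s≤s (s≤s z≤n)

  ℓat : ℓ (a · t) ≡ 2
  ℓat = ℓ2 a-S τ a≢t

  iat : In (a · t)
  iat = In-cons a-S Ka (In-S τ Kt)

  at≤x : a · t ≤ x
  at≤x with ℓ x ℕₚ.≟ 2
  ... | no n = dih2 iat ix (subst (_< ℓ x) (sym ℓat) (ℕₚ.≤∧≢⇒< 2≤x (λ q → n (sym q))))
  ... | yes q = subst (a · t ≤_) (DR.dih1 Kt iat ix (trans ℓat (sym q))
      (trans ℓat (cong suc (trans (sym (ℓS a-S)) (cong ℓ (sym (scR a τ)))))) dxt) ≤r

  a≤x : a ≤ x
  a≤x = ≤t (subst (_≤ a · t) (idʳ a) (mul≤ {m = a} {n = t} ≤r (e≤ t) (trans ℓat (cong₂ _+ℕ_ (sym (ℓS a-S)) (sym (ℓS τ)))))) at≤x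

  x₀≢e : ¬ x₀ ≡ e
  x₀≢e p = ℕₚ.<-irrefl refl (ℕₚ.≤-trans 2≤x (ℕₚ.≤-reflexive (trans dlx (cong suc (trans (cong ℓ p) ℓe)))))

  minS : ∀ {b} → Third b → MinL b
  minS (β , n , m) κ Kk = upS κ β λ { refl → [ n , m ]′ Kk }

  lost-right : ∀ {b} → Third b → x · b ≤ w → Lost l (x · b)
  lost-right {b} th@(β , b≢a , _) p = subst (Lost l) q (propagate (subst (Lost l) (sym lx₀) lostx) ulx₀ (upR β ub , ub)
      (proj₁ (up-next Ux₀ (upR β ub , ub) (≤t (monoR β x₀≤ ubx) p) (λ z → b≢a (canL x₀ (trans (sym z) (trans Mx₀ refl))))))
      ulb (subst (_≤ w) (sym q) p))
    where
    q : l · (x₀ · b) ≡ x · b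
    q = trans (sym (assoc l x₀ b)) (cong (_· b) lx₀)
    ub : UpR x₀ b
    ub = R.new-up β (third∉ th ix₀)
    ubx : UpR x b
    ubx = R.new-up β (third∉ th ix)
    ulb : UpL l (x₀ · b)
    ulb = ¬dn⇒up λ' λ d → third∉ th ix (subst (b ≤_) (trans (exch λ' (upR β ub , ub) ulx₀ d) lx₀)
            (Basics.dn⇒≤ (op Y) β (Basics.up⇒dn (op Y) β ub)))
  only-l-· : ∀ {h} → MinL h → (∀ {k} → S k → ¬ K k → DnL k (x · h) → ⊥) → ∀ {k} → S k → DnL k (x · h) → k ≡ l
  only-l-· m f {k} κ d with K? k
  ... | yes Kk = only-l κ (dn-d κ Kk ix m d)
  ... | no n = ⊥-elim (f κ n d)

  third-desc : ∀ {b m d} → Third b → In m → In d → ℓ (m · d) ≡ ℓ m +ℕ ℓ d → MinL (b · d) → DnL b (m · (b · d)) →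
               ∀ {s} → S s → s ≤ m → b · s ≡ s · b
  third-desc {b} {m} {d} th i j q mb dn = insert-desc m d (proj₁ th) q (add mb m i) (third∉ th (In-· j m i)) dn

  chainR : ∀ {b} → Third b → TR b → ∀ u → In u → ℓ u ≤ℕ ℓ x → Up u → UpR u a → u · b ≤ w → R.Lost b (u · b)
  chainR {b} th Tb = λ u → go (ℓ u) u refl
    where
    β = proj₁ th
    go : ∀ n u → ℓ u ≡ n → In u → ℓ u ≤ℕ ℓ x → Up u → UpR u a → u · b ≤ w → R.Lost b (u · b)
    step : ∀ n u → Dec (u ≡ e) → ℓ u ≡ n → In u → ℓ u ≤ℕ ℓ x → Up u → UpR u a → u · b ≤ w → R.Lost b (u · b)
    go n u = step n u (u ≟ e)
    step n u (yes ue) q i lu U ua p = subst (R.Lost b) (trans (sym (idˡ b)) (cong (_· b) (sym ue))) (R.lostTL Tb)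
    step zero u (no ne) q i lu U ua p = ⊥-elim (ne (ℓ0 q))
    step (suc n) u (no ne) q i lu U ua p = next (first i ne)
      where
      next : (∃ λ k → K k × DnL k u) → R.Lost b (u · b)
      next (k , Kk , d) = R.propagate (go n (k · u) (ℕₚ.suc-injective (trans (sym d) q)) i' (ℕₚ.≤-trans (≤ℓ ku≤) lu)
          (proj₁ su) (proj₂ su)
                          (≤t (monoR β ku≤ ub) p)) (R.new-up β (third∉ th i')) (ku≤ , d) U ub p
        where
        ku≤ = dn≤ (Sof Kk) d
        i' : In (k · u)
        i' = In-≤ ku≤ i
        ub : UpR u b
        ub = R.new-up β (third∉ th i)
        su = strip-up i lu (proj₁ U) ua (Sof Kk) d

  -- At x·b the only left descent l is destroyed by `lost-right` and the right descent b by
  -- `chainR`. That b is not a left descent uses that it does not commute with the letter a of x.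
  TR-after : ∀ {b} → Third b → TR b → x · b ≤ w → ⊥
  TR-after {b} th Tb p = clash (lost-right th p) (only-l-· (minS th) other-desc)
      (chainR th Tb x ix ℕₚ.≤-refl Ux xa p)
    where
    β = proj₁ th
    other-desc : ∀ {k} → S k → ¬ K k → DnL k (x · b) → ⊥
    other-desc {k} κ nk d = [ (λ z → nk (ix κ z)) , (λ z → [ S≢e κ , isb ]′ (≤s β z)) ]′ (supp-· x b κ (dn⇒≤ κ d))
      where
      isb : k ≡ b → ⊥
      isb refl = proj₂ (proj₂ (proj₂ (proj₂ Tb))) (third-desc th ix In-e
          (trans (cong ℓ (idʳ x)) (trans (sym (ℕₚ.+-identityʳ _)) (cong (ℓ x +ℕ_) (sym ℓe))))
                   (λ {k} κ' Kk → subst (UpL k) (sym (idʳ b)) (minS th κ' Kk))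
                       (subst (DnL b) (cong (x ·_) (sym (idʳ b))) d) a-S a≤x)

  TL-before-x : ∀ {b} → Third b → TL b → b · x ≤ w → ⊥
  TL-before-x th Tb p = lar Tb T (≤t (monoL (proj₁ th) at≤x (new-up (proj₁ th) (third∉ th ix))) p)

  -- A third letter b cannot be inserted into x in front of a letter g with which it does not
  -- commute. For q' = m·b·d the destroyed descent l of q = l·q' forces M q = k·q. If k lies in
  -- {a,t}, comparing cosets gives M q' = m·g·b·d; from M x₀ = x₀·a below M q', cancelling m and
  -- removing b leads to d·a = g·d, whose two sides have different lengths.
  inside : ∀ {b g m d} → Third b → K g → m · d ≡ x₀ → ℓ x₀ ≡ ℓ m +ℕ ℓ d → ¬ m ≡ e → DnL g d → ¬ b · g ≡ g · b →
           l · (m · (b · d)) ≤ w → ⊥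
  inside {b} {g} {m} {d} th Kg md lmd m≢e dg nbg q≤ = fin
    where
    β = proj₁ th
    γ = Sof Kg
    addmd : ℓ (m · d) ≡ ℓ m +ℕ ℓ d
    addmd = trans (cong ℓ md) lmd
    m≤ : m ≤ x₀
    m≤ = subst₂ _≤_ (idʳ m) md (mul≤ ≤r (e≤ d) addmd)
    d≤ : d ≤ x₀
    d≤ = subst₂ _≤_ (idˡ d) md (mul≤ (e≤ m) ≤r addmd)
    im : In m
    im = In-≤ m≤ ix₀
    id' : In d
    id' = In-≤ d≤ ix₀
    ubd : UpL b d
    ubd = new-up β (third∉ th id')
    b≢K : ∀ {k} → K k → ¬ k ≡ b
    b≢K Kk refl = [ proj₁ (proj₂ th) , proj₂ (proj₂ th) ]′ Kk
    mbd : MinL (b · d)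
    mbd {k} κ Kk = ¬dn⇒up κ λ dk → bad (DD κ β (b≢K Kk) ubd dk)
      where
      bad : DnL k d × (k · b ≡ b · k ⊎ DnL b (k · d)) → ⊥
      bad (dk , inj₂ z) = third∉ th (In-cons κ Kk id') (dn⇒≤ β z)
      bad (dk , inj₁ z) = nbg (subst (λ h → b · h ≡ h · b) (one-desc id' ixa
          (lt-xa (ℕₚ.≤-trans (≤ℓ d≤) (≤ℓ x₀≤))) Kk Kg dk dg) (sym z))
    q' = m · (b · d)
    addq' : ℓ q' ≡ ℓ m +ℕ ℓ (b · d)
    addq' = add mbd m im
    x₀q' : x₀ ⋖ q'
    x₀q' = subst (_≤ q') md (mul≤ ≤r (upL β ubd) addq')
         , trans addq' (trans (cong (ℓ m +ℕ_) ubd) (trans (ℕₚ.+-suc _ _) (cong suc (sym lmd))))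
    b≤q' : b ≤ q'
    b≤q' = ≤t (dn⇒≤ β (up⇒dn β ubd)) (subst (_≤ q') (idˡ (b · d)) (mul≤ (e≤ m) ≤r addq'))
    ulq' : UpL l q'
    ulq' = up-below λ' x₀q' ulx₀ (λ z → third∉ th ix (subst (b ≤_) (trans z lx₀) b≤q'))
    Q' : Up q'
    Q' = proj₁ (up-next Ux₀ x₀q' (≤t (upL λ' ulq') q≤) λ z → third∉ th (In-· (In-S a-S Ka) x₀ ix₀)
        (subst (b ≤_) (trans (sym z) Mx₀) b≤q'))
    q = l · q'
    Lq : Lost l q
    Lq = propagate (subst (Lost l) (sym lx₀) lostx) ulx₀ x₀q' Q' ulq' q≤
    o = proj₁ (other Kl)
    Ko : K o
    Ko = proj₁ (proj₂ (other Kl))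
    l≢o : ¬ l ≡ o
    l≢o = proj₁ (proj₂ (proj₂ (other Kl)))
    ω = Sof Ko
    ulm : UpL l m
    ulm = ¬dn⇒up λ' λ z → dnup (prefix-dn m (b · d) λ' addq' z) ulq'
    dom : DnL o m
    dom = firstOther im m≢e Kl Ko l≢o ulm
    ilm : In (l · m)
    ilm = In-cons λ' Kl im
    qK : q ≡ (l · m) · (b · d)
    qK = sym (assoc l m (b · d))
    lmd' : (l · m) · d ≡ x
    lmd' = trans (assoc l m d) (trans (cong (l ·_) md) lx₀)
    addlmd : ℓ ((l · m) · d) ≡ ℓ (l · m) +ℕ ℓ d
    addlmd = trans (cong ℓ lmd') (trans dlx (trans (cong suc lmd) (cong (_+ℕ ℓ d) (sym ulm))))
    lm≤x : l · m ≤ x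
    lm≤x = subst₂ _≤_ (idʳ (l · m)) lmd' (mul≤ ≤r (e≤ d) addlmd)
    suppq : ∀ {s} → S s → s ≤ q → K s ⊎ s ≡ b
    suppq σ p = [ (λ z → inj₁ (ilm σ z)) , (λ z → [ inj₂ , (λ z' → inj₁ (id' σ z')) ]′ (supp-s β σ z)) ]′
                  (supp-· (l · m) (b · d) σ (subst (_ ≤_) qK p))
    dl : ∀ {k} → S k → DnL k q → k ≡ l
    dl {k} κ dk = [ inK , (λ z → ⊥-elim (isb z)) ]′ (suppq κ (dn⇒≤ κ dk))
      where
      inK : K k → k ≡ l
      inK Kk = one-desc ilm ixa (lt-xa (≤ℓ lm≤x)) Kk Kl (dn-d κ Kk ilm mbd (subst (DnL k) qK dk)) (up⇒dn λ' ulm)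
      isb : k ≡ b → ⊥
      isb refl = nbg (third-desc th ilm id' addlmd mbd (subst (DnL b) qK dk) γ g≤lm)
        where
        g≤lm : g ≤ l · m
        g≤lm = g≤ (g ≟ l)
          where
          g≤ : Dec (g ≡ l) → g ≤ l · m
          g≤ (yes p) = subst (_≤ l · m) (sym p) (dn⇒≤ λ' (up⇒dn λ' ulm))
          g≤ (no n) = subst (_≤ l · m) (sym (third Kl Ko Kg l≢o n)) (≤t (dn⇒≤ ω dom) (upL λ' ulm))
    Z = M q'
    vZ : Z ⋖ M q
    vZ = up-step Q' (⋖up λ' ulq') (up Lq)
    ulZ : UpL l Z
    ulZ = M-upL λ' Q' ulq' (not-below Lq ulq')
    core : ∀ {k} → K k → UpL k q → M q ≡ k · q → ⊥
    core {k} Kk uk Mq = ℕₚ.<-asym (ℕₚ.≤-reflexive (sym dg)) (ℕₚ.≤-reflexive (trans (sym ℓda) (cong ℓ da≡)))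
      where
      sp' = decomp Z
      D = Split.d sp'
      h = Split.h sp'
      iD : In D
      iD = Split.inD sp'
      mh : MinL h
      mh = Split.minH sp'
      -- Projection to minimal representatives is monotone, and Z lies between q' and M q = k·q,
      -- both in the coset of b·d.
      h≡ : h ≡ b · d
      h≡ = ≤-anti (proj≤ iD mh (In-cons (Sof Kk) Kk ilm)
                    (subst₂ _≤_ (Split.eq sp') (trans Mq (trans (cong (k ·_) qK) (sym (assoc k (l · m) (b · d))))) (proj₁ vZ)))
                  (proj≤ im mbd iD (subst (q' ≤_) (Split.eq sp') (proj₁ (proj₂ Q'))))
      ℓD : ℓ D ≡ suc (ℓ m)
      ℓD = ℕₚ.+-cancelʳ-≡ (ℓ (b · d)) (ℓ D) (suc (ℓ m)) (trans (cong (ℓ D +ℕ_) (cong ℓ (sym h≡)))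
             (trans (sym (Split.len sp')) (trans (proj₂ (proj₂ Q')) (cong suc addq'))))
      D≢e : ¬ D ≡ e
      D≢e p = ℕₚ.1+n≢0 (trans (sym ℓD) (trans (cong ℓ p) ℓe))
      doD : DnL o D
      doD = firstOther iD D≢e Kl Ko l≢o (¬dn⇒up λ' λ z → dnup (subst (DnL l) (sym (Split.eq sp')) (dn-h λ' iD mh z)) ulZ)
      img : In (m · g)
      img = In-· (In-S γ Kg) m im
      gd = g · d
      ℓmg : ℓ (m · g) ≡ suc (ℓ m)
      ℓmg = ℕₚ.≤-antisym (ℕₚ.≤-trans (ℓ-sub m g) (ℕₚ.≤-reflexive (trans (cong (ℓ m +ℕ_) (ℓS γ)) (ℕₚ.+-comm _ 1))))
              (ℕₚ.+-cancelʳ-≤ (ℓ gd) (suc (ℓ m)) (ℓ (m · g)) (ℕₚ.≤-trans (ℕₚ.≤-reflexive (trans (sym (ℕₚ.+-suc (ℓ m) (ℓ gd)))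
                (trans (cong (ℓ m +ℕ_) (sym dg)) (trans (sym addmd)
                    (cong ℓ (trans (cong (m ·_) (sym (sc d γ))) (sym (assoc m g gd))))))))
                (ℓ-sub (m · g) gd)))
      D≡ : D ≡ m · g
      D≡ = dih1 Ko iD img (trans ℓD (sym ℓmg)) doD (prefix-dn m g ω
          (trans ℓmg (trans (ℕₚ.+-comm 1 _) (cong (ℓ m +ℕ_) (sym (ℓS γ))))) dom)
      Z≡ : Z ≡ m · (g · (b · d))
      Z≡ = trans (Split.eq sp') (trans (cong₂ _·_ D≡ h≡) (assoc m g (b · d)))
      x₀a≤ : m · (d · a) ≤ m · (g · (b · d))
      x₀a≤ = subst₂ _≤_ (trans Mx₀ (trans (cong (_· a) (sym md)) (assoc m d a))) Z≡ (proj₁ (up-step Ux₀ x₀q' Q'))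
      ℓda-up : ℓ (m · (d · a)) ≡ ℓ m +ℕ suc (ℓ d)
      ℓda-up = trans (cong ℓ (trans (sym (assoc m d a)) (trans (cong (_· a) md) (sym Mx₀))))
                 (trans (proj₂ (proj₂ Ux₀)) (trans (cong suc lmd) (sym (ℕₚ.+-suc (ℓ m) (ℓ d)))))
      ℓda : ℓ (d · a) ≡ suc (ℓ d)
      ℓda = ℕₚ.≤-antisym (ℕₚ.≤-trans (ℓ-sub d a) (ℕₚ.≤-reflexive (trans (cong (ℓ d +ℕ_) (ℓS a-S)) (ℕₚ.+-comm _ 1))))
              (ℕₚ.+-cancelˡ-≤ (ℓ m) (suc (ℓ d)) (ℓ (d · a)) (ℕₚ.≤-trans (ℕₚ.≤-reflexive (sym ℓda-up)) (ℓ-sub m (d · a))))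
      ugbd : UpL g (b · d)
      ugbd = mbd γ Kg
      ℓZ : ℓ (m · (g · (b · d))) ≡ ℓ m +ℕ ℓ (g · (b · d))
      ℓZ = trans (cong ℓ (sym Z≡)) (trans (proj₂ (proj₂ Q'))
          (trans (cong suc addq') (trans (sym (ℕₚ.+-suc (ℓ m) _)) (cong (ℓ m +ℕ_) (sym ugbd)))))
      da≤ : d · a ≤ g · (b · d)
      da≤ = cancel≤ m (trans ℓda-up (cong (ℓ m +ℕ_) (sym ℓda))) ℓZ x₀a≤
      dgda : DnL g (d · a)
      dgda = prefix-dn d a γ (trans ℓda (trans (ℕₚ.+-comm 1 _) (cong (ℓ d +ℕ_) (sym (ℓS a-S))))) dg
      gda≤ : g · (d · a) ≤ d
      gda≤ = peel β (subst (g · (d · a) ≤_) (sc (b · d) γ) (liftdd γ da≤ (up⇒dn γ ugbd) dgda))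
               (new-up β (third∉ th (In-≤ (dn≤ γ dgda) (In-· (In-S a-S Ka) d id'))))
      da≡ : d · a ≡ gd
      da≡ = mvL γ (≤ℓ≡ gda≤ (ℕₚ.suc-injective (trans (sym dgda) ℓda)))
    notb : ¬ M q ≡ b · q
    notb Mq = third∉ th iMx (subst (b ≤_) (sym same) (≤t b≤q' (upL λ' ulq')))
      where
      xq : x ⋖ q
      xq = subst (_⋖ q) lx₀ (⋖mono λ' x₀q' ulx₀ ulq')
      same : M x ≡ q
      same = ≤ℓ≡ (peel β (subst (M x ≤_) Mq (proj₁ (up-step Ux xq (up Lq)))) (new-up β (third∉ th iMx)))
               (trans (proj₂ (proj₂ Ux)) (sym (proj₂ xq)))
    fin : ⊥
    fin = go (all-lost (up Lq) (λ {k} κ dk → subst (λ z → UpL z (M q)) (sym (dl κ dk)) (gone Lq)))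
      where
      cases : ∀ {k} → UpL k q → M q ≡ k · q → K k ⊎ k ≡ b → ⊥
      cases uk Mq (inj₁ Kk) = core Kk uk Mq
      cases uk Mq (inj₂ refl) = notb Mq
      go : (∃ λ k → S k × UpL k q × M q ≡ k · q) → ⊥
      go (k , κ , uk , Mq) = cases uk Mq ([ (λ z → inj₁ (inj₁ z)) , suppq κ ]′
          (M-supp κ q≤ (subst (k ≤_) (sym Mq) (dn⇒≤ κ (up⇒dn κ uk)))))

-- The descent l destroyed at x stays destroyed at x·G for elements G of ⟨a,b⟩, b a third letter.
module BadG (Y : Sys) (w : Sys.W Y) (M : Sys.W Y → Sys.W Y) (sp : Special Y w M)
            (t : Sys.W Y) (T : Two.TR Y w M sp t) (B : Two.BadR Y w M sp t) where
  open Sys Y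
  open Products Y
  open Descents Y
  open Coatoms Y
  open Factor Y
  open Two Y w M sp
  open Bad Y w M sp t T B

  private
    xt = x · t

  m₂ : W
  m₂ = (x · t) · a

  private
    xt≤ : xt ≤ x
    xt≤ = dn≤R τ dxt

    xt≢e : ¬ xt ≡ e
    xt≢e p = ℕₚ.<-irrefl refl (ℕₚ.≤-trans 2≤x (ℕₚ.≤-reflexive (trans dxt (cong suc (trans (cong ℓ p) ℓe)))))

    dxta : DnR xt a
    dxta = DR.firstOther (In-≤ xt≤ ix) xt≢e Kt Ka t≢a (Basics.dn⇒up (op Y) τ dxt)

  x≡ : x ≡ m₂ · (a · t)
  x≡ = trans (sym (scR x τ)) (trans (cong (_· t) (sym (scR xt a-S))) (assoc m₂ a t))

  ℓx : ℓ x ≡ ℓ m₂ +ℕ 2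
  ℓx = trans dxt (trans (cong suc dxta) (ℕₚ.+-comm 2 _))

  -- As a descent, b would have to pass the letters a, t that end y. Since b does not commute with
  -- a, `DD` makes a a descent of b·t·G; then b must commute with t, and at last a with t, against
  -- `nc`.
  no-desc : ∀ {b y m G} → Third b → ¬ a · b ≡ b · a → In y → y ≡ m · (a · t) → ℓ y ≡ ℓ m +ℕ 2 →
            Supp2 a b G → MinL G → ¬ DnL b (y · G)
  no-desc {b} {y} {m} {G} th nab iy yq ly iG mG dn = bad₁ (DD β a-S b≢a uatG
      (strip-dn m (a · (t · G)) β ℓmz b∉m (subst (DnL b) yG dn)))
    where
    β = proj₁ th
    b≢a = proj₁ (proj₂ th)
    b≢t = proj₂ (proj₂ th)
    t∉bG : ¬ t ≤ b · G
    t∉bG z = [ (λ q → b≢t (sym q)) , (λ z' → [ t≢a , (λ q → b≢t (sym q)) ]′ (iG τ z')) ]′ (supp-s β τ z)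
    t∉abG : ¬ t ≤ a · (b · G)
    t∉abG z = [ t≢a , t∉bG ]′ (supp-s a-S τ z)
    yG : y · G ≡ m · (a · (t · G))
    yG = trans (cong (_· G) yq) (trans (assoc m (a · t) G) (cong (m ·_) (assoc a t G)))
    ℓatG : ℓ (a · (t · G)) ≡ 2 +ℕ ℓ G
    ℓatG = trans (cong ℓ (sym (assoc a t G))) (trans (add mG (a · t) iat) (cong (_+ℕ ℓ G) ℓat))
    ℓmz : ℓ (m · (a · (t · G))) ≡ ℓ m +ℕ ℓ (a · (t · G))
    ℓmz = trans (cong ℓ (sym yG)) (trans (add mG y iy) (trans (cong (_+ℕ ℓ G) ly)
        (trans (ℕₚ.+-assoc (ℓ m) 2 (ℓ G)) (cong (ℓ m +ℕ_) (sym ℓatG)))))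
    b∉m : ¬ b ≤ m
    b∉m z = third∉ th iy (≤t z (subst₂ _≤_ (idʳ m) (sym yq) (mul≤ ≤r (e≤ (a · t))
        (trans (cong ℓ (sym yq)) (trans ly (cong (ℓ m +ℕ_) (sym ℓat)))))))
    utG : UpL t G
    utG = mG τ Kt
    uatG : UpL a (t · G)
    uatG = trans ℓatG (cong suc (sym utG))
    bad₃ : DnL a (b · G) × (a · t ≡ t · a ⊎ DnL t (a · (b · G))) → ⊥
    bad₃ (_ , alt) = [ nc , (λ z → t∉abG (dn⇒≤ τ z)) ]′ alt
    bad₂ : DnL a (b · (t · G)) → DnL b G × (b · t ≡ t · b ⊎ DnL t (b · G)) → ⊥
    bad₂ da (_ , inj₂ z) = t∉bG (dn⇒≤ τ z)
    bad₂ da (_ , inj₁ q) = bad₃ (DD a-S τ a≢t (new-up τ t∉bG)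
      (subst (DnL a) (trans (sym (assoc b t G)) (trans (cong (_· G) q) (assoc t b G))) da))
    bad₁ : DnL b (t · G) × (b · a ≡ a · b ⊎ DnL a (b · (t · G))) → ⊥
    bad₁ (_ , inj₁ q) = nab (sym q)
    bad₁ (db , inj₂ da) = bad₂ da (DD β τ b≢t utG db)

  lostG : ∀ {b} → Third b → ¬ a · b ≡ b · a → ∀ G → Supp2 a b G → UpL a G → ¬ G ≡ e → x · G ≤ w →
          Lost l (x · G) × (∀ {k} → S k → DnL k (x · G) → k ≡ l) × ∃ λ k → K k × M (x · G) ≡ k · (x · G)
  lostG {b} th nab = λ G → go (ℓ G) G refl
    where
    β = proj₁ th
    b≢a = proj₁ (proj₂ th)
    b≢t = proj₂ (proj₂ th)
    Res : W → Set
    Res G = Lost l (x · G) × (∀ {k} → S k → DnL k (x · G) → k ≡ l) × ∃ λ k → K k × M (x · G) ≡ k · (x · G)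
    module _ (G : W) (iG : Supp2 a b G) (ua : UpL a G) where
      mG : MinL G
      mG {k} κ (inj₁ refl) = ua
      mG {k} κ (inj₂ refl) = new-up τ λ z → [ t≢a , (λ q → b≢t (sym q)) ]′ (iG τ z)
      isb : ∀ {k} → S k → ¬ K k → k ≤ x · G → k ≡ b
      isb κ nk p = [ (λ z → ⊥-elim (nk (ix κ z))) , (λ z → [ (λ q → ⊥-elim (nk (inj₁ q))) , (λ q → q) ]′ (iG κ z)) ]′
          (supp-· x G κ p)
      onl : ∀ {k} → S k → DnL k (x · G) → k ≡ l
      onl = only-l-· mG λ {k} κ nk dk → no-desc th nab ix x≡ ℓx iG mG (subst (λ z → DnL z (x · G)) (isb κ nk (dn⇒≤ κ dk)) dk)
      finish : (L : Lost l (x · G)) → ¬ M (x · G) ≡ b · (x · G) → Res G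
      finish L nb = L , onl , fin (all-lost (up L) (λ {k} κ d → subst (λ z → UpL z (M (x · G))) (sym (onl κ d)) (gone L)))
        where
        fin : (∃ λ k → S k × UpL k (x · G) × M (x · G) ≡ k · (x · G)) → ∃ λ k → K k × M (x · G) ≡ k · (x · G)
        fin (k , κ , uk , q) = isK (K? k)
          where
          isK : Dec (K k) → ∃ λ k → K k × M (x · G) ≡ k · (x · G)
          isK (yes Kk) = k , Kk , q
          isK (no nk) = ⊥-elim (nb (subst (λ z → M (x · G) ≡ z · (x · G)) kb q))
            where
            kb : k ≡ b
            kb = [ (λ z → ⊥-elim (nk (inj₁ z))) , isb κ nk ]′
                (M-supp κ (proj₁ (up L)) (subst (k ≤_) (sym q) (dn⇒≤ κ (up⇒dn κ uk))))
    go : ∀ n G → ℓ G ≡ n → Supp2 a b G → UpL a G → ¬ G ≡ e → x · G ≤ w → Res G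
    go zero G q iG ua ne p = ⊥-elim (ne (ℓ0 q))
    go (suc n) G q iG ua ne p = step (descR G ne)
      where
      step : (∃ λ g → S g × DnR G g) → Res G
      step (g , γ , dg) = split? (G' ≟ e)
        where
        G' = G · g
        G≡ : G ≡ G' · g
        G≡ = sym (scR G γ)
        G'≤ : G' ≤ G
        G'≤ = dn≤R γ dg
        split? : Dec (G' ≡ e) → Res G
        split? (yes z) = finish G iG ua (subst (λ z → Lost l (x · z)) (sym Gb) (lost-right th (subst (λ z → x · z ≤ w) Gb p)))
            λ q → bad (subst (λ z → M (x · z) ≡ b · (x · z)) Gb q)
          where
          Gg : G ≡ g
          Gg = trans G≡ (trans (cong (_· g) z) (idˡ g))
          Gb : G ≡ b
          Gb = trans Gg ([ (λ ga → ⊥-elim (dnup (dn-self a-S) (subst (UpL a) (trans Gg ga) ua))) , (λ gb → gb) ]′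
              (iG γ (Basics.dn⇒≤ (op Y) γ dg)))
          ub : UpR x b
          ub = R.new-up β (third∉ th ix)
          bad : ¬ M (x · b) ≡ b · (x · b)
          bad q = ℕₚ.<-irrefl refl (ℕₚ.≤-trans (ℕₚ.≤-reflexive (sym (proj₂ (proj₂ Ux)))) (≤ℓ
            (Basics.peel (op Y) β (peel β (subst (M x ≤_) q (proj₁ (up-step Ux (upR β ub , ub)
              (up (lost-right th (subst (λ z → x · z ≤ w) Gb p)))))) (new-up β (third∉ th iMx))) (R.new-up β (third∉ th iMx)))))
        split? (no ne') = next (go n G' (ℕₚ.suc-injective (trans (sym dg) q)) iG' ua' ne' (≤t (mul≤ ≤r G'≤ ℓxG) p))
          where
          iG' : Supp2 a b G'
          iG' σ z = iG σ (≤t z G'≤)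
          ua' : UpL a G'
          ua' = up-right a-S γ ua dg
          mG₁ = mG G iG ua
          mG' = mG G' iG' ua'
          ℓxG : ℓ (x · G) ≡ ℓ x +ℕ ℓ G
          ℓxG = add mG₁ x ix
          ℓxG' : ℓ (x · G') ≡ ℓ x +ℕ ℓ G'
          ℓxG' = add mG' x ix
          next : Res G' → Res G
          next (L' , onl' , k , Kk , Mq) = finish G iG ua LG notb
            where
            κ = Sof Kk
            assoc₀ : ∀ z → l · (x₀ · z) ≡ x · z
            assoc₀ z = trans (sym (assoc l x₀ z)) (cong (_· z) lx₀)
            U₀' : Up (x₀ · G')
            U₀' = subst Up (trans (cong (l ·_) (sym (assoc₀ G'))) (sc (x₀ · G') λ')) (upb L')
            cov₀ : x₀ · G' ⋖ x₀ · G
            cov₀ = mul≤ ≤r G'≤ (add mG₁ x₀ ix₀) , trans (add mG₁ x₀ ix₀)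
                (trans (cong (ℓ x₀ +ℕ_) dg) (trans (ℕₚ.+-suc _ _) (cong suc (sym (add mG' x₀ ix₀)))))
            ul' : UpL l (x₀ · G')
            ul' = up-h λ' Kl ix₀ mG' ulx₀
            ul₁ : UpL l (x₀ · G)
            ul₁ = up-h λ' Kl ix₀ mG₁ ulx₀
            x₀G≤ : x₀ · G ≤ w
            x₀G≤ = ≤t (subst (x₀ · G ≤_) (assoc₀ G) (upL λ' ul₁)) p
            M₀≢ : ¬ M (x₀ · G') ≡ x₀ · G
            -- This is why the letter k in {a,t} is carried through the induction: equality would
            -- put x₀·G below k·x·G', and projecting to cosets of ⟨a,t⟩ would give G ≤ G'.
            M₀≢ q = ℕₚ.<-irrefl refl (ℕₚ.≤-trans (ℕₚ.≤-reflexive (sym dg)) (≤ℓ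
              (proj≤ ix₀ mG₁ (In-cons κ Kk ix) (subst₂ _≤_ q (trans Mq (sym (assoc k x G')))
                (proj₁ (up-step U₀' (subst (x₀ · G' ⋖_) (assoc₀ G') (⋖up λ' ul')) (up L')))))))
            LG : Lost l (x · G)
            LG = subst (Lost l) (assoc₀ G) (propagate (subst (Lost l) (sym (assoc₀ G')) L') ul' cov₀
                   (proj₁ (up-next U₀' cov₀ x₀G≤ M₀≢)) ul₁ (subst (_≤ w) (sym (assoc₀ G)) p))
            covx : x · G' ⋖ x · G
            covx = mul≤ ≤r G'≤ ℓxG , trans ℓxG (trans (cong (ℓ x +ℕ_) dg) (trans (ℕₚ.+-suc _ _) (cong suc (sym ℓxG'))))
            ukx : UpL k x
            ukx = ¬dn⇒up κ λ z → dnup (prefix-dn x G' κ ℓxG' z) (trans (cong ℓ (sym Mq)) (proj₂ (proj₂ (up L'))))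
            ikx : In (k · x)
            ikx = In-cons κ Kk ix
            ℓkx : ℓ (k · x) ≡ ℓ (k · m₂) +ℕ 2
            ℓkx = ℕₚ.≤-antisym (ℕₚ.≤-trans (ℕₚ.≤-reflexive (cong ℓ kx≡))
                (ℕₚ.≤-trans (ℓ-sub (k · m₂) (a · t)) (ℕₚ.≤-reflexive (cong (ℓ (k · m₂) +ℕ_) ℓat))))
              (ℕₚ.≤-trans (ℕₚ.+-monoˡ-≤ 2 (ℓ≤suc m₂ κ)) (ℕₚ.≤-reflexive (trans (cong suc (sym ℓx)) (sym ukx))))
              where
              kx≡ : k · x ≡ (k · m₂) · (a · t)
              kx≡ = trans (cong (k ·_) x≡) (sym (assoc k m₂ (a · t)))
            ub : UpL b (k · (x · G'))
            ub = ¬dn⇒up β λ z → no-desc th nab ikx (trans (cong (k ·_) x≡) (sym (assoc k m₂ (a · t)))) ℓkx iG' mG'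
                   (subst (DnL b) (sym (assoc k x G')) z)
            notb : ¬ M (x · G) ≡ b · (x · G)
            notb q = ℕₚ.<-irrefl (cong ℓ (sym GG')) (ℕₚ.≤-reflexive (sym dg))
              where
              eq : k · (x · G') ≡ x · G
              eq = ≤ℓ≡ (peel β (subst₂ _≤_ Mq q (proj₁ (up-step (up L') covx (up LG)))) ub)
                     (trans (cong ℓ (sym Mq)) (trans (proj₂ (proj₂ (up L'))) (sym (proj₂ covx))))
              GG' : G ≡ G'
              GG' = uniq (In-· ikx (inv x) (In-inv x ix)) mG' mG₁
                (trans (trans (sym (idˡ G)) (trans (cong (_· G) (sym (invˡ x))) (assoc _ _ _)))
                  (trans (cong (inv x ·_) (trans (sym eq) (sym (assoc k x G')))) (sym (assoc _ _ _))))

-- Elements all of whose descents fail to commute with M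

module BadCore (Y : Sys) (w : Sys.W Y) (M : Sys.W Y → Sys.W Y) (sp : Special Y w M)
           (t : Sys.W Y) (T : Two.TR Y w M sp t) (B : Two.BadR Y w M sp t)
           (c : Sys.W Y) (c≤w : Sys._≤_ Y c w)
           (allup : ∀ {u} → Match.Up Y w M sp u → Sys._≤_ Y u c)
           (coreL : ∀ {s} → Sys.S Y s → Basics.DnL Y s c → ¬ Match.Comm Y w M sp s)
           (coreR : ∀ {s} → Sys.S Y s → Basics.DnR Y c s → ¬ Match.Comm (op Y) w M (opS sp) s) where
  open Sys Y
  open Products Y
  open Descents Y
  open Coatoms Y
  open Factor Y
  open Two Y w M sp
  open Bad Y w M sp t T B

  kindOf : ∀ {b} → Third b → b ≤ w → (a · b ≡ b · a) ⊎ TR b ⊎ TL b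
  kindOf {b} (β , b≢a , _) p = go ((a · b) ≟ (b · a))
    where
    go : Dec (a · b ≡ b · a) → _
    go (yes q) = inj₁ q
    go (no n) = [ (λ q → inj₂ (inj₁ (β , p , b≢a , q , λ z → n (sym z)))) ,
        (λ q → inj₂ (inj₂ (β , p , b≢a , q , n))) ]′ (letter β p b≢a)

  -- By `ord` one of the two minimal bad elements can be extended, below w, by the other letter,
  -- which `TR-after` forbids.
  unique-bad : ∀ {b} → Third b → TR b → BadR b → ⊥
  unique-bad {b} th@(β , b≢a , b≢t) Tb Bb =
    [ TR-after th Tb , B'.TR-after (τ , t≢a , λ z → b≢t (sym z)) T ]′
      (ord w (proj₁ Ux) (proj₁ B'.Ux) x≢e (λ κ d → only-t κ d) (λ κ d → B'.only-t κ d))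
    where
    module B' = Bad Y w M sp b Tb Bb

  TR-good : ∀ {b} → Third b → TR b → Good b
  TR-good th Tb = [ (λ g → g) , (λ Bb → ⊥-elim (unique-bad th Tb Bb)) ]′ (good-or-bad (proj₁ th) (proj₁ (proj₂ th)))

  -- A third letter that commutes with a or is of right type is good, hence commutes with M and
  -- cannot be a descent of c by `coreL`. One of left type would put k·x below w, because x ≤ c.
  DLK : ∀ {k} → S k → DnL k c → K k
  DLK {k} κ dk = go (K? k)
    where
    go : Dec (K k) → K k
    go (yes Kk) = Kk
    go (no n) = ⊥-elim ([ (λ q → coreL κ dk (Good⇒Comm κ (proj₁ (proj₂ th)) (C-good κ k≤w (proj₁ (proj₂ th)) q)))
                        , [ (λ Tk → coreL κ dk (Good⇒Comm κ (proj₁ (proj₂ th)) (TR-good th Tk)))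
                          , (λ Tk → TL-before-x th Tk (≤t (star κ (allup Ux) dk) c≤w)) ]′ ]′ (kindOf th k≤w))
      where
      th : Third k
      th = κ , (λ q → n (inj₁ q)) , (λ q → n (inj₂ q))
      k≤w = ≤t (dn⇒≤ κ dk) c≤w

  private
    spc = decomp c

  d h : W
  d = Split.d spc
  h = Split.h spc

  iD : In d
  iD = Split.inD spc

  mH : MinL h
  mH = Split.minH spc

  c≡ : c ≡ d · h
  c≡ = Split.eq spc

  ℓc : ℓ c ≡ ℓ d +ℕ ℓ h
  ℓc = Split.len spc

  ℓdh : ℓ (d · h) ≡ ℓ d +ℕ ℓ h
  ℓdh = trans (cong ℓ (sym c≡)) ℓc

  h≤c : h ≤ c
  h≤c = subst₂ _≤_ (idˡ h) (sym c≡) (mul≤ (e≤ d) ≤r ℓdh)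

  third-h : ∀ {b} → S b → DnL b h → Third b
  third-h β dh = β , (λ { refl → dnup dh (mH a-S Ka) }) , (λ { refl → dnup dh (mH τ Kt) })

  pre : ∀ n {p y} → ℓ p ≡ n → In p → In y → ℓ p ≤ℕ ℓ y → (p ≡ e ⊎ ∃ λ k → K k × DnL k p × DnL k y) →
        ∃ λ u → y ≡ p · u × ℓ y ≡ ℓ p +ℕ ℓ u
  pre n {p} {y} q i j le (inj₁ refl) = y , sym (idˡ y) , cong (_+ℕ ℓ y) (sym ℓe)
  pre zero q i j le (inj₂ (k , Kk , dp , dy)) = ⊥-elim (ℕₚ.1+n≢0 (trans (sym dp) q))
  pre (suc n) {p} {y} q i j le (inj₂ (k , Kk , dp , dy)) = wrap (pre n (ℕₚ.suc-injective (trans (sym dp) q)) i' j'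
      (ℕₚ.≤-pred (subst₂ _≤ℕ_ dp dy le)) (next ((k · p) ≟ e)))
    where
    κ = Sof Kk
    i' : In (k · p)
    i' = In-≤ (dn≤ κ dp) i
    j' : In (k · y)
    j' = In-≤ (dn≤ κ dy) j
    next : Dec (k · p ≡ e) → k · p ≡ e ⊎ ∃ λ k' → K k' × DnL k' (k · p) × DnL k' (k · y)
    next (yes z) = inj₁ z
    next (no z) = inj₂ (proj₁ (other Kk) , Ko , firstOther i' z Kk Ko k≢o (dn⇒up κ dp)
                       , firstOther j' (λ r → z (ℓ0 (ℕₚ.n≤0⇒n≡0
                           (ℕₚ.≤-trans (ℕₚ.≤-pred (subst₂ _≤ℕ_ dp dy le))
                               (ℕₚ.≤-reflexive (trans (cong ℓ r) ℓe)))))) Kk Ko k≢o (dn⇒up κ dy))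
      where
      Ko = proj₁ (proj₂ (other Kk))
      k≢o = proj₁ (proj₂ (proj₂ (other Kk)))
    wrap : (∃ λ u → k · y ≡ (k · p) · u × ℓ (k · y) ≡ ℓ (k · p) +ℕ ℓ u) → ∃ λ u → y ≡ p · u × ℓ y ≡ ℓ p +ℕ ℓ u
    wrap (u , r , l') = u , canL k (trans r (assoc k p u)) , trans dy (trans (cong suc l') (cong (_+ℕ ℓ u) (sym dp)))

  private
    oth = other Kl

  o : W
  o = proj₁ oth

  Ko : K o
  Ko = proj₁ (proj₂ oth)

  l≢o : ¬ l ≡ o
  l≢o = proj₁ (proj₂ (proj₂ oth))

  ω : S o
  ω = Sof Ko

  ncK : ∀ {k k'} → K k → K k' → ¬ k ≡ k' → ¬ k · k' ≡ k' · k
  ncK (inj₁ refl) (inj₁ refl) n = ⊥-elim (n refl)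
  ncK (inj₁ refl) (inj₂ refl) n = nc
  ncK (inj₂ refl) (inj₁ refl) n q = nc (sym q)
  ncK (inj₂ refl) (inj₂ refl) n = ⊥-elim (n refl)

  supp-lo : ∀ {u} → In u → Supp2 l o u
  supp-lo i {b} β p = go (b ≟ l)
    where
    go : Dec (b ≡ l) → b ≡ l ⊎ b ≡ o
    go (yes q) = inj₁ q
    go (no n) = inj₂ (third Kl Ko (i β p) l≢o n)

  a∈lo : a ≡ l ⊎ a ≡ o
  a∈lo = supp-lo In-a a-S ≤r
    where
    In-a : In a
    In-a = In-S a-S Ka

  -- Commuting with both a and t, the letter b would pass through d and become a left descent of c
  -- outside {a,t}, against `DLK`.
  stuck₀ : ∀ {b} → S b → DnL b h → ¬ (∀ {k} → K k → b · k ≡ k · b)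
  stuck₀ {b} β db f = [ proj₁ (proj₂ th) , proj₂ (proj₂ th) ]′
      (DLK β (lt⇒dn c β (ℕₚ.≤-trans (s≤s (ℕₚ.≤-trans (ℕₚ.≤-reflexive (cong ℓ eq)) (ℓ-sub d (b · h))))
        (ℕₚ.≤-reflexive (trans (sym (ℕₚ.+-suc (ℓ d) _)) (trans (cong (ℓ d +ℕ_) (sym db)) (sym ℓc)))))))
    where
    th = third-h β db
    eq : b · c ≡ d · (b · h)
    eq = trans (cong (b ·_) c≡) (trans (sym (assoc b d h)) (trans (cong (_· h) (comm-all d λ σ p → f (iD σ p))) (assoc d b h)))

  -- Insertion of a third letter c₀ which commutes with M on the left and starts h.
  module Sub (c₀ : W) (γ₀ : S c₀) (dc₀ : DnL c₀ h) (G₀ : Good c₀) (tr : a · c₀ ≡ c₀ · a ⊎ TR c₀) (x≰d : ¬ x ≤ d) where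
    th₀ : Third c₀
    th₀ = third-h γ₀ dc₀

    com₀ : Comm c₀
    com₀ = Good⇒Comm γ₀ (proj₁ (proj₂ th₀)) G₀

    ¬K₀ : ¬ K c₀
    ¬K₀ = [ proj₁ (proj₂ th₀) , proj₂ (proj₂ th₀) ]′

    stuck : ¬ (∀ {k} → K k → c₀ · k ≡ k · c₀)
    stuck = stuck₀ γ₀ dc₀

    stuck2 : ∀ {g g'} → K g → K g' → ¬ g ≡ g' → c₀ · g ≡ g · c₀ → ¬ c₀ · g' ≡ g' · c₀
    stuck2 {g} {g'} Kg Kg' n q q' = stuck λ {k} Kk → cases (k ≟ g) Kk
      where
      cases : ∀ {k} → Dec (k ≡ g) → K k → c₀ · k ≡ k · c₀
      cases (yes refl) _ = q
      cases (no m) Kk with third Kg Kg' Kk n m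
      ... | refl = q'

    -- A factorisation of c in which c₀ starts H and does not commute with the last letter of D. At
    -- most one letter has to be moved from d into H, since c₀ cannot commute with both a and t.
    record Cut : Set where
      field
        D H : W
        iD' : In D
        D≤d : D ≤ d
        eqc : c ≡ D · H
        lenc : ℓ c ≡ ℓ D +ℕ ℓ H
        dcH : DnL c₀ H
        lastnc : ∀ {k} → S k → DnR D k → ¬ c₀ · k ≡ k · c₀

    cut : Cut
    cut = go (dec Ka) (dec Kt)
      where
      Bad? : W → Set
      Bad? g = DnR d g × c₀ · g ≡ g · c₀
      dec : ∀ {g} → K g → Dec (Bad? g)
      dec {g} _ with ℓ d ℕₚ.≟ suc (ℓ (d · g)) | (c₀ · g) ≟ (g · c₀)
      ... | yes p | yes q = yes (p , q)
      ... | no p | _ = no λ z → p (proj₁ z)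
      ... | _ | no q = no λ z → q (proj₂ z)
      slide : ∀ {g} → K g → Bad? g → Cut
      slide {g} Kg (dg , cg) = record
        { D = d · g ; H = g · h ; iD' = In-≤ dg≤ iD ; D≤d = dg≤
        ; eqc = trans c≡ (trans (cong (_· h) (sym (scR d γ))) (assoc (d · g) g h))
        ; lenc = trans ℓc (trans (cong (_+ℕ ℓ h) dg) (trans (sym (ℕₚ.+-suc (ℓ (d · g)) (ℓ h)))
            (cong (ℓ (d · g) +ℕ_) (sym (mH γ Kg)))))
        ; dcH = lt⇒dn (g · h) γ₀ (ℕₚ.≤-trans (s≤s (ℕₚ.≤-trans
            (ℕₚ.≤-reflexive (cong ℓ (trans (sym (assoc c₀ g h)) (trans (cong (_· h) cg) (assoc g c₀ h)))))
                   (ℓ≤suc (c₀ · h) γ))) (ℕₚ.≤-reflexive (trans (cong suc (sym dc₀)) (sym (mH γ Kg)))))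
        ; lastnc = λ {k} κ dk → stuck2 Kg (In-≤ dg≤ iD κ (Basics.dn⇒≤ (op Y) κ dk))
                     (λ { refl → ¬Rdnup dk (Basics.dn⇒up (op Y) γ dg) }) cg }
        where
        γ = Sof Kg
        dg≤ : d · g ≤ d
        dg≤ = dn≤R γ dg
      go : Dec (Bad? a) → Dec (Bad? t) → Cut
      go (yes z) _ = slide Ka z
      go (no _) (yes z) = slide Kt z
      go (no na) (no nt) = record { D = d ; H = h ; iD' = iD ; D≤d = ≤r ; eqc = c≡ ; lenc = ℓc ; dcH = dc₀
        ; lastnc = λ {k} κ dk q → [ (λ { refl → na (dk , q) }) , (λ { refl → nt (dk , q) }) ]′ (iD κ (Basics.dn⇒≤ (op Y) κ dk)) }

    open Cut cut

    ℓDH : ℓ (D · H) ≡ ℓ D +ℕ ℓ H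
    ℓDH = trans (cong ℓ (sym eqc)) lenc

    D≢e : ¬ D ≡ e
    D≢e p = ¬K₀ (DLK γ₀ (subst (DnL c₀) (sym (trans eqc (trans (cong (_· H) p) (idˡ H)))) dcH))

    -- If u₁ is the single letter l, `star-lemma` applies. Otherwise c₀ moves past at most one
    -- letter of u₂ before it meets one with which it does not commute, where `inside` applies; if
    -- u₂ ends first, then x·c₀ ≤ w and the type of c₀ decides.
    contra₁ : ∀ {u₁ u₂} → x ≡ u₁ · u₂ → ℓ x ≡ ℓ u₁ +ℕ ℓ u₂ → ¬ u₁ ≡ e → ¬ u₂ ≡ e → u₁ · (c₀ · u₂) ≤ w →
              (u₁ ≡ l → ¬ c₀ · l ≡ l · c₀) → ⊥
    contra₁ {u₁} {u₂} xq lx u₁≢e u₂≢e q≤ lnc = go (m ≟ e)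
      where
      ℓxu : ℓ (u₁ · u₂) ≡ ℓ u₁ +ℕ ℓ u₂
      ℓxu = trans (cong ℓ (sym xq)) lx
      iu₁ : In u₁
      iu₁ = In-≤ (subst₂ _≤_ (idʳ u₁) (sym xq) (mul≤ ≤r (e≤ u₂) ℓxu)) ix
      iu₂ : In u₂
      iu₂ = In-≤ (subst₂ _≤_ (idˡ u₂) (sym xq) (mul≤ (e≤ u₁) ≤r ℓxu)) ix
      dl₁ : DnL l u₁
      dl₁ = at-l (first iu₁ u₁≢e)
        where
        at-l : (∃ λ k → K k × DnL k u₁) → DnL l u₁
        at-l (k , Kk , dk) = subst (λ z → DnL z u₁) (only-l (Sof Kk)
            (subst (DnL k) (sym xq) (prefix-dn u₁ u₂ (Sof Kk) ℓxu dk))) dk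
      m = l · u₁
      u₁≡ : u₁ ≡ l · m
      u₁≡ = sym (sc u₁ λ')
      x₀≡ : m · u₂ ≡ x₀
      x₀≡ = trans (assoc l u₁ u₂) (cong (l ·_) (sym xq))
      ℓx₀ : ℓ x₀ ≡ ℓ m +ℕ ℓ u₂
      ℓx₀ = ℕₚ.suc-injective (trans (sym dlx) (trans lx (cong (_+ℕ ℓ u₂) dl₁)))
      q≡ : ∀ z → u₁ · z ≡ l · (m · z)
      q≡ z = trans (cong (_· z) u₁≡) (assoc l m z)
      go : Dec (m ≡ e) → ⊥
      go (yes me) = star-lemma ω l≢o (ncK Kl Ko l≢o) a∈lo (subst (Lost l) (sym lx₀) lostx) ulx₀
          (supp-lo (λ {s} → subst In (sym lx₀) ix {s})) x₀≢e γ₀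
          (λ { refl → ¬K₀ Kl }) (λ { refl → ¬K₀ Ko }) com₀ (λ z → lnc u₁l (sym z))
          (subst (_≤ w) (cong₂ _·_ u₁l (cong (c₀ ·_) (trans (trans (sym (idˡ u₂)) (cong (_· u₂) (sym me))) x₀≡))) q≤)
        where
        u₁l : u₁ ≡ l
        u₁l = trans u₁≡ (trans (cong (l ·_) me) (idʳ l))
      go (no me) = at-g (first iu₂ u₂≢e)
        where
        at-g : (∃ λ g → K g × DnL g u₂) → ⊥
        at-g (g , Kg , dg) = commute? ((c₀ · g) ≟ (g · c₀))
          where
          γ = Sof Kg
          u₃ = g · u₂
          u₂≡ : u₂ ≡ g · u₃
          u₂≡ = sym (sc u₂ γ)
          commute? : Dec (c₀ · g ≡ g · c₀) → ⊥
          commute? (no n) = inside th₀ Kg x₀≡ ℓx₀ me dg n (subst (_≤ w) (q≡ (c₀ · u₂)) q≤)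
          commute? (yes cg) = end? (u₃ ≟ e)
            where
            shift : c₀ · u₂ ≡ g · (c₀ · u₃)
            shift = trans (cong (c₀ ·_) u₂≡) (trans (sym (assoc c₀ g u₃)) (trans (cong (_· u₃) cg) (assoc g c₀ u₃)))
            g' = proj₁ (other Kg)
            Kg' : K g'
            Kg' = proj₁ (proj₂ (other Kg))
            g≢g' = proj₁ (proj₂ (proj₂ (other Kg)))
            end? : Dec (u₃ ≡ e) → ⊥
            end? (no u₃≢e) = inside th₀ Kg' mg≡ ℓmg (λ z → ℕₚ.1+n≢0 (trans (sym ℓmg') (trans (cong ℓ z) ℓe)))
                (firstOther (In-≤ (dn≤ γ dg) iu₂) u₃≢e Kg Kg' g≢g' (dn⇒up γ dg)) (stuck2 Kg Kg' g≢g' cg)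
                (subst (_≤ w) (trans (q≡ (c₀ · u₂)) (cong (l ·_) (trans (cong (m ·_) shift) (sym (assoc m g (c₀ · u₃)))))) q≤)
              where
              mg≡ : (m · g) · u₃ ≡ x₀
              mg≡ = trans (assoc m g u₃) (trans (cong (m ·_) (sym u₂≡)) x₀≡)
              ℓx₀' : ℓ x₀ ≡ suc (ℓ m) +ℕ ℓ u₃
              ℓx₀' = trans ℓx₀ (trans (cong (ℓ m +ℕ_) dg) (ℕₚ.+-suc _ _))
              ℓmg' : ℓ (m · g) ≡ suc (ℓ m)
              ℓmg' = ℕₚ.≤-antisym (ℕₚ.≤-trans (ℓ-sub m g) (ℕₚ.≤-reflexive (trans (cong (ℓ m +ℕ_) (ℓS γ)) (ℕₚ.+-comm _ 1))))
                (ℕₚ.+-cancelʳ-≤ (ℓ u₃) _ _ (ℕₚ.≤-trans (ℕₚ.≤-reflexive (trans (sym ℓx₀') (cong ℓ (sym mg≡)))) (ℓ-sub (m · g) u₃)))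
              ℓmg : ℓ x₀ ≡ ℓ (m · g) +ℕ ℓ u₃
              ℓmg = trans ℓx₀' (cong (_+ℕ ℓ u₃) (sym ℓmg'))
            end? (yes u₃e) = tail tr
              where
              u₂g : u₂ ≡ g
              u₂g = trans u₂≡ (trans (cong (g ·_) u₃e) (idʳ g))
              g≡t : g ≡ t
              g≡t = only-t γ (subst (λ z → DnR z g) (sym (trans xq (cong (u₁ ·_) u₂g)))
                     (trans (cong ℓ (sym (trans xq (cong (u₁ ·_) u₂g))))
                         (trans lx (trans (cong (ℓ u₁ +ℕ_) (trans (cong ℓ u₂g) (ℓS γ)))
                       (trans (ℕₚ.+-comm _ 1) (cong suc (cong ℓ (sym (scR u₁ γ)))))))))
              xc₀ : x · c₀ ≤ w
              xc₀ = subst (_≤ w) (trans (cong (u₁ ·_) (trans (cong (c₀ ·_) u₂g) cg))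
                      (trans (sym (assoc u₁ g c₀)) (cong (_· c₀) (trans (cong (u₁ ·_) (sym u₂g)) (sym xq))))) q≤
              tail : a · c₀ ≡ c₀ · a ⊎ TR c₀ → ⊥
              tail (inj₁ ac) = stuck2 Kt Ka t≢a (subst (λ z → c₀ · z ≡ z · c₀) g≡t cg) (sym ac)
              tail (inj₂ Tc) = TR-after th₀ Tc xc₀

    -- c = o·H with o a left descent of c destroyed by M somewhere
    front : D ≡ o → ⊥
    front Do = [ coreL ω doc , wit ]′ (comm? o ω)
      where
      cH : c ≡ o · H
      cH = trans eqc (cong (_· H) Do)
      doc : DnL o c
      doc = subst (DnL o) (sym eqc) (prefix-dn D H ω ℓDH (subst (DnL o) (sym Do) (dn-self ω)))
      onc : ¬ c₀ · o ≡ o · c₀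
      onc = lastnc ω (subst (λ z → DnR z o) (sym Do) (R.dn-self ω))
      wit : Witness o → ⊥
      wit (r , q , ρ , o≢r , ain , i , L) = star-lemma ρ o≢r nor ain (subst (Lost o) (sym oq) L) uxo
          (λ β p → i β (subst (_ ≤_) oq p)) xo≢e γ₀
          (λ { refl → ¬K₀ Ko }) c₀≢r com₀ (λ z → onc (sym z)) bound
        where
        xo = o · q
        oq : o · xo ≡ q
        oq = sc q ω
        uxo : UpL o xo
        uxo = dn⇒up ω (dn L)
        xo≢e : ¬ xo ≡ e
        xo≢e z = single Ko
          where
          q≡o : q ≡ o
          q≡o = trans (sym oq) (trans (cong (o ·_) z) (idʳ o))
          single : K o → ⊥
          single (inj₁ oa) = up-down (up L) (subst Down (sym (trans q≡o oa)) (M-up e-up))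
          single (inj₂ ot) = dnup (subst (DnL o) (sym (trans (cong M (trans q≡o ot))
              (trans (proj₁ (proj₂ (proj₂ (proj₂ T)))) (cong (_· a) (sym ot)))))
                (up⇒dn ω (upS ω a-S (λ z → a≢t (trans (sym z) ot))))) (gone L)
        r≤q : r ≤ q
        r≤q = at-r (descL xo xo≢e)
          where
          at-r : (∃ λ k → S k × DnL k xo) → r ≤ q
          at-r (k , κ , dk) = [ (λ { refl → ⊥-elim (dnup dk uxo) }) , (λ { refl → ≤t (dn⇒≤ κ dk) (dn≤ ω (dn L)) }) ]′
                                (i κ (≤t (dn⇒≤ κ dk) (dn≤ ω (dn L))))
        r≤w = ≤t r≤q (proj₁ (up L))
        r≢a-case : o ≡ a → ¬ Good r
        r≢a-case oa Gr = good-kept Gr (λ β p → subst (λ z → _ ≡ z ⊎ _ ≡ r) oa (i β p)) L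
        r≢a : o ≡ a → ¬ r ≡ a
        r≢a oa z = o≢r (trans oa (sym z))
        r≡a : o ≡ t → a ≡ r
        r≡a ot = [ (λ z → ⊥-elim (a≢t (trans z ot))) , (λ z → z) ]′ ain
        nor : ¬ o · r ≡ r · o
        nor q' = cases Ko
          where
          cases : K o → ⊥
          cases (inj₁ oa) = r≢a-case oa (C-good ρ r≤w (r≢a oa) (subst (λ z → z · r ≡ r · z) oa q'))
          cases (inj₂ ot) = nc (sym (subst₂ (λ y z → y · z ≡ z · y) ot (sym (r≡a ot)) q'))
        c₀≢r : ¬ c₀ ≡ r
        c₀≢r z = cases Ko
          where
          cases : K o → ⊥
          cases (inj₁ oa) = r≢a-case oa (subst Good z G₀)
          cases (inj₂ ot) = proj₁ (proj₂ th₀) (trans z (sym (r≡a ot)))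
        bound : o · (c₀ · xo) ≤ w
        bound = ≤t (star ω (≤t (star γ₀ (peel ω (subst (xo ≤_) cH (allup (upb L))) uxo) dcH) H≤c) doc) c≤w
          where
          H≤c : H ≤ c
          H≤c = subst₂ _≤_ (idˡ H) (sym eqc) (mul≤ (e≤ D) ≤r ℓDH)

    -- Since x is not below d, D is no longer than x. So D, or D without its first letter o, is a
    -- left factor of x in the dihedral subgroup; the complementary factor lies below H, and c₀ can
    -- be put in front of it.
    absurd : ⊥
    absurd = go (ℓ x ℕₚ.<? ℓ D)
      where
      finish : ∀ {u₁ u₂} → x ≡ u₁ · u₂ → ℓ x ≡ ℓ u₁ +ℕ ℓ u₂ → ¬ u₁ ≡ e → ¬ u₂ ≡ e → u₂ ≤ H → u₁ · H ≤ c → ℓ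
          (u₁ · H) ≡ ℓ u₁ +ℕ ℓ H →
               (u₁ ≡ l → ¬ c₀ · l ≡ l · c₀) → ⊥
      finish xq lx n₁ n₂ u₂≤ u₁H≤ ℓu₁H lnc = contra₁ xq lx n₁ n₂ (≤t (mul≤ ≤r (star γ₀ u₂≤ dcH) ℓu₁H) (≤t u₁H≤ c≤w)) lnc
      x≤DH : x ≤ D · H
      x≤DH = subst (x ≤_) eqc (allup Ux)
      case₁ : ℓ D ≤ℕ ℓ x → DnL l D → ⊥
      case₁ le dl = go₁ (pre (ℓ D) refl iD' ix le (inj₂ (l , Kl , dl , dlx)))
        where
        go₁ : (∃ λ u → x ≡ D · u × ℓ x ≡ ℓ D +ℕ ℓ u) → ⊥
        go₁ (u , xq , lx) = finish xq lx D≢e u≢e (cancel≤ D (trans (cong ℓ (sym xq)) lx) ℓDH (subst (_≤ D · H) xq x≤DH))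
            (subst (_≤ c) eqc ≤r) ℓDH (λ Dl → lastnc λ' (subst (λ z → DnR z l) (sym Dl) (R.dn-self λ')))
          where
          u≢e : ¬ u ≡ e
          u≢e z = x≰d (subst (_≤ d) (sym (trans xq (trans (cong (D ·_) z) (idʳ D)))) D≤d)
      case₂ : ℓ D ≤ℕ ℓ x → UpL l D → ⊥
      case₂ le ul = go₂ (u₁ ≟ e)
        where
        doD : DnL o D
        doD = firstOther iD' D≢e Kl Ko l≢o ul
        u₁ = o · D
        D≡ : D ≡ o · u₁
        D≡ = sym (sc D ω)
        iu₁ : In u₁
        iu₁ = In-≤ (dn≤ ω doD) iD'
        lt : ℓ u₁ < ℓ x
        lt = ℕₚ.≤-trans (ℕₚ.≤-reflexive (sym doD)) le
        uox : UpL o x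
        uox = ¬dn⇒up ω λ z → l≢o (sym (only-l ω z))
        c≡o : c ≡ o · (u₁ · H)
        c≡o = trans eqc (trans (cong (_· H) D≡) (assoc o u₁ H))
        ℓu₁H : ℓ (u₁ · H) ≡ ℓ u₁ +ℕ ℓ H
        ℓu₁H = ℕₚ.≤-antisym (ℓ-sub u₁ H) (ℕₚ.≤-pred (ℕₚ.≤-trans
            (ℕₚ.≤-reflexive (trans (cong (_+ℕ ℓ H) (sym doD)) (trans (sym lenc) (cong ℓ c≡o)))) (ℓ≤suc (u₁ · H) ω)))
        x≤ : x ≤ u₁ · H
        x≤ = peel ω (subst (x ≤_) c≡o (allup Ux)) uox
        u₁H≤ : u₁ · H ≤ c
        u₁H≤ = subst (u₁ · H ≤_) (sym c≡o) (upL ω (trans (cong ℓ (sym c≡o))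
            (trans lenc (trans (cong (_+ℕ ℓ H) doD) (cong suc (sym ℓu₁H))))))
        go₂ : Dec (u₁ ≡ e) → ⊥
        go₂ (yes z) = front (trans D≡ (trans (cong (o ·_) z) (idʳ o)))
        go₂ (no n) = go₃ (pre (ℓ u₁) refl iu₁ ix (ℕₚ.<⇒≤ lt) (inj₂ (l , Kl , dl₁ , dlx)))
          where
          dl₁ : DnL l u₁
          dl₁ = firstOther iu₁ n Ko Kl (λ q → l≢o (sym q)) (dn⇒up ω doD)
          go₃ : (∃ λ u → x ≡ u₁ · u × ℓ x ≡ ℓ u₁ +ℕ ℓ u) → ⊥
          go₃ (u , xq , lx) = finish xq lx n u≢e (cancel≤ u₁ (trans (cong ℓ (sym xq)) lx) ℓu₁H
              (subst (_≤ u₁ · H) xq x≤)) u₁H≤ ℓu₁H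
              λ ul₁ → lastnc λ' (subst (λ z → DnR z l) (sym (trans D≡ (cong (o ·_) ul₁)))
                (trans (trans (upS ω λ' (λ q → l≢o (sym q))) (cong suc (ℓS λ')))
                    (cong suc (trans (sym (ℓS ω)) (cong ℓ (sym (scR o λ')))))))
            where
            u≢e : ¬ u ≡ e
            u≢e z = ℕₚ.<-irrefl (sym (trans lx (trans (cong (ℓ u₁ +ℕ_) (trans (cong ℓ z) ℓe)) (ℕₚ.+-identityʳ _)))) lt
      go : Dec (ℓ x < ℓ D) → ⊥
      go (yes lt) = x≰d (≤t (dih2 ix iD' lt) D≤d)
      go (no n) = [ case₂ (ℕₚ.≮⇒≥ n) , case₁ (ℕₚ.≮⇒≥ n) ]′ (stepL D λ')

  -- Otherwise `Sub` leaves only letters of left type as left descents of h. Moreover t occurs in h,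
  -- because x can end only in t and could be freed of h if t did not occur there. This contradicts
  -- `no-TR-above`.
  x≤d : x ≤ d
  x≤d = go (x ≤? d)
    where
    go : Dec (x ≤ d) → x ≤ d
    go (yes p) = p
    go (no n) = ⊥-elim (no-TR-above T h (≤t h≤c c≤w) TLof t≤h)
      where
      TLof : ∀ {k} → S k → DnL k h → TL k
      TLof {k} κ dk = [ (λ ac → ⊥-elim (Sub.absurd k κ dk (C-good κ k≤w (proj₁ (proj₂ th)) ac) (inj₁ ac) n))
                      , [ (λ Tk → ⊥-elim (Sub.absurd k κ dk (TR-good th Tk) (inj₂ Tk) n)) , (λ Tk → Tk) ]′ ]′ (kindOf th k≤w)
        where
        th = third-h κ dk
        k≤w = ≤t (dn⇒≤ κ dk) (≤t h≤c c≤w)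
      t≤h : t ≤ h
      t≤h = go' (t ≤? h)
        where
        go' : Dec (t ≤ h) → t ≤ h
        go' (yes p) = p
        go' (no m) = ⊥-elim (n (peelR d h (λ {g} γ g≤ → Basics.¬dn⇒up (op Y) γ λ z → m (subst (_≤ h) (only-t γ z) g≤))
                       (subst (x ≤_) c≡ (allup Ux))))

module BadEnd (Y : Sys) (w : Sys.W Y) (M : Sys.W Y → Sys.W Y) (sp : Special Y w M)
           (t : Sys.W Y) (T : Two.TR Y w M sp t) (B : Two.BadR Y w M sp t)
           (c : Sys.W Y) (c≤w : Sys._≤_ Y c w)
           (allup : ∀ {u} → Match.Up Y w M sp u → Sys._≤_ Y u c)
           (coreL : ∀ {s} → Sys.S Y s → Basics.DnL Y s c → ¬ Match.Comm Y w M sp s)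
           (coreR : ∀ {s} → Sys.S Y s → Basics.DnR Y c s → ¬ Match.Comm (op Y) w M (opS sp) s) where
  open Sys Y
  open Products Y
  open Descents Y
  open Coatoms Y
  open Factor Y
  open Two Y w M sp
  open Bad Y w M sp t T B
  open BadG Y w M sp t T B
  open BadCore Y w M sp t T B c c≤w allup coreL coreR

  third-after : ∀ {b} → Third b → b ≤ c → x · b ≤ c
  third-after {b} th p = subst (x · b ≤_) (sym c≡) (mul≤ x≤d b≤h ℓdh)
    where
    b≤h : b ≤ h
    b≤h = [ (λ z → ⊥-elim (third∉ th iD z)) , (λ z → z) ]′ (supp-· d h (proj₁ th) (subst (b ≤_) c≡ p))

  no-TR : ∀ {b} → Third b → b ≤ c → ¬ TR b
  no-TR th p Tb = TR-after th Tb (≤t (third-after th p) c≤w)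

  -- a letter of left type at which M is not left multiplication would give a second bad letter
  no-bad-TL : ∀ {b} → Third b → TL b → ¬ Two.BadR (op Y) w M (opS sp) b
  no-bad-TL {b} th@(β , b≢a , b≢t) Tb Bb = clash (proj₁ left) (proj₁ (proj₂ left)) (proj₁ right)
    where
    module B' = Bad (op Y) w M (opS sp) b Tb Bb
    x' = B'.x
    ncb : ¬ a · b ≡ b · a
    ncb = proj₂ (proj₂ (proj₂ (proj₂ Tb)))
    minx' : MinL x'
    minx' κ (inj₁ refl) = B'.xa
    minx' κ (inj₂ refl) = new-up τ λ z → [ t≢a , (λ q → b≢t (sym q)) ]′ (B'.ix τ z)
    xx'≤ : x · x' ≤ w
    xx'≤ = ≤t (subst (x · x' ≤_) (sym c≡) (mul≤ x≤d (peelAll minx' d iD (subst (x' ≤_) c≡ (allup B'.Ux))) ℓdh)) c≤w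
    left = lostG th ncb x' B'.ix B'.xa B'.x≢e xx'≤
    right = BadG.lostG (op Y) w M (opS sp) b Tb Bb (τ , t≢a , λ z → b≢t (sym z)) (λ z → nc (sym z)) x ix xa x≢e xx'≤

  TL-good : ∀ {b} → Third b → TL b → R.Good b
  TL-good th Tb = [ (λ g → g) , (λ Bb → ⊥-elim (no-bad-TL th Tb Bb)) ]′
      (Two.good-or-bad (op Y) w M (opS sp) (proj₁ th) (proj₁ (proj₂ th)))

  DRK : ∀ {k} → S k → DnR c k → K k
  DRK {k} κ dk = go (K? k)
    where
    go : Dec (K k) → K k
    go (yes Kk) = Kk
    go (no n) = ⊥-elim ([ (λ q → coreR κ dk (R.Good⇒Comm κ k≢a (R.C-good κ k≤w k≢a (sym q))))
                        , [ no-TR th k≤c , (λ Tk → coreR κ dk (R.Good⇒Comm κ k≢a (TL-good th Tk))) ]′ ]′ (kindOf th k≤w))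
      where
      k≢a = λ q → n (inj₁ q)
      th : Third k
      th = κ , k≢a , (λ q → n (inj₂ q))
      k≤c = Basics.dn⇒≤ (op Y) κ dk
      k≤w = ≤t k≤c c≤w

  -- Cut c = g·y so that y starts with b and with no other letter. By `no-TR-above` t does not occur
  -- in y, so y and c end in a. As this descent does not commute with M, it has a witness; goodness
  -- of the other letters places it in ⟨a,t⟩, and there b stands where the mirrored `star-lemma`
  -- forbids it.
  no-TL : ∀ {b} → Third b → b ≤ c → ¬ TL b
  no-TL {b} th@(β , b≢a , b≢t) b≤c Tb = at-r (descR y y≢e)
    where
    open Para Y (λ s → ¬ s ≡ b) (λ s → ¬? (s ≟ b)) using (Split) renaming (decomp to decomp')
    s' = decomp' c
    g = Split.d s'
    y = Split.h s'
    c≡' : c ≡ g · y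
    c≡' = Split.eq s'
    ℓgy : ℓ (g · y) ≡ ℓ g +ℕ ℓ y
    ℓgy = trans (cong ℓ (sym c≡')) (Split.len s')
    b≤y : b ≤ y
    b≤y = [ (λ z → ⊥-elim (Split.inD s' β z refl)) , (λ z → z) ]′ (supp-· g y β (subst (b ≤_) c≡' b≤c))
    y≢e : ¬ y ≡ e
    y≢e q = S≢e β (≤e (subst (b ≤_) q b≤y))
    y≤c : y ≤ c
    y≤c = subst₂ _≤_ (idˡ y) (sym c≡') (mul≤ (e≤ g) ≤r ℓgy)
    isb : ∀ {k} → S k → DnL k y → k ≡ b
    isb {k} κ dk = go (k ≟ b)
      where
      go : Dec (k ≡ b) → k ≡ b
      go (yes q) = q
      go (no n) = ⊥-elim (dnup dk (Split.minH s' κ n))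
    dby : DnL b y
    dby = at (descL y y≢e)
      where
      at : (∃ λ k → S k × DnL k y) → DnL b y
      at (k , κ , dk) = subst (λ z → DnL z y) (isb κ dk) dk
    t∉y : ¬ t ≤ y
    t∉y = no-TR-above T y (≤t y≤c c≤w) (λ κ dk → subst TL (sym (isb κ dk)) Tb)
    at-r : (∃ λ r → S r × DnR y r) → ⊥
    at-r (r , ρ , dr) = [ is-a , (λ q → t∉y (subst (_≤ y) q (Basics.dn⇒≤ (op Y) ρ dr))) ]′ (DRK ρ drc)
      where
      drc : DnR c r
      drc = subst (λ z → DnR z r) (sym c≡') (suffix-dn g y ρ ℓgy dr)
      is-a : r ≡ a → ⊥
      is-a refl = [ coreR a-S drc , wit ]′ (R.comm? a a-S)
        where
        wit : R.Witness a → ⊥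
        wit (r' , q , ρ' , a≢r' , _ , i , L) = split? (r' ≟ t)
          where
          ya = q · a
          yaa : ya · a ≡ q
          yaa = scR q a-S
          Uya : Up ya
          Uya = R.upb L
          uya : UpR ya a
          uya = Basics.dn⇒up (op Y) a-S (R.dn L)
          ya≤q : ya ≤ q
          ya≤q = dn≤R a-S (R.dn L)
          ya≢e : ¬ ya ≡ e
          ya≢e z = up-down (R.up L) (subst Down (trans (sym (idˡ a)) (trans (cong (_· a) (sym z)) yaa)) (M-up e-up))
          r'≤q : r' ≤ q
          r'≤q = at (descR ya ya≢e)
            where
            at : (∃ λ k → S k × DnR ya k) → r' ≤ q
            at (k , κ , dk) = [ (λ z → ⊥-elim (¬Rdnup (subst (DnR ya) z dk) uya)) , (λ z → subst (_≤ q) z k≤) ]′ (i κ k≤)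
              where k≤ = ≤t (Basics.dn⇒≤ (op Y) κ dk) ya≤q
          split? : Dec (r' ≡ t) → ⊥
          split? (no n) = [ (λ ac → R.good-kept (R.C-good ρ' r'≤w r'≢a (sym ac)) i L)
                          , [ (λ Tr → ¬Rdnup (R.dn L) (up-R (R.up L) (TR-good th' Tr (R.up L) i)))
                            , (λ Tl → R.good-kept (TL-good th' Tl) i L) ]′ ]′ (kindOf th' r'≤w)
            where
            r'≢a : ¬ r' ≡ a
            r'≢a z = a≢r' (sym z)
            r'≤w = ≤t r'≤q (proj₁ (R.up L))
            th' : Third r'
            th' = ρ' , r'≢a , n
          split? (yes refl) = R.star-lemma τ a≢t (λ z → nc (sym z)) (inj₁ refl) (subst (R.Lost a) (sym yaa) L) uya
              (λ {k} κ p → i κ (subst (k ≤_) yaa p)) ya≢e β b≢a b≢t (R.Good⇒Comm β b≢a (TL-good th Tb))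
                  (λ z → proj₂ (proj₂ (proj₂ (proj₂ Tb))) (sym z)) bound
            where
            ya≤g : ya ≤ g
            ya≤g = peelR g y (λ {k} γ k≤ → Basics.¬dn⇒up (op Y) γ λ dk → [ (λ z → ¬Rdnup (subst (DnR ya) z dk) uya) ,
                (λ z → t∉y (subst (_≤ y) z k≤)) ]′
                     (i γ (≤t (Basics.dn⇒≤ (op Y) γ dk) ya≤q))) (subst (ya ≤_) c≡' (allup Uya))
            bound : (ya · b) · a ≤ w
            bound = subst (_≤ w) (sym (assoc ya b a)) (≤t (subst (ya · (b · a) ≤_) (sym c≡')
                      (mul≤ ya≤g (star β (Basics.dn⇒≤ (op Y) a-S dr) dby) ℓgy)) c≤w)

  allC : ∀ {b} → Third b → b ≤ c → a · b ≡ b · a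
  allC th p = [ (λ q → q) , [ (λ Tb → ⊥-elim (no-TR th p Tb)) , (λ Tb → ⊥-elim (no-TL th p Tb)) ]′ ]′ (kindOf th (≤t p c≤w))

-- Elimination of letters outside the dihedral subgroup

module BadLast (Y : Sys) (w : Sys.W Y) (M : Sys.W Y → Sys.W Y) (sp : Special Y w M)
           (t : Sys.W Y) (T : Two.TR Y w M sp t) (B : Two.BadR Y w M sp t)
           (c : Sys.W Y) (c≤w : Sys._≤_ Y c w)
           (allup : ∀ {u} → Match.Up Y w M sp u → Sys._≤_ Y u c)
           (coreL : ∀ {s} → Sys.S Y s → Basics.DnL Y s c → ¬ Match.Comm Y w M sp s)
           (coreR : ∀ {s} → Sys.S Y s → Basics.DnR Y c s → ¬ Match.Comm (op Y) w M (opS sp) s) where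
  open Sys Y
  open Products Y
  open Descents Y
  open Coatoms Y
  open Factor Y
  open Two Y w M sp
  open Bad Y w M sp t T B
  open BadG Y w M sp t T B
  open BadCore Y w M sp t T B c c≤w allup coreL coreR
  open BadEnd Y w M sp t T B c c≤w allup coreL coreR

  Mx≡ : M x ≡ o · x
  Mx≡ = dih1 Ko iMx (In-cons ω Ko ix) (trans (proj₂ (proj₂ Ux)) (sym uox))
          (firstOther iMx Mx≢e Kl Ko l≢o (gone lostx)) (up⇒dn ω uox)
    where
    uox : UpL o x
    uox = ¬dn⇒up ω λ z → l≢o (sym (only-l ω z))
    Mx≢e : ¬ M x ≡ e
    Mx≢e q = ℕₚ.1+n≢0 (trans (sym (proj₂ (proj₂ Ux))) (trans (cong ℓ q) ℓe))

  dn-iR : ∀ {u s} → S s → UpR u s → DnR (u · s) s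
  dn-iR = Basics.up⇒dn (op Y)

  module NE (h≢e : ¬ h ≡ e) where
    private
      pick = descL h h≢e

    c₀ : W
    c₀ = proj₁ pick
    γ₀ : S c₀
    γ₀ = proj₁ (proj₂ pick)
    dc₀ : DnL c₀ h
    dc₀ = proj₂ (proj₂ pick)
    th₀ : Third c₀
    th₀ = third-h γ₀ dc₀
    c₀≢a = proj₁ (proj₂ th₀)
    c₀≢t = proj₂ (proj₂ th₀)
    c₀≤c : c₀ ≤ c
    c₀≤c = ≤t (dn⇒≤ γ₀ dc₀) h≤c
    c₀≤w = ≤t c₀≤c c≤w
    ac₀ : a · c₀ ≡ c₀ · a
    ac₀ = allC th₀ c₀≤c
    com₀R : R.Comm c₀
    com₀R = R.Good⇒Comm γ₀ c₀≢a (R.C-good γ₀ c₀≤w c₀≢a (sym ac₀))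

    nct : ¬ c₀ · t ≡ t · c₀
    nct q = stuck₀ γ₀ dc₀ λ { (inj₁ refl) → sym ac₀ ; (inj₂ refl) → q }

    suffix-h : ∀ {k} → S k → DnR h k → DnR c k
    suffix-h {k} κ dk = subst (λ z → DnR z k) (sym c≡) (suffix-dn d h κ ℓdh dk)

    commA : ∀ {g} → S g → g ≤ c → ¬ g ≡ t → a · g ≡ g · a
    commA {g} γ p n = go (g ≟ a)
      where
      go : Dec (g ≡ a) → a · g ≡ g · a
      go (yes refl) = refl
      go (no m) = allC (γ , m , n) p

    -- Among the letters of c, only t fails to commute with a.
    a-first : ∀ y → y ≤ c → ¬ t ≤ y → a ≤ y → DnL a y
    a-first y p nt ay = commute-desc y a-S (λ {g} γ g≤ → commA γ (≤t g≤ p) λ { refl → nt g≤ }) ay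

    t≤h : t ≤ h
    t≤h = go (t ≤? h)
      where
      go : Dec (t ≤ h) → t ≤ h
      go (yes p) = p
      go (no n) = at (descR h h≢e)
        where
        at : (∃ λ g → S g × DnR h g) → t ≤ h
        at (g , γ , dg) = [ (λ z → ⊥-elim (dnup (a-first h h≤c n (subst (_≤ h) z (Basics.dn⇒≤ (op Y) γ dg))) (mH a-S Ka)))
                          , (λ z → subst (_≤ h) z (Basics.dn⇒≤ (op Y) γ dg)) ]′ (DRK γ (suffix-h γ dg))

    G : W
    G = c₀ · t

    G≤h : G ≤ h
    G≤h = star γ₀ t≤h dc₀

    ℓG : ℓ G ≡ 2
    ℓG = ℓ2 γ₀ τ c₀≢t

    a∉G : ¬ a ≤ G
    a∉G z = [ (λ q → c₀≢a (sym q)) , (λ z' → [ S≢e a-S , a≢t ]′ (≤s τ z')) ]′ (supp-s γ₀ a-S z)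

    uc₀t : UpL c₀ t
    uc₀t = upS γ₀ τ c₀≢t

    mG : MinL G
    mG κ (inj₁ refl) = new-up a-S a∉G
    mG κ (inj₂ refl) = ¬dn⇒up τ λ z → bad (DD τ γ₀ (λ q → c₀≢t (sym q)) uc₀t z)
      where
      bad : DnL t t × (t · c₀ ≡ c₀ · t ⊎ DnL c₀ (t · t)) → ⊥
      bad (_ , inj₁ q) = nct (sym q)
      bad (_ , inj₂ z) = ℕₚ.1+n≢0 (trans (sym z) (trans (cong ℓ (SS τ)) ℓe))

    utG : UpL t G
    utG = mG τ Kt

    third-below : ∀ {k y} → In y → S k → ¬ K k → k ≤ y · G → k ≡ c₀
    third-below {k} {y} iy κ nk p = [ (λ z → ⊥-elim (nk (iy κ z))) ,
        (λ z → [ (λ q → q) , (λ z' → ⊥-elim (nk ([ (λ q → ⊥-elim (S≢e κ q)) , inj₂ ]′ (≤s τ z')))) ]′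
                                      (supp-s γ₀ κ z)) ]′ (supp-· y G κ p)

    -- Mirrored propagation along the left descents of E, starting from c₀·t; `strip-up` keeps the
    -- shorter elements matched upwards.
    chainRc : ∀ E → In E → ℓ E ≤ℕ ℓ x → Up E → UpR E a → (E · c₀) · t ≤ w → R.Lost t ((E · c₀) · t)
    chainRc E = go (ℓ E) E refl (E ≟ e)
      where
      uct : UpR c₀ t
      uct = trans uc₀t (cong suc (trans (ℓS τ) (sym (ℓS γ₀))))
      uEct : ∀ E → In E → UpR (E · c₀) t
      uEct E i = Basics.¬dn⇒up (op Y) τ λ z → bad (Descents.DD (op Y) τ γ₀ (λ q → c₀≢t (sym q)) (R.new-up γ₀ (third∉ th₀ i)) z)
        where
        bad : DnR E t × (c₀ · t ≡ t · c₀ ⊎ DnR (E · t) c₀) → ⊥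
        bad (_ , inj₁ q) = nct q
        bad (_ , inj₂ z) = third∉ th₀ (In-· (In-S τ Kt) E i) (Basics.dn⇒≤ (op Y) γ₀ z)
      go : ∀ n E → ℓ E ≡ n → Dec (E ≡ e) → In E → ℓ E ≤ℕ ℓ x → Up E → UpR E a → (E · c₀) · t ≤ w → R.Lost t ((E · c₀) · t)
      go n E q (yes Ee) i le U ua p = subst (λ z → R.Lost t (z · t)) (trans (sym (idˡ c₀)) (cong (_· c₀) (sym Ee)))
          (R.propagate (subst (R.Lost t) (sym (idˡ t)) (R.lostTL T)) (Basics.upe (op Y) τ)
              (e≤ c₀ , trans (ℓS γ₀) (cong suc (sym ℓe)))
             (S-up γ₀ c₀≤w c₀≢a) uct (subst (λ z → z · t ≤ w) (trans (cong (_· c₀) Ee) (idˡ c₀)) p))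
      go zero E q (no ne) i le U ua p = ⊥-elim (ne (ℓ0 q))
      go (suc n) E q (no ne) i le U ua p = at (first i ne)
        where
        at : (∃ λ k → K k × DnL k E) → R.Lost t ((E · c₀) · t)
        at (k , Kk , dk) = R.propagate (go n E' (ℕₚ.suc-injective (trans (sym dk) q)) (E' ≟ e) i'
            (ℕₚ.≤-trans (≤ℓ E'≤) le) (proj₁ su) (proj₂ su)
              (≤t (monoR τ (monoR γ₀ E'≤ uE) (uEct E i)) p)) (uEct E' i') covE UEc (uEct E i) p
          where
          κ = Sof Kk
          E' = k · E
          E'≤ : E' ≤ E
          E'≤ = dn≤ κ dk
          i' : In E'
          i' = In-≤ E'≤ i
          su = strip-up i le (proj₁ U) ua κ dk
          uE : UpR E c₀
          uE = R.new-up γ₀ (third∉ th₀ i)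
          uE' : UpR E' c₀
          uE' = R.new-up γ₀ (third∉ th₀ i')
          covE : E' · c₀ ⋖ E · c₀
          covE = monoR γ₀ E'≤ uE , trans uE (cong suc (trans dk (sym uE')))
          Ec≤ : E · c₀ ≤ w
          Ec≤ = ≤t (upR τ (uEct E i)) p
          UEc : Up (E · c₀)
          UEc = proj₁ (up-next U (upR γ₀ uE , uE) Ec≤ λ z → third∉ th₀ iM
              (subst (c₀ ≤_) (sym z) (Basics.dn⇒≤ (op Y) γ₀ (dn-iR γ₀ uE))))
            where
            iM : In (M E)
            iM σ s≤ = [ inj₁ , i σ ]′ (M-supp σ (proj₁ U) s≤)

    xG≤ : x · G ≤ w
    xG≤ = ≤t (subst (x · G ≤_) (sym c≡) (mul≤ x≤d G≤h ℓdh)) c≤w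

    -- Now x ends in t·a·t, and its first t keeps c₀ from being a left descent of x·c₀·t. So l is
    -- the only left descent there, destroyed on the left as t is on the right.
    long : 2 < ℓ x → ⊥
    long lt = clash LxG only (subst (R.Lost t) (assoc x c₀ t)
        (chainRc x ix ℕₚ.≤-refl Ux xa (subst (_≤ w) (sym (assoc x c₀ t)) xG≤)))
      where
      ulxG : UpL l (x₀ · G)
      ulxG = up-h λ' Kl ix₀ mG ulx₀
      assoc₀ : ∀ z → l · (x₀ · z) ≡ x · z
      assoc₀ z = trans (sym (assoc l x₀ z)) (cong (_· z) lx₀)
      ux₀c : UpR x₀ c₀
      ux₀c = R.new-up γ₀ (third∉ th₀ ix₀)
      xc≤ : x · c₀ ≤ w
      xc≤ = ≤t (mul≤ ≤r (subst (_≤ G) (idʳ c₀) (mul≤ {m = c₀} {n = t} ≤r (e≤ t)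
          (trans ℓG (cong₂ _+ℕ_ (sym (ℓS γ₀)) (sym (ℓS τ)))))) (add mG x ix)) xG≤
      Lc : Lost l (x · c₀)
      Lc = lost-right th₀ xc≤
      Uc : Up (x₀ · c₀)
      Uc = subst Up (trans (cong (l ·_) (sym (assoc₀ c₀))) (sc (x₀ · c₀) λ')) (upb Lc)
      x₀G≤ : x₀ · G ≤ w
      x₀G≤ = ≤t (subst (x₀ · G ≤_) (assoc₀ G) (upL λ' ulxG)) xG≤
      ℓx₀G : ℓ (x₀ · G) ≡ suc (ℓ (x₀ · c₀))
      ℓx₀G = trans (add mG x₀ ix₀) (trans (cong (ℓ x₀ +ℕ_) ℓG) (trans (ℕₚ.+-comm (ℓ x₀) 2) (cong suc (sym ux₀c))))
      covE : x₀ · c₀ ⋖ x₀ · G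
      covE = subst (x₀ · c₀ ≤_) (assoc x₀ c₀ t) (upR τ (trans (cong ℓ (assoc x₀ c₀ t)) ℓx₀G)) , ℓx₀G
      Mc≢ : ¬ M (x₀ · c₀) ≡ x₀ · G
      Mc≢ q = a∉G (cancel≤ x₀ (trans (cong ℓ (sym Mx₀)) (trans (proj₂ (proj₂ Ux₀))
          (trans (ℕₚ.+-comm 1 _) (cong (ℓ x₀ +ℕ_) (sym (ℓS a-S))))))
                (add mG x₀ ix₀) (subst₂ _≤_ Mx₀ q (proj₁ (up-step Ux₀ (upR γ₀ ux₀c , ux₀c) Uc))))
      LxG : Lost l (x · G)
      LxG = subst (Lost l) (assoc₀ G) (propagate (subst (Lost l) (sym (assoc₀ c₀)) Lc)
              (trans (cong ℓ (assoc₀ c₀)) (trans (R.new-up γ₀ (third∉ th₀ ix)) (cong suc (trans dlx (sym ux₀c)))))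
              covE (proj₁ (up-next Uc covE x₀G≤ Mc≢)) ulxG (subst (_≤ w) (sym (assoc₀ G)) xG≤))
      m₂≢e : ¬ m₂ ≡ e
      m₂≢e q = ℕₚ.<-irrefl refl (ℕₚ.≤-trans lt (ℕₚ.≤-reflexive (trans ℓx (cong (_+ℕ 2) (trans (cong ℓ q) ℓe)))))
      ux : UpR m₂ a
      ux = Basics.dn⇒up (op Y) a-S (DR.firstOther (In-≤ (dn≤R τ dxt) ix) xt≢e Kt Ka t≢a (Basics.dn⇒up (op Y) τ dxt))
        where
        xt≢e : ¬ x · t ≡ e
        xt≢e p = ℕₚ.<-irrefl refl (ℕₚ.≤-trans 2≤x (ℕₚ.≤-reflexive (trans dxt (cong suc (trans (cong ℓ p) ℓe)))))
      im₂ : In m₂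
      im₂ = In-≤ (subst₂ _≤_ (idʳ m₂) (sym x≡) (mul≤ ≤r (e≤ (a · t))
          (trans (cong ℓ (sym x≡)) (trans ℓx (cong (ℓ m₂ +ℕ_) (sym ℓat)))))) ix
      dm₂ : DnR m₂ t
      dm₂ = DR.firstOther im₂ m₂≢e Ka Kt a≢t ux
      m₃ = m₂ · t
      xG≡ : x · G ≡ m₃ · (t · (a · (t · G)))
      xG≡ = trans (cong (_· G) x≡) (trans (assoc m₂ (a · t) G) (trans (cong₂ _·_ (sym (scR m₂ τ)) (assoc a t G)) (assoc m₃ t _)))
      V = t · (a · (t · G))
      ℓatG : ℓ (a · (t · G)) ≡ 2 +ℕ ℓ G
      ℓatG = trans (cong ℓ (sym (assoc a t G))) (trans (add mG (a · t) iat) (cong (_+ℕ ℓ G) ℓat))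
      ℓxGs : ℓ (x · G) ≡ suc (ℓ m₃) +ℕ (2 +ℕ ℓ G)
      ℓxGs = trans (add mG x ix) (trans (cong (_+ℕ ℓ G) (trans ℓx (cong (_+ℕ 2) dm₂))) (ℕₚ.+-assoc (suc (ℓ m₃)) 2 (ℓ G)))
      ℓV : ℓ V ≡ suc (2 +ℕ ℓ G)
      ℓV = ℕₚ.≤-antisym (ℕₚ.≤-trans (ℓ≤suc _ τ) (ℕₚ.≤-reflexive (cong suc ℓatG)))
             (ℕₚ.+-cancelˡ-≤ (ℓ m₃) _ _ (ℕₚ.≤-trans (ℕₚ.≤-reflexive
                 (trans (ℕₚ.+-suc (ℓ m₃) _) (trans (sym ℓxGs) (cong ℓ xG≡)))) (ℓ-sub m₃ V)))
      utV : UpL t (a · (t · G))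
      utV = trans ℓV (cong suc (sym ℓatG))
      bad : ¬ DnL c₀ (x · G)
      bad dn = bad₁ (DD γ₀ τ c₀≢t utV (strip-dn m₃ V γ₀ (trans (cong ℓ (sym xG≡))
          (trans ℓxGs (trans (sym (ℕₚ.+-suc (ℓ m₃) _)) (cong (ℓ m₃ +ℕ_) (sym ℓV)))))
                 (third∉ th₀ (In-≤ (dn≤R τ dm₂) im₂)) (subst (DnL c₀) xG≡ dn)))
        where
        cV : c₀ · (a · (t · G)) ≡ a · (c₀ · (t · G))
        cV = trans (sym (assoc c₀ a _)) (trans (cong (_· (t · G)) (sym ac₀)) (assoc a c₀ _))
        a∉ : ¬ a ≤ c₀ · (t · G)
        a∉ z = [ (λ q → c₀≢a (sym q)) , (λ z' → [ a≢t , a∉G ]′ (supp-s τ a-S z')) ]′ (supp-s γ₀ a-S z)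
        bad₂ : DnL t (c₀ · (t · G)) × (t · a ≡ a · t ⊎ DnL a (t · (c₀ · (t · G)))) → ⊥
        bad₂ (_ , inj₁ q) = nc (sym q)
        bad₂ (_ , inj₂ z) = [ a≢t , a∉ ]′ (supp-s τ a-S (dn⇒≤ a-S z))
        bad₁ : DnL c₀ (a · (t · G)) × (c₀ · t ≡ t · c₀ ⊎ DnL t (c₀ · (a · (t · G)))) → ⊥
        bad₁ (_ , inj₁ q) = nct q
        bad₁ (_ , inj₂ z) = bad₂ (DD τ a-S t≢a (new-up a-S a∉) (subst (DnL t) cV z))
      only : ∀ {k} → S k → DnL k (x · G) → k ≡ l
      only = only-l-· mG λ {k} κ nk dk → bad (subst (λ z → DnL z (x · G)) (third-below ix κ nk (dn⇒≤ κ dk)) dk)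

    module Short (x≡at : x ≡ a · t) where
      l≡a : a ≡ l
      l≡a = only-l a-S (subst (DnL a) (sym x≡at) (up⇒dn a-S (upS a-S τ a≢t)))

      o≡t : t ≡ o
      o≡t = third Kl Ko Kt l≢o (λ q → a≢t (trans l≡a (sym q)))

      Mat : M (a · t) ≡ t · (a · t)
      Mat = trans (cong M (sym x≡at)) (trans Mx≡ (cong₂ _·_ (sym o≡t) x≡at))

      lost-at : Lost a (a · t)
      lost-at = subst₂ Lost (sym l≡a) x≡at lostx

      ata : W
      ata = a · (t · a)

      ata≡ : (a · t) · a ≡ ata
      ata≡ = assoc a t a

      uat : UpR (a · t) a
      uat = subst (λ z → UpR z a) x≡at xa

      ℓata : ℓ ata ≡ 3
      ℓata = trans (cong ℓ (sym ata≡)) (trans uat (cong suc ℓat))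

      iata : In ata
      iata = In-cons a-S Ka (In-cons τ Kt (In-S a-S Ka))

      Uat : Up (a · t)
      Uat = up lost-at

      covata : a · t ⋖ ata
      covata = subst (a · t ≤_) ata≡ (upR a-S uat) , trans (cong ℓ (sym ata≡)) uat

      Mat≢ : ¬ M (a · t) ≡ ata
      Mat≢ q = Mx≢ (trans (cong M x≡at) (trans q (trans (sym ata≡) (cong (_· a) (sym x≡at)))))

      -- Propagate from a·t along a Bruhat chain from t to z; its members do not contain a and are
      -- therefore matched upwards.
      lost-az : ∀ z → ¬ a ≤ z → t ≤ z → a · z ≤ w → Lost a (a · z)
      lost-az z na tz p = climb (ℓ z) t tz lost-at (ℕₚ.m≤n+m (ℓ z) (ℓ t))
        where
        uz : UpL a z
        uz = new-up a-S na
        climb : ∀ m u → u ≤ z → Lost a (a · u) → ℓ z ≤ℕ ℓ u +ℕ m → Lost a (a · z)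
        climb m u uz' L b = at m (u ≟ z) b
          where
          at : ∀ m → Dec (u ≡ z) → ℓ z ≤ℕ ℓ u +ℕ m → Lost a (a · z)
          at m (yes q) b = subst (λ k → Lost a (a · k)) q L
          at zero (no ne) b = ⊥-elim (ne (≤≡ uz' (subst (ℓ z ≤ℕ_) (ℕₚ.+-identityʳ _) b)))
          at (suc m) (no ne) b = up' (chain-up uz' ne)
            where
            up' : (∃ λ v → u ⋖ v × v ≤ z) → Lost a (a · z)
            up' (v , uv , vz) = climb m v vz (propagate L (new-up a-S (λ k → na (≤t k uz'))) uv
                (noa⇒up (≤t vz (≤t (upL a-S uz) p)) (λ k → na (≤t k vz))) (new-up a-S (λ k → na (≤t k vz)))
                (≤t (monoL a-S vz uz) p)) (subst (ℓ z ≤ℕ_) (trans (ℕₚ.+-suc (ℓ u) m) (cong (_+ℕ m) (sym (proj₂ uv)))) b)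

      RL : W → W → Set
      RL s u = R.Lost s u

      lost-tz : ∀ z → ¬ a ≤ z → UpR (t · z) t → UpR (a · (t · z)) t → UpL t z → (a · (t · z)) · t ≤ w → RL t ((a · (t · z)) · t)
      lost-tz z na utz uatz utz' p = R.propagate (R.chain-TL T (t · z) na' utz tzt≤) utz (⋖up a-S uatz') Uatz uatz p
        where
        na' : ¬ a ≤ t · z
        na' k = [ a≢t , na ]′ (supp-s τ a-S k)
        uatz' : UpL a (t · z)
        uatz' = new-up a-S na'
        Uatz : Up (a · (t · z))
        Uatz = up (lost-az (t · z) na' (dn⇒≤ τ (up⇒dn τ utz')) (≤t (upR τ uatz) p))
        tzt≤ : (t · z) · t ≤ w
        tzt≤ = ≤t (monoR τ (upL a-S uatz') uatz) p

      dn-end : ∀ y → In y → DnR (y · G) t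
      dn-end y iy = suffix-dn y G τ (add mG y iy) (trans ℓG (cong suc (trans (sym (ℓS γ₀)) (cong ℓ (sym (scR c₀ τ))))))

      -- At a·t·a·c₀·t the only left descent a is destroyed, by propagation from a·t·c₀·t, and so is
      -- the right descent t, by propagation from a·t·c₀·t on the other side.
      Q1 : ¬ ata · G ≤ w
      Q1 p = clash Lv only Rv
        where
        Z = t · G
        v = t · (a · G)
        av≡ : ata · G ≡ a · v
        av≡ = trans (assoc a (t · a) G) (cong (a ·_) (assoc t a G))
        p' : a · v ≤ w
        p' = subst (_≤ w) av≡ p
        ita : In (t · a)
        ita = In-cons τ Kt (In-S a-S Ka)
        ℓta : ℓ (t · a) ≡ 2
        ℓta = ℓ2 τ a-S t≢a
        ℓv : ℓ v ≡ 4
        ℓv = trans (cong ℓ (sym (assoc t a G))) (trans (add mG (t · a) ita) (cong₂ _+ℕ_ ℓta ℓG))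
        uaG : UpL a G
        uaG = mG a-S Ka
        utaG : UpL t (a · G)
        utaG = trans ℓv (cong suc (sym (trans uaG (cong suc ℓG))))
        uav : UpL a v
        uav = trans (cong ℓ (sym av≡)) (trans (add mG ata iata) (trans (cong₂ _+ℕ_ ℓata ℓG) (cong suc (sym ℓv))))
        a∉Z : ¬ a ≤ Z
        a∉Z k = [ a≢t , a∉G ]′ (supp-s τ a-S k)
        uaZ : UpL a Z
        uaZ = new-up a-S a∉Z
        Zv : Z ⋖ v
        Zv = ⋖mono τ (⋖up a-S uaG) utG utaG
        aZ≤ : a · Z ≤ w
        aZ≤ = ≤t (monoL a-S (proj₁ Zv) uav) p'
        LZ : Lost a (a · Z)
        LZ = lost-az Z a∉Z (dn⇒≤ τ (up⇒dn τ utG)) aZ≤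
        UZ : Up Z
        UZ = subst Up (sc Z a-S) (upb LZ)
        Z≡ : (t · c₀) · t ≡ Z
        Z≡ = assoc t c₀ t
        RZ : RL t Z
        RZ = subst (RL t) Z≡ (R.chain-TL T (t · c₀) (λ k → [ a≢t ,
            (λ k' → [ S≢e a-S , (λ q → c₀≢a (sym q)) ]′ (≤s γ₀ k')) ]′ (supp-s τ a-S k))
               (trans (cong ℓ Z≡) (trans utG (trans (cong suc ℓG) (cong suc (sym (ℓ2 τ γ₀ (λ q → c₀≢t (sym q))))))))
               (subst (_≤ w) (sym Z≡) (proj₁ UZ)))
        dnv : DnR v t
        dnv = subst (λ k → DnR k t) (assoc t a G) (dn-end (t · a) ita)
        Uv : Up v
        Uv = proj₁ (up-next UZ Zv (≤t (upL a-S uav) p') λ q → ¬Rdnup dnv (subst (λ k → UpR k t) q (R.gone RZ)))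
        Lv : Lost a (ata · G)
        Lv = subst (Lost a) (sym av≡) (propagate LZ uaZ Zv Uv uav p')
        Uata : Up ata
        Uata = proj₁ (up-next Uat covata (≤t (subst₂ _≤_ (idʳ ata) refl (mul≤ ≤r (e≤ G) (add mG ata iata))) p) Mat≢)
        iMata : In (M ata)
        iMata σ s≤ = [ inj₁ , iata σ ]′ (M-supp σ (proj₁ Uata) s≤)
        only : ∀ {k} → S k → DnL k (ata · G) → k ≡ a
        only {k} κ dk = go (K? k)
          where
          dna : DnL a ata
          dna = up⇒dn a-S (trans ℓata (cong suc (sym ℓta)))
          bad₁ : DnL c₀ (a · G) × (c₀ · t ≡ t · c₀ ⊎ DnL t (c₀ · (a · G))) → ⊥
          bad₁ (_ , inj₁ q) = nct q
          bad₁ (_ , inj₂ z) = t≢a (sym (one-desc iat iata (subst₂ _<_ (sym ℓat) (sym ℓata) (s≤s (s≤s (s≤s z≤n)))) Ka Kt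
              (up⇒dn a-S (upS a-S τ a≢t))
                (subst (DnL t) (trans (sym (assoc c₀ a G)) (trans (cong (_· G) (sym ac₀))
                    (trans (assoc a c₀ G) (cong (a ·_) (sc t γ₀))))) z)))
          bad : ¬ DnL c₀ (ata · G)
          bad z = bad₁ (DD γ₀ τ c₀≢t utaG (proj₁ (DD γ₀ a-S c₀≢a uav (subst (DnL c₀) av≡ z))))
          go : Dec (K k) → k ≡ a
          -- M(a·t·a) is longer and stays in ⟨a,t⟩, so a·t·a is not the longest element and has a
          -- single left descent.
          go (yes Kk) = one-desc iata iMata (ℕₚ.≤-reflexive (sym (proj₂ (proj₂ Uata)))) Kk Ka (dn-d κ Kk iata mG dk) dna
          go (no nk) = ⊥-elim (bad (subst (λ z → DnL z (ata · G)) (third-below iata κ nk (dn⇒≤ κ dk)) dk))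
        ub : ∀ {y} → In y → UpR y c₀
        ub i = R.new-up γ₀ (third∉ th₀ i)
        atc≤ : ((a · t) · c₀) · t ≤ w
        atc≤ = ≤t (subst (_≤ ata · G) (sym (assoc (a · t) c₀ t)) (mul≤ (proj₁ covata) ≤r (add mG ata iata))) p
        cov₁ : (a · t) · c₀ ⋖ ata · c₀
        cov₁ = monoR γ₀ (proj₁ covata) (ub iata) , trans (ub iata) (cong suc (trans (proj₂ covata) (sym (ub iat))))
        uatc : UpR ((a · t) · c₀) t
        uatc = trans (cong ℓ (assoc (a · t) c₀ t)) (trans (add mG (a · t) iat)
            (trans (cong₂ _+ℕ_ ℓat ℓG) (cong suc (trans (cong suc (sym ℓat)) (sym (ub iat))))))
        uatac : UpR (ata · c₀) t
        uatac = trans (cong ℓ (assoc ata c₀ t)) (trans (add mG ata iata)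
            (trans (cong₂ _+ℕ_ ℓata ℓG) (cong suc (trans (cong suc (sym ℓata)) (sym (ub iata))))))
        p'' : (ata · c₀) · t ≤ w
        p'' = subst (_≤ w) (sym (assoc ata c₀ t)) p
        Ratc : RL t (((a · t) · c₀) · t)
        Ratc = chainRc (a · t) iat (ℕₚ.≤-reflexive (cong ℓ (sym x≡at))) Uat uat atc≤
        atc : Up ((a · t) · c₀)
        atc = subst Up (scR ((a · t) · c₀) τ) (R.upb Ratc)
        Rv : RL t (ata · G)
        Rv = subst (RL t) (assoc ata c₀ t) (R.propagate Ratc uatc cov₁
               (proj₁ (up-next atc cov₁ (≤t (upR τ uatac) p'') λ q → Mat≢
                   (canR c₀ (trans (sym (com₀R (ub iat) (proj₁ atc))) q)))) uatac p'')

      ata≰d : ¬ ata ≤ d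
      ata≰d q = Q1 (≤t (subst (ata · G ≤_) (sym c≡) (mul≤ q G≤h ℓdh)) c≤w)

      -- A shortest left factor y of h containing s. Descents of a left factor are descents of the
      -- whole, so y inherits minimality with respect to ⟨a,t⟩ from h.
      record Pre (s : W) : Set where
        field
          r : Prefix s h
        open Prefix r public hiding (dn)
        dnY : DnR y s
        dnY = Prefix.dn r
        minY : MinL y
        minY {k} κ Kk = ¬dn⇒up κ λ z' → dnup (subst (DnL k) (sym eq) (prefix-dn y z κ (trans (cong ℓ (sym eq)) len) z')) (mH κ Kk)
        y≤h : y ≤ h
        y≤h = subst₂ _≤_ (idʳ y) (sym eq) (mul≤ ≤r (e≤ z) (trans (cong ℓ (sym eq)) len))
        -- d·y is a left factor of c
        dy-dn : ∀ {k} → S k → DnL k (d · y) → K k × DnL k d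
        dy-dn {k} κ dk = Kk , dn-d κ Kk iD minY dk
          where
          cyz : c ≡ (d · y) · z
          cyz = trans c≡ (trans (cong (d ·_) eq) (sym (assoc d y z)))
          Kk : K k
          Kk = DLK κ (subst (DnL k) (sym cyz) (prefix-dn (d · y) z κ
                 (trans (cong ℓ (sym cyz)) (trans ℓc (trans (cong (ℓ d +ℕ_) len)
                     (trans (sym (ℕₚ.+-assoc (ℓ d) _ _)) (cong (_+ℕ ℓ z) (sym (add minY d iD))))))) dk))
        dy≤w : d · y ≤ w
        dy≤w = ≤t (subst (d · y ≤_) (sym c≡) (mul≤ ≤r y≤h ℓdh)) c≤w

      -- Let y be the shortest left factor of h ending in t. It does not contain a, since a would
      -- move to its front. So at d·y = a·t·y the left descent a and the right descent t are both
      -- destroyed, and a is the only left descent.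
      case-at : d ≡ a · t → ⊥
      case-at dq = clash Lq onl Rq
        where
        P : Pre t
        P = record { r = prefix τ h t≤h }
        open Pre P
        y' = y · t
        y≡ : y ≡ y' · t
        y≡ = sym (scR y τ)
        y'≤ : y' ≤ y
        y'≤ = dn≤R τ dnY
        a∉y : ¬ a ≤ y
        a∉y p = dnup (prefix-dn y' t a-S (trans (cong ℓ (sym y≡))
            (trans dnY (trans (ℕₚ.+-comm 1 _) (cong (ℓ y' +ℕ_) (sym (ℓS τ)))))) (a-first y' (≤t y'≤ (≤t y≤h h≤c)) new ay'))
                     (trans (cong (λ z → ℓ (a · z)) (sym y≡)) (trans (minY a-S Ka) (cong (λ z → suc (ℓ z)) y≡)))
          where
          ay' : a ≤ y'
          ay' = [ (λ q → ⊥-elim (a≢t q)) , (λ z → z) ]′ (Basics.supp-s (op Y) τ a-S (subst (a ≤_) y≡ p))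
        miny' : MinL y'
        miny' κ Kk = up-right κ τ (minY κ Kk) dnY
        q≡ : d · y ≡ a · (t · y)
        q≡ = trans (cong (_· y) dq) (assoc a t y)
        Lq : Lost a (d · y)
        Lq = subst (Lost a) (sym q≡) (lost-az (t · y) (λ k → [ a≢t , a∉y ]′ (supp-s τ a-S k))
            (dn⇒≤ τ (up⇒dn τ (minY τ Kt))) (subst (_≤ w) q≡ dy≤w))
        onl : ∀ {k} → S k → DnL k (d · y) → k ≡ a
        onl κ dk = trans (only-l κ (subst (DnL _) (trans dq (sym x≡at)) (proj₂ (dy-dn κ dk)))) (sym l≡a)
        qt : d · y ≡ (a · (t · y')) · t
        qt = trans q≡ (trans (cong (λ z → a · (t · z)) y≡) (trans (cong (a ·_) (sym (assoc t y' t))) (sym (assoc a (t · y') t))))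
        Rq : RL t (d · y)
        Rq = subst (RL t) (sym qt) (lost-tz y' (λ k → a∉y (≤t k y'≤))
               (trans (cong ℓ (trans (assoc t y' t) (cong (t ·_) (sym y≡))))
                   (trans (minY τ Kt) (cong suc (trans dnY (sym (miny' τ Kt))))))
               (trans (cong ℓ (trans (sym qt) (cong (_· y) dq))) (trans (add minY (a · t) iat) (trans (cong (ℓ (a · t) +ℕ_) dnY)
                 (trans (ℕₚ.+-suc _ _) (cong suc (trans (sym (add miny' (a · t) iat)) (cong ℓ (assoc a t y'))))))))
               (miny' τ Kt) (subst (_≤ w) qt dy≤w))

      -- Here t is a left descent of c, so it has a witness q in ⟨a,t⟩. If q is longer than t·a·t·a,
      -- then h lies above a·t and `Q1` is violated. If q = t·a·t·a, both kinds of destruction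
      -- spread from it to d·y, where y is the shortest left factor of h ending in a.
      case-tat : d ≡ t · (a · t) → UpL a d → ⊥
      case-tat dq uad = [ coreL τ dtc , wit ]′ (comm? t τ)
        where
        dtd : DnL t d
        dtd = ¬up⇒dn τ λ u → ℕₚ.<-irrefl refl (ℕₚ.≤-trans (s≤s (≤ℓ x≤d)) (ℕₚ.≤-reflexive (trans (sym u)
                (cong ℓ (trans (cong (t ·_) dq) (trans (sc (a · t) τ) (sym x≡at)))))))
        dtc : DnL t c
        dtc = subst (DnL t) (sym c≡) (prefix-dn d h τ ℓdh dtd)
        td≡ : t · d ≡ a · t
        td≡ = trans (cong (t ·_) dq) (sc (a · t) τ)
        at≤d : a · t ≤ d
        at≤d = subst (_≤ d) td≡ (dn≤ τ dtd)
        ℓd : ℓ d ≡ 3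
        ℓd = trans dtd (cong suc (trans (cong ℓ td≡) ℓat))
        cth : c ≡ t · ((a · t) · h)
        cth = trans c≡ (trans (cong (_· h) dq) (assoc t (a · t) h))
        wit : Witness t → ⊥
        wit (r' , q , ρ' , t≢r' , ain , i , L) = [ (λ z → a≢t z) , go ]′ ain
          where
          go : a ≡ r' → ⊥
          go refl = u-cases ((a · u) ≟ e)
            where
            iq : In q
            iq β p = [ inj₂ , inj₁ ]′ (i β p)
            X = t · q
            tX : t · X ≡ q
            tX = sc q τ
            UX : Up X
            UX = upb L
            utX : UpL t X
            utX = dn⇒up τ (dn L)
            X≤q : X ≤ q
            X≤q = dn≤ τ (dn L)
            iX : In X
            iX = In-≤ X≤q iq
            nb : ¬ M X ≡ t · X
            nb = not-below (subst (Lost t) (sym tX) L) utX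
            X≢e : ¬ X ≡ e
            X≢e z = dnup (subst (DnL t) (sym (trans (cong M (trans (sym tX) (trans (cong (t ·_) z) (idʳ t))))
                (proj₁ (proj₂ (proj₂ (proj₂ T))))))
                      (up⇒dn τ (upS τ a-S t≢a))) (gone L)
            daX : DnL a X
            daX = firstOther iX X≢e Kt Ka t≢a utX
            ℓX≥2 : 2 ≤ℕ ℓ X
            ℓX≥2 = bound (ℓ X) refl
              where
              bound : ∀ n → ℓ X ≡ n → 2 ≤ℕ n
              bound 0 z = ⊥-elim (X≢e (ℓ0 z))
              bound 1 z = ⊥-elim ([ (λ k → up-down UX (subst Down (sym k) (M-up e-up))) ,
                  (λ k → dnup (subst (DnL a) k daX) (upS a-S τ a≢t)) ]′ (iX (ℓ1 z) ≤r))
              bound (suc (suc n)) z = s≤s (s≤s z≤n)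
            pr = pre 2 ℓat iat iX (ℕₚ.≤-trans (ℕₚ.≤-reflexive ℓat) ℓX≥2) (inj₂ (a , Ka , up⇒dn a-S (upS a-S τ a≢t) , daX))
            u = proj₁ pr
            Xq : X ≡ (a · t) · u
            Xq = proj₁ (proj₂ pr)
            ℓX : ℓ X ≡ ℓ (a · t) +ℕ ℓ u
            ℓX = proj₂ (proj₂ pr)
            u≢e : ¬ u ≡ e
            u≢e z = nb (trans (cong M Xat) (trans Mat (cong (t ·_) (sym Xat))))
              where
              Xat : X ≡ a · t
              Xat = trans Xq (trans (cong ((a · t) ·_) z) (idʳ (a · t)))
            u≤h : u ≤ h
            u≤h = cancel≤ (a · t) (trans (cong ℓ (sym Xq)) ℓX) (add mH (a · t) iat)
                    (subst (_≤ (a · t) · h) Xq (peel τ (subst (X ≤_) cth (allup UX)) utX))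
            u≤X : u ≤ X
            u≤X = subst₂ _≤_ (idˡ u) (sym Xq) (mul≤ (e≤ (a · t)) ≤r (trans (cong ℓ (sym Xq)) ℓX))
            iu : In u
            iu = In-≤ u≤X iX
            dau : DnL a u
            dau = firstOther iu u≢e Kt Ka t≢a (¬dn⇒up τ λ z → ℕₚ.<-irrefl refl (ℕₚ.≤-trans
                    (ℕₚ.≤-trans (ℕₚ.≤-reflexive (trans (cong suc (cong ℓ (trans Xq (assoc a t u)))) refl))
                        (s≤s (ℕₚ.≤-trans (ℓ≤suc (t · u) a-S) (ℕₚ.≤-reflexive (sym z)))))
                    (ℕₚ.≤-trans (ℕₚ.n≤1+n _) (ℕₚ.≤-reflexive (sym (trans ℓX (cong (_+ℕ ℓ u) ℓat)))))))
            u-cases : Dec (a · u ≡ e) → ⊥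
            u-cases (no n) = Q1 (≤t (subst (_≤ c) eq (subst ((a · t) · (c₀ · (a · t)) ≤_) (sym c≡)
                (mul≤ at≤d (star γ₀ (≤t at≤u u≤h) dc₀) ℓdh))) c≤w)
              where
              eq : (a · t) · (c₀ · (a · t)) ≡ ata · G
              eq = trans (cong ((a · t) ·_) (trans (sym (assoc c₀ a t)) (trans (cong (_· t) (sym ac₀)) (assoc a c₀ t))))
                     (trans (sym (assoc (a · t) a G)) (cong (_· G) ata≡))
              at≤u : a · t ≤ u
              at≤u = subst (a · t ≤_) (sc u a-S) (monoL a-S (dn⇒≤ τ
                  (firstOther (In-≤ (dn≤ a-S dau) iu) n Ka Kt a≢t (dn⇒up a-S dau))) (dn⇒up a-S dau))
            u-cases (yes z) = clash (LA Z₀ minZ new tvvZ≤) onl RvZ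
              where
              ua : u ≡ a
              ua = trans (mvL a-S z) (idʳ a)
              X≡ : X ≡ ata
              X≡ = trans Xq (trans (cong ((a · t) ·_) ua) ata≡)
              Uata : Up ata
              Uata = subst Up X≡ UX
              dna-ata : DnR ata a
              dna-ata = trans ℓata (cong suc (trans (sym ℓat) (cong ℓ (sym (trans (cong (_· a) (sym ata≡)) (scR (a · t) a-S))))))
              iM : In (M X)
              iM σ s≤ = [ inj₁ , iX σ ]′ (M-supp σ (proj₁ UX) s≤)
              utM : UpL t (M X)
              utM = M-upL τ UX utX nb
              goneM : UpR (M ata) a
              goneM = Basics.¬dn⇒up (op Y) a-S λ dk → bad (subst (λ k → DnR (M k) a) (sym X≡) dk)
                where
                bad : DnR (M X) a → ⊥
                bad dk = ℕₚ.<-irrefl (sym (trans (cong ℓ (trans (sym (scR (M X) a-S))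
                    (trans (cong (_· a) (trans y₃≡ X≡)) (trans (cong (_· a) (sym ata≡)) (scR (a · t) a-S))))) ℓat))
                              (subst (2 <_) (sym (trans (proj₂ (proj₂ UX)) (cong suc (trans (cong ℓ X≡) ℓata))))
                                  (s≤s (s≤s (s≤s z≤n))))
                  where
                  y₃ = M X · a
                  y₃≤ : y₃ ≤ M X
                  y₃≤ = dn≤R a-S dk
                  ℓy₃ : ℓ y₃ ≡ ℓ X
                  ℓy₃ = ℕₚ.suc-injective (trans (sym dk) (proj₂ (proj₂ UX)))
                  y₃≡ : y₃ ≡ X
                  y₃≡ = dih1 Ka (In-≤ y₃≤ iM) iX ℓy₃ (firstOther (In-≤ y₃≤ iM)
                      (λ k → X≢e (ℓ0 (trans (sym ℓy₃) (trans (cong ℓ k) ℓe)))) Kt Ka t≢a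
                            (up-right τ a-S utM dk)) daX
              Rata : RL a ata
              Rata = R.lost a-S Uata dna-ata (subst Up (sym (trans (cong (_· a) (sym ata≡)) (scR (a · t) a-S))) Uat) goneM
              a≤h : a ≤ h
              a≤h = subst (_≤ h) ua u≤h
              P : Pre a
              P = record { r = prefix a-S h a≤h }
              open Pre P using (y; minY; dnY; new; only; dy-dn; y≤h; dy≤w)
              Z₀ = y · a
              y≡ : y ≡ Z₀ · a
              y≡ = sym (scR y a-S)
              minZ : MinL Z₀
              minZ κ Kk = up-right κ a-S (minY κ Kk) dnY
              Z₀≢e : ¬ Z₀ ≡ e
              Z₀≢e k = dnup (dn-self a-S) (subst (UpL a) (trans y≡ (trans (cong (_· a) k) (idˡ a))) (minY a-S Ka))
              Z₀≤c : Z₀ ≤ c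
              Z₀≤c = ≤t (dn≤R a-S dnY) (≤t y≤h h≤c)
              dZt : DnR Z₀ t
              dZt = at (descR Z₀ Z₀≢e)
                where
                at : (∃ λ g → S g × DnR Z₀ g) → DnR Z₀ t
                at (g , γ , dg) = is-t (g ≟ t)
                  where
                  g≤ : g ≤ Z₀
                  g≤ = Basics.dn⇒≤ (op Y) γ dg
                  is-t : Dec (g ≡ t) → DnR Z₀ t
                  is-t (yes refl) = dg
                  is-t (no n) = ⊥-elim (new (subst (_≤ Z₀) (only γ dyg) g≤))
                    where
                    yg : y · g ≡ (Z₀ · g) · a
                    yg = trans (cong (_· g) y≡) (trans (assoc Z₀ a g)
                        (trans (cong (Z₀ ·_) (commA γ (≤t g≤ Z₀≤c) n)) (sym (assoc Z₀ g a))))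
                    dyg : DnR y g
                    dyg = Basics.lt⇒dn (op Y) y γ (ℕₚ.≤-trans
                        (s≤s (ℕₚ.≤-trans (ℕₚ.≤-reflexive (cong ℓ yg)) (Basics.ℓ≤suc (op Y) (Z₀ · g) a-S)))
                            (ℕₚ.≤-reflexive (trans (cong suc (sym dg)) (sym dnY))))
              ur : ∀ {p z} → In p → UpR p a → MinL z → ¬ a ≤ z → UpR (p · z) a
              ur {p} {z} ip up' mz na = Basics.¬dn⇒up (op Y) a-S λ dk →
                ¬Rdnup (Factor.strip-dn (op Y) z p a-S (trans (add mz p ip) (ℕₚ.+-comm (ℓ p) (ℓ z))) na dk) up'
              uda : UpR d a
              uda = Basics.¬dn⇒up (op Y) a-S λ dk → a≢t (DR.one-desc iD iq (subst₂ _<_ (sym ℓd) (sym ℓq) ℕₚ.≤-refl) Ka Kt dk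
                      (subst (λ k → DnR k t) (sym dq) (suffix-dn t (a · t) τ
                          (trans (cong ℓ (sym dq)) (trans ℓd (cong₂ _+ℕ_ (sym (ℓS τ)) (sym ℓat))))
                        (trans ℓat (cong suc (trans (sym (ℓS a-S)) (cong ℓ (sym (scR a τ)))))))))
                where
                ℓq : ℓ q ≡ 4
                ℓq = trans (dn L) (cong suc (trans (cong ℓ X≡) ℓata))
              -- The elements a·t·z·a and t·a·t·z·a start, for z = e, at elements where the right
              -- descent a and the left descent t are known to be destroyed; for z = y·a the second
              -- is d·y.
              vv : W → W
              vv z = ((a · t) · z) · a
              ℓvv : ∀ {z} → MinL z → ¬ a ≤ z → ℓ (vv z) ≡ 3 +ℕ ℓ z
              ℓvv {z} mz na = trans (ur iat uat mz na) (cong suc (trans (add mz (a · t) iat) (cong (_+ℕ ℓ z) ℓat)))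
              tvv : ∀ z → t · vv z ≡ (d · z) · a
              tvv z = trans (sym (assoc t _ a)) (cong (_· a) (trans (sym (assoc t (a · t) z)) (cong (_· z) (sym dq))))
              utvv : ∀ {z} → MinL z → ¬ a ≤ z → UpL t (vv z)
              utvv {z} mz na = trans (cong ℓ (tvv z)) (trans (ur iD uda mz na)
                  (cong suc (trans (add mz d iD) (trans (cong (_+ℕ ℓ z) ℓd) (sym (ℓvv mz na))))))
              RA : ∀ z → MinL z → ¬ a ≤ z → vv z ≤ w → RL a (vv z)
              RA z = go' (ℓ z) z refl (z ≟ e)
                where
                go' : ∀ n z → ℓ z ≡ n → Dec (z ≡ e) → MinL z → ¬ a ≤ z → vv z ≤ w → RL a (vv z)
                go' n z q' (yes ze) mz na p = subst (RL a) (trans (sym ata≡)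
                    (cong (_· a) (trans (sym (idʳ (a · t))) (cong ((a · t) ·_) (sym ze))))) Rata
                go' zero z q' (no ne) mz na p = ⊥-elim (ne (ℓ0 q'))
                go' (suc n) z q' (no ne) mz na p = at (descR z ne)
                  where
                  at : (∃ λ g → S g × DnR z g) → RL a (vv z)
                  at (g , γ , dg) = R.propagate (go' n z' (ℕₚ.suc-injective (trans (sym dg) q')) (z' ≟ e) mz' na'
                      (≤t (monoR a-S (proj₁ cv) uv) p))
                      (ur iat uat mz' na') cv Uv uv p
                    where
                    z' = z · g
                    z'≤ : z' ≤ z
                    z'≤ = dn≤R γ dg
                    mz' : MinL z'
                    mz' κ Kk = up-right κ γ (mz κ Kk) dg
                    na' : ¬ a ≤ z'
                    na' k = na (≤t k z'≤)
                    uv : UpR ((a · t) · z) a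
                    uv = ur iat uat mz na
                    cv : (a · t) · z' ⋖ (a · t) · z
                    cv = mul≤ ≤r z'≤ (add mz (a · t) iat) , trans (add mz (a · t) iat)
                        (trans (cong (ℓ (a · t) +ℕ_) dg) (trans (ℕₚ.+-suc _ _) (cong suc (sym (add mz' (a · t) iat)))))
                    Uv : Up ((a · t) · z)
                    Uv = subst Up (sym (assoc a t z)) (up (lost-az (t · z) (λ k → [ a≢t , na ]′ (supp-s τ a-S k))
                        (dn⇒≤ τ (up⇒dn τ (mz τ Kt)))
                           (subst (_≤ w) (assoc a t z) (≤t (upR a-S uv) p))))
              LA : ∀ z → MinL z → ¬ a ≤ z → t · vv z ≤ w → Lost t (t · vv z)
              LA z = go' (ℓ z) z refl (z ≟ e)
                where
                go' : ∀ n z → ℓ z ≡ n → Dec (z ≡ e) → MinL z → ¬ a ≤ z → t · vv z ≤ w → Lost t (t · vv z)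
                go' n z q' (yes ze) mz na p = subst (λ k → Lost t (t · k))
                    (trans X≡ (trans (sym ata≡) (cong (_· a) (trans (sym (idʳ (a · t))) (cong ((a · t) ·_) (sym ze))))))
                                                (subst (Lost t) (sym tX) L)
                go' zero z q' (no ne) mz na p = ⊥-elim (ne (ℓ0 q'))
                go' (suc n) z q' (no ne) mz na p = at (descR z ne)
                  where
                  at : (∃ λ g → S g × DnR z g) → Lost t (t · vv z)
                  at (g , γ , dg) = propagate L' (utvv mz' na') cv
                      (proj₁ (up-next Uu cv (≤t (upL τ (utvv mz na)) p) M≢)) (utvv mz na) p
                    where
                    z' = z · g
                    z'≤ : z' ≤ z
                    z'≤ = dn≤R γ dg
                    mz' : MinL z'
                    mz' κ Kk = up-right κ γ (mz κ Kk) dg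
                    na' : ¬ a ≤ z'
                    na' k = na (≤t k z'≤)
                    cv : vv z' ⋖ vv z
                    cv = monoR a-S (mul≤ ≤r z'≤ (add mz (a · t) iat)) (ur iat uat mz na)
                       , trans (ℓvv mz na) (trans (cong (3 +ℕ_) dg) (cong suc (sym (ℓvv mz' na'))))
                    L' : Lost t (t · vv z')
                    L' = go' n z' (ℕₚ.suc-injective (trans (sym dg) q')) (z' ≟ e) mz' na' (≤t (monoL τ (proj₁ cv) (utvv mz na)) p)
                    Uu : Up (vv z')
                    Uu = subst Up (sc (vv z') τ) (upb L')
                    M≢ : ¬ M (vv z') ≡ vv z
                    M≢ k = ¬Rdnup (dn-iR a-S (ur iat uat mz na)) (subst (λ m → UpR m a) k (R.gone (RA z' mz' na' (proj₁ Uu))))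
              tvvZ : t · vv Z₀ ≡ d · y
              tvvZ = trans (tvv Z₀) (trans (assoc d Z₀ a) (cong (d ·_) (sym y≡)))
              tvvZ≤ : t · vv Z₀ ≤ w
              tvvZ≤ = subst (_≤ w) (sym tvvZ) dy≤w
              onl : ∀ {k} → S k → DnL k (t · vv Z₀) → k ≡ t
              onl {k} κ dk = [ (λ q' → ⊥-elim (dnup (subst (λ m → DnL m d) q' (proj₂ dyk)) uad)) , (λ q' → q') ]′ (proj₁ dyk)
                where dyk = dy-dn κ (subst (DnL k) tvvZ dk)
              vvZ≤ : vv Z₀ ≤ w
              vvZ≤ = ≤t (upL τ (utvv minZ new)) tvvZ≤
              RZ : RL a (vv Z₀)
              RZ = RA Z₀ minZ new vvZ≤
              uu = (a · t) · Z₀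
              Uuu : Up uu
              Uuu = subst Up (scR uu a-S) (R.upb RZ)
              Z₁ = Z₀ · t
              Z₁≤ : Z₁ ≤ Z₀
              Z₁≤ = dn≤R τ dZt
              minZ₁ : MinL Z₁
              minZ₁ κ Kk = up-right κ τ (minZ κ Kk) dZt
              uu≡ : uu ≡ (a · (t · Z₁)) · t
              uu≡ = trans (assoc a t Z₀) (trans (cong (λ k → a · (t · k)) (sym (scR Z₀ τ)))
                  (trans (cong (a ·_) (sym (assoc t Z₁ t))) (sym (assoc a (t · Z₁) t))))
              Ruu : RL t uu
              Ruu = subst (RL t) (sym uu≡) (lost-tz Z₁ (λ k → new (≤t k Z₁≤))
                 (trans (cong ℓ (trans (assoc t Z₁ t) (cong (t ·_) (scR Z₀ τ))))
                     (trans (minZ τ Kt) (cong suc (trans dZt (sym (minZ₁ τ Kt))))))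
                 (trans (cong ℓ (sym uu≡)) (trans (add minZ (a · t) iat) (trans (cong (ℓ (a · t) +ℕ_) dZt)
                   (trans (ℕₚ.+-suc _ _) (cong suc (trans (sym (add minZ₁ (a · t) iat)) (cong ℓ (assoc a t Z₁))))))))
                 (minZ₁ τ Kt) (subst (_≤ w) uu≡ (proj₁ Uuu)))
              tuu≡ : t · uu ≡ d · Z₀
              tuu≡ = trans (sym (assoc t (a · t) Z₀)) (cong (_· Z₀) (sym dq))
              utuu : UpL t uu
              utuu = trans (cong ℓ tuu≡) (trans (add minZ d iD)
                  (trans (cong (_+ℕ ℓ Z₀) (trans ℓd (cong suc (sym ℓat)))) (cong suc (sym (add minZ (a · t) iat)))))
              vva : (t · uu) · a ≡ t · vv Z₀
              vva = assoc t uu a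
              utuua : UpR (t · uu) a
              utuua = subst (λ k → UpR k a) (sym tuu≡) (ur iD uda minZ new)
              tuu≤ : t · uu ≤ w
              tuu≤ = ≤t (upR a-S utuua) (subst (_≤ w) (sym vva) tvvZ≤)
              Mu≢ : ¬ M uu ≡ t · uu
              Mu≢ k = ¬Rdnup (suffix-dn t uu τ (trans utuu (cong (_+ℕ ℓ uu) (sym (ℓS τ)))) (R.dn Ruu))
                  (subst (λ m → UpR m t) k (R.gone Ruu))
              RvZ : RL a (t · vv Z₀)
              RvZ = subst (RL a) vva (R.propagate RZ (ur iat uat minZ new) (⋖up τ utuu)
                  (proj₁ (up-next Uuu (⋖up τ utuu) tuu≤ Mu≢)) utuua
                      (subst (_≤ w) (sym vva) tvvZ≤))

      -- In the dihedral subgroup d lies above a·t but not above a·t·a, which leaves a·t and t·a·t.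
      absurd : ⊥
      absurd = go (ℓ d) refl
        where
        2≤d : 2 ≤ℕ ℓ d
        2≤d = ℕₚ.≤-trans 2≤x (≤ℓ x≤d)
        case3 : ℓ d ≡ 3 → DnL a d ⊎ UpL a d → ⊥
        case3 q (inj₁ da) = ata≰d (subst (_≤ d) (dih1 Ka iD iata (trans q (sym ℓata)) da
            (up⇒dn a-S (trans ℓata (cong suc (sym (ℓ2 τ a-S t≢a)))))) ≤r)
        case3 q (inj₂ ua) = case-tat (mvL τ td) ua
          where
          d≢e : ¬ d ≡ e
          d≢e z = ℕₚ.1+n≢0 (trans (sym q) (trans (cong ℓ z) ℓe))
          dtd : DnL t d
          dtd = firstOther iD d≢e Ka Kt a≢t ua
          ℓtd : ℓ (t · d) ≡ 2
          ℓtd = ℕₚ.suc-injective (trans (sym dtd) q)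
          itd : In (t · d)
          itd = In-≤ (dn≤ τ dtd) iD
          td : t · d ≡ a · t
          td = dih1 Ka itd iat (trans ℓtd (sym ℓat)) (firstOther itd
              (λ z → ℕₚ.1+n≢0 (trans (sym ℓtd) (trans (cong ℓ z) ℓe))) Kt Ka t≢a (dn⇒up τ dtd))
                 (up⇒dn a-S (upS a-S τ a≢t))
        go : ∀ n → ℓ d ≡ n → ⊥
        go 0 q = ℕₚ.n≮0 (subst (2 ≤ℕ_) q 2≤d)
        go 1 q = ℕₚ.n≮0 (ℕₚ.≤-pred (subst (2 ≤ℕ_) q 2≤d))
        go 2 q = case-at (sym (≤ℓ≡ (subst (_≤ d) x≡at x≤d) (trans ℓat (sym q))))
        go 3 q = case3 q (swap (stepL d a-S))
        go (suc (suc (suc (suc n)))) q = ata≰d (dih2 iata iD (subst₂ _<_ (sym ℓata) (sym q) (s≤s (s≤s (s≤s (s≤s z≤n))))))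

    contradiction : ⊥
    contradiction = go (ℓ x ℕₚ.≟ 2)
      where
      go : Dec (ℓ x ≡ 2) → ⊥
      go (no n) = long (ℕₚ.≤∧≢⇒< 2≤x (λ q → n (sym q)))
      go (yes q) = Short.absurd (sym (≤ℓ≡ at≤x (trans ℓat (sym q))))

  core-In : Supp2 a t c
  core-In = go (h ≟ e)
    where
    go : Dec (h ≡ e) → Supp2 a t c
    go (yes q) {b} = subst (Supp2 a t) (sym (trans c≡ (trans (cong (d ·_) q) (idʳ d)))) iD {b}
    go (no n) = ⊥-elim (NE.contradiction n)

-- From bad letters to the dihedral alternative

module Letters (Y : Sys) (w : Sys.W Y) (M : Sys.W Y → Sys.W Y) (sp : Special Y w M)
               (goodR : ∀ {t} → Two.TR Y w M sp t → Half.Good Y w M sp t)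
               (goodL : ∀ {t} → Two.TL Y w M sp t → Half.Good (op Y) w M (opS sp) t) where
  open Sys Y
  open Products Y
  open Two Y w M sp

  kind : ∀ {s} → S s → s ≤ w → ¬ s ≡ a → TL s ⊎ Good s
  kind {s} σ p n = go (letter σ p n) ((a · s) ≟ (s · a))
    where
    go : M s ≡ s · a ⊎ M s ≡ a · s → Dec (a · s ≡ s · a) → TL s ⊎ Good s
    go _ (yes q) = inj₂ (C-good σ p n q)
    go (inj₁ m) (no q) = inj₂ (goodR (σ , p , n , m , λ k → q (sym k)))
    go (inj₂ m) (no q) = inj₁ (σ , p , n , m , q)

  -- A witness would lie in some ⟨a,r⟩ on which M is multiplication by a from one side. From the
  -- left it cannot match q upwards, as a is a left descent of q; from the right it destroys no left
  -- descent.
  comm-a : Comm a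
  comm-a = pick (comm? a a-S)
    where
    pick : Comm a ⊎ Witness a → Comm a
    wit : Witness a → ⊥
    wit (r , q , ρ , a≢r , _ , i , L) = go (r ≤? q)
      where
      letters : Dec (a · q ≡ e) → ¬ r ≤ q → ⊥
      letters (yes k) _ = up-down (up L) (subst Down (sym (trans (mvL a-S k) (idʳ a))) (M-up e-up))
      letters (no n) nr = at (descL (a · q) n)
        where
        at : (∃ λ k → S k × DnL k (a · q)) → ⊥
        at (k , κ , dk) = [ (λ z → dnup (subst (λ z → DnL z (a · q)) z dk) (dn⇒up a-S (dn L)))
                          , (λ z → nr (subst (_≤ q) z k≤q)) ]′ (i κ k≤q)
          where
          k≤q : k ≤ q
          k≤q = ≤t (dn⇒≤ κ dk) (dn≤ a-S (dn L))
      kinds : TL r ⊎ Good r → ⊥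
      kinds (inj₁ T) = dnup (dn L) (R.up-R (up L) (goodL T (up L) i))
      kinds (inj₂ G) = good-kept G i L
      go : Dec (r ≤ q) → ⊥
      go (no nr) = letters ((a · q) ≟ e) nr
      go (yes p) = kinds
                   (kind ρ (≤t p (proj₁ (up L))) (λ k → a≢r (sym k)))
    pick (inj₁ c) = c
    pick (inj₂ W) = ⊥-elim (wit W)

  not-comm : ∀ {s} → S s → s ≤ w → ¬ Comm s → TL s
  not-comm {s} σ p nc = go (s ≟ a)
    where
    go : Dec (s ≡ a) → TL s
    go (yes refl) = ⊥-elim (nc comm-a)
    go (no n) = pick (kind σ p n)
      where
      pick : TL s ⊎ Good s → TL s
      pick (inj₁ T) = T
      pick (inj₂ G) = ⊥-elim (nc (Good⇒Comm σ n G))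

module Core (Y : Sys) (w : Sys.W Y) (M : Sys.W Y → Sys.W Y) (sp : Special Y w M)
           (c : Sys.W Y) (c≤w : Sys._≤_ Y c w)
           (allup : ∀ {u} → Match.Up Y w M sp u → Sys._≤_ Y u c)
           (coreL : ∀ {s} → Sys.S Y s → Basics.DnL Y s c → ¬ Match.Comm Y w M sp s)
           (coreR : ∀ {s} → Sys.S Y s → Basics.DnR Y c s → ¬ Match.Comm (op Y) w M (opS sp) s) where
  open Sys Y
  open Products Y
  open Two Y w M sp
  private module O = Two (op Y) w M (opS sp)

  -- A bad letter would give the dihedral support that f rules out. Without bad letters, the
  -- descents of c, none of which commutes with M, are of left type on the left and of right type on
  -- the right, against `no-TR-above`.
  core : (∀ {t} → S t → Supp2 a t c → ⊥) → ⊥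
  core f = go (c ≟ e)
    where
    goodR : ∀ {t} → TR t → Good t
    goodR {t} T = pick (good-or-bad (proj₁ T) (proj₁ (proj₂ (proj₂ T))))
      where
      pick : Good t ⊎ BadR t → Good t
      pick (inj₁ G) = G
      pick (inj₂ B) = ⊥-elim (f (proj₁ T) (BadLast.core-In Y w M sp t T B c c≤w allup coreL coreR))
    goodL : ∀ {t} → TL t → R.Good t
    goodL {t} T = pick (O.good-or-bad (proj₁ T) (proj₁ (proj₂ (proj₂ T))))
      where
      pick : R.Good t ⊎ O.BadR t → R.Good t
      pick (inj₁ G) = G
      pick (inj₂ B) = ⊥-elim (f (proj₁ T) (BadLast.core-In (op Y) w M (opS sp) t T B c c≤w allup coreR coreL))
    go : Dec (c ≡ e) → ⊥
    go (yes q) = f a-S λ σ p → ⊥-elim (S≢e σ (≤e (subst (_ ≤_) q p)))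
    go (no n) = at (descR c n)
      where
      at : (∃ λ t → S t × DnR c t) → ⊥
      at (t , τ , d) = no-TR-above (Letters.not-comm (op Y) w M (opS sp) goodL goodR τ (≤t t≤c c≤w)
          (λ C → coreR τ d (λ {u} → C {u})))
          c c≤w (λ κ dk → Letters.not-comm Y w M sp goodR goodL κ (≤t (dn⇒≤ κ dk) c≤w) (λ C → coreL κ dk (λ {u} → C {u}))) t≤c
        where
        t≤c : t ≤ c
        t≤c = Basics.dn⇒≤ (op Y) τ d

-- Recursion operators and dihedral R-polynomials

infix 4 _∼_
_∼_ : ℕ → ℕ → Set
n ∼ m = m ≡ suc n ⊎ n ≡ suc m

up⇒true : ∀ {n m} → m ≡ suc n → (n <ᵇ m) ≡ true
up⇒true {zero} refl = refl
up⇒true {suc n} refl = up⇒true {n} refl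

dn⇒false : ∀ {n m} → n ≡ suc m → (n <ᵇ m) ≡ false
dn⇒false {m = zero} refl = refl
dn⇒false {m = suc m} refl = dn⇒false {m = m} refl

-- In a square of consecutive lengths parallel edges have the same direction unless the two
-- neighbours of a corner are both above or both below it and the opposite corner has the same length.
square : ∀ {x y z t} → x ∼ y → x ∼ z → y ∼ t → z ∼ t →
         (y ≡ suc x → z ≡ suc x → t ≡ x → ⊥) → (x ≡ suc y → x ≡ suc z → t ≡ x → ⊥) →
         (x <ᵇ y) ≡ (z <ᵇ t) × (x <ᵇ z) ≡ (y <ᵇ t)
square {x} (inj₁ refl) (inj₁ refl) (inj₁ refl) (inj₁ q) n m = trans (up⇒true {x} refl)
    (sym (up⇒true {suc x} q)) , trans (up⇒true {x} refl) (sym (up⇒true {suc x} refl))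
square (inj₁ refl) (inj₁ refl) (inj₁ refl) (inj₂ ()) n m
square (inj₁ refl) (inj₁ refl) (inj₂ q) _ n m = ⊥-elim (n refl refl (sym (ℕₚ.suc-injective q)))
square {z = z} (inj₁ refl) (inj₂ refl) (inj₁ refl) (inj₁ ()) n m
square {z = z} (inj₁ refl) (inj₂ refl) (inj₁ refl) (inj₂ ()) n m
square {z = z} (inj₁ refl) (inj₂ refl) (inj₂ refl) _ n m = trans (up⇒true {suc z} refl)
    (sym (up⇒true {z} refl)) , trans (dn⇒false {suc z} refl) (sym (dn⇒false {suc (suc z)} refl))
square {y = y} (inj₂ refl) (inj₁ refl) (inj₁ refl) _ n m = trans (dn⇒false {suc y} refl)
    (sym (dn⇒false {suc (suc y)} refl)) , trans (up⇒true {suc y} refl) (sym (up⇒true {y} refl))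
square (inj₂ refl) (inj₁ refl) (inj₂ refl) (inj₁ ()) n m
square (inj₂ refl) (inj₁ refl) (inj₂ refl) (inj₂ ()) n m
square (inj₂ refl) (inj₂ refl) (inj₁ refl) _ n m = ⊥-elim (m refl refl refl)
square {t = t} (inj₂ refl) (inj₂ refl) (inj₂ refl) _ n m = trans (dn⇒false {suc (suc t)} refl)
    (sym (dn⇒false {suc t} refl)) , trans (dn⇒false {suc (suc t)} refl) (sym (dn⇒false {suc t} refl))

module Recursion (q : ℤ) where
  -- One step of the R-recursion: the flag says that the step leads upwards, and the arguments are
  -- the values at the element and at its partner.
  h : Bool → ℤ → ℤ → ℤ
  h true  x y = (q - + 1) * x + q * y
  h false x y = y

  h-swap : ∀ b c x y z t → h b (h c x y) (h c z t) ≡ h c (h b x z) (h b y t)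
  h-swap true true = lem q
    where
    lem : ∀ q x y z t → (q - + 1) * ((q - + 1) * x + q * y) + q * ((q - + 1) * z + q * t)
                      ≡ (q - + 1) * ((q - + 1) * x + q * z) + q * ((q - + 1) * y + q * t)
    lem = solve-∀
  h-swap true false _ _ _ _ = refl
  h-swap false true _ _ _ _ = refl
  h-swap false false _ _ _ _ = refl

  h0 : ∀ b → h b (+ 0) (+ 0) ≡ + 0
  h0 true = lem q
    where
    lem : ∀ q → (q - + 1) * + 0 + q * + 0 ≡ + 0
    lem = solve-∀
  h0 false = refl

  -- R-polynomials of dihedral intervals, by length
  r : ℕ → ℤ
  r 0 = + 1
  r 1 = q - + 1
  r 2 = (q - + 1) * (q - + 1)
  r (suc (suc (suc n))) = (q - + 1) * r (suc (suc n)) + q * r (suc n)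

module Ops (Y : Sys) (q : ℤ) where
  open Sys Y
  open Products Y
  open Recursion q public

  Tm : (W → W) → (W → ℤ) → W → ℤ
  Tm m f u = h (ℓ u <ᵇ ℓ (m u)) (f u) (f (m u))

  Tm-cong : ∀ m (f g : W → ℤ) u → f u ≡ g u → f (m u) ≡ g (m u) → Tm m f u ≡ Tm m g u
  Tm-cong m f g u p p' = cong₂ (h (ℓ u <ᵇ ℓ (m u))) p p'

  Tm-0 : ∀ m f u → f u ≡ + 0 → f (m u) ≡ + 0 → Tm m f u ≡ + 0
  Tm-0 m f u p p' = trans (cong₂ (h (ℓ u <ᵇ ℓ (m u))) p p') (h0 (ℓ u <ᵇ ℓ (m u)))

  Tm-up : ∀ m f u → ℓ (m u) ≡ suc (ℓ u) → Tm m f u ≡ (q - + 1) * f u + q * f (m u)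
  Tm-up m f u p = cong (λ b → h b (f u) (f (m u))) (up⇒true p)

  Tm-dn : ∀ m f u → ℓ u ≡ suc (ℓ (m u)) → Tm m f u ≡ f (m u)
  Tm-dn m f u p = cong (λ b → h b (f u) (f (m u))) (dn⇒false p)

  -- If u, its two images and their common image form a square whose parallel edges point the same
  -- way, this is `h-swap`. If the two images coincide, the square collapses and both composites are
  -- the same expression.
  Tm-comm : ∀ m n f u → m (n u) ≡ n (m u) → n (n u) ≡ u → (¬ m u ≡ n u → (ℓ u <ᵇ ℓ (m u)) ≡ (ℓ (n u) <ᵇ ℓ (m (n u))) ×
      (ℓ u <ᵇ ℓ (n u)) ≡ (ℓ (m u) <ᵇ ℓ (m (n u)))) →
            Tm m (Tm n f) u ≡ Tm n (Tm m f) u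
  Tm-comm m n f u c i sq = go (m u ≟ n u)
    where
    go : Dec (m u ≡ n u) → Tm m (Tm n f) u ≡ Tm n (Tm m f) u
    go (yes p) = cong₂ (λ z z' → h (ℓ u <ᵇ ℓ z) (h (ℓ u <ᵇ ℓ z') (f u) (f z')) (h (ℓ z <ᵇ ℓ (n z)) (f z) (f (n z)))) p (sym p)
                   ∙ cong (λ z → h (ℓ u <ᵇ ℓ (n u)) (h (ℓ u <ᵇ ℓ (m u)) (f u) (f (m u))) (h (ℓ (n u) <ᵇ ℓ z) (f (n u)) (f z)))
                       (sym (trans c (cong n p)))
      where
      infixr 5 _∙_
      _∙_ : ∀ {A : Set} {x y z : A} → x ≡ y → y ≡ z → x ≡ z
      _∙_ = trans
    go (no p) = trans (cong₂ (λ b z → h (ℓ u <ᵇ ℓ (m u)) (h (ℓ u <ᵇ ℓ (n u)) (f u) (f (n u))) (h b (f (m u)) (f z)))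
                       (trans (cong (λ z → ℓ (m u) <ᵇ ℓ z) (sym c)) (sym (proj₂ (sq p)))) (sym c))
               (trans (h-swap (ℓ u <ᵇ ℓ (m u)) (ℓ u <ᵇ ℓ (n u)) (f u) (f (n u)) (f (m u)) (f (m (n u))))
                 (cong (λ b → h (ℓ u <ᵇ ℓ (n u)) (h (ℓ u <ᵇ ℓ (m u)) (f u) (f (m u))) (h b (f (n u)) (f (m (n u)))))
                     (proj₁ (sq p))))

  LR-comm : ∀ {s t} → S s → S t → ∀ f u → Tm (s ·_) (Tm (_· t) f) u ≡ Tm (_· t) (Tm (s ·_) f) u
  LR-comm {s} {t} σ τ f u = Tm-comm (s ·_) (_· t) f u (sym (assoc s u t)) (scR u τ) sq
    where
    sut = assoc s u t
    sq : ¬ s · u ≡ u · t → (ℓ u <ᵇ ℓ (s · u)) ≡ (ℓ (u · t) <ᵇ ℓ (s · (u · t))) × (ℓ u <ᵇ ℓ (u · t)) ≡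
        (ℓ (s · u) <ᵇ ℓ (s · (u · t)))
    sq n = square (stepL u σ) (stepR u τ) (subst (λ z → ℓ (s · u) ∼ ℓ z) sut (stepR (s · u) τ)) (stepL (u · t) σ)
      (λ a b c → n (Basics.exch (op Y) τ (⋖up σ a) b (trans a (cong suc (trans (sym c) (cong ℓ (sym sut)))))))
      (λ a b c → n (trans (cong (s ·_) (exch σ (Basics.dn≤ (op Y) τ b , b) (trans c b) a)) (sc (u · t) σ)))

-- Ordinary R-polynomials

-- The ordinary R-polynomials evaluated at q; the entry F w u is R_{u,w}.
record IsR (Y : Sys) (q : ℤ) (F : Sys.W Y → Sys.W Y → ℤ) : Set where
  open Sys Y
  open Ops Y q
  open Products Y using (DnL; DnR)
  field
    Fe  : F e e ≡ + 1
    F0  : ∀ {u} → ¬ u ≡ e → F e u ≡ + 0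
    Fl  : ∀ {s w} → S s → DnL s w → ∀ u → F w u ≡ Tm (s ·_) (F (s · w)) u
    Fr  : ∀ {s w} → S s → DnR w s → ∀ u → F w u ≡ Tm (_· s) (F (w · s)) u

opR : ∀ {Y q F} → IsR Y q F → IsR (op Y) q F
opR I = record { Fe = Fe ; F0 = F0 ; Fl = Fr ; Fr = Fl }
  where open IsR I

module Dihedral (Y : Sys) (q : ℤ) (a t : Sys.W Y) (α : Sys.S Y a) (τ : Sys.S Y t) (a≢t : ¬ a ≡ t) where
  open Sys Y
  open Products Y
  open Ops Y q
  open Dih Y a t α τ a≢t

  IsDih : W → (W → ℤ) → Set
  IsDih v f = ∀ u → (u ≤ v → f u ≡ r (ℓ v ∸ ℓ u)) × (¬ u ≤ v → f u ≡ + 0)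

  private
    gap-cases : ∀ {m n} → m ≤ℕ n → n ≡ m ⊎ n ≡ suc m ⊎ ∃ λ k → n ≡ suc (suc (k +ℕ m))
    gap-cases {m} {n} p = go (n ∸ m) (sym (ℕₚ.m∸n+n≡m p))
      where
      go : ∀ k → n ≡ k +ℕ m → n ≡ m ⊎ n ≡ suc m ⊎ ∃ λ k → n ≡ suc (suc (k +ℕ m))
      go 0 e = inj₁ e
      go 1 e = inj₂ (inj₁ e)
      go (suc (suc k)) e = inj₂ (inj₂ (k , e))

    gap : ∀ k m → k +ℕ m ∸ m ≡ k
    gap k m = ℕₚ.m+n∸n≡m k m

  -- For a gap of 0 or 1 between u and v, x is not below v and its term vanishes, which produces the
  -- values of `r` at 1 and 2; from gap 2 on the recursion of `r` takes over.
  dih-up : ∀ {v w u x f} → IsDih v f → In v → ℓ w ≡ suc (ℓ v) → u ≤ v → In x → ℓ x ≡ suc (ℓ u) → ¬ x ≡ v →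
           (q - + 1) * f u + q * f x ≡ r (ℓ w ∸ ℓ u)
  dih-up {v} {w} {u} {x} {f} D iv lw uv ix lx x≢v = go (gap-cases (≤ℓ uv))
    where
    p = q - + 1
    fu : ∀ k → ℓ v ≡ k +ℕ ℓ u → f u ≡ r k
    fu k e = trans (proj₁ (D u) uv) (cong r (trans (cong (_∸ ℓ u) e) (gap k (ℓ u))))
    fin : ∀ k → ℓ v ≡ k +ℕ ℓ u → r (suc k) ≡ r (ℓ w ∸ ℓ u)
    fin k e = cong r (sym (trans (cong (_∸ ℓ u) (trans lw (cong suc e))) (gap (suc k) (ℓ u))))
    fx0 : ℓ v ≤ℕ ℓ x → f x ≡ + 0
    fx0 l = proj₂ (D x) λ xv → x≢v (≤≡ xv l)
    lem₀ : ∀ q → (q - + 1) * + 1 + q * + 0 ≡ q - + 1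
    lem₀ = solve-∀
    lem₁ : ∀ q → (q - + 1) * (q - + 1) + q * + 0 ≡ (q - + 1) * (q - + 1)
    lem₁ = solve-∀
    go : ℓ v ≡ ℓ u ⊎ ℓ v ≡ suc (ℓ u) ⊎ ∃ (λ k → ℓ v ≡ suc (suc (k +ℕ ℓ u))) → p * f u + q * f x ≡ r (ℓ w ∸ ℓ u)
    go (inj₁ e) = trans (cong₂ (λ y z → p * y + q * z) (fu 0 e) (fx0 (subst₂ _≤ℕ_ (sym e) (sym lx) (ℕₚ.n≤1+n _))))
        (trans (lem₀ q) (fin 0 e))
    go (inj₂ (inj₁ e)) = trans (cong₂ (λ y z → p * y + q * z) (fu 1 e) (fx0 (ℕₚ.≤-reflexive (trans e (sym lx)))))
        (trans (lem₁ q) (fin 1 e))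
    go (inj₂ (inj₂ (k , e))) = trans (cong₂ (λ y z → p * y + q * z) (fu (suc (suc k)) e) fx) (fin (suc (suc k)) e)
      where
      fx : f x ≡ r (suc k)
      fx = trans (proj₁ (D x) (dih2 ix iv (subst₂ _<_ (sym lx) (sym e) (s≤s (s≤s (ℕₚ.m≤n+m (ℓ u) k))))))
             (cong r (trans (cong₂ _∸_ e lx) (gap (suc k) (ℓ u))))

  dih-step : ∀ {s v f} → K s → In v → UpL s v → IsDih v f → IsDih (s · v) (Tm (s ·_) f)
  dih-step {s} {v} {f} Ks iv up D u = go (stepL u σ)
    where
    σ = Sof Ks
    go : UpL s u ⊎ DnL s u → (u ≤ s · v → Tm (s ·_) f u ≡ r (ℓ (s · v) ∸ ℓ u)) × (¬ u ≤ s · v → Tm (s ·_) f u ≡ + 0)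
    go (inj₁ uu) = yes' , no'
      where
      yes' : u ≤ s · v → Tm (s ·_) f u ≡ r (ℓ (s · v) ∸ ℓ u)
      yes' p = trans (Tm-up (s ·_) f u uu) (dih-up {w = s · v} D iv up uv (In-cons σ Ks (In-≤ uv iv)) uu
          (λ q → dnup (subst (DnL s) q (up⇒dn σ uu)) up))
        where
        uv : u ≤ v
        uv = up-mono σ p up uu
      no' : ¬ u ≤ s · v → Tm (s ·_) f u ≡ + 0
      no' n = Tm-0 (s ·_) f u (proj₂ (D u) λ p → n (≤t p (upL σ up)))
          (proj₂ (D (s · u)) λ p → n (≤t (upL σ uu) (≤t p (upL σ up))))
    go (inj₂ du) = yes' , no'
      where
      yes' : u ≤ s · v → Tm (s ·_) f u ≡ r (ℓ (s · v) ∸ ℓ u)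
      yes' p = trans (Tm-dn (s ·_) f u du) (trans (proj₁ (D (s · u)) (subst (s · u ≤_) (sc v σ) (liftdd σ p (up⇒dn σ up) du)))
                 (cong r (sym (cong₂ _∸_ up du))))
      no' : ¬ u ≤ s · v → Tm (s ·_) f u ≡ + 0
      no' n = trans (Tm-dn (s ·_) f u du) (proj₂ (D (s · u)) λ p → n (subst (_≤ s · v) (sc u σ) (monoL σ p up)))

  IsDih-cong : ∀ {v f g} → (∀ u → f u ≡ g u) → IsDih v f → IsDih v g
  IsDih-cong eq D u = (λ p → trans (sym (eq u)) (proj₁ (D u) p)) , (λ p → trans (sym (eq u)) (proj₂ (D u) p))

  -- Only one recursion per element is assumed, because `Construct` applies the formula before
  -- independence of the chosen descent is known.
  formula : (F : W → W → ℤ) → F e e ≡ + 1 → (∀ {u} → ¬ u ≡ e → F e u ≡ + 0) →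
            (∀ w → ¬ w ≡ e → ∃ λ s → S s × DnL s w × (∀ u → F w u ≡ Tm (s ·_) (F (s · w)) u)) →
            ∀ v → In v → IsDih v (F v)
  formula F F1 F0 chosen v i = go (ℓ v) v refl i (v ≟ e)
    where
    go : ∀ n v → ℓ v ≡ n → In v → Dec (v ≡ e) → IsDih v (F v)
    go n v q i (yes refl) u = (λ p → trans (cong (F e) (≤e p))
        (trans F1 (cong r (sym (trans (cong (_∸ ℓ u) ℓe) (ℕₚ.0∸n≡0 (ℓ u)))))))
                            , (λ n → F0 λ p → n (subst (_≤ e) (sym p) ≤r))
    go zero v q i (no ne) = ⊥-elim (ne (ℓ0 q))
    go (suc n) v q i (no ne) = at (chosen v ne)
      where
      at : (∃ λ s → S s × DnL s v × (∀ u → F v u ≡ Tm (s ·_) (F (s · v)) u)) → IsDih v (F v)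
      at (s , σ , d , f) = IsDih-cong {v} (λ u → sym (f u))
        (subst (λ z → IsDih z (Tm (s ·_) (F (s · v)))) (sc v σ)
          (dih-step (In-dn σ i d) (In-≤ (dn≤ σ d) i) (dn⇒up σ d)
            (go n (s · v) (ℕₚ.suc-injective (trans (sym d) q)) (In-≤ (dn≤ σ d) i) ((s · v) ≟ e))))

-- Existence: the recursion along a chosen left descent satisfies all left and right recursions.
module Construct (Y : Sys) (q' : ℤ) where
  open Sys Y
  open Products Y
  open Descents Y using (suffix-dn)
  open Ops Y q'

  private
    δ′ : ∀ {u} → Dec (u ≡ e) → ℤ
    δ′ (yes _) = + 1
    δ′ (no _) = + 0

    δ : W → ℤ
    δ u = δ′ (u ≟ e)

    δ0 : ∀ {u} → ¬ u ≡ e → δ u ≡ + 0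
    δ0 {u} n = go (u ≟ e)
      where
      go : (d : Dec (u ≡ e)) → δ′ d ≡ + 0
      go (yes p) = ⊥-elim (n p)
      go (no _) = refl

    δ1 : δ e ≡ + 1
    δ1 = go (e ≟ e)
      where
      go : (d : Dec (e ≡ e)) → δ′ d ≡ + 1
      go (yes _) = refl
      go (no n) = ⊥-elim (n refl)

    pick : ∀ w → w ≡ e ⊎ ∃ λ s → S s × DnL s w
    pick w = go (w ≟ e)
      where
      go : Dec (w ≡ e) → w ≡ e ⊎ ∃ λ s → S s × DnL s w
      go (yes p) = inj₁ p
      go (no p) = inj₂ (descL w p)

    next : (W → W → ℤ) → ∀ {w} → w ≡ e ⊎ ∃ (λ s → S s × DnL s w) → W → ℤ
    next g (inj₁ _) = δ
    next g {w} (inj₂ (s , _)) = Tm (s ·_) (g (s · w))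

    fuel : ℕ → W → W → ℤ
    fuel zero w = δ
    fuel (suc n) w = next (fuel n) (pick w)

  F : W → W → ℤ
  F w = fuel (ℓ w) w

  private
    F-e : ∀ u → F e u ≡ δ u
    F-e u = cong (λ n → fuel n e u) ℓe

    Chosen : W → (W → ℤ) → Set
    Chosen w f = ∃ λ s → S s × DnL s w × (∀ u → f u ≡ Tm (s ·_) (F (s · w)) u)

    chosen : ∀ w → ¬ w ≡ e → Chosen w (F w)
    chosen w ne = go (ℓ w) refl
      where
      at : ∀ n → (p : w ≡ e ⊎ ∃ (λ s → S s × DnL s w)) → ℓ w ≡ suc n → Chosen w (next (fuel n) p)
      at n (inj₁ p) q = ⊥-elim (ne p)
      at n (inj₂ (s , σ , d)) q = s , σ , d , λ u → cong (λ k → Tm (s ·_) (fuel k (s · w)) u) (ℕₚ.suc-injective (trans (sym q) d))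
      go : ∀ n → ℓ w ≡ n → Chosen w (F w)
      go zero q = ⊥-elim (ne (ℓ0 q))
      go (suc n) q = shift (at n (pick w) q)
        where
        shift : Chosen w (fuel (suc n) w) → Chosen w (F w)
        shift (s , σ , d , f) = s , σ , d , λ u → trans (cong (λ k → fuel k w u) q) (f u)

    LeftAt RightAt : W → Set
    LeftAt w = ∀ {s} → S s → DnL s w → ∀ u → F w u ≡ Tm (s ·_) (F (s · w)) u
    RightAt w = ∀ {s} → S s → DnR w s → ∀ u → F w u ≡ Tm (_· s) (F (w · s)) u

    module Step (w : W) (ih : ∀ {v} → ℓ v < ℓ w → LeftAt v × RightAt v) where
      -- Both sides reduce to the entry at s·w·t, and left and right recursion operators commute.
      link : ∀ {s t} → S s → S t → DnL s w → DnR w t → ¬ s · w ≡ w · t →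
             ∀ u → Tm (s ·_) (F (s · w)) u ≡ Tm (_· t) (F (w · t)) u
      link {s} {t} σ τ ds dt n u = trans (Tm-cong (s ·_) (F (s · w)) (Tm (_· t) (F ((s · w) · t))) u (right u)
          (right (s · u))) (trans (LR-comm σ τ (F ((s · w) · t)) u)
                                     (sym (Tm-cong (_· t) (F (w · t)) (Tm (s ·_) (F ((s · w) · t))) u (left u) (left (u · t)))))
        where
        dnR : DnR (s · w) t
        dnR = Basics.¬up⇒dn (op Y) τ λ up → n (trans (sym (scR (s · w) τ)) (cong (_· t)
                (sym (Basics.exch (op Y) τ (dn≤ σ ds , ds) up dt))))
        dnL : DnL s (w · t)
        dnL = ¬up⇒dn σ λ up → n (trans (cong (s ·_) (exch σ (Basics.dn≤ (op Y) τ dt , dt) up ds)) (sc (w · t) σ))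
        right : ∀ u → F (s · w) u ≡ Tm (_· t) (F ((s · w) · t)) u
        right = proj₂ (ih (ℕₚ.≤-reflexive (sym ds))) τ dnR
        left : ∀ u → F (w · t) u ≡ Tm (s ·_) (F ((s · w) · t)) u
        left u = subst (λ z → F (w · t) u ≡ Tm (s ·_) (F z) u) (sym (assoc s w t)) (proj₁ (ih (ℕₚ.≤-reflexive (sym dt))) σ dnL u)

      -- Now s·w·t is w again and gives no reduction. Choose another left descent p of w. If w lies
      -- in ⟨s,p⟩, both sides depend on lengths only. Otherwise a right descent g of its minimal
      -- coset representative allows three uses of `link`: s with g, g with p, p with t.
      same : ∀ {s t} → S s → S t → DnL s w → DnR w t → s · w ≡ w · t →
             ∀ u → Tm (s ·_) (F (s · w)) u ≡ Tm (_· t) (F (w · t)) u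
      same {s} {t} σ τ ds dt q u = go (v ≟ e)
        where
        v = s · w
        w≡ : w ≡ v · t
        w≡ = trans (sym (scR w τ)) (cong (_· t) (sym q))
        at : (∃ λ p → S p × DnL p v) → Tm (s ·_) (F (s · w)) u ≡ Tm (_· t) (F (w · t)) u
        at (p , π , dpv) = cases (h' ≟ e)
          where
          upt : UpR v t
          upt = trans (cong ℓ (sym w≡)) (trans dt (cong (λ z → suc (ℓ z)) (sym q)))
          dp : DnL p w
          dp = subst (DnL p) (sym w≡) (prefix-dn v t π (trans upt (trans (ℕₚ.+-comm 1 _) (cong (ℓ v +ℕ_) (sym (ℓS τ))))) dpv)
          s≢p : ¬ s ≡ p
          s≢p refl = dnup dpv (dn⇒up σ ds)
          open Dih Y s p σ π s≢p
          open Split (decomp w) renaming (h to h')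
          cases : Dec (h' ≡ e) → Tm (s ·_) (F (s · w)) u ≡ Tm (_· t) (F (w · t)) u
          cases (yes he) = dihedral
            where
            iw : In w
            iw = subst In (sym (trans eq (trans (cong (d ·_) he) (idʳ d)))) inD
            Kt' : K t
            Kt' = iw τ (Basics.dn⇒≤ (op Y) τ dt)
            iv : In v
            iv = In-≤ (dn≤ σ ds) iw
            D₁ = Dihedral.dih-step Y q' s p σ π s≢p Ka iv (dn⇒up σ ds)
                (Dihedral.formula Y q' s p σ π s≢p F (trans (F-e e) δ1) (λ {u} n → trans (F-e u) (δ0 n)) chosen v iv)
            -- `IsDih` speaks of order and length only, so the formula for F v serves the mirrored
            -- step unchanged.
            D₂ = Dihedral.dih-step (op Y) q' s p σ π s≢p Kt' iv upt
                (Dihedral.formula Y q' s p σ π s≢p F (trans (F-e e) δ1) (λ {u} n → trans (F-e u) (δ0 n)) chosen v iv)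
            dihedral : Tm (s ·_) (F (s · w)) u ≡ Tm (_· t) (F (w · t)) u
            dihedral = trans (by (u ≤? w)) (cong (λ z → Tm (_· t) (F z) u) q)
              where
              by : Dec (u ≤ w) → Tm (s ·_) (F v) u ≡ Tm (_· t) (F v) u
              by (yes uw) = trans (proj₁ (D₁ u) (subst (u ≤_) (sym (sc w σ)) uw))
                  (trans (cong (λ z → r (ℓ z ∸ ℓ u)) (trans (sc w σ) w≡)) (sym (proj₁ (D₂ u) (subst (u ≤_) w≡ uw))))
              by (no n) = trans (proj₂ (D₁ u) (λ z → n (subst (u ≤_) (sc w σ) z)))
                  (sym (proj₂ (D₂ u) (λ z → n (subst (u ≤_) (sym w≡) z))))
          cases (no hne) = with-g (descR h' hne)
            where
            with-g : (∃ λ g → S g × DnR h' g) → Tm (s ·_) (F (s · w)) u ≡ Tm (_· t) (F (w · t)) u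
            with-g (g , γ , dg) = trans (link σ γ ds dwg (λ z → g≢t (canL w (trans (sym z) q))) u)
                (trans (sym (link π γ dp dwg pw≢ u)) (link π τ dp dt (λ z → s≢p (canR w (trans q (sym z)))) u))
              where
              dwg : DnR w g
              dwg = subst (λ z → DnR z g) (sym eq) (suffix-dn d h' γ (add minH d inD) dg)
              v≡ : v ≡ (s · d) · h'
              v≡ = trans (cong (s ·_) eq) (sym (assoc s d h'))
              dvg : DnR v g
              dvg = subst (λ z → DnR z g) (sym v≡) (suffix-dn (s · d) h' γ (add minH (s · d) (In-cons σ Ka inD)) dg)
              g≢t : ¬ g ≡ t
              g≢t refl = Basics.dnup (op Y) dvg upt
              pw≢ : ¬ p · w ≡ w · g
              pw≢ z = ℕₚ.<-irrefl (cong ℓ (uniq (In-· (In-cons π Kt inD) (inv d) (In-inv d inD)) minH (min-right γ minH dg)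
                        (trans (trans (sym (idˡ _)) (trans (cong (_· (h' · g)) (sym (invˡ d))) (assoc (inv d) d _)))
                          (trans (cong (inv d ·_) (trans (sym (assoc d h' g)) (trans (cong (_· g) (sym eq)) (trans (sym z)
                            (trans (cong (p ·_) eq) (sym (assoc p d h')))))))
                            (sym (assoc (inv d) (p · d) h')))))) (ℕₚ.≤-reflexive (sym dg))
        go : Dec (v ≡ e) → Tm (s ·_) (F (s · w)) u ≡ Tm (_· t) (F (w · t)) u
        go (no ne) = at (descL v ne)
        go (yes ve) = trans (cong (λ z → Tm (s ·_) (F z) u) ve) (trans base (cong (λ z → Tm (_· t) (F z) u) (trans (sym ve) q)))
          where
          s≡t : t ≡ s
          s≡t = trans (sym (trans w≡ (trans (cong (_· t) ve) (idˡ t)))) (trans (mvL σ ve) (idʳ s))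
          cs : Dec (u ≡ e) → Dec (u ≡ s) → Tm (s ·_) (F e) u ≡ Tm (_· s) (F e) u
          cs (yes refl) _ = cong (λ z → h (ℓ e <ᵇ ℓ z) (F e e) (F e z)) (trans (idʳ s) (sym (idˡ s)))
          cs (no _) (yes refl) = refl
          cs (no n) (no m) = trans (Tm-0 (s ·_) (F e) u (f0 n) (f0 λ z → m (trans (mvL σ z) (idʳ s))))
                               (sym (Tm-0 (_· s) (F e) u (f0 n) (f0 λ z → m (trans (Basics.mvL (op Y) σ z) (idˡ s)))))
            where
            f0 : ∀ {u} → ¬ u ≡ e → F e u ≡ + 0
            f0 {u} n = trans (F-e u) (δ0 n)
          base : Tm (s ·_) (F e) u ≡ Tm (_· t) (F e) u
          base = subst (λ z → Tm (s ·_) (F e) u ≡ Tm (_· z) (F e) u) (sym s≡t) (cs (u ≟ e) (u ≟ s))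

      LR : ∀ {s t} → S s → S t → DnL s w → DnR w t → ∀ u → Tm (s ·_) (F (s · w)) u ≡ Tm (_· t) (F (w · t)) u
      LR {s} {t} σ τ ds dt u = go ((s · w) ≟ (w · t))
        where
        go : Dec (s · w ≡ w · t) → Tm (s ·_) (F (s · w)) u ≡ Tm (_· t) (F (w · t)) u
        go (yes q) = same σ τ ds dt q u
        go (no n) = link σ τ ds dt n u

      both : LeftAt w × RightAt w
      both = go (w ≟ e)
        where
        go : Dec (w ≡ e) → LeftAt w × RightAt w
        go (yes refl) = (λ σ d → ⊥-elim (ℕₚ.1+n≢0 (trans (sym d) ℓe))) , (λ σ d → ⊥-elim (ℕₚ.1+n≢0 (trans (sym d) ℓe)))
        go (no ne) = at (chosen w ne) (descR w ne)
          where
          at : (∃ λ s → S s × DnL s w × (∀ u → F w u ≡ Tm (s ·_) (F (s · w)) u)) → (∃ λ t → S t × DnR w t) → LeftAt w × RightAt w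
          at (s , σ , d , f) (t , τ , dt) = (λ σ' d' u → trans (f u) (trans (LR σ τ d dt u) (sym (LR σ' τ d' dt u))))
                                          , (λ τ' d' u → trans (f u) (LR σ τ' d d' u))

  isR : IsR Y q' F
  isR = record
    { Fe = trans (F-e e) δ1 ; F0 = λ {u} n → trans (F-e u) (δ0 n)
    ; Fl = λ {s} {w} → proj₁ (all w) ; Fr = λ {s} {w} → proj₂ (all w) }
    where
    all : ∀ w → LeftAt w × RightAt w
    all w = <-rec (λ n → ∀ w → ℓ w ≡ n → LeftAt w × RightAt w)
              (λ n ih w q → Step.both w (λ {v} lt → ih (subst (ℓ v <_) q lt) v refl)) (ℓ w) w refl

module Support (Y : Sys) (q' : ℤ) (F : Sys.W Y → Sys.W Y → ℤ) (I : IsR Y q' F) where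
  open Sys Y
  open Products Y
  open Ops Y q'
  open IsR I

  vanish : ∀ w {u} → ¬ u ≤ w → F w u ≡ + 0
  vanish w {u} = go (ℓ w) w u refl (w ≟ e)
    where
    go : ∀ n w u → ℓ w ≡ n → Dec (w ≡ e) → ¬ u ≤ w → F w u ≡ + 0
    go n w u q (yes refl) nu = F0 λ { refl → nu ≤r }
    go zero w u q (no ne) nu = ⊥-elim (ne (ℓ0 q))
    go (suc n) w u q (no ne) nu = at (descL w ne)
      where
      at : (∃ λ s → S s × DnL s w) → F w u ≡ + 0
      at (s , σ , d) = trans (Fl σ d u) (Tm-0 (s ·_) (F (s · w)) u (ih u λ p → nu (≤t p (dn≤ σ d)))
                         (ih (s · u) λ p → nu (subst (_≤ w) (sc u σ) (star σ (≤t p (dn≤ σ d)) d))))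
        where
        ih : ∀ u → ¬ u ≤ s · w → F (s · w) u ≡ + 0
        ih u = go n (s · w) u (ℕₚ.suc-injective (trans (sym d) q)) ((s · w) ≟ e)

module OrdStep (Y : Sys) (q' : ℤ) (F : Sys.W Y → Sys.W Y → ℤ) (I : IsR Y q' F)
               (w : Sys.W Y) (M : Sys.W Y → Sys.W Y) (sp : Special Y w M)
               (ih : ∀ {z} → Special Y z M → Sys.ℓ Y z < Sys.ℓ Y w →
                     ∀ {u} → Sys._≤_ Y u z → F z u ≡ Ops.Tm Y q' M (F (M z)) u) where
  open Sys Y
  open Products Y
  open Ops Y q'
  open IsR I
  open Match Y w M sp
  open Support Y q' F I

  top-down : Down w
  top-down = [ (λ U → ⊥-elim (ℕₚ.<-irrefl refl (ℕₚ.≤-trans (ℕₚ.≤-reflexive (sym (proj₂ (proj₂ U))))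
      (≤ℓ (closed ≤r))))) , (λ D → D) ]′ (dir ≤r)

  v : W
  v = M w

  v≤w : v ≤ w
  v≤w = closed ≤r

  ℓw : ℓ w ≡ suc (ℓ v)
  ℓw = proj₂ (proj₂ top-down)

  M∼ : ∀ {u} → u ≤ w → ℓ u ∼ ℓ (M u)
  M∼ p = [ (λ U → inj₁ (proj₂ (proj₂ U))) , (λ D → inj₂ (proj₂ (proj₂ D))) ]′ (dir p)

  comm-all : ∀ {p u} → S p → Comm p → u ≤ w → p · u ≤ w → p · M u ≡ M (p · u)
  comm-all {p} {u} π C uw puw = go (stepL u π)
    where
    go : UpL p u ⊎ DnL p u → p · M u ≡ M (p · u)
    go (inj₁ up) = sym (C up puw)
    go (inj₂ dn) = sym (mvL π (trans (sym (C (dn⇒up π dn) (subst (_≤ w) (sym (sc u π)) uw))) (cong M (sc u π))))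

  M-comm : ∀ {p} → S p → Comm p → ∀ f {u} → u ≤ w → p · u ≤ w → Tm (p ·_) (Tm M f) u ≡ Tm M (Tm (p ·_) f) u
  M-comm {p} π C f {u} uw puw = Tm-comm (p ·_) M f u c (invol uw) sq
    where
    c : p · M u ≡ M (p · u)
    c = comm-all π C uw puw
    sq : ¬ p · u ≡ M u → (ℓ u <ᵇ ℓ (p · u)) ≡ (ℓ (M u) <ᵇ ℓ (p · M u)) × (ℓ u <ᵇ ℓ (M u)) ≡ (ℓ (p · u) <ᵇ ℓ (p · M u))
    sq n = square (stepL u π) (M∼ uw) (subst (λ z → ℓ (p · u) ∼ ℓ z) (sym c) (M∼ puw)) (stepL (M u) π)
      (λ a b d → n (sym (exch π (proj₂ (U b)) a (trans b (cong suc (sym d))))))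
      (λ a b d → n (trans (cong (p ·_) (exch π (proj₂ (D b)) (trans d b) a)) (sc (M u) π)))
      where
      U : ℓ (M u) ≡ suc (ℓ u) → Up u
      U b = ¬down⇒up uw λ D → ℕₚ.<-asym (ℕₚ.≤-reflexive (sym b)) (ℕₚ.≤-reflexive (sym (proj₂ (proj₂ D))))
      D : ℓ u ≡ suc (ℓ (M u)) → Down u
      D b = [ (λ U → ⊥-elim (ℕₚ.<-asym (ℕₚ.≤-reflexive (sym b)) (ℕₚ.≤-reflexive (sym (proj₂ (proj₂ U)))))) , (λ D → D) ]′ (dir uw)

  -- A left descent p of v commuting with M is a left descent of w, and the recursions for p and M commute.
  reduce : ∀ {p} → S p → DnL p v → Comm p → ∀ {u} → u ≤ w → F w u ≡ Tm M (F v) u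
  reduce {p} π dp C {u} uw =
    trans (trans (Fl π dw u) (cong (λ z → Tm (p ·_) (F z) u) pw≡))
      (trans (Tm-cong (p ·_) (F w') (Tm M (F z₀)) u (ext uw) (ext puw))
        (trans (M-comm π C (F z₀) uw puw)
          (sym (Tm-cong M (F v) (Tm (p ·_) (F z₀)) u (Fl π dp u) (Fl π dp (M u))))))
    where
    z₀ = p · v
    w' = M z₀
    z₀≤v : z₀ ≤ v
    z₀≤v = dn≤ π dp
    z₀≤w : z₀ ≤ w
    z₀≤w = ≤t z₀≤v v≤w
    w≡ : w ≡ p · w'
    w≡ = trans (sym (invol ≤r)) (trans (cong M (sym (sc v π))) (C (dn⇒up π dp) (subst (_≤ w) (sym (sc v π)) v≤w)))
    pw≡ : p · w ≡ w'
    pw≡ = trans (cong (p ·_) w≡) (sc w' π)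
    dw : DnL p w
    dw = lt⇒dn w π (ℕₚ.≤-trans (s≤s (ℕₚ.≤-trans (ℕₚ.≤-reflexive (cong ℓ pw≡)) (ℓM≤ z₀≤w)))
        (ℕₚ.≤-reflexive (sym (trans ℓw (cong suc dp)))))
    puw : p · u ≤ w
    puw = star π uw dw
    ℓw' : ℓ w' ≡ suc (ℓ z₀)
    ℓw' = trans (cong ℓ (sym pw≡)) (ℕₚ.suc-injective (trans (sym dw) (trans ℓw (cong suc dp))))
    D' : Down w'
    D' = M-up (¬down⇒up z₀≤w λ D → ℕₚ.<-asym (ℕₚ.≤-reflexive (sym ℓw')) (ℕₚ.≤-reflexive (sym (proj₂ (proj₂ D)))))
    sp' : Special Y w' M
    sp' = restrict D'
    z₀≤w' : z₀ ≤ w'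
    z₀≤w' = subst (_≤ w') (invol z₀≤w) (proj₁ (proj₂ D'))
    -- The points u and p·u are below w but perhaps not below w', where the induction hypothesis is
    -- silent; there both sides vanish.
    ext : ∀ {y} → y ≤ w → F w' y ≡ Tm M (F z₀) y
    ext {y} yw = go (y ≤? w')
      where
      go : Dec (y ≤ w') → F w' y ≡ Tm M (F z₀) y
      go (yes p) = trans (ih sp' (ℕₚ.≤-reflexive (sym (trans dw (cong suc (cong ℓ pw≡))))) p)
          (cong (λ z → Tm M (F z) y) (invol z₀≤w))
      go (no n) = trans (vanish w' n) (sym (Tm-0 M (F z₀) y (vanish z₀ λ q → n (≤t q z₀≤w'))
                    (vanish z₀ λ q → n (subst (_≤ w') (invol yw) (Special.closed sp' (≤t q z₀≤w'))))))

module Ord (Y : Sys) (q' : ℤ) (F : Sys.W Y → Sys.W Y → ℤ) (I : IsR Y q' F) where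
  open Sys Y
  open Products Y
  open Ops Y q'
  open IsR I

  ordinary : ∀ {w M} → Special Y w M → ∀ {u} → u ≤ w → F w u ≡ Tm M (F (M w)) u
  ordinary {w} {M} sp = <-rec P step (ℓ w) w refl sp
    where
    P : ℕ → Set
    P n = ∀ w → ℓ w ≡ n → Special Y w M → ∀ {u} → u ≤ w → F w u ≡ Tm M (F (M w)) u
    step : ∀ n → (∀ {m} → m < n → P m) → P n
    step n rec w q sp {u} uw = decide (F w u ℤₚ.≟ Tm M (F (M w)) u)
      where
      ih : ∀ {z} → Special Y z M → ℓ z < ℓ w → ∀ {u} → u ≤ z → F z u ≡ Tm M (F (M z)) u
      ih {z} s lt = rec (subst (ℓ z <_) q lt) z refl s
      open Half Y w M sp
      open OrdStep Y q' F I w M sp ih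
      module O = OrdStep (op Y) q' F (opR I) w M (opS sp) (λ s → ih (opS s))
      Goal = F w u ≡ Tm M (F v) u
      supp : ∀ {t} → Supp2 a t v → Supp2 a t w
      supp i σ p = [ inj₁ , i σ ]′ (M-supp σ v≤w (subst (_ ≤_) (sym (invol ≤r)) p))
      single : Supp2 a a w → Goal
      single i = subst (λ z → F z u ≡ Tm M (F (M z)) u) (sym w≡a)
                   (trans (Fl a-S (dn-self a-S) u) (trans (cong (λ z → Tm (a ·_) (F z) u) (trans (SS a-S) (sym (invol (e≤ w)))))
                     (cong (λ z → h (ℓ u <ᵇ ℓ z) (F (M a) u) (F (M a) z)) (sym Mu))))
        where
        only-a : ∀ {s} → S s → s ≤ w → s ≡ a
        only-a σ p = [ (λ z → z) , (λ z → z) ]′ (i σ p)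
        w≡a : w ≡ a
        w≡a = at (descL w λ z → S≢e a-S (≤e (subst (a ≤_) z a≤w)))
          where
          at : (∃ λ s → S s × DnL s w) → w ≡ a
          at (s , σ , d) = fin ((s · w) ≟ e)
            where
            s≡a = only-a σ (dn⇒≤ σ d)
            fin : Dec (s · w ≡ e) → w ≡ a
            fin (yes z) = trans (mvL σ z) (trans (idʳ s) s≡a)
            fin (no n) = at' (descL (s · w) n)
              where
              at' : (∃ λ g → S g × DnL g (s · w)) → w ≡ a
              at' (g , γ , dg) = ⊥-elim (dnup dg (subst (λ z → UpL z (s · w))
                  (trans s≡a (sym (only-a γ (≤t (dn⇒≤ γ dg) (dn≤ σ d))))) (dn⇒up σ d)))
        Mu : M u ≡ a · u
        Mu = [ (λ z → trans (cong M z) (trans (sym (idʳ a)) (cong (a ·_) (sym z))))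
             , (λ z → trans (cong M z) (trans (invol (e≤ w)) (trans (sym (SS a-S)) (cong (a ·_) (sym z))))) ]′
               (≤s a-S (subst (u ≤_) w≡a uw))
      dihedral : ∀ {t} → S t → ¬ a ≡ t → Supp2 a t w → Goal
      dihedral {t} τ a≢t i = go (dir uw)
        where
        open Dih Y a t a-S τ a≢t using (In; In-≤)
        module D = Dihedral Y q' a t a-S τ a≢t
        form : ∀ v → In v → D.IsDih v (F v)
        form = D.formula F Fe (λ {u} → F0 {u}) λ w ne → lift (descL w ne)
          where
          lift : ∀ {w} → ∃ (λ s → S s × DnL s w) → ∃ λ s → S s × DnL s w × (∀ u → F w u ≡ Tm (s ·_) (F (s · w)) u)
          lift (s , σ , d) = s , σ , d , Fl σ d
        iw : In w
        iw = i
        go : Up u ⊎ Down u → Goal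
        go (inj₁ U) = trans (proj₁ (form w iw u) uw) (sym (trans (Tm-up M (F v) u (proj₂ (proj₂ U)))
            (D.dih-up {w = w} (form v (In-≤ v≤w iw)) (In-≤ v≤w iw) ℓw (M-lift uw U top-down) (In-≤ (closed uw) iw)
                (proj₂ (proj₂ U))
              (λ z → up-down U (subst Down (trans (sym (invol ≤r)) (trans (cong M (sym z)) (invol uw))) top-down)))))
        go (inj₂ D) = trans (proj₁ (form w iw u) uw) (sym (trans (Tm-dn M (F v) u (proj₂ (proj₂ D)))
            (trans (proj₁ (form v (In-≤ v≤w iw) (M u)) (M-lift (closed uw) (M-down D) top-down))
                (cong r (sym (cong₂ _∸_ ℓw (proj₂ (proj₂ D))))))))
      decide : Dec Goal → Goal
      decide (yes g) = g
      -- Assuming the goal fails, no descent of v on either side commutes with M, by `reduce`, and v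
      -- lies in no dihedral subgroup containing a, by the length formula; `Core` refutes this
      -- combination.
      decide (no n) = ⊥-elim (Core.core Y w M sp v v≤w (λ U → M-lift (proj₁ U) U top-down)
          (λ σ d C → n (reduce σ d (λ {u} → C {u}) uw)) (λ σ d C → n (O.reduce σ d (λ {u} → C {u}) uw))
          λ {t} τ i → by τ i (a ≟ t))
        where
        by : ∀ {t} → S t → Supp2 a t v → Dec (a ≡ t) → ⊥
        by τ i (yes refl) = n (single (supp i))
        by τ i (no a≢t) = n (dihedral τ a≢t (supp i))

-- Finite sums and reindexing

module Sums {A : Set} (_≟_ : (x y : A) → Dec (x ≡ y)) where
  ∑ : List A → (A → ℤ) → ℤ
  ∑ [] f = + 0
  ∑ (y ∷ l) f = f y + ∑ l f

  ∑-cong : ∀ l (f g : A → ℤ) → (∀ {y} → y ∈ l → f y ≡ g y) → ∑ l f ≡ ∑ l g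
  ∑-cong [] f g p = refl
  ∑-cong (y ∷ l) f g p = cong₂ _+_ (p (here refl)) (∑-cong l f g λ m → p (there m))

  ∑-zero : ∀ l (f : A → ℤ) → (∀ {y} → y ∈ l → f y ≡ + 0) → ∑ l f ≡ + 0
  ∑-zero [] f p = refl
  ∑-zero (y ∷ l) f p = cong₂ _+_ (p (here refl)) (∑-zero l f λ m → p (there m))

  ∑-add : ∀ l (f g : A → ℤ) → ∑ l (λ y → f y + g y) ≡ ∑ l f + ∑ l g
  ∑-add [] f g = refl
  ∑-add (y ∷ l) f g = trans (cong (λ z → f y + g y + z) (∑-add l f g)) (lem (f y) (g y) (∑ l f) (∑ l g))
    where
    lem : ∀ a b c d → a + b + (c + d) ≡ a + c + (b + d)
    lem = solve-∀

  ∑-scale : ∀ l c (f : A → ℤ) → ∑ l (λ y → c * f y) ≡ c * ∑ l f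
  ∑-scale [] c f = sym (ℤₚ.*-zeroʳ c)
  ∑-scale (y ∷ l) c f = trans (cong (λ z → c * f y + z) (∑-scale l c f)) (sym (ℤₚ.*-distribˡ-+ c (f y) (∑ l f)))

  ∑-swap : ∀ l l' (f : A → A → ℤ) → ∑ l (λ y → ∑ l' (f y)) ≡ ∑ l' (λ z → ∑ l (λ y → f y z))
  ∑-swap [] l' f = sym (∑-zero l' (λ _ → + 0) λ _ → refl)
  ∑-swap (y ∷ l) l' f = trans (cong (λ z → ∑ l' (f y) + z) (∑-swap l l' f)) (sym (∑-add l' (f y) (λ z → ∑ l (λ y → f y z))))

  ∑-single : ∀ {l y} (f : A → ℤ) → Unique l → y ∈ l → (∀ {z} → z ∈ l → ¬ z ≡ y → f z ≡ + 0) → ∑ l f ≡ f y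
  ∑-single {x ∷ l} f (a ∷ u) (here refl) p = trans (cong (λ z → f x + z)
      (∑-zero l f λ m → p (there m) λ { refl → All.lookup a m refl })) (ℤₚ.+-identityʳ (f x))
  ∑-single {x ∷ l} f (a ∷ u) (there m) p = trans (cong₂ _+_ (p (here refl) λ { refl → All.lookup a m refl })
      (∑-single f u m λ m' → p (there m'))) (ℤₚ.+-identityˡ _)

  private
    if= : ∀ {y z : A} → Dec (y ≡ z) → ℤ → ℤ
    if= (yes _) n = n
    if= (no _) n = + 0

    if=-yes : ∀ {y z} (d : Dec (y ≡ z)) n → y ≡ z → if= d n ≡ n
    if=-yes (yes _) n p = refl
    if=-yes (no q) n p = ⊥-elim (q p)

    if=-no : ∀ {y z} (d : Dec (y ≡ z)) n → ¬ y ≡ z → if= d n ≡ + 0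
    if=-no (yes p) n q = ⊥-elim (q p)
    if=-no (no _) n q = refl

    if=-0 : ∀ {y z} (d : Dec (y ≡ z)) → if= d (+ 0) ≡ + 0
    if=-0 (yes _) = refl
    if=-0 (no _) = refl

  ∑-reindex : ∀ {l l'} (m m' : A → A) (g : A → ℤ) → Unique l → Unique l' →
    (∀ {y} → y ∈ l → m y ∈ l' × m' (m y) ≡ y) → (∀ {z} → z ∈ l' → g z ≡ + 0 ⊎ m' z ∈ l × m (m' z) ≡ z) →
    ∑ l (λ y → g (m y)) ≡ ∑ l' g
  ∑-reindex {l} {l'} m m' g u u' to from =
    trans (∑-cong l _ (λ y → ∑ l' (D y)) λ {y} i → sym (trans
        (∑-single (D y) u' (proj₁ (to i)) λ {z} _ n → if=-no (m y ≟ z) (g z) λ p → n (sym p))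
                                                    (if=-yes (m y ≟ m y) (g (m y)) refl)))
      (trans (∑-swap l l' D) (∑-cong l' _ g λ {z} i → at z (from i)))
    where
    D : A → A → ℤ
    D y z = if= (m y ≟ z) (g z)
    at : ∀ z → g z ≡ + 0 ⊎ m' z ∈ l × m (m' z) ≡ z → ∑ l (λ y → D y z) ≡ g z
    at z (inj₁ p) = trans (∑-zero l (λ y → D y z) λ {y} _ → trans (cong (if= (m y ≟ z)) p) (if=-0 (m y ≟ z))) (sym p)
    at z (inj₂ (i , p)) = trans (∑-single (λ y → D y z) u i λ {y} j n → if=-no (m y ≟ z) (g z) λ q → n
        (trans (sym (proj₂ (to j))) (cong m' q)))
                            (if=-yes (m (m' z) ≟ z) (g z) p)

-- The iterates of y cannot all be distinct, and injectivity pulls a coincidence back to y, which is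
-- therefore one of its own iterates.
finite-surjective : ∀ {A : Set} (P : A → Set) (l : List A) (g : A → A) → (∀ {y} → P y → y ∈ l) → (∀ {y} → P y → P (g y)) →
  (∀ {y z} → P y → P z → g y ≡ g z → y ≡ z) → ∀ {y} → P y → ∃ λ z → P z × g z ≡ y
finite-surjective {A} P l g mem closed inj {y} py = from (pigeonhole (ℕₚ.n<1+n (length l)) (λ i → index (mem (P-it (toℕ i)))))
  where
  it : ℕ → A
  it zero = y
  it (suc k) = g (it k)
  P-it : ∀ k → P (it k)
  P-it zero = py
  P-it (suc k) = closed (P-it k)
  back : ∀ i k → it (i +ℕ k) ≡ it i → it k ≡ y
  back zero k p = p
  back (suc i) k p = back i k (inj (P-it (i +ℕ k)) (P-it i) p)
  from : (∃ λ i → ∃ λ j → toℕ i < toℕ j × index (mem (P-it (toℕ i))) ≡ index (mem (P-it (toℕ j)))) → ∃ λ z → P z × g z ≡ y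
  from (i , j , lt , q) = it k , P-it k , back (toℕ i) (suc k) (sym (trans eq (cong it (sym split))))
    where
    -- The period is `suc k`, which makes `it k` the preimage of y.
    k = toℕ j ∸ suc (toℕ i)
    split : toℕ i +ℕ suc k ≡ toℕ j
    split = trans (ℕₚ.+-suc (toℕ i) k) (ℕₚ.m+[n∸m]≡n lt)
    eq : it (toℕ i) ≡ it (toℕ j)
    eq = trans (lookup-index (mem (P-it (toℕ i)))) (trans (cong (lookup l) q) (sym (lookup-index (mem (P-it (toℕ j))))))

-- Cosets of W_H and parabolic R-polynomials

module Cosets (Y : Sys) (H : Sys.W Y → Set) (H? : ∀ s → Dec (H s)) where
  open Sys Y
  open Products Y
  private module O = Para (op Y) H H?

  In : W → Set
  In = O.In

  MinR : W → Set
  MinR u = ∀ {k} → S k → H k → UpR u k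

  pr : W → W
  pr y = O.Split.h (O.decomp y)

  pr-min : ∀ y → MinR (pr y)
  pr-min y = O.Split.minH (O.decomp y)

  pr-split : ∀ y → ∃ λ z → In z × y ≡ pr y · z
  pr-split y = O.Split.d (O.decomp y) , O.Split.inD (O.decomp y) , O.Split.eq (O.decomp y)

  pr-char : ∀ {u z} → MinR u → In z → pr (u · z) ≡ u
  pr-char {u} {z} m i = at (pr-split (u · z))
    where
    at : (∃ λ d → In d × u · z ≡ pr (u · z) · d) → pr (u · z) ≡ u
    at (d , j , q) = O.uniq (O.In-· i (inv d) (O.In-inv d j)) m (pr-min (u · z))
      (trans (sym (idʳ _)) (trans (cong (pr (u · z) ·_) (sym (invʳ d))) (trans (sym (assoc _ d (inv d)))
        (trans (cong (_· inv d) (sym q)) (assoc u z (inv d))))))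

  pr-fix : ∀ {u} → MinR u → pr u ≡ u
  pr-fix {u} m = trans (cong pr (sym (idʳ u))) (pr-char m O.In-e)

  add : ∀ {u z} → MinR u → In z → ℓ (u · z) ≡ ℓ u +ℕ ℓ z
  add {u} {z} m i = trans (O.add m z i) (ℕₚ.+-comm (ℓ z) (ℓ u))

  pr≤ : ∀ y → pr y ≤ y
  pr≤ y = at (pr-split y)
    where
    at : (∃ λ d → In d × y ≡ pr y · d) → pr y ≤ y
    at (d , j , q) = subst₂ _≤_ (idʳ (pr y)) (sym q) (mul≤ ≤r (e≤ d) (add (pr-min y) j))

  pr-mono : ∀ {y z} → y ≤ z → pr y ≤ pr z
  pr-mono {y} {z} p = at (pr-split y) (pr-split z)
    where
    at : (∃ λ d → In d × y ≡ pr y · d) → (∃ λ d → In d × z ≡ pr z · d) → pr y ≤ pr z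
    at (d , i , q) (d' , i' , q') = O.proj≤ i (pr-min y) i' (subst₂ _≤_ q q' p)

  below-pr : ∀ {u y} → MinR u → u ≤ y → u ≤ pr y
  below-pr m p = subst (_≤ pr _) (pr-fix m) (pr-mono p)

  module HSpecial (w : W) (M : W → W) (sp : Special Y w M)
                  (par : ∀ {u} → u ≤ w → MinR u → M u ⋖ u → MinR (M u)) where
    open Match Y w M sp

    private
      module Above {u y} (mu : MinR u) (Y↑ : Up y) (q : pr y ≡ u) where
        p : W
        p = pr (M y)
        p≤ : p ≤ M y
        p≤ = pr≤ (M y)
        p≤w : p ≤ w
        p≤w = ≤t p≤ (closed (proj₁ Y↑))
        y≥ : ∀ {z} → MinR z → z ≤ y → z ≤ u
        y≥ m z≤ = subst (_ ≤_) q (below-pr m z≤)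
        u≤p : u ≤ p
        u≤p = subst (_≤ p) q (pr-mono (proj₁ (proj₂ Y↑)))
        below-y : ∀ {z} → z ≤ M y → Up z → z ≤ y
        below-y r U = subst (_ ≤_) (invol (proj₁ Y↑)) (M-lift r U (M-up Y↑))
        case-up : Up p → p ≡ u
        case-up U = ≤-anti (y≥ (pr-min (M y)) (below-y p≤ U)) u≤p
        case-down : Down p → M p ≤ u
        case-down D = y≥ (par p≤w (pr-min (M y)) (proj₂ D)) (below-y (≤t (proj₁ (proj₂ D)) p≤) (M-down D))

    -- Lifting along M gives M u ≤ p for p = pr (M y). If p were matched upwards it would lie below
    -- y and hence below u. So it is matched downwards, and M p ≤ u bounds its length by that of M
    -- u.
    coset-up : ∀ {u y} → Up u → MinR u → MinR (M u) → y ≤ w → pr y ≡ u → Up y × pr (M y) ≡ M u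
    coset-up {u} {y} U mu mMu yw q = Y↑ , [ (λ P → ⊥-elim (Mu≰u (subst (M u ≤_) (case-up P) Mu≤p)))
        , (λ D → sym (≤≡ Mu≤p (subst₂ _≤ℕ_ (sym (proj₂ (proj₂ D))) (sym (proj₂ (proj₂ U)))
            (s≤s (≤ℓ (case-down D)))))) ]′ (dir p≤w)
      where
      u≤y : u ≤ y
      u≤y = subst (_≤ y) q (pr≤ y)
      Mu≰u : ¬ M u ≤ u
      Mu≰u z = ℕₚ.<-irrefl refl (ℕₚ.≤-trans (ℕₚ.≤-reflexive (sym (proj₂ (proj₂ U)))) (≤ℓ z))
      Y↑ : Up y
      Y↑ = ¬down⇒up yw λ D → Mu≰u (subst (M u ≤_) q (below-pr mMu (M-lift' u≤y U D)))
      open Above mu Y↑ q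
      Mu≤p : M u ≤ p
      Mu≤p = below-pr mMu (M-lift' (≤t u≤y (proj₁ (proj₂ Y↑))) U (M-up Y↑))

    -- For y matched upwards, a p = pr (M y) matched downwards would satisfy M p ≤ u; if p differs
    -- from u, lengths force M p = u, making M u = p minimal. For y matched downwards, lifting
    -- squeezes the projection from both sides.
    coset-fixed : ∀ {u y} → Up u → MinR u → ¬ MinR (M u) → y ≤ w → pr y ≡ u → pr (M y) ≡ u
    coset-fixed {u} {y} U mu nMu yw q = [ up-case , down-case ]′ (dir yw)
      where
      u≤y : u ≤ y
      u≤y = subst (_≤ y) q (pr≤ y)
      up-case : Up y → pr (M y) ≡ u
      up-case Y↑ = [ case-up , (λ D → ⊥-elim (bad D (u ≟ p))) ]′ (dir p≤w)
        where
        open Above mu Y↑ q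
        bad : Down p → Dec (u ≡ p) → ⊥
        bad D (yes r) = up-down U (subst Down (sym r) D)
        bad D (no n) = nMu λ {k} κ Hk → subst (λ z → UpR z k) (trans (sym (invol p≤w)) (cong M Mp≡u)) (pr-min (M y) κ Hk)
          where
          Mp≡u : M p ≡ u
          Mp≡u = ≤≡ (case-down D) (ℕₚ.≤-pred (ℕₚ.≤-trans (<ℓ u≤p n) (ℕₚ.≤-reflexive (proj₂ (proj₂ D)))))
      down-case : Down y → pr (M y) ≡ u
      down-case D = ≤-anti (subst (pr (M y) ≤_) q (pr-mono (proj₁ (proj₂ D)))) (below-pr mu (M-lift u≤y U D))

    -- z ↦ M (M u · u⁻¹ · z) is an injective self-map of the part of the coset of u below w
    coset-down : ∀ {u y} → Down u → MinR u → y ≤ w → pr y ≡ u → Down y × pr (M y) ≡ M u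
    coset-down {u} {y} D mu yw q = from (finite-surjective (λ y → y ≤ w × pr y ≡ u) (low w) g (λ A → ≤⇒∈low (proj₁ A))
                                          (λ A → closed (t≤w A) , trans (proj₂ (t-up A)) (invol (proj₁ D)))
                                          (λ A B r → canL (inv u) (canL u'
                                              (trans (sym (invol (t≤w A))) (trans (cong M r) (invol (t≤w B)))))) (yw , q))
      where
      u' = M u
      U' : Up u'
      U' = M-down D
      mu' : MinR u'
      mu' = par (proj₁ D) mu (proj₂ D)
      t : W → W
      t y = u' · (inv u · y)
      g : W → W
      g y = M (t y)
      coset : ∀ {y} → pr y ≡ u → t y ≤ y × pr (t y) ≡ u'
      coset {y} q = at (pr-split y)
        where
        at : (∃ λ z → In z × y ≡ pr y · z) → t y ≤ y × pr (t y) ≡ u'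
        at (z , i , r) = subst₂ _≤_ (cong (u' ·_) z≡) (sym y≡) (mul≤ (proj₁ (proj₂ D)) ≤r (add mu i)) , trans
            (cong (λ k → pr (u' · k)) (sym z≡)) (pr-char mu' i)
          where
          y≡ : y ≡ u · z
          y≡ = trans r (cong (_· z) q)
          z≡ : z ≡ inv u · y
          z≡ = sym (trans (cong (inv u ·_) y≡) (trans (sym (assoc (inv u) u z)) (trans (cong (_· z) (invˡ u)) (idˡ z))))
      t≤w : ∀ {y} → y ≤ w × pr y ≡ u → t y ≤ w
      t≤w (p , q) = ≤t (proj₁ (coset q)) p
      t-up : ∀ {y} → y ≤ w × pr y ≡ u → Up (t y) × pr (M (t y)) ≡ M u'
      t-up A = coset-up U' mu' (λ {k} κ Hk → subst (λ z → UpR z k) (sym (invol (proj₁ D))) (mu κ Hk)) (t≤w A)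
          (proj₂ (coset (proj₂ A)))
      from : (∃ λ z → (z ≤ w × pr z ≡ u) × g z ≡ y) → Down y × pr (M y) ≡ u'
      from (z , A , r) = subst Down r (M-up (proj₁ (t-up A))) , trans
          (cong pr (trans (cong M (sym r)) (invol (t≤w A)))) (proj₂ (coset (proj₂ A)))

private
  self-neg : ∀ i → i ≡ - i → i ≡ + 0
  self-neg (+ zero) p = refl
  self-neg (+ suc n) ()
  self-neg -[1+ n ] ()

-- Deodhar's formula: the parabolic R-polynomials are alternating sums of ordinary ones over cosets.
module Deodhar (Y : Sys) (H : Sys.W Y → Set) (H? : ∀ s → Dec (H s)) (q' x : ℤ) (root : (x + + 1) * (x - q') ≡ + 0)
               (F : Sys.W Y → Sys.W Y → ℤ) (I : IsR Y q' F) where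
  open Sys Y
  open Products Y
  open Ops Y q'
  open IsR I
  open Cosets Y H H?
  open Sums _≟_
  open Support Y q' F I

  interval : W → List W
  interval v = deduplicate _≟_ (low v)

  interval-unique : ∀ v → Unique (interval v)
  interval-unique v = deduplicate-! _≟_ (low v)

  ∈interval⇒≤ : ∀ {y v} → y ∈ interval v → y ≤ v
  ∈interval⇒≤ {v = v} i = ∈low⇒≤ (∈-deduplicate⁻ _≟_ (low v) i)

  ≤⇒∈interval : ∀ {y v} → y ≤ v → y ∈ interval v
  ≤⇒∈interval p = ∈-deduplicate⁺ _≟_ (≤⇒∈low p)

  private
    kernel : ∀ {u y} → Dec (pr y ≡ u) → ℤ
    kernel {u} {y} (yes _) = (- x) ^ (ℓ y ∸ ℓ u)
    kernel (no _) = + 0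

  K : W → W → ℤ
  K u y = kernel {u} {y} (pr y ≟ u)

  K-in : ∀ {u y} → pr y ≡ u → K u y ≡ (- x) ^ (ℓ y ∸ ℓ u)
  K-in {u} {y} p = go (pr y ≟ u)
    where
    go : (d : Dec (pr y ≡ u)) → kernel {u} {y} d ≡ (- x) ^ (ℓ y ∸ ℓ u)
    go (yes _) = refl
    go (no n) = ⊥-elim (n p)

  K-out : ∀ {u y} → ¬ pr y ≡ u → K u y ≡ + 0
  K-out {u} {y} n = go (pr y ≟ u)
    where
    go : (d : Dec (pr y ≡ u)) → kernel {u} {y} d ≡ + 0
    go (yes p) = ⊥-elim (n p)
    go (no _) = refl

  φ : W → W → ℤ
  φ v u = ∑ (interval v) (λ y → K u y * F v y)

  φ-extend : ∀ {v w} u → v ≤ w → φ v u ≡ ∑ (interval w) (λ y → K u y * F v y)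
  φ-extend {v} {w} u p = ∑-reindex (λ y → y) (λ y → y) (λ y → K u y * F v y) (interval-unique v) (interval-unique w)
    (λ i → ≤⇒∈interval (≤t (∈interval⇒≤ i) p) , refl) (λ {z} _ → at z (z ≤? v))
    where
    at : ∀ z → Dec (z ≤ v) → K u z * F v z ≡ + 0 ⊎ z ∈ interval v × z ≡ z
    at z (yes p) = inj₂ (≤⇒∈interval p , refl)
    at z (no n) = inj₁ (trans (cong (K u z *_) (vanish v n)) (ℤₚ.*-zeroʳ (K u z)))

  φ-zero : ∀ {u v} → ¬ u ≤ v → φ v u ≡ + 0
  φ-zero {u} {v} n = ∑-zero (interval v) (λ y → K u y * F v y) λ {y} i →
    cong (_* F v y) (K-out λ q → n (≤t (subst (_≤ y) q (pr≤ y)) (∈interval⇒≤ i)))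

  F-diag : ∀ v → F v v ≡ + 1
  F-diag v = go (ℓ v) v refl (v ≟ e)
    where
    go : ∀ n v → ℓ v ≡ n → Dec (v ≡ e) → F v v ≡ + 1
    go n v q (yes refl) = Fe
    go zero v q (no ne) = ⊥-elim (ne (ℓ0 q))
    go (suc n) v q (no ne) = at (descL v ne)
      where
      at : (∃ λ s → S s × DnL s v) → F v v ≡ + 1
      at (s , σ , d) = trans (Fl σ d v) (trans (Tm-dn (s ·_) (F (s · v)) v d)
          (go n (s · v) (ℕₚ.suc-injective (trans (sym d) q)) ((s · v) ≟ e)))

  φ-diag : ∀ {v} → MinR v → φ v v ≡ + 1
  φ-diag {v} m = trans (∑-single (λ y → K v y * F v y) (interval-unique v) (≤⇒∈interval ≤r)
      (λ {y} i n → cong (_* F v y) (K-out λ q → n (≤-anti (∈interval⇒≤ i) (subst (_≤ y) q (pr≤ y))))))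
    (cong₂ _*_ (trans (K-in {v} (pr-fix m)) (cong ((- x) ^_) (ℕₚ.n∸n≡0 (ℓ v)))) (F-diag v))

  module MatchingRecursion (w : W) (M : W → W) (sp : Special Y w M)
                    (par : ∀ {u} → u ≤ w → MinR u → M u ⋖ u → MinR (M u)) where
    open Match Y w M sp
    open HSpecial w M sp par
    open Ord Y q' F I

    private
      v : W
      v = M w

      v≤w : v ≤ w
      v≤w = closed ≤r

    K-match : ∀ {u y} → Up u → MinR u → MinR (M u) → y ≤ w → K u y ≡ K (M u) (M y)
    K-match {u} {y} U mu mMu yw = go (pr y ≟ u)
      where
      go : Dec (pr y ≡ u) → K u y ≡ K (M u) (M y)
      go (yes p) = trans (K-in p) (trans (cong ((- x) ^_) (sym
          (cong₂ _∸_ (proj₂ (proj₂ (proj₁ c))) (proj₂ (proj₂ U))))) (sym (K-in (proj₂ c))))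
        where c = coset-up U mu mMu yw p
      go (no n) = trans (K-out n) (sym (K-out λ p → n (trans (cong pr (sym (invol yw)))
                    (trans (proj₂ (coset-down (M-up U) mMu (closed yw) p)) (invol (proj₁ U))))))

    K-match' : ∀ {u y} → Down u → MinR u → y ≤ w → K u y ≡ K (M u) (M y)
    K-match' {u} {y} D mu yw = sym (trans (K-match (M-down D) (par (proj₁ D) mu (proj₂ D))
        (λ {k} κ Hk → subst (λ z → UpR z k) (sym (invol (proj₁ D))) (mu κ Hk)) (closed yw))
      (cong₂ K (invol (proj₁ D)) (invol yw)))

    ∑-invol : ∀ G → ∑ (interval w) (λ y → G (M y)) ≡ ∑ (interval w) G
    ∑-invol G = ∑-reindex M M G (interval-unique w) (interval-unique w) to (λ i → inj₂ (to i))
      where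
      to : ∀ {y} → y ∈ interval w → M y ∈ interval w × M (M y) ≡ y
      to i = ≤⇒∈interval (closed (∈interval⇒≤ i)) , invol (∈interval⇒≤ i)

    φ-M : ∀ u → φ w u ≡ ∑ (interval w) (λ y → K u y * Tm M (F v) y)
    φ-M u = ∑-cong (interval w) _ _ λ {y} i → cong (K u y *_) (ordinary sp (∈interval⇒≤ i))

    φ-down : ∀ {u} → Down u → MinR u → φ w u ≡ φ v (M u)
    φ-down {u} D mu = trans (φ-M u) (trans (∑-cong (interval w) _ (λ y → G (M y)) λ {y} i → term (∈interval⇒≤ i) (pr y ≟ u))
                        (trans (∑-invol G) (sym (φ-extend (M u) v≤w))))
      where
      G : W → ℤ
      G z = K (M u) z * F v z
      term : ∀ {y} → y ≤ w → Dec (pr y ≡ u) → K u y * Tm M (F v) y ≡ G (M y)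
      term {y} yw (yes p) = cong₂ _*_ (K-match' D mu yw) (Tm-dn M (F v) y (proj₂ (proj₂ (proj₁ (coset-down D mu yw p)))))
      term {y} yw (no n) = trans (cong (_* Tm M (F v) y) (K-out n))
          (sym (cong (_* F v (M y)) (trans (sym (K-match' D mu yw)) (K-out n))))

    φ-up : ∀ {u} → Up u → MinR u → MinR (M u) → φ w u ≡ (q' - + 1) * φ v u + q' * φ v (M u)
    φ-up {u} U mu mMu = trans (φ-M u) (trans (∑-cong (interval w) _ (λ y → (q' - + 1) * E y + q' * G (M y))
        λ {y} i → term (∈interval⇒≤ i) (pr y ≟ u))
        (trans (∑-add (interval w) (λ y → (q' - + 1) * E y) (λ y → q' * G (M y)))
          (cong₂ _+_ (trans (∑-scale (interval w) (q' - + 1) E) (cong ((q' - + 1) *_) (sym (φ-extend u v≤w))))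
            (trans (∑-scale (interval w) q' (λ y → G (M y))) (cong (q' *_) (trans (∑-invol G) (sym (φ-extend (M u) v≤w))))))))
      where
      E G : W → ℤ
      E y = K u y * F v y
      G z = K (M u) z * F v z
      lem : ∀ q k f g → k * ((q - + 1) * f + q * g) ≡ (q - + 1) * (k * f) + q * (k * g)
      lem = solve-∀
      lem₀ : ∀ q t f g → + 0 * t ≡ (q - + 1) * (+ 0 * f) + q * (+ 0 * g)
      lem₀ = solve-∀
      term : ∀ {y} → y ≤ w → Dec (pr y ≡ u) → K u y * Tm M (F v) y ≡ (q' - + 1) * E y + q' * G (M y)
      term {y} yw d = trans (at d) (cong (λ k → (q' - + 1) * E y + q' * (k * F v (M y))) (K-match U mu mMu yw))
        where
        at : Dec (pr y ≡ u) → K u y * Tm M (F v) y ≡ (q' - + 1) * E y + q' * (K u y * F v (M y))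
        at (yes p) = trans (cong (K u y *_) (Tm-up M (F v) y (proj₂ (proj₂ (proj₁ (coset-up U mu mMu yw p))))))
            (lem q' (K u y) (F v y) (F v (M y)))
        at (no n) = subst (λ k → k * Tm M (F v) y ≡ (q' - + 1) * (k * F v y) + q' * (k * F v (M y))) (sym (K-out n))
            (lem₀ q' (Tm M (F v) y) (F v y) (F v (M y)))

    -- M preserves the part of the coset below w. Reindexing the summed defect A along M therefore
    -- yields its own negative, so it vanishes in ℤ.
    φ-out : ∀ {u} → Up u → MinR u → ¬ MinR (M u) → φ w u ≡ (q' - + 1 - x) * φ v u
    φ-out {u} U mu nMu = trans (φ-M u) (ℤₚ.i-j≡0⇒i≡j _ _ (trans (sym ∑A) (self-neg (∑ (interval w) A)
        (trans (sym (∑-invol A)) (trans (∑-cong (interval w) (λ y → A (M y)) (λ y → - + 1 * A y) λ {y} i → anti (∈interval⇒≤ i))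
          (trans (∑-scale (interval w) (- + 1) A) (lem-neg (∑ (interval w) A))))))))
      where
      c = q' - + 1 - x
      E A : W → ℤ
      E y = K u y * F v y
      -- The terms at y and M y cancel because (x + 1)(x - q) = 0.
      A y = K u y * Tm M (F v) y + - + 1 * (c * E y)
      lem-neg : ∀ a → - + 1 * a ≡ - a
      lem-neg = solve-∀
      lem-sub : ∀ a b → a + - + 1 * b ≡ a - b
      lem-sub = solve-∀
      ∑A : ∑ (interval w) A ≡ ∑ (interval w) (λ y → K u y * Tm M (F v) y) - c * φ v u
      ∑A = trans (∑-add (interval w) (λ y → K u y * Tm M (F v) y) (λ y → - + 1 * (c * E y)))
             (trans (cong (λ z → ∑ (interval w) (λ y → K u y * Tm M (F v) y) + z)
                (trans (∑-scale (interval w) (- + 1) (λ y → c * E y))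
                    (cong (- + 1 *_) (trans (∑-scale (interval w) c E) (cong (c *_) (sym (φ-extend u v≤w)))))))
               (lem-sub (∑ (interval w) (λ y → K u y * Tm M (F v) y)) (c * φ v u)))
      neg-neg : ∀ a b → a ≡ - + 1 * b → b ≡ - + 1 * a
      neg-neg a b p = trans (lem b) (cong (- + 1 *_) (sym p))
        where
        lem : ∀ b → b ≡ - + 1 * (- + 1 * b)
        lem = solve-∀
      cancel : ∀ q x k f g → (x + + 1) * (x - q) ≡ + 0 →
               (- x * k) * f + - + 1 * ((q - + 1 - x) * ((- x * k) * g)) ≡ - + 1 *
                   (k * ((q - + 1) * f + q * g) + - + 1 * ((q - + 1 - x) * (k * f)))
      cancel q x k f g r = trans (lem q x k f g) (trans (cong
          (λ z → - + 1 * (k * ((q - + 1) * f + q * g) + - + 1 * ((q - + 1 - x) * (k * f))) + - + 1 * (k * g) * z) r)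
              (lem' _ (k * g)))
        where
        lem : ∀ q x k f g → (- x * k) * f + - + 1 * ((q - + 1 - x) * ((- x * k) * g)) ≡
              - + 1 * (k * ((q - + 1) * f + q * g) + - + 1 * ((q - + 1 - x) * (k * f))) + - + 1 * (k * g) * ((x + + 1) * (x - q))
        lem = solve-∀
        lem' : ∀ a b → a + - + 1 * b * + 0 ≡ a
        lem' = solve-∀
      up-anti : ∀ {y} → Up y → pr y ≡ u → A (M y) ≡ - + 1 * A y
      up-anti {y} Y↑ p = trans (cong₂ (λ k t → k * t + - + 1 * (c * (k * F v (M y)))) K' T')
                           (trans (cancel q' x (K u y) (F v y) (F v (M y)) root)
                             (cong (λ t → - + 1 * (K u y * t + - + 1 * (c * E y))) (sym (Tm-up M (F v) y (proj₂ (proj₂ Y↑))))))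
        where
        T' : Tm M (F v) (M y) ≡ F v y
        T' = trans (Tm-dn M (F v) (M y) (proj₂ (proj₂ (M-up Y↑)))) (cong (F v) (invol (proj₁ Y↑)))
        K' : K u (M y) ≡ - x * K u y
        K' = trans (K-in (coset-fixed U mu nMu (proj₁ Y↑) p)) (trans (cong ((- x) ^_) (trans (cong (_∸ ℓ u) (proj₂ (proj₂ Y↑)))
               (ℕₚ.+-∸-assoc 1 (subst (_≤ℕ ℓ y) (cong ℓ p) (≤ℓ (pr≤ y)))))) (cong (- x *_) (sym (K-in p))))
      anti : ∀ {y} → y ≤ w → A (M y) ≡ - + 1 * A y
      anti {y} yw = go (pr y ≟ u) (dir yw)
        where
        A0 : ∀ y → K u y ≡ + 0 → A y ≡ + 0
        A0 y p = subst (λ k → k * Tm M (F v) y + - + 1 * (c * (k * F v y)) ≡ + 0) (sym p) (lem (Tm M (F v) y) c (F v y))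
          where
          lem : ∀ t c f → + 0 * t + - + 1 * (c * (+ 0 * f)) ≡ + 0
          lem = solve-∀
        go : Dec (pr y ≡ u) → Up y ⊎ Down y → A (M y) ≡ - + 1 * A y
        go (yes p) (inj₁ Y↑) = up-anti Y↑ p
        go (yes p) (inj₂ Y↓) = neg-neg (A y) (A (M y)) (trans (cong A (sym (invol yw)))
            (up-anti (M-down Y↓) (coset-fixed U mu nMu yw p)))
        go (no n) _ = trans (A0 (M y) (K-out λ p → n (trans (cong pr (sym (invol yw))) (coset-fixed U mu nMu (closed yw) p))))
                        (sym (cong (- + 1 *_) (A0 y (K-out n))))

  -- Multiplication by a left descent becomes an instance of the matching recursion. One computation
  -- thus gives both the defining recursion for the sums `φ`, hence Deodhar's formula, and the
  -- recursion for M.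
  left-special : ∀ {s v} → S s → DnL s v → Special Y v (s ·_)
  left-special {s} {v} σ d = record
    { closed = λ p → star σ p d ; invol = λ {u} _ → sc u σ ; cov = λ {u} _ → cover (stepL u σ) ; compat =
        λ {u} {z} c _ n → comp c n (stepL u σ) (stepL z σ) }
    where
    cover : ∀ {u} → UpL s u ⊎ DnL s u → u ⋖ s · u ⊎ s · u ⋖ u
    cover (inj₁ up) = inj₁ (⋖up σ up)
    cover (inj₂ dn) = inj₂ (dn≤ σ dn , dn)
    comp : ∀ {u z} → u ⋖ z → ¬ s · u ≡ z → UpL s u ⊎ DnL s u → UpL s z ⊎ DnL s z → s · u ≤ s · z
    comp c n (inj₁ up) _ = monoL σ (proj₁ c) (up-below σ c up λ q → n (sym q))
    comp c n (inj₂ dn) (inj₁ upz) = ≤t (dn≤ σ dn) (≤t (proj₁ c) (upL σ upz))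
    comp c n (inj₂ dn) (inj₂ dnz) = liftdd σ (proj₁ c) dnz dn

  left-par : ∀ {s u} → S s → MinR u → s · u ⋖ u → MinR (s · u)
  left-par σ m c κ Hk = Coatoms.up-right (op Y) κ σ (m κ Hk) (proj₂ c)

  MinR? : ∀ u → Dec (MinR u)
  MinR? u = go (pr u ≟ u)
    where
    go : Dec (pr u ≡ u) → Dec (MinR u)
    go (yes p) = yes λ {k} κ Hk → subst (λ z → UpR z k) p (pr-min u κ Hk)
    go (no n) = no λ m → n (pr-fix m)

  -- All conditions are confined to elements below w: there H can be replaced by its letters below w
  -- without changing the quotient.
  record IsParabolic (w : W) (R : W → W → ℤ) : Set where
    field
      zero-off : ∀ {u v} → u ≤ w → v ≤ w → MinR u → MinR v → ¬ u ≤ v → R u v ≡ + 0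
      diag     : ∀ {u} → u ≤ w → MinR u → R u u ≡ + 1
      rec-dn   : ∀ {u v s} → v ≤ w → MinR u → MinR v → u ≤ v → ¬ u ≡ v → S s → DnL s v → DnL s u → R u v ≡ R (s · u) (s · v)
      rec-up   : ∀ {u v s} → v ≤ w → MinR u → MinR v → u ≤ v → ¬ u ≡ v → S s → DnL s v → UpL s u → MinR (s · u) →
                 R u v ≡ (q' - + 1) * R u (s · v) + q' * R (s · u) (s · v)
      rec-out  : ∀ {u v s} → v ≤ w → MinR u → MinR v → u ≤ v → ¬ u ≡ v → S s → DnL s v → UpL s u → ¬ MinR (s · u) →
                 R u v ≡ (q' - + 1 - x) * R u (s · v)

  module _ {w : W} {R : W → W → ℤ} (P : IsParabolic w R) where
    open IsParabolic P

    parabolic-formula : ∀ {u v} → u ≤ w → v ≤ w → MinR u → MinR v → R u v ≡ φ v u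
    parabolic-formula {u} {v} p p' m m' = go (ℓ v) u v refl p p' m m' (u ≤? v) (u ≟ v)
      where
      go : ∀ n u v → ℓ v ≡ n → u ≤ w → v ≤ w → MinR u → MinR v → Dec (u ≤ v) → Dec (u ≡ v) → R u v ≡ φ v u
      go n u v q p p' m m' (no nu) _ = trans (zero-off p p' m m' nu) (sym (φ-zero nu))
      go n u v q p p' m m' (yes uv) (yes refl) = trans (diag p m) (sym (φ-diag m))
      go zero u v q p p' m m' (yes uv) (no ne) = ⊥-elim (ne (≤≡ uv (subst (_≤ℕ ℓ u) (sym q) z≤n)))
      go (suc n) u v q p p' m m' (yes uv) (no ne) = at (descL v λ ve → ne (trans (≤e (subst (u ≤_) ve uv)) (sym ve)))
        where
        at : (∃ λ s → S s × DnL s v) → R u v ≡ φ v u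
        at (s , σ , d) = cases (stepL u σ)
          where
          open MatchingRecursion v (s ·_) (left-special σ d) (λ _ → left-par σ)
          v' = s · v
          v'≤w : v' ≤ w
          v'≤w = ≤t (dn≤ σ d) p'
          m'' : MinR v'
          m'' = left-par σ m' (dn≤ σ d , d)
          ih : ∀ y → y ≤ w → MinR y → R y v' ≡ φ v' y
          ih y yw my = go n y v' (ℕₚ.suc-injective (trans (sym d) q)) yw v'≤w my m'' (y ≤? v') (y ≟ v')
          su≤w : s · u ≤ w
          su≤w = ≤t (star σ uv d) p'
          cases : UpL s u ⊎ DnL s u → R u v ≡ φ v u
          cases (inj₂ dn) = trans (rec-dn p' m m' uv ne σ d dn)
              (trans (ih (s · u) su≤w (left-par σ m (dn≤ σ dn , dn))) (sym (φ-down (uv , dn≤ σ dn , dn) m)))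
          cases (inj₁ up) = inner (MinR? (s · u))
            where
            inner : Dec (MinR (s · u)) → R u v ≡ φ v u
            inner (yes k) = trans (rec-up p' m m' uv ne σ d up k)
                (trans (cong₂ (λ y z → (q' - + 1) * y + q' * z) (ih u p m) (ih (s · u) su≤w k)) (sym (φ-up (uv , ⋖up σ up) m k)))
            inner (no k) = trans (rec-out p' m m' uv ne σ d up k)
                (trans (cong ((q' - + 1 - x) *_) (ih u p m)) (sym (φ-out (uv , ⋖up σ up) m k)))

    module _ (mw : MinR w) {M : W → W} (sp : Special Y w M) (par : ∀ {u} → u ≤ w → MinR u → M u ⋖ u → MinR (M u)) where
      open Match Y w M sp
      open MatchingRecursion w M sp par

      private
        v≤w : M w ≤ w
        v≤w = closed ≤r

        mv : MinR (M w)
        mv = par ≤r mw ([ (λ U → ⊥-elim (ℕₚ.<-irrefl refl (ℕₚ.≤-trans (ℕₚ.≤-reflexive (sym (proj₂ (proj₂ U))))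
            (≤ℓ v≤w)))) , proj₂ ]′ (dir ≤r))

        top : ∀ {u} → u ≤ w → MinR u → R u w ≡ φ w u
        top p m = parabolic-formula p ≤r m mw

        low-top : ∀ {u} → u ≤ w → MinR u → φ (M w) u ≡ R u (M w)
        low-top p m = sym (parabolic-formula p v≤w m mv)

      special-down : ∀ {u} → MinR u → Down u → R u w ≡ R (M u) (M w)
      special-down m D = trans (top (proj₁ D) m) (trans (φ-down D m) (low-top (closed (proj₁ D)) (par (proj₁ D) m (proj₂ D))))

      special-up : ∀ {u} → MinR u → Up u → MinR (M u) → R u w ≡ (q' - + 1) * R u (M w) + q' * R (M u) (M w)
      special-up m U k = trans (top (proj₁ U) m) (trans (φ-up U m k)
          (cong₂ (λ y z → (q' - + 1) * y + q' * z) (low-top (proj₁ U) m) (low-top (closed (proj₁ U)) k)))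

      special-out : ∀ {u} → MinR u → Up u → ¬ MinR (M u) → R u w ≡ (q' - + 1 - x) * R u (M w)
      special-out m U k = trans (top (proj₁ U) m) (trans (φ-out U m k) (cong ((q' - + 1 - x) *_) (low-top (proj₁ U) m)))

-- Evaluation of polynomials

module Evaluation (k : ℤ) where
  eval : Poly → ℤ
  eval [] = + 0
  eval (a ∷ p) = a + k * eval p

  eval-add : ∀ p r → eval (addP p r) ≡ eval p + eval r
  eval-add [] r = sym (ℤₚ.+-identityˡ (eval r))
  eval-add (a ∷ p) [] = sym (ℤₚ.+-identityʳ (eval (a ∷ p)))
  eval-add (a ∷ p) (b ∷ r) = trans (cong (λ z → a + b + k * z) (eval-add p r)) (lem k a b (eval p) (eval r))
    where
    lem : ∀ k a b p r → a + b + k * (p + r) ≡ a + k * p + (b + k * r)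
    lem = solve-∀

  eval-scale : ∀ c p → eval (scaleP c p) ≡ c * eval p
  eval-scale c [] = sym (ℤₚ.*-zeroʳ c)
  eval-scale c (a ∷ p) = trans (cong (λ z → c * a + k * z) (eval-scale c p)) (lem k a c (eval p))
    where
    lem : ∀ k a c p → c * a + k * (c * p) ≡ c * (a + k * p)
    lem = solve-∀

  eval-mul : ∀ p r → eval (mulP p r) ≡ eval p * eval r
  eval-mul [] r = refl
  eval-mul (a ∷ p) r = trans (eval-add (scaleP a r) (+ 0 ∷ mulP p r))
    (trans (cong₂ (λ y z → y + (+ 0 + k * z)) (eval-scale a r) (eval-mul p r)) (lem k a (eval p) (eval r)))
    where
    lem : ∀ k a p r → a * r + (+ 0 + k * (p * r)) ≡ (a + k * p) * r
    lem = solve-∀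

  eval-0 : ∀ p → zeroP ≈P p → eval p ≡ + 0
  eval-0 [] e = refl
  eval-0 (a ∷ p) e = trans (cong₂ (λ y z → y + k * z) (sym (e 0)) (eval-0 p (λ n → e (suc n)))) (lem k)
    where
    lem : ∀ k → + 0 + k * + 0 ≡ + 0
    lem = solve-∀

  eval-cong : ∀ p r → p ≈P r → eval p ≡ eval r
  eval-cong [] r e = sym (eval-0 r e)
  eval-cong (a ∷ p) [] e = eval-0 (a ∷ p) (λ n → sym (e n))
  eval-cong (a ∷ p) (b ∷ r) e = cong₂ (λ y z → y + k * z) (e 0) (eval-cong p r (λ n → e (suc n)))

  eval-one : eval oneP ≡ + 1
  eval-one = lem k
    where
    lem : ∀ k → + 1 + k * + 0 ≡ + 1
    lem = solve-∀

  eval-q : eval qP ≡ k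
  eval-q = lem k
    where
    lem : ∀ k → + 0 + k * (+ 1 + k * + 0) ≡ k
    lem = solve-∀

  eval-qm1 : eval qm1P ≡ k - + 1
  eval-qm1 = lem k
    where
    lem : ∀ k → - (+ 1) + k * (+ 1 + k * + 0) ≡ k - + 1
    lem = solve-∀

  eval-qm1mx : ∀ x → eval (qm1mxP x) ≡ k - + 1 - eval (xPoly x)
  eval-qm1mx x = trans (eval-add qm1P (scaleP (- (+ 1)) (xPoly x)))
    (trans (cong₂ _+_ eval-qm1 (eval-scale (- (+ 1)) (xPoly x))) (lem (k - + 1) (eval (xPoly x))))
    where
    lem : ∀ a b → a + - (+ 1) * b ≡ a - b
    lem = solve-∀

  x-root : ∀ x → (eval (xPoly x) + + 1) * (eval (xPoly x) - k) ≡ + 0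
  x-root x=-1 = lem k
    where
    lem : ∀ k → (- (+ 1) + k * + 0 + + 1) * (- (+ 1) + k * + 0 - k) ≡ + 0
    lem = solve-∀
  x-root x=q = lem k
    where
    lem : ∀ k → (+ 0 + k * (+ 1 + k * + 0) + + 1) * (+ 0 + k * (+ 1 + k * + 0) - k) ≡ + 0
    lem = solve-∀

  eval-up : ∀ p r → eval (addP (mulP qm1P p) (mulP qP r)) ≡ (k - + 1) * eval p + k * eval r
  eval-up p r = trans (eval-add (mulP qm1P p) (mulP qP r)) (cong₂ _+_
      (trans (eval-mul qm1P p) (cong (_* eval p) eval-qm1)) (trans (eval-mul qP r) (cong (_* eval r) eval-q)))

  eval-out : ∀ x p → eval (mulP (qm1mxP x) p) ≡ (k - + 1 - eval (xPoly x)) * eval p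
  eval-out x p = trans (eval-mul (qm1mxP x) p) (cong (_* eval p) (eval-qm1mx x))

module _ where
  open Evaluation

  -- If a + k·b = 0 then k divides a, so a = 0 once k > |a|.
  vanishing : ∀ p → (∀ m → eval (+ suc m) p ≡ + 0) → zeroP ≈P p
  vanishing [] f n = refl
  vanishing (a ∷ p) f = λ { zero → sym a≡0 ; (suc n) → vanishing p f' n }
    where
    big : ∀ E → a + + suc ∣ a ∣ * E ≡ + 0 → a ≡ + 0
    big E q = ℤₚ.∣i∣≡0⇒i≡0 (small ∣ E ∣ (trans (cong ∣_∣ a≡) (trans (ℤₚ.∣-i∣≡∣i∣ (+ suc ∣ a ∣ * E)) (ℤₚ.abs-* (+ suc ∣ a ∣) E))))
      where
      a≡ : a ≡ - (+ suc ∣ a ∣ * E)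
      a≡ = trans (lem a (+ suc ∣ a ∣ * E)) (trans (cong (_- + suc ∣ a ∣ * E) q) (ℤₚ.+-identityˡ _))
        where
        lem : ∀ a b → a ≡ a + b - b
        lem = solve-∀
      small : ∀ m → ∣ a ∣ ≡ suc ∣ a ∣ *ℕ m → ∣ a ∣ ≡ 0
      small zero r = trans r (ℕₚ.*-zeroʳ ∣ a ∣)
      small (suc m) r = ⊥-elim (ℕₚ.<-irrefl r (ℕₚ.≤-trans (ℕₚ.n<1+n ∣ a ∣) (ℕₚ.m≤m*n (suc ∣ a ∣) (suc m))))
    a≡0 : a ≡ + 0
    a≡0 = big _ (f ∣ a ∣)
    f' : ∀ m → eval (+ suc m) p ≡ + 0
    f' m = [ (λ ()) , (λ q → q) ]′ (ℤₚ.i*j≡0⇒i≡0∨j≡0 (+ suc m)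
        (trans (sym (ℤₚ.+-identityˡ _)) (trans (cong (_+ + suc m * eval (+ suc m) p) (sym a≡0)) (f m))))

  coeff-add : ∀ p r n → coeff (addP p r) n ≡ coeff p n + coeff r n
  coeff-add [] r n = sym (ℤₚ.+-identityˡ (coeff r n))
  coeff-add (a ∷ p) [] n = sym (ℤₚ.+-identityʳ (coeff (a ∷ p) n))
  coeff-add (a ∷ p) (b ∷ r) zero = refl
  coeff-add (a ∷ p) (b ∷ r) (suc n) = coeff-add p r n

  coeff-scale : ∀ c p n → coeff (scaleP c p) n ≡ c * coeff p n
  coeff-scale c [] n = sym (ℤₚ.*-zeroʳ c)
  coeff-scale c (a ∷ p) zero = refl
  coeff-scale c (a ∷ p) (suc n) = coeff-scale c p n

  eval-ext : ∀ p r → (∀ m → eval (+ suc m) p ≡ eval (+ suc m) r) → p ≈P r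
  eval-ext p r f n = ℤₚ.i-j≡0⇒i≡j _ _ (trans (trans (lem (coeff p n) (coeff r n))
      (trans (cong (λ z → coeff p n + z) (sym (coeff-scale (- (+ 1)) r n))) (sym (coeff-add p (scaleP (- (+ 1)) r) n))))
      (sym (vanishing (addP p (scaleP (- (+ 1)) r)) (λ m → trans (eval-add (+ suc m) p (scaleP (- (+ 1)) r))
        (trans (cong₂ _+_ (f m) (eval-scale (+ suc m) (- (+ 1)) r)) (lem' (eval (+ suc m) r)))) n)))
    where
    lem : ∀ a b → a - b ≡ a + - (+ 1) * b
    lem = solve-∀
    lem' : ∀ a → a + - (+ 1) * a ≡ + 0
    lem' = solve-∀

-- Transfer to the given definitions

module Translate (C : CoxeterSystem) (H : CoxeterSystem.W C → Set) (w : CoxeterSystem.W C) where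
  open FromCoxeter C using (sys)
  open Sys sys
  open Products sys

  ⋖⇒⊲ : ∀ {u v} → u ⋖ v → _⊲_ C u v
  ⋖⇒⊲ {u} {v} (p , q) = (p , λ r → ℕₚ.1+n≢n (trans (sym q) (cong ℓ (sym r)))) , λ z a b → go z a b (z ≟ u)
    where
    go : ∀ z → u ≤ z → z ≤ v → Dec (z ≡ u) → z ≡ u ⊎ z ≡ v
    go z a b (yes r) = inj₁ r
    go z a b (no n) = inj₂ (≤≡ b (subst (_≤ℕ ℓ z) (sym q) (<ℓ a λ r → n (sym r))))

  ⊲⇒⋖ : ∀ {u v} → _⊲_ C u v → u ⋖ v
  ⊲⇒⋖ {u} {v} ((p , n) , f) = at (chain-up p n)
    where
    at : (∃ λ z → u ⋖ z × z ≤ v) → u ⋖ v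
    at (z , c , b) = [ (λ r → ⊥-elim (ℕₚ.1+n≢n (trans (sym (proj₂ c)) (cong ℓ r)))) , (λ r → subst (u ⋖_) r c) ]′
        (f z (proj₁ c) b)

  special : ∀ {M} → IsSpecialMatching C H w M → Special sys w M
  special {M} sm = record
    { closed = λ {u} → closed u ; invol = λ {u} → invol u
    ; cov = λ {u} p → [ (λ c → inj₁ (⊲⇒⋖ c)) , (λ c → inj₂ (⊲⇒⋖ c)) ]′ (cover u p)
    ; compat = λ {u} {v} c p n → compat u v (≤t (proj₁ c) p) p (⋖⇒⊲ c) n }
    where open IsSpecialMatching sm

  -- Only the letters of H below w matter; membership in H is decidable for them up to double negation.
  H↓ : W → Set
  H↓ s = H s × s ≤ w

  Decided : Set
  Decided = ∀ {s} → s ∈ low w → Dec (H s)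

  ¬¬decided : ¬ ¬ Decided
  ¬¬decided = go (low w)
    where
    go : ∀ l → ¬ ¬ (∀ {s} → s ∈ l → Dec (H s))
    go [] n = n λ ()
    go (y ∷ l) n = go l λ f → n λ { (here refl) → no (λ h → n λ { (here refl) → yes h ; (there i) → f i }) ; (there i) → f i }

  H↓? : Decided → ∀ s → Dec (H↓ s)
  H↓? D s = go (s ≤? w)
    where
    go : Dec (s ≤ w) → Dec (H↓ s)
    go (no n) = no λ h → n (proj₂ h)
    go (yes p) = at (D (≤⇒∈low p))
      where
      at : Dec (H s) → Dec (H↓ s)
      at (yes h) = yes (h , p)
      at (no n) = no λ h → n (proj₁ h)

  MinR : W → Set
  MinR u = ∀ {k} → S k → H↓ k → UpR u k

  InWH⇒MinR : ∀ {u} → InWH C H u → MinR u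
  InWH⇒MinR {u} f {k} κ (h , _) = Basics.¬dn⇒up (op sys) κ λ d → f k (κ , ℕₚ.≤-reflexive (sym d)) h

  MinR⇒InWH : ∀ {u} → u ≤ w → MinR u → InWH C H u
  MinR⇒InWH {u} p m s (σ , lt) h = Basics.dnup (op sys) d (m σ (h , ≤t (Basics.dn⇒≤ (op sys) σ d) p))
    where
    d : DnR u s
    d = Basics.lt⇒dn (op sys) u σ lt

  module AtPoint (D : Decided) (x : XParam) (R : W → W → Poly) (P : IsParabolicR C H x R) (k : ℤ) where
    open Evaluation k
    open IsParabolicR P
    open Construct sys k using (F; isR)
    open Deodhar sys H↓ (H↓? D) k (eval (xPoly x)) (x-root x) F isR using (IsParabolic; special-down; special-up; special-out)

    R′ : W → W → ℤ
    R′ u v = eval (R u v)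

    isParabolic : IsParabolic w R′
    isParabolic = record
      { zero-off = λ {u} {v} p p' m m' n → eval-cong (R u v) zeroP (R-zero u v (MinR⇒InWH p m) (MinR⇒InWH p' m') n)
      ; diag = λ {u} p m → trans (eval-cong (R u u) oneP (R-diag u (MinR⇒InWH p m))) eval-one
      ; rec-dn = λ {u} {v} {s} p m m' uv n σ d d' → eval-cong (R u v) (R (s · u) (s · v))
          (R-desc u v s (MinR⇒InWH (≤t uv p) m) (MinR⇒InWH p m') (uv , n) (σ , ℕₚ.≤-reflexive (sym d))
              (σ , ℕₚ.≤-reflexive (sym d')))
      ; rec-up = λ {u} {v} {s} p m m' uv n σ d up k → trans (eval-cong (R u v)
          (addP (mulP qm1P (R u (s · v))) (mulP qP (R (s · u) (s · v))))
          (R-asc-in u v s (MinR⇒InWH (≤t uv p) m) (MinR⇒InWH p m') (uv , n) (σ , ℕₚ.≤-reflexive (sym d)) (not-desc up)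
              (MinR⇒InWH (≤t (star σ uv d) p) k)))
          (eval-up (R u (s · v)) (R (s · u) (s · v)))
      ; rec-out = λ {u} {v} {s} p m m' uv n σ d up k → trans (eval-cong (R u v) (mulP (qm1mxP x) (R u (s · v)))
          (R-asc-out u v s (MinR⇒InWH (≤t uv p) m) (MinR⇒InWH p m') (uv , n) (σ , ℕₚ.≤-reflexive (sym d)) (not-desc up)
              (λ i → k (λ {z} → InWH⇒MinR i {z}))))
          (eval-out x (R u (s · v))) }
      where
      not-desc : ∀ {s u} → UpL s u → ¬ InDL C s u
      not-desc up (σ , lt) = ℕₚ.<-asym lt (ℕₚ.≤-reflexive (sym up))

    module _ (wH : InWH C H w) (M : W → W) (sm : IsSpecialMatching C H w M) {u : W} (uH : InWH C H u) (uw : u ≤ w) where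
      private
        sp : Special sys w M
        sp = special sm

        par : ∀ {u} → u ≤ w → MinR u → M u ⋖ u → MinR (M u)
        par {u} p m c = InWH⇒MinR (IsSpecialMatching.par sm u p (MinR⇒InWH p m) (⋖⇒⊲ c))

      down : _⊲_ C (M u) u → eval (R u w) ≡ eval (R (M u) (M w))
      down c = special-down isParabolic (InWH⇒MinR wH) sp par (InWH⇒MinR uH) (uw , ⊲⇒⋖ c)

      up : _⊲_ C u (M u) → InWH C H (M u) → eval (R u w) ≡ eval (addP (mulP qm1P (R u (M w))) (mulP qP (R (M u) (M w))))
      up c i = trans (special-up isParabolic (InWH⇒MinR wH) sp par (InWH⇒MinR uH) (uw , ⊲⇒⋖ c) (InWH⇒MinR i))
          (sym (eval-up (R u (M w)) (R (M u) (M w))))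

      out : _⊲_ C u (M u) → ¬ InWH C H (M u) → eval (R u w) ≡ eval (mulP (qm1mxP x) (R u (M w)))
      out c n = trans (special-out isParabolic (InWH⇒MinR wH) sp par (InWH⇒MinR uH) (uw , ⊲⇒⋖ c)
          (λ m → n (MinR⇒InWH (Special.closed sp uw) m)))
                  (sym (eval-out x (R u (M w))))

open CoxeterSystem

theorem1p5 : (C : CoxeterSystem) (H : W C → Set) → (∀ s → H s → S C s) →
    (w : W C) → InWH C H w → (x : XParam) →
    (R : W C → W C → Poly) → IsParabolicR C H x R →
    (M : W C → W C) → IsSpecialMatching C H w M →
    (u : W C) → InWH C H u → _≤B_ C u w →
      (_⊲_ C (M u) u → R u w ≈P R (M u) (M w)) ×
      (_⊲_ C u (M u) → InWH C H (M u) →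
         R u w ≈P addP (mulP qm1P (R u (M w))) (mulP qP (R (M u) (M w)))) ×
      (_⊲_ C u (M u) → ¬ InWH C H (M u) →
         R u w ≈P mulP (qm1mxP x) (R u (M w)))
theorem1p5 C H _ w wH x R P M sm u uH uw =
    (λ c → pointwise (R u w) (R (M u) (M w)) λ D k → AtPoint.down D x R P k wH M sm uH uw c)
  , (λ c i → pointwise (R u w) (addP (mulP qm1P (R u (M w))) (mulP qP (R (M u) (M w))))
      λ D k → AtPoint.up D x R P k wH M sm uH uw c i)
  , (λ c n → pointwise (R u w) (mulP (qm1mxP x) (R u (M w))) λ D k → AtPoint.out D x R P k wH M sm uH uw c n)
  where
  open Translate C H w
  open Evaluation
  pointwise : ∀ p r → (Decided → ∀ k → eval k p ≡ eval k r) → p ≈P r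
  -- Equality of integers is stable under double negation, so the decisions about H, available only
  -- up to double negation, may be assumed at each evaluation point.
  pointwise p r f = eval-ext p r λ m → decidable-stable (eval (+ suc m) p ℤₚ.≟ eval (+ suc m) r) λ n → ¬¬decided
      λ D → n (f D (+ suc m))
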